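{- Let $n,N$ be positive integers with $n\ge2$ and $n\mid N$. There exists a subset $S'$ of $\mathcal{P}(n,N)$ such that: (a) $\displaystyle\frac{|S'\cap\mathcal{P}(n,N,H)|}{|\mathcal{P}(n,N,H)|}=1-O\Big(\frac{\log H}{\sqrt H}\Big)$ as $H\to\infty$ (in particular $S'$ has density $1$); (b) for each $P(T)\in S'$ there is a constant $\alpha$ with $0<\alpha<1$ such that $|\mathcal{N}_n(P(T),x)|=O(x\log^{ -\alpha}(x))$ as $x\to\infty$; in particular, the subset $\mathcal{N}_n(P(T))$ of $\mathcal{N}_n$ has density $0$ (i.e. $|\mathcal{N}_n(P(T),x)|/|\mathcal{N}_n(x)|\to0$).
   Context: $\mathcal{P}(n,N)$ is the set of degree $N$ polynomials $P(T)\in\mathbb{Z}[T]$ all of whose roots have multiplicity at most $n-1$; $\mathcal{P}(n,N,H)$ the subset of those with height (maximum absolute value of coefficients) at most $H$. $\mathcal{N}_n$ is the set of $n$-free integers: integers $d\notin\{0,1\}$ such that $p^n\nmid d$ for every prime $p$; $\mathcal{N}_n(x)=\{d\in\mathcal{N}_n:|d|\le x\}$. For $P(T)=\sum_{i=0}^N a_iT^i$ with $n\mid N$, let $P(T,Z)=\sum_i a_iT^iZ^{N-i}$; the superelliptic curve $C_{d\cdot P(T)}: y^n=d\cdot P(t)$ (in the weighted projective space $\mathbb{P}_{N/n,1,1}$) has a non-trivial $\mathbb{Q}$-rational point iff there exist $(y,t,z)\in\mathbb{Q}^3$ with $y\ne0$ and $y^n=d\cdot P(t,z)$. $\mathcal{N}_n(P(T))$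 is the set of $d\in\mathcal{N}_n$ such that $C_{d\cdot P(T)}$ has a non-trivial $\mathbb{Q}$-rational point, and $\mathcal{N}_n(P(T),x)=\mathcal{N}_n(P(T))\cap\mathcal{N}_n(x)$. -}

module Defs where

open import Data.Nat as ℕ using (ℕ; zero; suc; _≤_; _<_)
open import Data.Nat.Divisibility using (_∣_)
open import Data.Nat.Primality using (Prime)
open import Data.Nat.Logarithm using (⌊log₂_⌋)
open import Data.Integer as ℤ using (ℤ; ∣_∣)
open import Data.Rational as ℚ using (ℚ; 0ℚ; 1ℚ)
open import Data.Fin using (Fin; fromℕ; toℕ)
open import Data.Vec using (Vec; lookup; last)
open import Data.List using (List; []; _∷_; length)
open import Data.List.Relation.Unary.All using (All)
open import Data.List.Relation.Unary.Unique.Propositional using (Unique)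
open import Data.Product using (Σ; ∃; _×_; _,_)
open import Relation.Nullary using (¬_)
open import Relation.Binary.PropositionalEquality using (_≡_; _≢_)

_^ℚ_ : ℚ → ℕ → ℚ
q ^ℚ zero  = 1ℚ
q ^ℚ suc k = q ℚ.* (q ^ℚ k)

ιℚ : ℤ → ℚ
ιℚ z = z ℚ./ 1

ΣFin : (m : ℕ) → (Fin m → ℚ) → ℚ
ΣFin zero    f = 0ℚ
ΣFin (suc m) f = f Fin.zero ℚ.+ ΣFin m (λ i → f (Fin.suc i))
  where import Data.Fin as Fin

-- An integer polynomial of degree N, given by its coefficient vector
-- (a_0, ..., a_N); degree exactly N means a_N ≠ 0.
Poly : ℕ → Set
Poly N = Vec ℤ (suc N)

coeff : ∀ {N} → Poly N → Fin (suc N) → ℤ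
coeff P i = lookup P i

HasDegree : ∀ N → Poly N → Set
HasDegree N P = coeff P (fromℕ N) ≢ ℤ.0ℤ

HeightLE : ∀ {N} → Poly N → ℕ → Set
HeightLE {N} P H = ∀ (i : Fin (suc N)) → ∣ coeff P i ∣ ≤ H

evalHom : ∀ {N} → Poly N → ℚ → ℚ → ℚ
evalHom {N} P t z =
  ΣFin (suc N) (λ i → ιℚ (coeff P i) ℚ.* ((t ^ℚ toℕ i) ℚ.* (z ^ℚ (N ℕ.∸ toℕ i))))

evalPoly : ∀ {N} → Poly N → ℚ → ℚ
evalPoly P t = evalHom P t 1ℚ

evalList : List ℚ → ℚ → ℚ
evalList []       t = 0ℚ
evalList (c ∷ cs) t = c ℚ.+ t ℚ.* evalList cs t

evalVec : ∀ {m} → Vec ℚ m → ℚ → ℚ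
evalVec Data.Vec.[] t = 0ℚ
evalVec (c Data.Vec.∷ cs) t = c ℚ.+ t ℚ.* evalVec cs t

-- "some root of P has multiplicity ≥ n": there is a nonconstant Q ∈ ℚ[T]
-- (degree k+1 ≥ 1, i.e. nonzero leading coefficient) with Q^n ∣ P in ℚ[T].
-- (Polynomial identities over the infinite field ℚ are checked pointwise.)
HasRootOfMultAtLeast : ∀ {N} → ℕ → Poly N → Set
HasRootOfMultAtLeast {N} n P =
  Σ ℕ λ k → Σ (Vec ℚ (suc (suc k))) λ Q → Σ (List ℚ) λ R →
    (last Q ≢ 0ℚ) ×
    (∀ (t : ℚ) → evalPoly P t ≡ (evalVec Q t ^ℚ n) ℚ.* evalList R t)

InP : ℕ → (N : ℕ) → Poly N → Set
InP n N P = HasDegree N P × ¬ HasRootOfMultAtLeast n P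

InPH : ℕ → (N : ℕ) → ℕ → Poly N → Set
InPH n N H P = InP n N P × HeightLE P H

NFree : ℕ → ℤ → Set
NFree n d = d ≢ ℤ.0ℤ × d ≢ ℤ.1ℤ × (∀ (p : ℕ) → Prime p → ¬ ((p ℕ.^ n) ∣ ∣ d ∣))

NFreeLE : ℕ → ℕ → ℤ → Set
NFreeLE n x d = NFree n d × ∣ d ∣ ≤ x

HasNontrivialPoint : ∀ {N} → ℕ → ℤ → Poly N → Set
HasNontrivialPoint n d P =
  Σ ℚ λ y → Σ ℚ λ t → Σ ℚ λ z → (y ≢ 0ℚ) × (y ^ℚ n ≡ ιℚ d ℚ.* evalHom P t z)

InNP : ∀ {N} → ℕ → Poly N → ℤ → Set
InNP n P d = NFree n d × HasNontrivialPoint n d P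

InNPx : ∀ {N} → ℕ → Poly N → ℕ → ℤ → Set
InNPx n P x d = InNP n P d × ∣ d ∣ ≤ x

DistinctIn : ∀ {A : Set} → (A → Set) → List A → Set
DistinctIn S L = Unique L × All S L

{-# OPTIONS --safe #-}
-- Let S′ consist of the P in 𝒫(n,N) for which (b) holds; it must be shown that (b) holds whenever P does not
-- factor over ℤ, reducible polynomials being rare (a factorisation P = QR is determined by the values of Q and R
-- at 0, …, N - 1, which are divisors of the values of P), while Eisenstein polynomials at 2 are plentiful.
-- Every prime p dividing some d in 𝒩_n(P) has ρ(p) ≥ 1, where ρ(p) is the number of roots modulo p of the monic
-- polynomial G attached to P, so it suffices to sieve by the primes with ρ(p) = 0.  These have positive density,
-- without Chebotarev: ∑ min(ρ(p),2) (log p)/p ≤ log X + O(1) by a larger sieve in ℤ[T]/(G), while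
-- ∑_{ρ(p) ≥ 2} (log p)/p ≫ log X by counting prime factors of norms in a number ring containing two roots of G;
-- comparison with Mertens' theorem leaves ∑_{ρ(p) = 0} (log p)/p ≫ log X.
-- Sums ∑ (log p) w(p) are written multiplicatively, as products of powers p ^ w(p) with p w(p) = D, and Liouville
-- type inequalities come from the pigeonhole principle, so that neither logarithms nor determinants are needed.
module Submission where

open import Defs
open import Level using (0ℓ)
open import Algebra.Bundles using (CommutativeRing)
open import Algebra.Solver.Ring.AlmostCommutativeRing using (_-Raw-AlmostCommutative⟶_; fromCommutativeRing)
import Algebra.Solver.Ring as RingSolver
import Algebra.Properties.Ring as RingProps
open import Data.Nat as N using (ℕ; zero; suc; _≤_; _<_; z≤n; s≤s; _^_; _∸_; _⊔_; _≤?_; _<?_; NonZero; >-nonZero; ≢-nonZero)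
import Data.Nat.Properties as NP
open import Data.Nat.Coprimality using (Coprime; coprime-Bézout)
open import Data.Nat.Divisibility as ND using () renaming (_∣_ to _∣ℕ_; _∣?_ to _∣ℕ?_)
open import Data.Nat.GCD using (module Bézout)
open import Data.Nat.Logarithm using (⌊log₂_⌋; ⌊log₂⌋-mono-≤; ⌊log₂[2^n]⌋≡n; ⌊log₂⌊n/2⌋⌋≡⌊log₂n⌋∸1)
open import Data.Nat.Primality using (Prime; euclidsLemma; prime⇒irreducible; prime?; prime⇒nonTrivial; prime[2])
open import Data.Nat.Tactic.RingSolver using (solve-∀)
open import Data.Integer.Tactic.RingSolver using () renaming (solve-∀ to solveZ)
open import Data.List using (List; []; _∷_; _++_; map; upTo; length; filter; take; concatMap; cartesianProduct; cartesianProductWith)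
open import Data.List.Properties using (length-map; length-upTo; upTo-∷ʳ; length-filter; length-take)
open import Data.List.Membership.Propositional using (_∈_; find; lose)
open import Data.List.Membership.Propositional.Properties using (∈-filter⁻; ∈-filter⁺; ∈-upTo⁻; ∈-upTo⁺; ∈-map⁻; ∈-map⁺; ∈-++⁺ˡ; ∈-++⁺ʳ; ∈-++⁻; ∈-∃++; ∈-concatMap⁻; ∈-concatMap⁺; ∈-cartesianProduct⁻; ∈-cartesianProductWith⁺; ∈-cartesianProductWith⁻)
open import Data.List.Relation.Unary.All using (All; []; _∷_)
import Data.List.Relation.Unary.All as All
import Data.List.Relation.Unary.All.Properties as AllP
open import Data.List.Relation.Unary.AllPairs using ([]; _∷_)
open import Data.List.Relation.Unary.Any using (Any; here; there; any?)
open import Data.List.Relation.Unary.Unique.Propositional using (Unique)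
import Data.List.Relation.Unary.Unique.Propositional.Properties as Uniq
open import Data.Fin using (Fin; zero; suc; toℕ; fromℕ; fromℕ<)
open import Data.Fin.Properties using (toℕ<n; toℕ-fromℕ; toℕ-fromℕ<)
open import Data.Maybe using (Maybe; just; nothing)
open import Data.Product using (Σ; ∃; _×_; _,_) renaming (proj₁ to fst; proj₂ to snd)
open import Data.Product.Properties using () renaming (≡-dec to ×-≡-dec)
open import Data.Sum using (_⊎_; inj₁; inj₂; [_,_]′)
open import Data.Empty using (⊥; ⊥-elim)
open import Data.Vec as V using (Vec; []; _∷_; lookup; toList)
open import Data.Vec.Properties using (≡-dec; lookup-map; lookup∘tabulate)
import Data.Vec.Relation.Unary.All as VAll
import Data.Vec.Relation.Unary.All.Properties as VAllP
open import Relation.Binary.Definitions using (tri<; tri≈; tri>)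
open import Relation.Binary.PropositionalEquality as Eq using (_≡_; _≢_; cong; cong₂; subst)
import Relation.Binary.Reasoning.Setoid as SetoidReasoning
open import Relation.Nullary
open import Relation.Nullary.Decidable using (decidable-stable; _×-dec_)
open NP using (≤-trans; ≤-reflexive; ≤-refl; *-monoʳ-≤; *-monoˡ-≤; *-mono-≤; +-mono-≤; +-monoˡ-≤; +-monoʳ-≤; ^-monoˡ-≤; ^-monoʳ-≤; <⇒≱; <⇒≤; <⇒≢; n≤1+n; m≤m+n; m≤n+m; <-≤-trans; ≤-<-trans; m≤m*n; m≤n*m; ≤-pred; ≰⇒>; m≤n⊔m; m≤m⊔n; ⊔-lub; m∸n≤m; m+[n∸m]≡n; ≤-total; ^-*-assoc; ^-distribˡ-+-*; +-suc; suc-injective; ≤-antisym; n<1+n; module ≤-Reasoning)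

-- Norms, least integers in ideals and the domain containing two roots exist only up to double
-- negation. This suffices: they are used to prove inequalities between natural numbers, which are
-- stable, and (a) concerns only the negation of `Good`. Taking (b) itself as the definition of S′
-- is what allows (b) to be proved doubly negated. The comparison rests on 1 + [ρ ≥ 2] = min(ρ, 2) +
-- [ρ = 0]. The term 1 and the term min(ρ, 2) both contribute log X, so the rootless primes must
-- match those with two roots. Two roots are needed in one ring because of the primes with exactly
-- one root: a proper ideal above such a prime, finitely many primes excepted, has index at least p
-- ^ 2, so these primes contribute O(1) to the norms. With a single root they could account for all
-- of log X. The outcome is used in blocks: rootless primes in (y, y ^ K] have reciprocal sum at
-- least 1/c. About log log x / log K blocks fit below x and each multiplies a logarithmic density
-- by c / (c + 1), whence α = 1/(cK).

module _ where
 open import Data.Nat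
 open import Data.Nat.Properties
 open import Data.Nat.DivMod using (_/_; m/n*n≤m; m≡m%n+[m/n]*n; m%n<n)
 open import Data.Nat.Divisibility
 open import Data.Nat.Induction using (<-rec)
 open import Data.Nat.ListAction using (product)
 open import Data.Nat.Primality.Factorisation using (factorise; module PrimeFactorisation)
 open import Data.List using (_∷ʳ_)
 open import Relation.Binary.PropositionalEquality hiding (J)

 -- Double negation; sums, products and counting over lists

 ¬¬-bind : ∀ {a b} {A : Set a} {B : Set b} → ¬ ¬ A → (A → ¬ ¬ B) → ¬ ¬ B
 ¬¬-bind m f k = m (λ a → f a k)

 lem : ∀ {a} (A : Set a) → ¬ ¬ (Dec A)
 lem A k = k (no (λ a → k (yes a)))

 ¬¬-All : ∀ {A : Set} {P : A → Set} (xs : List A) → (∀ {x} → x ∈ xs → ¬ ¬ P x) → ¬ ¬ All P xs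
 ¬¬-All [] f k = k []
 ¬¬-All (x ∷ xs) f k = f (here refl) λ p → ¬¬-All xs (λ m → f (there m)) λ ps → k (p ∷ ps)

 χ : ∀ {P : Set} → Dec P → ℕ
 χ (yes _) = 1
 χ (no _) = 0

 χ≤1 : ∀ {P : Set} (d : Dec P) → χ d ≤ 1
 χ≤1 (yes _) = s≤s z≤n
 χ≤1 (no _) = z≤n

 χ-yes : ∀ {P : Set} (d : Dec P) → P → χ d ≡ 1
 χ-yes (yes _) _ = refl
 χ-yes (no ¬p) p = ⊥-elim (¬p p)

 χ-no : ∀ {P : Set} (d : Dec P) → ¬ P → χ d ≡ 0
 χ-no (yes p) ¬p = ⊥-elim (¬p p)
 χ-no (no _) _ = refl

 χ-mono : ∀ {P Q : Set} (d : Dec P) (e : Dec Q) → (P → Q) → χ d ≤ χ e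
 χ-mono (yes p) e f = ≤-reflexive (sym (χ-yes e (f p)))
 χ-mono (no _) e f = z≤n

 ∑ : ∀ {A : Set} → List A → (A → ℕ) → ℕ
 ∑ [] f = 0
 ∑ (x ∷ xs) f = f x + ∑ xs f

 ∏ : ∀ {A : Set} → List A → (A → ℕ) → ℕ
 ∏ [] f = 1
 ∏ (x ∷ xs) f = f x * ∏ xs f

 *-left-comm : ∀ a b c → a * (b * c) ≡ b * (a * c)
 *-left-comm = solve-∀

 ^-*-distrib : ∀ k a b → (a * b) ^ k ≡ a ^ k * b ^ k
 ^-*-distrib zero a b = refl
 ^-*-distrib (suc k) a b rewrite ^-*-distrib k a b = lemma a b (a ^ k) (b ^ k)
  where
  lemma : ∀ a b c d → (a * b) * (c * d) ≡ (a * c) * (b * d)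
  lemma = solve-∀

 module _ {A : Set} where

  ∑-mono : ∀ (l : List A) {f g} → (∀ {x} → x ∈ l → f x ≤ g x) → ∑ l f ≤ ∑ l g
  ∑-mono [] h = z≤n
  ∑-mono (x ∷ l) h = +-mono-≤ (h (here refl)) (∑-mono l (λ m → h (there m)))

  ∑-cong : ∀ (l : List A) {f g} → (∀ {x} → x ∈ l → f x ≡ g x) → ∑ l f ≡ ∑ l g
  ∑-cong [] h = refl
  ∑-cong (x ∷ l) h = cong₂ _+_ (h (here refl)) (∑-cong l (λ m → h (there m)))

  ∑-+ : ∀ (l : List A) f g → ∑ l (λ x → f x + g x) ≡ ∑ l f + ∑ l g
  ∑-+ [] f g = refl
  ∑-+ (x ∷ l) f g rewrite ∑-+ l f g = lemma (f x) (g x) (∑ l f) (∑ l g)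
   where
   lemma : ∀ a b c d → (a + b) + (c + d) ≡ (a + c) + (b + d)
   lemma = solve-∀

  ∑-*ˡ : ∀ (l : List A) c f → ∑ l (λ x → c * f x) ≡ c * ∑ l f
  ∑-*ˡ [] c f = sym (*-zeroʳ c)
  ∑-*ˡ (x ∷ l) c f rewrite ∑-*ˡ l c f = sym (*-distribˡ-+ c (f x) (∑ l f))

  ∑-const : ∀ (l : List A) c → ∑ l (λ _ → c) ≡ length l * c
  ∑-const [] c = refl
  ∑-const (x ∷ l) c = cong (c +_) (∑-const l c)

  ∑-bound : ∀ (l : List A) c {f} → (∀ {x} → x ∈ l → f x ≤ c) → ∑ l f ≤ length l * c
  ∑-bound l c {f} h = ≤-trans (∑-mono l h) (≤-reflexive (∑-const l c))

  ∑-∈ : ∀ (l : List A) {f x} → x ∈ l → f x ≤ ∑ l f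
  ∑-∈ (x ∷ l) (here refl) = m≤m+n _ _
  ∑-∈ (y ∷ l) (there m) = ≤-trans (∑-∈ l m) (m≤n+m _ _)

  ∏-mono : ∀ (l : List A) {f g} → (∀ {x} → x ∈ l → f x ≤ g x) → ∏ l f ≤ ∏ l g
  ∏-mono [] h = ≤-refl
  ∏-mono (x ∷ l) h = *-mono-≤ (h (here refl)) (∏-mono l (λ m → h (there m)))

  ∏-cong : ∀ (l : List A) {f g} → (∀ {x} → x ∈ l → f x ≡ g x) → ∏ l f ≡ ∏ l g
  ∏-cong [] h = refl
  ∏-cong (x ∷ l) h = cong₂ _*_ (h (here refl)) (∏-cong l (λ m → h (there m)))

  ∏-* : ∀ (l : List A) f g → ∏ l (λ x → f x * g x) ≡ ∏ l f * ∏ l g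
  ∏-* [] f g = refl
  ∏-* (x ∷ l) f g rewrite ∏-* l f g = lemma (f x) (g x) (∏ l f) (∏ l g)
   where
   lemma : ∀ a b c d → (a * b) * (c * d) ≡ (a * c) * (b * d)
   lemma = solve-∀

  ∏-^ : ∀ (l : List A) f k → ∏ l (λ x → f x ^ k) ≡ ∏ l f ^ k
  ∏-^ [] f k = sym (^-zeroˡ k)
  ∏-^ (x ∷ l) f k rewrite ∏-^ l f k = sym (^-*-distrib k (f x) (∏ l f))

  ∏-base : ∀ (l : List A) b f → ∏ l (λ x → b ^ f x) ≡ b ^ ∑ l f
  ∏-base [] b f = refl
  ∏-base (x ∷ l) b f rewrite ∏-base l b f = sym (^-distribˡ-+-* b (f x) (∑ l f))

  ∏-const : ∀ (l : List A) c → ∏ l (λ _ → c) ≡ c ^ length l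
  ∏-const [] c = refl
  ∏-const (x ∷ l) c = cong (c *_) (∏-const l c)

  ∏-bound : ∀ (l : List A) c {f} → (∀ {x} → x ∈ l → f x ≤ c) → ∏ l f ≤ c ^ length l
  ∏-bound l c h = ≤-trans (∏-mono l h) (≤-reflexive (∏-const l c))

  ∏≥1 : ∀ (l : List A) {f} → (∀ {x} → x ∈ l → 1 ≤ f x) → 1 ≤ ∏ l f
  ∏≥1 [] h = ≤-refl
  ∏≥1 (x ∷ l) h = *-mono-≤ (h (here refl)) (∏≥1 l (λ m → h (there m)))

  length-filter-∑ : ∀ {P : A → Set} (P? : ∀ x → Dec (P x)) (l : List A) → length (filter P? l) ≡ ∑ l (λ x → χ (P? x))
  length-filter-∑ P? [] = refl
  length-filter-∑ P? (x ∷ l) with P? x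
  ... | yes _ = cong suc (length-filter-∑ P? l)
  ... | no _ = length-filter-∑ P? l

 module _ {A B : Set} where

  ∑-swap : ∀ (l : List A) (k : List B) (f : A → B → ℕ) → ∑ l (λ x → ∑ k (f x)) ≡ ∑ k (λ y → ∑ l (λ x → f x y))
  ∑-swap [] k f = sym (trans (∑-const k 0) (*-zeroʳ (length k)))
  ∑-swap (x ∷ l) k f rewrite ∑-swap l k f = sym (∑-+ k (f x) (λ y → ∑ l (λ z → f z y)))

  ∏-swap : ∀ (l : List A) (k : List B) (f : A → B → ℕ) → ∏ l (λ x → ∏ k (f x)) ≡ ∏ k (λ y → ∏ l (λ x → f x y))
  ∏-swap [] k f = sym (trans (∏-const k 1) (^-zeroˡ (length k)))
  ∏-swap (x ∷ l) k f rewrite ∏-swap l k f = sym (∏-* k (f x) (λ y → ∏ l (λ z → f z y)))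

  ∑-map : ∀ (l : List A) (h : A → B) f → ∑ (map h l) f ≡ ∑ l (λ x → f (h x))
  ∑-map [] h f = refl
  ∑-map (x ∷ l) h f = cong (f (h x) +_) (∑-map l h f)

 ∑-++ : ∀ {A : Set} (l k : List A) f → ∑ (l ++ k) f ≡ ∑ l f + ∑ k f
 ∑-++ [] k f = refl
 ∑-++ (x ∷ l) k f = trans (cong (f x +_) (∑-++ l k f)) (sym (+-assoc (f x) (∑ l f) (∑ k f)))

 ∑-concatMap : ∀ {A B : Set} (l : List A) (h : A → List B) f → ∑ (concatMap h l) f ≡ ∑ l (λ x → ∑ (h x) f)
 ∑-concatMap [] h f = refl
 ∑-concatMap (x ∷ l) h f = trans (∑-++ (h x) _ f) (cong (∑ (h x) f +_) (∑-concatMap l h f))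

 ∏-++ : ∀ {A : Set} (l k : List A) f → ∏ (l ++ k) f ≡ ∏ l f * ∏ k f
 ∏-++ [] k f = sym (+-identityʳ _)
 ∏-++ (x ∷ l) k f = trans (cong (f x *_) (∏-++ l k f)) (sym (*-assoc (f x) (∏ l f) (∏ k f)))

 ∏-concatMap : ∀ {A B : Set} (l : List A) (h : A → List B) f → ∏ (concatMap h l) f ≡ ∏ l (λ x → ∏ (h x) f)
 ∏-concatMap [] h f = refl
 ∏-concatMap (x ∷ l) h f = trans (∏-++ (h x) _ f) (cong (∏ (h x) f *_) (∏-concatMap l h f))

 ∏-map : ∀ {A B : Set} (l : List A) (h : A → B) f → ∏ (map h l) f ≡ ∏ l (λ x → f (h x))
 ∏-map [] h f = refl
 ∏-map (x ∷ l) h f = cong (f (h x) *_) (∏-map l h f)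

 ∑-take : ∀ {A : Set} n (l : List A) → length (take n l) ≤ n
 ∑-take n l = ≤-trans (≤-reflexive (length-take n l)) (m⊓n≤m n (length l))

 fibre-count : ∀ {A B : Set} (L : List A) (cs : List B) (R : A → B → Set) (R? : ∀ x c → Dec (R x c)) (T : ℕ) →
  (∀ {x} → x ∈ L → ∃ λ c → c ∈ cs × R x c) →
  (∀ {c} → c ∈ cs → length (filter (λ x → R? x c) L) ≤ T) → length L ≤ length cs * T
 fibre-count L cs R R? T cover fib = begin
  length L ≡⟨ sym (*-identityʳ _) ⟩
  length L * 1 ≡⟨ sym (∑-const L 1) ⟩
  ∑ L (λ _ → 1) ≤⟨ ∑-mono L one ⟩
  ∑ L (λ x → ∑ cs (λ c → χ (R? x c))) ≡⟨ ∑-swap L cs _ ⟩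
  ∑ cs (λ c → ∑ L (λ x → χ (R? x c))) ≡⟨ ∑-cong cs (λ {c} _ → sym (length-filter-∑ (λ x → R? x c) L)) ⟩
  ∑ cs (λ c → length (filter (λ x → R? x c) L)) ≤⟨ ∑-bound cs T fib ⟩
  length cs * T ∎
  where
  open ≤-Reasoning
  one : ∀ {x} → x ∈ L → 1 ≤ ∑ cs (λ c → χ (R? x c))
  one {x} m with cover m
  ... | c , c∈ , r = ≤-trans (≤-reflexive (sym (χ-yes (R? x c) r))) (∑-∈ cs c∈)

 at-most-one : ∀ {A : Set} {xs : List A} → Unique xs → (∀ {x y} → x ∈ xs → y ∈ xs → x ≡ y) → length xs ≤ 1
 at-most-one {xs = []} u h = z≤n
 at-most-one {xs = x ∷ []} u h = ≤-refl
 at-most-one {xs = x ∷ y ∷ xs} ((x≢y ∷ _) ∷ _) h = ⊥-elim (x≢y (h (here refl) (there (here refl))))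

 inj-count : ∀ {A B : Set} (L : List A) (cs : List B) (f : A → B) (_≟_ : ∀ (x y : B) → Dec (x ≡ y)) → Unique L →
  (∀ {x y} → x ∈ L → y ∈ L → f x ≡ f y → x ≡ y) → (∀ {x} → x ∈ L → f x ∈ cs) → length L ≤ length cs
 inj-count L cs f _≟_ u inj into = ≤-trans
  (fibre-count L cs (λ x c → f x ≡ c) (λ x c → f x ≟ c) 1 (λ {x} m → f x , into m , refl)
   (λ {c} _ → at-most-one (Uniq.filter⁺ (λ x → f x ≟ c) u) λ {x} {y} mx my →
    let (x∈ , ex) = ∈-filter⁻ (λ z → f z ≟ c) mx
        (y∈ , ey) = ∈-filter⁻ (λ z → f z ≟ c) my in inj x∈ y∈ (trans ex (sym ey))))
  (≤-reflexive (*-identityʳ _))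

 -- Fibres of f of size > T would contain T+1 distinct elements.
 fibre-by-contradiction : ∀ {A : Set} (L : List A) → Unique L → ∀ T {P : A → Set} →
  (∀ {x} → x ∈ L → P x) → (∀ (F : List A) → Unique F → length F ≡ suc T → (∀ {x} → x ∈ F → P x) → ⊥) → length L ≤ T
 fibre-by-contradiction {A} L u T {P} p contra with length L ≤? T
 ... | yes h = h
 ... | no ¬h = ⊥-elim (contra (take (suc T) L) (Uniq.take⁺ (suc T) u)
   (trans (length-take (suc T) L) (m≤n⇒m⊓n≡m (≰⇒> ¬h))) (λ m → p (take-⊆ (suc T) L m)))
  where
  take-⊆ : ∀ n (l : List A) {x} → x ∈ take n l → x ∈ l
  take-⊆ (suc n) (y ∷ l) (here e) = here e
  take-⊆ (suc n) (y ∷ l) (there m) = there (take-⊆ n l m)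

 root-≤ : ∀ {a b} n → 1 ≤ n → a ^ n ≤ b ^ n → a ≤ b
 root-≤ {a} {b} (suc n) _ h with a ≤? b
 ... | yes p = p
 ... | no ¬p = ⊥-elim (<⇒≱ (^-monoˡ-< (suc n) (≰⇒> ¬p)) h)

 module _ {A : Set} where

  vecs : List A → (m : ℕ) → List (Vec A m)
  vecs as zero = [] ∷ []
  vecs as (suc m) = cartesianProductWith _∷_ as (vecs as m)

  length-cart : ∀ {B C : Set} (f : A → B → C) (as : List A) (bs : List B) → length (cartesianProductWith f as bs) ≡ length as * length bs
  length-cart f [] bs = refl
  length-cart f (a ∷ as) bs = trans (Data.List.Properties.length-++ (map (f a) bs))
   (cong₂ _+_ (length-map (f a) bs) (length-cart f as bs))

  length-vecs : ∀ as m → length (vecs as m) ≡ length as ^ m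
  length-vecs as zero = refl
  length-vecs as (suc m) = trans (length-cart _∷_ as (vecs as m)) (cong (length as *_) (length-vecs as m))

  vecs-Unique : ∀ {as} m → Unique as → Unique (vecs as m)
  vecs-Unique zero u = [] ∷ []
  vecs-Unique (suc m) u = Uniq.cartesianProductWith⁺ _∷_ (λ { refl → refl , refl }) u (vecs-Unique m u)

  ∈-vecs⁺ : ∀ {as m} {v : Vec A m} → VAll.All (_∈ as) v → v ∈ vecs as m
  ∈-vecs⁺ VAll.[] = here refl
  ∈-vecs⁺ (p VAll.∷ ps) = ∈-cartesianProductWith⁺ _∷_ p (∈-vecs⁺ ps)

  ∈-vecs⁻ : ∀ {as} m {v : Vec A m} → v ∈ vecs as m → VAll.All (_∈ as) v
  ∈-vecs⁻ zero {[]} _ = VAll.[]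
  ∈-vecs⁻ {as} (suc m) {v} h with ∈-cartesianProductWith⁻ _∷_ as (vecs as m) h
  ... | a , w , a∈ , w∈ , refl = a∈ VAll.∷ ∈-vecs⁻ m w∈

 ∏-filter-χ : ∀ {A : Set} {P : A → Set} (P? : ∀ x → Dec (P x)) (f : A → ℕ) l → ∏ l (λ x → f x ^ χ (P? x)) ≡ ∏ (filter P? l) f
 ∏-filter-χ P? f [] = refl
 ∏-filter-χ P? f (x ∷ l) with P? x
 ... | yes _ = cong₂ _*_ (*-identityʳ (f x)) (∏-filter-χ P? f l)
 ... | no _ = trans (+-identityʳ _) (∏-filter-χ P? f l)

 -- Elementary prime number theory: estimates of Chebyshev and Mertens

 infixl 7 _÷_

 -- Total floor division, with m ÷ 0 = 0.
 _÷_ : ℕ → ℕ → ℕ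
 m ÷ zero = 0
 m ÷ suc n = m / suc n

 ÷-≤ : ∀ m n → m ÷ n * n ≤ m
 ÷-≤ m zero = z≤n
 ÷-≤ m (suc n) = m/n*n≤m m (suc n)

 <-÷ : ∀ m n → 1 ≤ n → m < suc (m ÷ n) * n
 <-÷ m (suc n) _ = begin-strict
  m ≡⟨ m≡m%n+[m/n]*n m (suc n) ⟩
  m Data.Nat.DivMod.% suc n + m / suc n * suc n <⟨ +-monoˡ-< (m / suc n * suc n) (m%n<n m (suc n)) ⟩
  suc n + m / suc n * suc n ∎
  where open ≤-Reasoning

 ÷-greatest : ∀ {m n} q → 1 ≤ n → q * n ≤ m → q ≤ m ÷ n
 ÷-greatest {m} {n} q n≥1 h with q ≤? m ÷ n
 ... | yes p = p
 ... | no ¬p = ⊥-elim (<⇒≱ (<-÷ m n n≥1) (≤-trans (*-monoˡ-≤ n (≰⇒> ¬p)) h))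

 prime≥2 : ∀ {p} → Prime p → 2 ≤ p
 prime≥2 {p} pr = nonTrivial⇒n>1 p {{prime⇒nonTrivial pr}}

 prime≥1 : ∀ {p} → Prime p → 1 ≤ p
 prime≥1 pr = ≤-trans (s≤s z≤n) (prime≥2 pr)

 pow≥1 : ∀ {b} k → 1 ≤ b → 1 ≤ b ^ k
 pow≥1 {b} k h = m^n>0 b {{>-nonZero h}} k

 pow-monoʳ : ∀ {b j k} → 1 ≤ b → j ≤ k → b ^ j ≤ b ^ k
 pow-monoʳ {b} h = ^-monoʳ-≤ b {{>-nonZero h}}

 n<2^n : ∀ n → n < 2 ^ n
 n<2^n zero = s≤s z≤n
 n<2^n (suc n) = +-mono-≤-< (m^n>0 2 n) (subst (n <_) (sym (+-identityʳ (2 ^ n))) (n<2^n n))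

 n<p^n : ∀ {p} n → 2 ≤ p → n < p ^ n
 n<p^n n h = <-≤-trans (n<2^n n) (^-monoˡ-≤ n h)

 *-cancelʳ-≤' : ∀ {m n} o → 1 ≤ o → m * o ≤ n * o → m ≤ n
 *-cancelʳ-≤' {m} {n} o h = *-cancelʳ-≤ m n o {{>-nonZero h}}

 *-cancelˡ-≤' : ∀ {m n} o → 1 ≤ o → o * m ≤ o * n → m ≤ n
 *-cancelˡ-≤' o h = *-cancelˡ-≤ o {{>-nonZero h}}

 ∏-gain : ∀ {A : Set} (l : List A) {f g} c {x0} → x0 ∈ l → (∀ {x} → x ∈ l → f x ≤ g x) → c * f x0 ≤ g x0 → c * ∏ l f ≤ ∏ l g
 ∏-gain (x ∷ l) {f} {g} c (here refl) h h0 = ≤-trans (≤-reflexive (sym (*-assoc c (f x) (∏ l f))))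
  (*-mono-≤ h0 (∏-mono l (λ m → h (there m))))
 ∏-gain (x ∷ l) {f} {g} c (there m) h h0 = ≤-trans (≤-reflexive (lemma c (f x) (∏ l f)))
  (*-mono-≤ (h (here refl)) (∏-gain l c m (λ m' → h (there m')) h0))
  where
  lemma : ∀ a b d → a * (b * d) ≡ b * (a * d)
  lemma = solve-∀

 ∏-upTo : ∀ n f → ∏ (upTo (suc n)) f ≡ ∏ (upTo n) f * f n
 ∏-upTo n f = trans (cong (λ l → ∏ l f) (sym (upTo-∷ʳ n)))
  (trans (∏-++ (upTo n) (n ∷ []) f) (cong (∏ (upTo n) f *_) (*-identityʳ (f n))))

 ∑-upTo : ∀ n f → ∑ (upTo (suc n)) f ≡ ∑ (upTo n) f + f n
 ∑-upTo n f = trans (cong (λ l → ∑ l f) (sym (upTo-∷ʳ n)))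
  (trans (∑-++ (upTo n) (n ∷ []) f) (cong (∑ (upTo n) f +_) (+-identityʳ (f n))))

 ∑-upTo-mono : ∀ {m n} f → m ≤ n → ∑ (upTo m) f ≤ ∑ (upTo n) f
 ∑-upTo-mono {m} {n} f m≤n = go (≤⇒≤′ m≤n)
  where
  go : ∀ {n} → m ≤′ n → ∑ (upTo m) f ≤ ∑ (upTo n) f
  go ≤′-refl = ≤-refl
  go {suc n} (≤′-step q) = ≤-trans (go q) (≤-trans (m≤m+n _ (f n)) (≤-reflexive (sym (∑-upTo n f))))

 factorial-∏ : ∀ n → n ! ≡ ∏ (upTo n) suc
 factorial-∏ zero = refl
 factorial-∏ (suc n) = trans (trans (*-comm (suc n) (n !)) (cong (_* suc n) (factorial-∏ n))) (sym (∏-upTo n suc))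

 primes : ℕ → List ℕ
 primes X = filter prime? (upTo (suc X))

 primes⁻ : ∀ {X p} → p ∈ primes X → Prime p × p ≤ X
 primes⁻ {X} m with ∈-filter⁻ prime? {xs = upTo (suc X)} m
 ... | a , b = b , s≤s⁻¹ (∈-upTo⁻ a)

 primes⁺ : ∀ {X p} → Prime p → p ≤ X → p ∈ primes X
 primes⁺ pr h = ∈-filter⁺ prime? (∈-upTo⁺ (s≤s h)) pr

 primes-Unique : ∀ X → Unique (primes X)
 primes-Unique X = Uniq.filter⁺ prime? (Uniq.upTo⁺ (suc X))

 length-primes : ∀ X → length (primes X) ≤ suc X
 length-primes X = ≤-trans (length-filter prime? (upTo (suc X))) (≤-reflexive (length-upTo (suc X)))

 prime∣∏ : ∀ {p} (l : List ℕ) f → Prime p → p ∣ ∏ l f → ∃ λ q → q ∈ l × p ∣ f q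
 prime∣∏ [] f pr d = ⊥-elim (<⇒≱ (prime≥2 pr) (∣⇒≤ d))
 prime∣∏ (q ∷ l) f pr d with euclidsLemma (f q) (∏ l f) pr d
 ... | inj₁ e = q , here refl , e
 ... | inj₂ e with prime∣∏ l f pr e
 ... | r , m , e' = r , there m , e'

 prime∣prime : ∀ {p q} → Prime p → Prime q → p ∣ q → p ≡ q
 prime∣prime {p} pp pq d with prime⇒irreducible pq d
 ... | inj₁ refl = ⊥-elim (<⇒≱ (prime≥2 pp) ≤-refl)
 ... | inj₂ e = e

 distinct-primes-∣ : ∀ (l : List ℕ) n → Unique l → (∀ {p} → p ∈ l → Prime p × p ∣ n) → ∏ l (λ p → p) ∣ n
 distinct-primes-∣ [] n u h = 1∣ n
 distinct-primes-∣ (p ∷ l) n (px ∷ u) h with distinct-primes-∣ l n u (λ m → h (there m))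
 ... | divides k eq with euclidsLemma k (∏ l (λ q → q)) (fst (h (here refl))) (subst (p ∣_) eq (snd (h (here refl))))
 ... | inj₁ (divides j eq') = divides j (trans eq (trans (cong (_* ∏ l (λ q → q)) eq') (*-assoc j p _)))
 ... | inj₂ d with prime∣∏ l (λ q → q) (fst (h (here refl))) d
 ... | q , q∈ , d' = ⊥-elim (All.lookup px q∈ (prime∣prime (fst (h (here refl))) (fst (h (there q∈))) d'))

 -- The binomial coefficient of a + b over a; with both lower entries as arguments Pascal's rule is
 -- structural and free of subtraction.
 bin : ℕ → ℕ → ℕ
 bin zero b = 1
 bin (suc a) zero = 1
 bin (suc a) (suc b) = bin a (suc b) + bin (suc a) b

 bin-! : ∀ a b → bin a b * (a ! * b !) ≡ (a + b) !
 bin-! zero b = trans (+-identityʳ _) (+-identityʳ _)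
 bin-! (suc a) zero = trans (+-identityʳ _) (trans (*-identityʳ _) (cong _! (sym (+-identityʳ (suc a)))))
 bin-! (suc a) (suc b) = begin
  (bin a (suc b) + bin (suc a) b) * ((suc a) ! * (suc b) !)
   ≡⟨ lemma (bin a (suc b)) (bin (suc a) b) a b (a !) (b !) ⟩
  suc a * (bin a (suc b) * (a ! * (suc b) !)) + suc b * (bin (suc a) b * ((suc a) ! * b !))
   ≡⟨ cong₂ (λ x y → suc a * x + suc b * y) (bin-! a (suc b)) (bin-! (suc a) b) ⟩
  suc a * (a + suc b) ! + suc b * (suc a + b) !
   ≡⟨ cong (λ z → suc a * z ! + suc b * (suc a + b) !) (+-suc a b) ⟩
  suc a * (suc a + b) ! + suc b * (suc a + b) !
   ≡⟨ sym (*-distribʳ-+ ((suc a + b) !) (suc a) (suc b)) ⟩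
  (suc a + suc b) * (suc a + b) !
   ≡⟨ cong (λ z → (suc a + suc b) * z !) (sym (+-suc a b)) ⟩
  (suc a + suc b) ! ∎
  where
  open ≡-Reasoning
  lemma : ∀ x y a b u v → (x + y) * ((suc a * u) * (suc b * v)) ≡ suc a * (x * (u * (suc b * v))) + suc b * (y * ((suc a * u) * v))
  lemma = solve-∀

 bin≤ : ∀ a b → bin a b ≤ 2 ^ (a + b)
 bin≤ zero b = m^n>0 2 b
 bin≤ (suc a) zero = m^n>0 2 (suc a + 0)
 bin≤ (suc a) (suc b) = begin
  bin a (suc b) + bin (suc a) b ≤⟨ +-mono-≤ (bin≤ a (suc b)) (bin≤ (suc a) b) ⟩
  2 ^ (a + suc b) + 2 ^ (suc a + b) ≡⟨ cong (λ z → 2 ^ (a + suc b) + 2 ^ z) (sym (+-suc a b)) ⟩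
  2 ^ (a + suc b) + 2 ^ (a + suc b) ≡⟨ cong (2 ^ (a + suc b) +_) (sym (+-identityʳ _)) ⟩
  2 ^ (suc a + suc b) ∎
  where open ≤-Reasoning

 ∣!⇒≤ : ∀ {p} n → Prime p → p ∣ n ! → p ≤ n
 ∣!⇒≤ {p} n pr d with prime∣∏ (upTo n) suc pr (subst (p ∣_) (factorial-∏ n) d)
 ... | q , q∈ , d' = ≤-trans (∣⇒≤ d') (∈-upTo⁻ q∈)

 ≤⇒∣! : ∀ {m n} → 1 ≤ m → m ≤ n → m ∣ n !
 ≤⇒∣! {suc m} h le = ∣-trans (m∣m*n (m !)) (m≤n⇒m!∣n! le)

 ∏-split-filter : ∀ {A : Set} {P : A → Set} (P? : ∀ x → Dec (P x)) (l : List A) f →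
  ∏ l f ≡ ∏ (filter P? l) f * ∏ (filter (λ x → ¬? (P? x)) l) f
 ∏-split-filter P? [] f = refl
 ∏-split-filter P? (x ∷ l) f with P? x
 ... | yes _ = trans (cong (f x *_) (∏-split-filter P? l f)) (sym (*-assoc (f x) _ _))
 ... | no _ = trans (cong (f x *_) (∏-split-filter P? l f)) (*-left-comm (f x) (∏ (filter P? l) f) (∏ (filter (λ y → ¬? (P? y)) l) f))

 halve : ∀ n → ∃ λ h → (n ≡ h + h) ⊎ (n ≡ suc (h + h))
 halve zero = 0 , inj₁ refl
 halve (suc n) with halve n
 ... | h , inj₁ e = h , inj₂ (cong suc e)
 ... | h , inj₂ e = suc h , inj₁ (trans (cong suc e) (cong suc (sym (+-suc h h))))

 ∏-inj : ∀ (l k : List ℕ) (f : ℕ → ℕ) → Unique l → (∀ {x} → x ∈ l → x ∈ k) → (∀ {x} → x ∈ k → 1 ≤ f x) → ∏ l f ≤ ∏ k f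
 ∏-inj [] k f u sub pos = ∏≥1 k pos
 ∏-inj (x ∷ l) k f (px ∷ u) sub pos with ∈-∃++ (sub (here refl))
 ... | k1 , k2 , refl = begin
  f x * ∏ l f ≤⟨ *-monoʳ-≤ (f x) (∏-inj l (k1 ++ k2) f u sub' pos') ⟩
  f x * ∏ (k1 ++ k2) f ≡⟨ cong (f x *_) (∏-++ k1 k2 f) ⟩
  f x * (∏ k1 f * ∏ k2 f) ≡⟨ *-left-comm (f x) (∏ k1 f) (∏ k2 f) ⟩
  ∏ k1 f * (f x * ∏ k2 f) ≡⟨ sym (∏-++ k1 (x ∷ k2) f) ⟩
  ∏ (k1 ++ x ∷ k2) f ∎
  where
  open ≤-Reasoning
  sub' : ∀ {y} → y ∈ l → y ∈ k1 ++ k2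
  sub' {y} m with ∈-++⁻ k1 (sub (there m))
  ... | inj₁ h = ∈-++⁺ˡ h
  ... | inj₂ (here refl) = ⊥-elim (All.lookup px m refl)
  ... | inj₂ (there h) = ∈-++⁺ʳ k1 h
  pos' : ∀ {y} → y ∈ k1 ++ k2 → 1 ≤ f y
  pos' m with ∈-++⁻ k1 m
  ... | inj₁ h = pos (∈-++⁺ˡ h)
  ... | inj₂ h = pos (∈-++⁺ʳ k1 (there h))

 -- Primes in (b, a+b] divide the binomial coefficient of a + b and a when a ≤ b.
 primorial-step : ∀ a b → a ≤ b → ∏ (primes (a + b)) (λ p → p) ≤ 2 ^ (a + b) * ∏ (primes b) (λ p → p)
 primorial-step a b a≤b = begin
  ∏ ps id' ≡⟨ ∏-split-filter (λ p → b <? p) ps id' ⟩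
  ∏ big id' * ∏ small id' ≤⟨ *-mono-≤ big≤ small≤ ⟩
  2 ^ (a + b) * ∏ (primes b) id' ∎
  where
  open ≤-Reasoning
  id' : ℕ → ℕ
  id' p = p
  ps = primes (a + b)
  big = filter (λ p → b <? p) ps
  small = filter (λ p → ¬? (b <? p)) ps
  bin≥1 : 1 ≤ bin a b
  bin≥1 with bin a b in eq
  ... | zero = ⊥-elim (<⇒≱ (≤-trans (s≤s z≤n) (1≤n! (a + b))) (≤-reflexive (trans (sym (bin-! a b)) (cong (_* (a ! * b !)) eq))))
  ... | suc _ = s≤s z≤n
  bigp : ∀ {p} → p ∈ big → Prime p × p ∣ bin a b
  bigp {p} m with ∈-filter⁻ (λ p → b <? p) {xs = ps} m
  ... | p∈ , b<p with primes⁻ {a + b} p∈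
  ... | pr , p≤ with euclidsLemma (bin a b) (a ! * b !) pr (subst (p ∣_) (sym (bin-! a b)) (≤⇒∣! (prime≥1 pr) p≤))
  ... | inj₁ d = pr , d
  ... | inj₂ d with euclidsLemma (a !) (b !) pr d
  ... | inj₁ e = ⊥-elim (<⇒≱ b<p (≤-trans (∣!⇒≤ a pr e) a≤b))
  ... | inj₂ e = ⊥-elim (<⇒≱ b<p (∣!⇒≤ b pr e))
  big≤ : ∏ big id' ≤ 2 ^ (a + b)
  big≤ = ≤-trans (∣⇒≤ {{>-nonZero bin≥1}} (distinct-primes-∣ big (bin a b) (Uniq.filter⁺ _ (primes-Unique (a + b))) bigp)) (bin≤ a b)
  small≤ : ∏ small id' ≤ ∏ (primes b) id'
  small≤ = ∏-inj small (primes b) id' (Uniq.filter⁺ _ (primes-Unique (a + b)))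
   (λ m → let (p∈ , ¬q) = ∈-filter⁻ (λ p → ¬? (b <? p)) {xs = ps} m in primes⁺ (fst (primes⁻ {a + b} p∈)) (≮⇒≥ ¬q))
   (λ m → prime≥1 (fst (primes⁻ {b} m)))

 -- Strong induction through halves. Base 8 instead of the usual 4 leaves room for the uneven halves
 -- of an odd X: the step asks only for 3b ≤ 2(a + b), which holds for b = a + 1 and a ≥ 1.
 primorial≤ : ∀ X → ∏ (primes X) (λ p → p) ≤ 8 ^ X
 primorial≤ = <-rec (λ X → ∏ (primes X) (λ p → p) ≤ 8 ^ X) go
  where
  8^ : ∀ n → 8 ^ n ≡ 2 ^ (3 * n)
  8^ n = ^-*-assoc 2 3 n
  step : ∀ a b → a ≤ b → b + b + b ≤ (a + b) + (a + b) → b < a + b →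
   (∀ {m} → m < a + b → ∏ (primes m) (λ p → p) ≤ 8 ^ m) → ∏ (primes (a + b)) (λ p → p) ≤ 8 ^ (a + b)
  step a b a≤b h lt rec = begin
   ∏ (primes (a + b)) (λ p → p) ≤⟨ primorial-step a b a≤b ⟩
   2 ^ (a + b) * ∏ (primes b) (λ p → p) ≤⟨ *-monoʳ-≤ (2 ^ (a + b)) (rec lt) ⟩
   2 ^ (a + b) * 8 ^ b ≡⟨ cong (2 ^ (a + b) *_) (8^ b) ⟩
   2 ^ (a + b) * 2 ^ (3 * b) ≡⟨ sym (^-distribˡ-+-* 2 (a + b) (3 * b)) ⟩
   2 ^ (a + b + 3 * b) ≤⟨ ^-monoʳ-≤ 2 (≤-trans (≤-reflexive (lem1 a b)) (≤-trans (+-monoʳ-≤ (a + b) h) (≤-reflexive (lem2 (a + b))))) ⟩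
   2 ^ (3 * (a + b)) ≡⟨ sym (8^ (a + b)) ⟩
   8 ^ (a + b) ∎
   where
   open ≤-Reasoning
   lem1 : ∀ a b → a + b + 3 * b ≡ a + b + (b + b + b)
   lem1 = solve-∀
   lem2 : ∀ c → c + (c + c) ≡ 3 * c
   lem2 = solve-∀
  go : ∀ X → (∀ {m} → m < X → ∏ (primes m) (λ p → p) ≤ 8 ^ m) → ∏ (primes X) (λ p → p) ≤ 8 ^ X
  go 0 rec = s≤s z≤n
  go 1 rec = s≤s z≤n
  go X@(suc (suc X')) rec with halve X
  ... | zero , inj₁ ()
  ... | zero , inj₂ ()
  ... | suc h , inj₁ e = subst (λ Z → ∏ (primes Z) (λ p → p) ≤ 8 ^ Z) (sym e)
     (step (suc h) (suc h) ≤-refl (m≤n+o⇒m≤o+n (suc h)) (m<n+m (suc h) (s≤s z≤n)) (λ {m} lt → rec (subst (m <_) (sym e) lt)))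
   where
   m≤n+o⇒m≤o+n : ∀ k → k + k + k ≤ (k + k) + (k + k)
   m≤n+o⇒m≤o+n k = +-monoʳ-≤ (k + k) (m≤m+n k k)
  ... | suc h , inj₂ e = subst (λ Z → ∏ (primes Z) (λ p → p) ≤ 8 ^ Z) (sym e')
     (step (suc h) (suc (suc h)) (n≤1+n _) (≤-trans (m≤m+n _ h) (≤-reflexive (lem3 h))) (m<n+m (suc (suc h)) (s≤s z≤n))
      (λ {m} lt → rec (subst (m <_) (sym e') lt)))
   where
   lem3 : ∀ h → suc (suc h) + suc (suc h) + suc (suc h) + h ≡ (suc h + suc (suc h)) + (suc h + suc (suc h))
   lem3 = solve-∀
   e' : X ≡ suc h + suc (suc h)
   e' = trans e (sym (+-suc (suc h) (suc h)))

 prime-divisor : ∀ m → 2 ≤ m → ∃ λ p → Prime p × p ∣ m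
 prime-divisor m@(suc _) h with factorise m
 ... | record { factors = [] ; isFactorisation = e ; factorsPrime = _ } = ⊥-elim (<⇒≱ h (≤-reflexive e))
 ... | record { factors = p ∷ ps ; isFactorisation = e ; factorsPrime = pr ∷ _ } = p , pr , subst (p ∣_) (sym e) (m∣m*n (product ps))

 exponent : ∀ p m → 2 ≤ p → 1 ≤ m → ∃ λ k → p ^ k ∣ m × ¬ (p ^ suc k ∣ m)
 exponent p m p≥2 m≥1 = go m 0 (1∣ m) (≤-reflexive (sym (+-identityʳ m)))
  where
  go : ∀ fuel k → p ^ k ∣ m → m ≤ fuel + k → ∃ λ k → p ^ k ∣ m × ¬ (p ^ suc k ∣ m)
  go zero k d h = ⊥-elim (<⇒≱ (n<p^n k p≥2) (≤-trans (∣⇒≤ {{>-nonZero m≥1}} d) h))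
  go (suc fuel) k d h with p ^ suc k ∣? m
  ... | yes d' = go fuel (suc k) d' (≤-trans h (≤-reflexive (sym (+-suc fuel k))))
  ... | no ¬d = k , d , ¬d

 factor≥1 : ∀ {m p} m' → suc m ≡ m' * p → 1 ≤ m'
 factor≥1 (suc _) _ = s≤s z≤n

 -- This is log m ≤ ∑ Λ(q) over the prime powers q dividing m, written multiplicatively. The
 -- induction removes one prime p: if p ^ k exactly divides the cofactor, the indicator at p ^ (k +
 -- 1) supplies the lost factor p.
 pp-bound : ∀ Z K m → 1 ≤ m → (∀ p k → Prime p → p ^ suc k ∣ m → p ≤ Z × k < K) →
  m ≤ ∏ (primes Z) (λ p → ∏ (upTo K) (λ k → p ^ χ (p ^ suc k ∣? m)))
 pp-bound Z K = <-rec (λ m → 1 ≤ m → (∀ p k → Prime p → p ^ suc k ∣ m → p ≤ Z × k < K) → m ≤ F m) go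
  where
  F : ℕ → ℕ
  F m = ∏ (primes Z) (λ p → ∏ (upTo K) (λ k → p ^ χ (p ^ suc k ∣? m)))
  go : ∀ m → (∀ {m'} → m' < m → 1 ≤ m' → (∀ p k → Prime p → p ^ suc k ∣ m' → p ≤ Z × k < K) → m' ≤ F m') →
   1 ≤ m → (∀ p k → Prime p → p ^ suc k ∣ m → p ≤ Z × k < K) → m ≤ F m
  go 1 rec h b = ∏≥1 (primes Z) (λ {p} p∈ → ∏≥1 (upTo K) (λ {k} _ → pow≥1 (χ (p ^ suc k ∣? 1)) (prime≥1 (fst (primes⁻ {Z} p∈)))))
  go m@(suc (suc _)) rec h b with prime-divisor m (s≤s (s≤s z≤n))
  ... | p , pr , divides m' eq with exponent p m' (prime≥2 pr) (factor≥1 m' eq)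
  ... | k , d , ¬d = begin
    m ≡⟨ trans eq (*-comm m' p) ⟩
    p * m' ≤⟨ *-monoʳ-≤ p (rec m'<m m'≥1 (λ q j qr e → b q j qr (∣-trans e m'∣m))) ⟩
    p * F m' ≤⟨ ∏-gain (primes Z) p (primes⁺ pr (fst pk)) (λ {q} q∈ → ∏-mono (upTo K) (λ {j} _ → mono {q} {j} q∈))
            (∏-gain (upTo K) p (∈-upTo⁺ (snd pk)) (λ {j} _ → mono {p} {j} (primes⁺ pr (fst pk))) gain) ⟩
    F m ∎
   where
   open ≤-Reasoning
   m'≥1 = factor≥1 m' eq
   m'∣m : m' ∣ m
   m'∣m = divides p (trans eq (*-comm m' p))
   m'<m : m' < m
   m'<m = <-≤-trans (m<m*n m' p {{>-nonZero m'≥1}} (prime≥2 pr)) (≤-reflexive (sym eq))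
   dk : p ^ suc k ∣ m
   dk = subst (p ^ suc k ∣_) (sym (trans eq (*-comm m' p))) (*-monoʳ-∣ p d)
   pk = b p k pr dk
   mono : ∀ {q j} → q ∈ primes Z → q ^ χ (q ^ suc j ∣? m') ≤ q ^ χ (q ^ suc j ∣? m)
   mono {q} {j} q∈ = pow-monoʳ (prime≥1 (fst (primes⁻ {Z} q∈))) (χ-mono (q ^ suc j ∣? m') (q ^ suc j ∣? m) (λ e → ∣-trans e m'∣m))
   gain : p * p ^ χ (p ^ suc k ∣? m') ≤ p ^ χ (p ^ suc k ∣? m)
   gain rewrite χ-no (p ^ suc k ∣? m') ¬d | χ-yes (p ^ suc k ∣? m) dk = ≤-refl

 ∑-front : ∀ n (f : ℕ → ℕ) → ∑ (upTo (suc n)) f ≡ f 0 + ∑ (upTo n) (λ k → f (suc k))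
 ∑-front zero f = refl
 ∑-front (suc n) f = trans (∑-upTo (suc n) f) (trans (cong (_+ f (suc n)) (∑-front n f))
  (trans (+-assoc (f 0) _ _) (cong (f 0 +_) (sym (∑-upTo n (λ k → f (suc k)))))))

 -- Telescoping 1/m² ≤ 1/(m-1) - 1/m for a < m ≤ a + k.
 ∑-telescope : ∀ a k X → 1 ≤ a → a * (a + k) * ∑ (upTo k) (λ i → X ÷ (suc (a + i) * suc (a + i))) ≤ k * X
 ∑-telescope a zero X a≥1 = ≤-reflexive (*-zeroʳ (a * (a + 0)))
 ∑-telescope a (suc k) X a≥1 = *-cancelˡ-≤' (a + k) (≤-trans a≥1 (m≤m+n a k)) (begin
  (a + k) * (a * (a + suc k) * ∑ (upTo (suc k)) f) ≡⟨ cong (λ z → (a + k) * (a * (a + suc k) * z)) (∑-upTo k f) ⟩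
  (a + k) * (a * (a + suc k) * (∑ (upTo k) f + f k)) ≡⟨ lem1 a k (∑ (upTo k) f) (f k) ⟩
  suc (a + k) * (a * (a + k) * ∑ (upTo k) f) + a * (f k * (suc (a + k) * (a + k)))
   ≤⟨ +-mono-≤ (*-monoʳ-≤ (suc (a + k)) (∑-telescope a k X a≥1)) (*-monoʳ-≤ a (≤-trans (*-monoʳ-≤ (f k) (*-monoʳ-≤ (suc (a + k)) (n≤1+n (a + k)))) (÷-≤ X (suc (a + k) * suc (a + k))))) ⟩
  suc (a + k) * (k * X) + a * X ≡⟨ lem2 a k X ⟩
  (a + k) * (suc k * X) ∎)
  where
  open ≤-Reasoning
  f : ℕ → ℕ
  f i = X ÷ (suc (a + i) * suc (a + i))
  lem1 : ∀ a k s t → (a + k) * (a * (a + suc k) * (s + t)) ≡ suc (a + k) * (a * (a + k) * s) + a * (t * (suc (a + k) * (a + k)))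
  lem1 = solve-∀
  lem2 : ∀ a k X → suc (a + k) * (k * X) + a * X ≡ (a + k) * (suc k * X)
  lem2 = solve-∀

 ∑-squares : ∀ n X → ∑ (upTo n) (λ i → X ÷ (suc i * suc i)) ≤ 2 * X
 ∑-squares zero X = z≤n
 ∑-squares (suc n) X = ≤-trans (≤-reflexive (∑-front n (λ i → X ÷ (suc i * suc i)))) (+-mono-≤ (≤-trans (≤-reflexive (sym (*-identityʳ (X ÷ 1)))) (÷-≤ X 1)) (≤-trans tail (≤-reflexive (sym (+-identityʳ X)))))
  where
  tail : ∑ (upTo n) (λ i → X ÷ (suc (suc i) * suc (suc i))) ≤ X
  tail = *-cancelˡ-≤' (suc n) (s≤s z≤n) (≤-trans (≤-reflexive (cong (_* ∑ (upTo n) (λ i → X ÷ (suc (suc i) * suc (suc i)))) (sym (*-identityˡ (suc n))))) (≤-trans (∑-telescope 1 n X ≤-refl) (*-monoˡ-≤ X (n≤1+n n))))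

 count-initial : ∀ {P : ℕ → Set} (P? : ∀ j → Dec (P j)) q X → q ≤ X → (∀ {j} → j < q → P j) → q ≤ ∑ (upTo X) (λ j → χ (P? j))
 count-initial P? q X q≤X h = begin
  q ≡⟨ sym (trans (∑-const (upTo q) 1) (trans (*-identityʳ _) (length-upTo q))) ⟩
  ∑ (upTo q) (λ _ → 1) ≡⟨ ∑-cong (upTo q) (λ {j} j∈ → sym (χ-yes (P? j) (h (∈-upTo⁻ j∈)))) ⟩
  ∑ (upTo q) (λ j → χ (P? j)) ≤⟨ ∑-upTo-mono (λ j → χ (P? j)) q≤X ⟩
  ∑ (upTo X) (λ j → χ (P? j)) ∎
  where open ≤-Reasoning

 ∑-below : ∀ n q → ∑ (upTo n) (λ j → χ (j <? q)) ≤ q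
 ∑-below zero q = z≤n
 ∑-below (suc n) q = ≤-trans (≤-reflexive (∑-upTo n (λ j → χ (j <? q)))) (cases (≤-<-connex q n))
  where
  cases : q ≤ n ⊎ n < q → ∑ (upTo n) (λ j → χ (j <? q)) + χ (n <? q) ≤ q
  cases (inj₁ h) = ≤-trans (≤-reflexive (trans (cong (∑ (upTo n) (λ j → χ (j <? q)) +_) (χ-no (n <? q) (≤⇒≯ h))) (+-identityʳ _))) (∑-below n q)
  cases (inj₂ h) = ≤-trans (+-mono-≤ (≤-trans (∑-bound (upTo n) 1 (λ {j} _ → χ≤1 (j <? q))) (≤-reflexive (trans (*-identityʳ _) (length-upTo n)))) (χ≤1 (n <? q))) (≤-trans (≤-reflexive (+-comm n 1)) h)

 ∏-primes-χ : ∀ {P : ℕ → Set} (P? : ∀ p → Dec (P p)) Y s → (∀ {p} → p ∈ primes Y → P p → p ≤ s) → ∏ (primes Y) (λ p → p ^ χ (P? p)) ≤ 8 ^ s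
 ∏-primes-χ P? Y s h = begin
  ∏ (primes Y) (λ p → p ^ χ (P? p)) ≡⟨ ∏-filter-χ P? (λ p → p) (primes Y) ⟩
  ∏ (filter P? (primes Y)) (λ p → p) ≤⟨ ∏-inj (filter P? (primes Y)) (primes s) (λ p → p) (Uniq.filter⁺ P? (primes-Unique Y))
                        (λ m → let (a , b) = ∈-filter⁻ P? {xs = primes Y} m in primes⁺ (fst (primes⁻ {Y} a)) (h a b)) (λ m → prime≥1 (fst (primes⁻ {s} m))) ⟩
  ∏ (primes s) (λ p → p) ≤⟨ primorial≤ s ⟩
  8 ^ s ∎
  where open ≤-Reasoning

 -- Both sides count pairs (j , m) with j m² ≤ X, the left one only with m prime.
 ∏-primes-squares : ∀ Y X → ∏ (primes Y) (λ p → p ^ (X ÷ (p * p))) ≤ 64 ^ X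
 ∏-primes-squares Y X = begin
  ∏ (primes Y) (λ p → p ^ (X ÷ (p * p))) ≤⟨ ∏-mono (primes Y) (λ {p} p∈ → pow-monoʳ (prime≥1 (fst (primes⁻ {Y} p∈))) (multiples p (prime≥1 (fst (primes⁻ {Y} p∈))))) ⟩
  ∏ (primes Y) (λ p → p ^ ∑ (upTo X) (λ j → χ (hit? j p))) ≡⟨ ∏-cong (primes Y) (λ {p} _ → sym (∏-base (upTo X) p (λ j → χ (hit? j p)))) ⟩
  ∏ (primes Y) (λ p → ∏ (upTo X) (λ j → p ^ χ (hit? j p))) ≡⟨ ∏-swap (primes Y) (upTo X) (λ p j → p ^ χ (hit? j p)) ⟩
  ∏ (upTo X) (λ j → ∏ (primes Y) (λ p → p ^ χ (hit? j p))) ≤⟨ ∏-mono (upTo X) (λ {j} _ → ∏-primes-χ (hit? j) Y (∑ (upTo X) (λ m → χ (hit? j (suc m)))) (λ {p} _ → roots j p)) ⟩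
  ∏ (upTo X) (λ j → 8 ^ ∑ (upTo X) (λ m → χ (hit? j (suc m)))) ≡⟨ ∏-base (upTo X) 8 _ ⟩
  8 ^ ∑ (upTo X) (λ j → ∑ (upTo X) (λ m → χ (hit? j (suc m)))) ≡⟨ cong (8 ^_) (∑-swap (upTo X) (upTo X) (λ j m → χ (hit? j (suc m)))) ⟩
  8 ^ ∑ (upTo X) (λ m → ∑ (upTo X) (λ j → χ (hit? j (suc m)))) ≤⟨ ^-monoʳ-≤ 8 (≤-trans (∑-mono (upTo X) (λ {m} _ → column m)) (∑-squares X X)) ⟩
  8 ^ (2 * X) ≡⟨ sym (^-*-assoc 8 2 X) ⟩
  64 ^ X ∎
  where
  open ≤-Reasoning
  hit? : ∀ j m → Dec (suc j * (m * m) ≤ X)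
  hit? j m = suc j * (m * m) ≤? X
  multiples : ∀ p → 1 ≤ p → X ÷ (p * p) ≤ ∑ (upTo X) (λ j → χ (hit? j p))
  multiples p p≥1 = count-initial (λ j → hit? j p) (X ÷ (p * p)) X (≤-trans (m≤m*n _ (p * p) {{>-nonZero (*-mono-≤ p≥1 p≥1)}}) (÷-≤ X (p * p))) (λ lt → ≤-trans (*-monoˡ-≤ (p * p) lt) (÷-≤ X (p * p)))
  roots : ∀ j p → suc j * (p * p) ≤ X → p ≤ ∑ (upTo X) (λ m → χ (hit? j (suc m)))
  roots j zero h = z≤n
  roots j (suc p) h = count-initial (λ m → hit? j (suc m)) (suc p) X (≤-trans (m≤m*n (suc p) (suc p)) (≤-trans (m≤n*m (suc p * suc p) (suc j)) h)) (λ lt → ≤-trans (*-monoʳ-≤ (suc j) (*-mono-≤ lt lt)) h)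
  column : ∀ m → ∑ (upTo X) (λ j → χ (hit? j (suc m))) ≤ X ÷ (suc m * suc m)
  column m = ≤-trans (∑-mono (upTo X) (λ {j} _ → χ-mono (hit? j (suc m)) (j <? X ÷ (suc m * suc m)) (÷-greatest (suc j) (s≤s z≤n)))) (∑-below X (X ÷ (suc m * suc m)))

 count-multiples : ∀ q X → 1 ≤ q → ∑ (upTo X) (λ m → χ (q ∣? suc m)) * q ≤ X
 count-multiples q zero q≥1 = z≤n
 count-multiples q (suc X) q≥1 rewrite ∑-upTo X (λ m → χ (q ∣? suc m)) with q ∣? suc X
 ... | no _ = ≤-trans (≤-reflexive (cong (_* q) (+-identityʳ (∑ (upTo X) (λ m → χ (q ∣? suc m)))))) (≤-trans (count-multiples q X q≥1) (n≤1+n X))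
 ... | yes (divides t e) = ≤-trans (*-monoˡ-≤ q (≤-trans (≤-reflexive (+-comm _ 1)) c<t)) (≤-reflexive (sym e))
  where
  c<t : ∑ (upTo X) (λ m → χ (q ∣? suc m)) < t
  c<t = *-cancelʳ-< q _ t (<-≤-trans (s≤s (count-multiples q X q≥1)) (≤-reflexive e))

 ∑-geometric : ∀ p K Z → 2 ≤ p → ∑ (upTo K) (λ k → Z ÷ p ^ k) ≤ 2 * Z
 ∑-geometric p K Z p≥2 = ≤-trans (m≤m+n _ _) (go K)
  where
  a : ℕ → ℕ
  a k = Z ÷ p ^ k
  shift : ∀ k → 2 * a (suc k) ≤ a k
  shift k = ÷-greatest _ (pow≥1 k (≤-trans (s≤s z≤n) p≥2)) (begin
   2 * c * p ^ k ≡⟨ lemma c (p ^ k) ⟩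
   c * (2 * p ^ k) ≤⟨ *-monoʳ-≤ c (*-monoˡ-≤ (p ^ k) p≥2) ⟩
   c * (p * p ^ k) ≤⟨ ÷-≤ Z (p ^ suc k) ⟩
   Z ∎)
   where
   open ≤-Reasoning
   c = a (suc k)
   lemma : ∀ a b → 2 * a * b ≡ a * (2 * b)
   lemma = solve-∀
  go : ∀ K → ∑ (upTo K) a + 2 * a K ≤ 2 * Z
  go zero = *-monoʳ-≤ 2 (≤-trans (≤-reflexive (sym (*-identityʳ (Z ÷ 1)))) (÷-≤ Z 1))
  go (suc K) = begin
   ∑ (upTo (suc K)) a + 2 * a (suc K) ≤⟨ +-mono-≤ (≤-reflexive (∑-upTo K a)) (shift K) ⟩
   ∑ (upTo K) a + a K + a K ≡⟨ lemma (∑ (upTo K) a) (a K) ⟩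
   ∑ (upTo K) a + 2 * a K ≤⟨ go K ⟩
   2 * Z ∎
   where
   open ≤-Reasoning
   lemma : ∀ s x → s + x + x ≡ s + 2 * x
   lemma = solve-∀

 -- By the geometric series the powers from the square onwards contribute at most 2X/p², and
 -- `∏-primes-squares` sums these; 4096 = 64².
 ∏-higher-powers : ∀ Y K X → ∏ (primes Y) (λ p → p ^ ∑ (upTo K) (λ k → X ÷ p ^ suc (suc k))) ≤ 4096 ^ X
 ∏-higher-powers Y K X = begin
  ∏ (primes Y) (λ p → p ^ ∑ (upTo K) (λ k → X ÷ p ^ suc (suc k)))
   ≤⟨ ∏-mono (primes Y) (λ {p} m → pow-monoʳ (prime≥1 (fst (primes⁻ {Y} m))) (bound p (fst (primes⁻ {Y} m)))) ⟩
  ∏ (primes Y) (λ p → p ^ (2 * (X ÷ (p * p))))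
   ≡⟨ ∏-cong (primes Y) (λ {p} _ → trans (cong (p ^_) (*-comm 2 (X ÷ (p * p)))) (sym (^-*-assoc p (X ÷ (p * p)) 2))) ⟩
  ∏ (primes Y) (λ p → (p ^ (X ÷ (p * p))) ^ 2) ≡⟨ ∏-^ (primes Y) _ 2 ⟩
  ∏ (primes Y) (λ p → p ^ (X ÷ (p * p))) ^ 2 ≤⟨ ^-monoˡ-≤ 2 (∏-primes-squares Y X) ⟩
  (64 ^ X) ^ 2 ≡⟨ trans (^-*-assoc 64 X 2) (trans (cong (64 ^_) (*-comm X 2)) (sym (^-*-assoc 64 2 X))) ⟩
  4096 ^ X ∎
  where
  open ≤-Reasoning
  bound : ∀ p → Prime p → ∑ (upTo K) (λ k → X ÷ p ^ suc (suc k)) ≤ 2 * (X ÷ (p * p))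
  bound p pr = ≤-trans (∑-mono (upTo K) (λ {k} _ → ÷-greatest _ (pow≥1 k p≥1) (÷-greatest _ (*-mono-≤ p≥1 p≥1)
    (≤-trans (≤-reflexive (lemma (X ÷ p ^ suc (suc k)) p (p ^ k))) (÷-≤ X (p ^ suc (suc k)))))))
   (∑-geometric p K (X ÷ (p * p)) (prime≥2 pr))
   where
   p≥1 = prime≥1 pr
   lemma : ∀ a b c → a * c * (b * b) ≡ a * (b * (b * c))
   lemma = solve-∀

 -- Beyond n ! the number (2n)! has n further factors greater than n, and the central binomial
 -- coefficient is at most 4 ^ n.
 n^n≤4^n*n! : ∀ n → n ^ n ≤ 4 ^ n * n !
 n^n≤4^n*n! n = *-cancelʳ-≤' (n !) (1≤n! n) (begin
  n ^ n * n ! ≤⟨ rising n ⟩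
  (n + n) ! ≡⟨ sym (bin-! n n) ⟩
  bin n n * (n ! * n !) ≤⟨ *-monoˡ-≤ (n ! * n !) (bin≤ n n) ⟩
  2 ^ (n + n) * (n ! * n !) ≡⟨ cong (λ z → 2 ^ z * (n ! * n !)) (cong (n +_) (sym (+-identityʳ n))) ⟩
  2 ^ (2 * n) * (n ! * n !) ≡⟨ cong (_* (n ! * n !)) (sym (^-*-assoc 2 2 n)) ⟩
  4 ^ n * (n ! * n !) ≡⟨ sym (*-assoc (4 ^ n) (n !) (n !)) ⟩
  4 ^ n * n ! * n ! ∎)
  where
  open ≤-Reasoning
  go : ∀ k m → m ^ k * m ! ≤ (k + m) !
  go zero m = ≤-reflexive (+-identityʳ (m !))
  go (suc k) m = ≤-trans (≤-reflexive (*-assoc m (m ^ k) (m !))) (*-mono-≤ (≤-trans (m≤n+m m k) (n≤1+n _)) (go k m))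
  rising : ∀ n → n ^ n * n ! ≤ (n + n) !
  rising n = go n n

 -- Legendre's formula, with all powers of primes beyond the first collected in 4096 ^ X.
 factorial-bound : ∀ X → X ! ≤ 4096 ^ X * ∏ (primes X) (λ p → p ^ (X ÷ p))
 factorial-bound X = begin
  X ! ≡⟨ factorial-∏ X ⟩
  ∏ (upTo X) suc ≤⟨ ∏-mono (upTo X) (λ {m} m∈ → pp-bound X (suc X) (suc m) (s≤s z≤n) (small m (∈-upTo⁻ m∈))) ⟩
  ∏ (upTo X) (λ m → ∏ (primes X) (λ p → ∏ (upTo (suc X)) (λ k → p ^ χ (p ^ suc k ∣? suc m))))
   ≡⟨ ∏-swap (upTo X) (primes X) _ ⟩
  ∏ (primes X) (λ p → ∏ (upTo X) (λ m → ∏ (upTo (suc X)) (λ k → p ^ χ (p ^ suc k ∣? suc m))))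
   ≡⟨ ∏-cong (primes X) (λ {p} _ → trans (∏-swap (upTo X) (upTo (suc X)) (λ m k → p ^ χ (p ^ suc k ∣? suc m)))
      (trans (∏-cong (upTo (suc X)) (λ {k} _ → ∏-base (upTo X) p (λ m → χ (p ^ suc k ∣? suc m))))
       (∏-base (upTo (suc X)) p (λ k → ∑ (upTo X) (λ m → χ (p ^ suc k ∣? suc m)))))) ⟩
  ∏ (primes X) (λ p → p ^ ∑ (upTo (suc X)) (λ k → ∑ (upTo X) (λ m → χ (p ^ suc k ∣? suc m))))
   ≤⟨ ∏-mono (primes X) (λ {p} p∈ → pow-monoʳ (prime≥1 (fst (primes⁻ {X} p∈))) (split p (fst (primes⁻ {X} p∈)))) ⟩
  ∏ (primes X) (λ p → p ^ ((X ÷ p) + ∑ (upTo X) (λ k → X ÷ p ^ suc (suc k))))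
   ≡⟨ ∏-cong (primes X) (λ {p} _ → ^-distribˡ-+-* p (X ÷ p) _) ⟩
  ∏ (primes X) (λ p → p ^ (X ÷ p) * p ^ ∑ (upTo X) (λ k → X ÷ p ^ suc (suc k))) ≡⟨ ∏-* (primes X) _ _ ⟩
  ∏ (primes X) (λ p → p ^ (X ÷ p)) * ∏ (primes X) (λ p → p ^ ∑ (upTo X) (λ k → X ÷ p ^ suc (suc k)))
   ≤⟨ *-monoʳ-≤ (∏ (primes X) (λ p → p ^ (X ÷ p))) (∏-higher-powers X X X) ⟩
  ∏ (primes X) (λ p → p ^ (X ÷ p)) * 4096 ^ X ≡⟨ *-comm _ (4096 ^ X) ⟩
  4096 ^ X * ∏ (primes X) (λ p → p ^ (X ÷ p)) ∎
  where
  open ≤-Reasoning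
  small : ∀ m → m < X → ∀ p k → Prime p → p ^ suc k ∣ suc m → p ≤ X × k < suc X
  small m m<X p k pr d = ≤-trans (≤-trans (≤-reflexive (sym (*-identityʳ p))) (*-monoʳ-≤ p (pow≥1 k (prime≥1 pr)))) q≤X
   , <-trans (n<1+n k) (<-≤-trans (n<p^n (suc k) (prime≥2 pr)) (≤-trans q≤X (n≤1+n X)))
   where
   q≤X : p ^ suc k ≤ X
   q≤X = ≤-trans (∣⇒≤ d) m<X
  split : ∀ p → Prime p → ∑ (upTo (suc X)) (λ k → ∑ (upTo X) (λ m → χ (p ^ suc k ∣? suc m))) ≤ (X ÷ p) + ∑ (upTo X) (λ k → X ÷ p ^ suc (suc k))
  split p pr = begin
   ∑ (upTo (suc X)) (λ k → ∑ (upTo X) (λ m → χ (p ^ suc k ∣? suc m)))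
    ≤⟨ ∑-mono (upTo (suc X)) (λ {k} _ → ÷-greatest _ (pow≥1 (suc k) (prime≥1 pr)) (count-multiples (p ^ suc k) X (pow≥1 (suc k) (prime≥1 pr)))) ⟩
   ∑ (upTo (suc X)) (λ k → X ÷ p ^ suc k) ≡⟨ ∑-front X (λ k → X ÷ p ^ suc k) ⟩
   (X ÷ p ^ 1) + ∑ (upTo X) (λ k → X ÷ p ^ suc (suc k)) ≡⟨ cong (λ z → (X ÷ z) + ∑ (upTo X) (λ k → X ÷ p ^ suc (suc k))) (*-identityʳ p) ⟩
   (X ÷ p) + ∑ (upTo X) (λ k → X ÷ p ^ suc (suc k)) ∎

 -- With w p = D / p this is log X ≤ log 16384 + ∑ (log p)/p. The constant is 4 · 4096: the 4 comes
 -- from the bound for n ^ n, the 4096 from higher prime powers. Raising to the X-th power trades D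
 -- ⌊X/p⌋ for X w p.
 mertens-lower : ∀ X D (w : ℕ → ℕ) → 1 ≤ X → (∀ {p} → p ∈ primes X → p * w p ≡ D) → X ^ D ≤ 16384 ^ D * ∏ (primes X) (λ p → p ^ w p)
 mertens-lower X D w X≥1 pw = root-≤ X X≥1 (begin
  (X ^ D) ^ X ≡⟨ trans (^-*-assoc X D X) (trans (cong (X ^_) (*-comm D X)) (sym (^-*-assoc X X D))) ⟩
  (X ^ X) ^ D ≤⟨ ^-monoˡ-≤ D (n^n≤4^n*n! X) ⟩
  (4 ^ X * X !) ^ D ≤⟨ ^-monoˡ-≤ D (*-monoʳ-≤ (4 ^ X) (factorial-bound X)) ⟩
  (4 ^ X * (4096 ^ X * Q)) ^ D ≡⟨ cong (_^ D) (sym (*-assoc (4 ^ X) (4096 ^ X) Q)) ⟩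
  (4 ^ X * 4096 ^ X * Q) ^ D ≡⟨ cong (λ z → (z * Q) ^ D) (sym (^-*-distrib X 4 4096)) ⟩
  (16384 ^ X * Q) ^ D ≡⟨ ^-*-distrib D (16384 ^ X) Q ⟩
  (16384 ^ X) ^ D * Q ^ D ≡⟨ cong₂ _*_ (trans (^-*-assoc 16384 X D) (trans (cong (16384 ^_) (*-comm X D)) (sym (^-*-assoc 16384 D X)))) (sym (∏-^ (primes X) _ D)) ⟩
  (16384 ^ D) ^ X * ∏ (primes X) (λ p → (p ^ (X ÷ p)) ^ D)
   ≤⟨ *-monoʳ-≤ ((16384 ^ D) ^ X) (∏-mono (primes X) (λ {p} m → each p m)) ⟩
  (16384 ^ D) ^ X * ∏ (primes X) (λ p → (p ^ w p) ^ X) ≡⟨ cong ((16384 ^ D) ^ X *_) (∏-^ (primes X) _ X) ⟩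
  (16384 ^ D) ^ X * ∏ (primes X) (λ p → p ^ w p) ^ X ≡⟨ sym (^-*-distrib X (16384 ^ D) _) ⟩
  (16384 ^ D * ∏ (primes X) (λ p → p ^ w p)) ^ X ∎)
  where
  open ≤-Reasoning
  Q = ∏ (primes X) (λ p → p ^ (X ÷ p))
  each : ∀ p → p ∈ primes X → (p ^ (X ÷ p)) ^ D ≤ (p ^ w p) ^ X
  each p m = ≤-trans (≤-reflexive (^-*-assoc p (X ÷ p) D)) (≤-trans (pow-monoʳ (prime≥1 (fst (primes⁻ {X} m))) (begin
    (X ÷ p) * D ≡⟨ cong ((X ÷ p) *_) (sym (pw m)) ⟩
    (X ÷ p) * (p * w p) ≡⟨ sym (*-assoc (X ÷ p) p (w p)) ⟩
    (X ÷ p) * p * w p ≤⟨ *-monoˡ-≤ (w p) (÷-≤ X p) ⟩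
    X * w p ≡⟨ *-comm X (w p) ⟩
    w p * X ∎)) (≤-reflexive (sym (^-*-assoc p (w p) X))))

 -- If c p is the number of multiples of p up to X, then X < (c p + 1) p. The summand 1 costs the
 -- primorial, at most 8 ^ X, and the product of all p ^ c p is a product of radicals of the m ≤ X,
 -- hence at most X ^ X.
 mertens-upper : ∀ X D (e : ℕ → ℕ) → 1 ≤ X → (∀ {p} → p ∈ primes X → p * e p ≤ D) → ∏ (primes X) (λ p → p ^ e p) ≤ (8 * X) ^ D
 mertens-upper X D e X≥1 pe = root-≤ X X≥1 (begin
  ∏ (primes X) (λ p → p ^ e p) ^ X ≡⟨ sym (∏-^ (primes X) _ X) ⟩
  ∏ (primes X) (λ p → (p ^ e p) ^ X) ≤⟨ ∏-mono (primes X) (λ {p} m → each p m) ⟩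
  ∏ (primes X) (λ p → (p * p ^ c p) ^ D) ≡⟨ ∏-^ (primes X) _ D ⟩
  ∏ (primes X) (λ p → p * p ^ c p) ^ D ≡⟨ cong (_^ D) (∏-* (primes X) _ _) ⟩
  (∏ (primes X) (λ p → p) * ∏ (primes X) (λ p → p ^ c p)) ^ D ≤⟨ ^-monoˡ-≤ D (*-mono-≤ (primorial≤ X) low) ⟩
  (8 ^ X * X ^ X) ^ D ≡⟨ cong (_^ D) (sym (^-*-distrib X 8 X)) ⟩
  ((8 * X) ^ X) ^ D ≡⟨ trans (^-*-assoc (8 * X) X D) (trans (cong ((8 * X) ^_) (*-comm X D)) (sym (^-*-assoc (8 * X) D X))) ⟩
  ((8 * X) ^ D) ^ X ∎)
  where
  open ≤-Reasoning
  c : ℕ → ℕ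
  c p = ∑ (upTo X) (λ m → χ (p ∣? suc m))
  count≥ : ∀ p X → 1 ≤ p → X < suc (∑ (upTo X) (λ m → χ (p ∣? suc m))) * p
  count≥ p X p≥1 = go X
   where
   k : ℕ → ℕ
   k X = ∑ (upTo X) (λ m → χ (p ∣? suc m))
   inv : ∀ X → ∃ λ r → r < p × X ≡ k X * p + r
   inv zero = 0 , p≥1 , refl
   inv (suc X) with inv X
   ... | r , r<p , e rewrite ∑-upTo X (λ m → χ (p ∣? suc m)) with p ∣? suc X
   ... | yes (divides t e') = 0 , p≥1 , trans e″ (trans (lem1 (k X) p) (sym (+-identityʳ _)))
    where
    lem1 : ∀ a b → a * b + b ≡ (a + 1) * b
    lem1 = solve-∀
    p∣ : p ∣ suc r
    p∣ = ∣m+n∣m⇒∣n (subst (p ∣_) (trans (cong suc e) (sym (+-suc (k X * p) r))) (divides t e')) (divides (k X) refl)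
    e″ : suc X ≡ k X * p + p
    e″ = trans (cong suc e) (trans (sym (+-suc (k X * p) r)) (cong (k X * p +_) (≤-antisym r<p (∣⇒≤ p∣))))
   ... | no ¬d = suc r , ≤∧≢⇒< r<p (λ eq → ¬d (divides (suc (k X)) (trans (cong suc e) (trans (sym (+-suc (k X * p) r))
         (trans (cong (k X * p +_) eq) (+-comm (k X * p) p))))))
        , trans (cong suc e) (trans (sym (+-suc (k X * p) r)) (cong (λ z → z * p + suc r) (sym (+-identityʳ (k X)))))
   go : ∀ X → X < suc (k X) * p
   go X with inv X
   ... | r , r<p , e = subst (_< suc (k X) * p) (sym e) (<-≤-trans (+-monoʳ-< (k X * p) r<p) (≤-reflexive (+-comm (k X * p) p)))
  each : ∀ p → p ∈ primes X → (p ^ e p) ^ X ≤ (p * p ^ c p) ^ D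
  each p m = ≤-trans (≤-reflexive (^-*-assoc p (e p) X)) (≤-trans (pow-monoʳ p≥1 (*-cancelˡ-≤' p p≥1 (begin
    p * (e p * X) ≡⟨ sym (*-assoc p (e p) X) ⟩
    p * e p * X ≤⟨ *-mono-≤ (pe m) (<⇒≤ (count≥ p X p≥1)) ⟩
    D * (suc (c p) * p) ≡⟨ lemma D (suc (c p)) p ⟩
    p * (suc (c p) * D) ∎))) (≤-reflexive (sym (^-*-assoc p (suc (c p)) D))))
   where
   p≥1 = prime≥1 (fst (primes⁻ {X} m))
   lemma : ∀ a b d → a * (b * d) ≡ d * (b * a)
   lemma = solve-∀
  low : ∏ (primes X) (λ p → p ^ c p) ≤ X ^ X
  low = begin
   ∏ (primes X) (λ p → p ^ c p) ≡⟨ ∏-cong (primes X) (λ {p} _ → sym (∏-base (upTo X) p _)) ⟩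
   ∏ (primes X) (λ p → ∏ (upTo X) (λ m → p ^ χ (p ∣? suc m))) ≡⟨ ∏-swap (primes X) (upTo X) _ ⟩
   ∏ (upTo X) (λ m → ∏ (primes X) (λ p → p ^ χ (p ∣? suc m))) ≤⟨ ∏-bound (upTo X) X (λ {m} m∈ → ≤-trans (rad m) (∈-upTo⁻ m∈)) ⟩
   X ^ length (upTo X) ≡⟨ cong (X ^_) (length-upTo X) ⟩
   X ^ X ∎
   where
   filt : ∀ (l : List ℕ) m → ∏ l (λ p → p ^ χ (p ∣? suc m)) ≡ ∏ (filter (_∣? suc m) l) (λ p → p)
   filt [] m = refl
   filt (p ∷ l) m with p ∣? suc m
   ... | yes _ = cong₂ _*_ (*-identityʳ p) (filt l m)
   ... | no _ = trans (+-identityʳ _) (filt l m)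
   rad : ∀ m → ∏ (primes X) (λ p → p ^ χ (p ∣? suc m)) ≤ suc m
   rad m = ≤-trans (≤-reflexive (filt (primes X) m)) (∣⇒≤ (distinct-primes-∣ (filter (_∣? suc m) (primes X)) (suc m)
    (Uniq.filter⁺ (_∣? suc m) (primes-Unique X))
    (λ q → let (a , b) = ∈-filter⁻ (_∣? suc m) {xs = primes X} q in fst (primes⁻ {X} a) , b)))

 pow-swap : ∀ a m n → (a ^ m) ^ n ≡ (a ^ n) ^ m
 pow-swap a m n = trans (^-*-assoc a m n) (trans (cong (a ^_) (*-comm m n)) (sym (^-*-assoc a n m)))

 pow-cancel : ∀ {b i j} → 2 ≤ b → b ^ i ≤ b ^ j → i ≤ j
 pow-cancel {b} {i} {j} b≥2 h with i ≤? j
 ... | yes p = p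
 ... | no ¬p = ⊥-elim (<⇒≱ (^-monoʳ-< b b≥2 (≰⇒> ¬p)) h)

 ∑-sub : ∀ (l k : List ℕ) (f : ℕ → ℕ) → Unique l → (∀ {x} → x ∈ l → x ∈ k) → ∑ l f ≤ ∑ k f
 ∑-sub l k f u sub = pow-cancel {2} ≤-refl (≤-trans (≤-reflexive (sym (∏-base l 2 f))) (≤-trans (∏-inj l k (λ x → 2 ^ f x) u sub (λ {x} _ → pow≥1 (f x) (s≤s z≤n))) (≤-reflexive (∏-base k 2 f))))

 -- Cauchy-Schwarz and the combinatorial core of the larger sieve

 private
  am-gm : ∀ a b → 2 * (a * b) ≤ a * a + b * b
  am-gm a b with ≤-total a b
  ... | inj₁ h = core a b h
   where
   core : ∀ a b → a ≤ b → 2 * (a * b) ≤ a * a + b * b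
   core a b h = subst (λ b → 2 * (a * b) ≤ a * a + b * b) (m+[n∸m]≡n h) (≤-trans (m≤m+n _ ((b ∸ a) * (b ∸ a))) (≤-reflexive (lemma a (b ∸ a))))
    where
    lemma : ∀ a d → 2 * (a * (a + d)) + d * d ≡ a * a + (a + d) * (a + d)
    lemma = solve-∀
  ... | inj₂ h = am-gm'
   where
   am-gm' : 2 * (a * b) ≤ a * a + b * b
   am-gm' = subst (λ a → 2 * (a * b) ≤ a * a + b * b) (m+[n∸m]≡n h) (≤-trans (m≤m+n _ ((a ∸ b) * (a ∸ b))) (≤-reflexive (lemma b (a ∸ b))))
    where
    lemma : ∀ b d → 2 * ((b + d) * b) + d * d ≡ (b + d) * (b + d) + b * b
    lemma = solve-∀

 cauchy-schwarz : ∀ {A : Set} (l : List A) (f : A → ℕ) → ∑ l f * ∑ l f ≤ length l * ∑ l (λ x → f x * f x)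
 cauchy-schwarz [] f = z≤n
 cauchy-schwarz (y ∷ l) f = begin
  (x + S) * (x + S) ≡⟨ lem1 x S ⟩
  x * x + 2 * (x * S) + S * S ≤⟨ +-mono-≤ (+-monoʳ-≤ (x * x) (cross l)) (cauchy-schwarz l f) ⟩
  x * x + (length l * (x * x) + Q) + length l * Q ≡⟨ lem2 (x * x) (length l) Q ⟩
  suc (length l) * (x * x + Q) ∎
  where
  open ≤-Reasoning
  x = f y
  S = ∑ l f
  Q = ∑ l (λ z → f z * f z)
  lem1 : ∀ x s → (x + s) * (x + s) ≡ x * x + 2 * (x * s) + s * s
  lem1 = solve-∀
  lem2 : ∀ a k q → a + (k * a + q) + k * q ≡ suc k * (a + q)
  lem2 = solve-∀
  cross : ∀ l → 2 * (x * ∑ l f) ≤ length l * (x * x) + ∑ l (λ z → f z * f z)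
  cross [] = ≤-reflexive (cong (2 *_) (*-zeroʳ x))
  cross (z ∷ l) = ≤-trans (≤-reflexive (lem3 x (f z) (∑ l f))) (≤-trans (+-mono-≤ (am-gm x (f z)) (cross l))
    (≤-reflexive (lem4 (x * x) (f z * f z) (length l * (x * x)) (∑ l (λ z → f z * f z)))))
   where
   lem3 : ∀ x a b → 2 * (x * (a + b)) ≡ 2 * (x * a) + 2 * (x * b)
   lem3 = solve-∀
   lem4 : ∀ a b c d → a + b + (c + d) ≡ a + c + (b + d)
   lem4 = solve-∀

 ∑-χ-select : ∀ (l : List ℕ) a (h : ℕ → ℕ) → Unique l → ∑ l (λ j → χ (a ≟ j) * h j) ≤ h a
 ∑-χ-select [] a h u = z≤n
 ∑-χ-select (j ∷ l) a h (px ∷ u) with a ≟ j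
 ... | no _ = ∑-χ-select l a h u
 ... | yes refl = ≤-reflexive (trans (cong₂ _+_ (+-identityʳ (h a)) (rest l px)) (+-identityʳ (h a)))
  where
  rest : ∀ l → All (λ z → a ≢ z) l → ∑ l (λ j → χ (a ≟ j) * h j) ≡ 0
  rest [] [] = refl
  rest (z ∷ l) (p ∷ ps) = cong₂ _+_ (cong (_* h z) (χ-no (a ≟ z) p)) (rest l ps)

 -- The fibre sizes ν j over the p residues add up to the length of bs; Cauchy-Schwarz bounds the
 -- sum of their squares, which counts colliding pairs, from below.
 collisions : ∀ {A : Set} (bs : List A) p (φ : A → ℕ) → (∀ b → φ b < p) →
  length bs * length bs ≤ p * ∑ bs (λ b → ∑ bs (λ c → χ (φ b ≟ φ c)))
 collisions bs p φ lt = begin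
  length bs * length bs ≤⟨ *-mono-≤ total total ⟩
  ∑ (upTo p) ν * ∑ (upTo p) ν ≤⟨ cauchy-schwarz (upTo p) ν ⟩
  length (upTo p) * ∑ (upTo p) (λ j → ν j * ν j) ≡⟨ cong (_* ∑ (upTo p) (λ j → ν j * ν j)) (length-upTo p) ⟩
  p * ∑ (upTo p) (λ j → ν j * ν j) ≤⟨ *-monoʳ-≤ p pairs ⟩
  p * ∑ bs (λ b → ∑ bs (λ c → χ (φ b ≟ φ c))) ∎
  where
  open ≤-Reasoning
  ν : ℕ → ℕ
  ν j = ∑ bs (λ b → χ (φ b ≟ j))
  total : length bs ≤ ∑ (upTo p) ν
  total = begin
   length bs ≡⟨ sym (trans (∑-const bs 1) (*-identityʳ _)) ⟩
   ∑ bs (λ _ → 1) ≤⟨ ∑-mono bs (λ {b} _ → ≤-trans (≤-reflexive (sym (χ-yes (φ b ≟ φ b) refl))) (∑-∈ (upTo p) (∈-upTo⁺ (lt b)))) ⟩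
   ∑ bs (λ b → ∑ (upTo p) (λ j → χ (φ b ≟ j))) ≡⟨ ∑-swap bs (upTo p) (λ b j → χ (φ b ≟ j)) ⟩
   ∑ (upTo p) ν ∎
  pairs : ∑ (upTo p) (λ j → ν j * ν j) ≤ ∑ bs (λ b → ∑ bs (λ c → χ (φ b ≟ φ c)))
  pairs = begin
   ∑ (upTo p) (λ j → ν j * ν j) ≡⟨ ∑-cong (upTo p) (λ {j} _ → trans (*-comm (ν j) (ν j)) (sym (∑-*ˡ bs (ν j) (λ b → χ (φ b ≟ j))))) ⟩
   ∑ (upTo p) (λ j → ∑ bs (λ b → ν j * χ (φ b ≟ j))) ≡⟨ ∑-swap (upTo p) bs (λ j b → ν j * χ (φ b ≟ j)) ⟩
   ∑ bs (λ b → ∑ (upTo p) (λ j → ν j * χ (φ b ≟ j))) ≤⟨ ∑-mono bs (λ {b} _ → ≤-trans (≤-reflexive (∑-cong (upTo p) (λ {j} _ → *-comm (ν j) (χ (φ b ≟ j))))) (∑-χ-select (upTo p) (φ b) ν (Uniq.upTo⁺ p))) ⟩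
   ∑ bs (λ b → ν (φ b)) ≤⟨ ∑-mono bs (λ {b} _ → ∑-mono bs (λ {c} _ → χ-mono (φ c ≟ φ b) (φ b ≟ φ c) sym)) ⟩
   ∑ bs (λ b → ∑ bs (λ c → χ (φ b ≟ φ c))) ∎

 -- A prime p with a residue r, later a root of the polynomial modulo p: a prime ideal of degree
 -- one.
 Place : Set
 Place = ℕ × ℕ

 -- One digit below p for every place. `separated` shows that these lists label distinct residue
 -- classes, so their number ∏ p is a lower bound for the index of an ideal.
 idx : List Place → List (List ℕ)
 idx [] = [] ∷ []
 idx ((p , r) ∷ vl) = cartesianProductWith _∷_ (upTo p) (idx vl)

 length-idx : ∀ vl → length (idx vl) ≡ ∏ vl fst
 length-idx [] = refl
 length-idx ((p , r) ∷ vl) = trans (length-cart _∷_ (upTo p) (idx vl)) (cong₂ _*_ (length-upTo p) (length-idx vl))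

 idx-Unique : ∀ vl → Unique (idx vl)
 idx-Unique [] = [] ∷ []
 idx-Unique ((p , r) ∷ vl) = Uniq.cartesianProductWith⁺ _∷_ (λ { refl → refl , refl }) (Uniq.upTo⁺ p) (idx-Unique vl)

 nearest-power : ∀ m X → 1 ≤ X → Σ ℕ λ A → 1 ≤ A × X ≤ A ^ suc m × A ^ suc m ≤ 2 ^ suc m * X
 nearest-power m X X≥1 = go X (≤-trans (n≤1+n X) (m≤m*n (suc X) (suc X ^ m) {{m^n≢0 (suc X) m}}))
  where
  go : ∀ A → X ≤ suc A ^ suc m → Σ ℕ λ A → 1 ≤ A × X ≤ A ^ suc m × A ^ suc m ≤ 2 ^ suc m * X
  go zero h = 1 , s≤s z≤n , h , ≤-trans (≤-reflexive (^-zeroˡ (suc m))) (*-mono-≤ (pow≥1 (suc m) (s≤s z≤n)) X≥1)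
  go (suc A) h with X ≤? suc A ^ suc m
  ... | yes h' = go A h'
  ... | no ¬h = suc (suc A) , s≤s z≤n , h , (begin
    suc (suc A) ^ suc m ≤⟨ ^-monoˡ-≤ (suc m) (≤-trans (m≤m+n (suc (suc A)) A) (≤-reflexive (lemma A))) ⟩
    (2 * suc A) ^ suc m ≡⟨ ^-*-distrib (suc m) 2 (suc A) ⟩
    2 ^ suc m * suc A ^ suc m ≤⟨ *-monoʳ-≤ (2 ^ suc m) (<⇒≤ (≰⇒> ¬h)) ⟩
    2 ^ suc m * X ∎)
   where
   open ≤-Reasoning
   lemma : ∀ A → suc (suc A) + A ≡ 2 * suc A
   lemma = solve-∀

 -- The larger sieve over pairs in a box: collisions are frequent by Cauchy–Schwarz, and each pair b ≢ c of elements
 -- collides only at places whose norms multiply to at most K.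
 larger-sieve-count : ∀ {V : Set} (_≟'_ : ∀ (x y : V) → Dec (x ≡ y)) (bs : List V) → Unique bs → (PL : List Place) (φ : Place → V → ℕ) → ∀ K X B D (w : ℕ → ℕ) →
  length bs ≡ B → 1 ≤ B → X ≤ B → 1 ≤ K → ∏ PL fst ≤ 64 ^ X →
  (∀ {pl} → pl ∈ PL → ∀ b → φ pl b < fst pl) →
  (∀ {pl} → pl ∈ PL → fst pl * w (fst pl) ≡ D) →
  (∀ {b c} → b ∈ bs → c ∈ bs → b ≢ c → ∏ PL (λ pl → fst pl ^ χ (φ pl b ≟ φ pl c)) ≤ K) →
  ∏ PL (λ pl → fst pl ^ w (fst pl)) ≤ (64 * K) ^ D
 larger-sieve-count _≟'_ bs ub PL φ K X B D w lenB B≥1 X≤B K≥1 primes≤ φ< pw bound = root-≤ (B * B) (*-mono-≤ B≥1 B≥1) (begin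
  ∏ PL (λ pl → fst pl ^ w (fst pl)) ^ (B * B) ≡⟨ ∏-^ PL _ (B * B) ⟨
  ∏ PL (λ pl → (fst pl ^ w (fst pl)) ^ (B * B)) ≤⟨ ∏-mono PL (λ {pl} m → each pl m) ⟩
  ∏ PL (λ pl → (fst pl ^ S pl) ^ D) ≡⟨ ∏-^ PL _ D ⟩
  ∏ PL (λ pl → fst pl ^ S pl) ^ D ≡⟨ cong (_^ D) regroup ⟩
  ∏ bs (λ b → ∏ bs (λ c → Π b c)) ^ D ≤⟨ ^-monoˡ-≤ D total ⟩
  ((64 * K) ^ (B * B)) ^ D ≡⟨ pow-swap (64 * K) (B * B) D ⟩
  ((64 * K) ^ D) ^ (B * B) ∎)
  where
  open ≤-Reasoning
  hit : Place → _ → _ → ℕ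
  hit pl b c = χ (φ pl b ≟ φ pl c)
  Π : _ → _ → ℕ
  Π b c = ∏ PL (λ pl → fst pl ^ hit pl b c)
  S : Place → ℕ
  S pl = ∑ bs (λ b → ∑ bs (λ c → hit pl b c))
  p≥1 : ∀ {pl} → pl ∈ PL → 1 ≤ fst pl
  p≥1 {pl} m = ≤-trans (s≤s z≤n) (φ< m (some bs (≤-trans B≥1 (≤-reflexive (sym lenB)))))
   where
   some : ∀ {V : Set} (l : List V) → 1 ≤ length l → V
   some (b ∷ _) _ = b
  each : ∀ pl → pl ∈ PL → (fst pl ^ w (fst pl)) ^ (B * B) ≤ (fst pl ^ S pl) ^ D
  each pl m = ≤-trans (≤-reflexive (^-*-assoc p (w p) (B * B))) (≤-trans (pow-monoʳ (p≥1 m) (begin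
    w p * (B * B) ≡⟨ cong (λ z → w p * (z * z)) lenB ⟨
    w p * (length bs * length bs) ≤⟨ *-monoʳ-≤ (w p) (collisions bs p (φ pl) (φ< m)) ⟩
    w p * (p * S pl) ≡⟨ lemma (w p) p (S pl) ⟩
    S pl * (p * w p) ≡⟨ cong (S pl *_) (pw m) ⟩
    S pl * D ∎)) (≤-reflexive (sym (^-*-assoc p (S pl) D))))
   where
   p = fst pl
   lemma : ∀ a b c → a * (b * c) ≡ c * (b * a)
   lemma = solve-∀
  regroup : ∏ PL (λ pl → fst pl ^ S pl) ≡ ∏ bs (λ b → ∏ bs (λ c → Π b c))
  regroup = sym (trans (∏-cong bs (λ {b} _ → ∏-swap bs PL (λ c pl → fst pl ^ hit pl b c)))
   (trans (∏-swap bs PL (λ b pl → ∏ bs (λ c → fst pl ^ hit pl b c)))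
    (∏-cong PL (λ {pl} _ → trans (∏-cong bs (λ {b} _ → ∏-base bs (fst pl) (hit pl b))) (∏-base bs (fst pl) (λ b → ∑ bs (hit pl b)))))))
  -- A diagonal pair collides at every place and costs 64 ^ X; there is one such pair in each row,
  -- and X ≤ B makes this affordable.
  pair≤ : ∀ {b c} → b ∈ bs → c ∈ bs → Π b c ≤ (64 ^ X) ^ χ (b ≟' c) * K
  pair≤ {b} {c} b∈ c∈ with b ≟' c
  ... | no b≢c = ≤-trans (bound b∈ c∈ b≢c) (≤-reflexive (sym (+-identityʳ K)))
  ... | yes refl = ≤-trans (≤-trans (∏-mono PL (λ {pl} m → ≤-trans (pow-monoʳ (p≥1 m) (χ≤1 (φ pl b ≟ φ pl b))) (≤-reflexive (*-identityʳ (fst pl))))) primes≤)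
     (≤-trans (≤-reflexive (sym (*-identityʳ (64 ^ X)))) (m≤m*n (64 ^ X * 1) K {{>-nonZero K≥1}}))
  diag : ∀ b → ∑ bs (λ c → χ (b ≟' c)) ≤ 1
  diag b = ≤-trans (≤-reflexive (sym (length-filter-∑ (b ≟'_) bs))) (at-most-one (Uniq.filter⁺ (b ≟'_) ub)
   (λ mx my → trans (sym (snd (∈-filter⁻ (b ≟'_) {xs = bs} mx))) (snd (∈-filter⁻ (b ≟'_) {xs = bs} my))))
  row : ∀ {b} → b ∈ bs → ∏ bs (λ c → Π b c) ≤ (64 * K) ^ B
  row {b} b∈ = begin
   ∏ bs (λ c → Π b c) ≤⟨ ∏-mono bs (pair≤ b∈) ⟩
   ∏ bs (λ c → (64 ^ X) ^ χ (b ≟' c) * K) ≡⟨ ∏-* bs (λ c → (64 ^ X) ^ χ (b ≟' c)) (λ _ → K) ⟩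
   ∏ bs (λ c → (64 ^ X) ^ χ (b ≟' c)) * ∏ bs (λ _ → K) ≡⟨ cong₂ _*_ (∏-base bs (64 ^ X) _) (trans (∏-const bs K) (cong (K ^_) lenB)) ⟩
   (64 ^ X) ^ ∑ bs (λ c → χ (b ≟' c)) * K ^ B ≤⟨ *-monoˡ-≤ (K ^ B) (pow-monoʳ (pow≥1 X (s≤s z≤n)) (diag b)) ⟩
   (64 ^ X) ^ 1 * K ^ B ≡⟨ cong (_* K ^ B) (*-identityʳ (64 ^ X)) ⟩
   64 ^ X * K ^ B ≤⟨ *-monoˡ-≤ (K ^ B) (^-monoʳ-≤ 64 X≤B) ⟩
   64 ^ B * K ^ B ≡⟨ ^-*-distrib B 64 K ⟨
   (64 * K) ^ B ∎
  total : ∏ bs (λ b → ∏ bs (λ c → Π b c)) ≤ (64 * K) ^ (B * B)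
  total = ≤-trans (∏-bound bs ((64 * K) ^ B) row) (≤-reflexive (trans (cong (((64 * K) ^ B) ^_) lenB) (^-*-assoc (64 * K) B B)))

 -- Arithmetic behind the lower bound for primes with two roots

 ∑-upTo-+ : ∀ b a (f : ℕ → ℕ) → ∑ (upTo (b + a)) f ≡ ∑ (upTo a) f + ∑ (upTo b) (λ i → f (i + a))
 ∑-upTo-+ zero a f = sym (+-identityʳ _)
 ∑-upTo-+ (suc b) a f = trans (∑-upTo (b + a) f) (trans (cong (_+ f (b + a)) (∑-upTo-+ b a f))
  (trans (+-assoc (∑ (upTo a) f) _ _) (cong (∑ (upTo a) f +_) (sym (∑-upTo b (λ i → f (i + a)))))))

 -- Each quotient k ÷ M is taken by M values of k; this produces one of the two factors M in the
 -- exponent M² of the small primes.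
 ∑-blocks : ∀ M → 1 ≤ M → ∀ n (g : ℕ → ℕ) → (∀ {i j} → i ≤ j → g j ≤ g i) → ∑ (upTo (n * M)) (λ k → g (k ÷ M)) ≤ M * ∑ (upTo n) g
 ∑-blocks M M≥1 zero g anti = z≤n
 ∑-blocks M M≥1 (suc n) g anti = begin
  ∑ (upTo (M + n * M)) (λ k → g (k ÷ M)) ≡⟨ ∑-upTo-+ M (n * M) (λ k → g (k ÷ M)) ⟩
  ∑ (upTo (n * M)) (λ k → g (k ÷ M)) + ∑ (upTo M) (λ i → g ((i + n * M) ÷ M)) ≤⟨ +-mono-≤ (∑-blocks M M≥1 n g anti) (∑-bound (upTo M) (g n) (λ {i} _ → anti (÷-greatest n M≥1 (m≤n+m (n * M) i)))) ⟩
  M * ∑ (upTo n) g + length (upTo M) * g n ≡⟨ cong (λ z → M * ∑ (upTo n) g + z * g n) (length-upTo M) ⟩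
  M * ∑ (upTo n) g + M * g n ≡⟨ sym (*-distribˡ-+ M (∑ (upTo n) g) (g n)) ⟩
  M * (∑ (upTo n) g + g n) ≡⟨ cong (M *_) (sym (∑-upTo n g)) ⟩
  M * ∑ (upTo (suc n)) g ∎
  where open ≤-Reasoning

 count-powers : ∀ p Z n → 1 ≤ p → 1 ≤ Z → p ^ ∑ (upTo n) (λ k → χ (p ^ suc k ≤? Z)) ≤ Z
 count-powers p Z zero p≥1 Z≥1 = Z≥1
 count-powers p Z (suc n) p≥1 Z≥1 rewrite ∑-upTo n (λ k → χ (p ^ suc k ≤? Z)) with p ^ suc n ≤? Z
 ... | no _ = subst (λ z → p ^ z ≤ Z) (sym (+-identityʳ (∑ (upTo n) (λ k → χ (p ^ suc k ≤? Z))))) (count-powers p Z n p≥1 Z≥1)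
 ... | yes h = ≤-trans (pow-monoʳ p≥1 (≤-trans (+-monoˡ-≤ 1 (≤-trans (∑-bound (upTo n) 1 (λ {k} _ → χ≤1 (p ^ suc k ≤? Z))) (≤-reflexive (trans (*-identityʳ _) (length-upTo n))))) (≤-reflexive (+-comm n 1)))) h

 ÷-anti : ∀ A {a b} → 1 ≤ a → a ≤ b → A ÷ b ≤ A ÷ a
 ÷-anti A {a} {b} a≥1 h = ÷-greatest (A ÷ b) a≥1 (≤-trans (*-monoʳ-≤ (A ÷ b) h) (÷-≤ A b))

 -- The situation abstracted here: a box of A · B elements, with `cnt p k` the number of those whose
 -- norm is divisible by p ^ (k + 1), and `inW` marking the primes above Y with two roots. Per
 -- element the primes up to Y absorb about M² log Y and the other primes outside `inW` only O(1),
 -- so for A well beyond Y ^ (M²) the rest of log A must come from `inW`.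
 module SplitArith (M' A Y Cz E C2 Δ2 B : ℕ) (cnt : ℕ → ℕ → ℕ) (inW : ℕ → ℕ)
  (Y≥1 : 1 ≤ Y) (Y²≤A : Y * Y ≤ A) (Cz≥1 : 1 ≤ Cz) (Cz≤Y : Cz ≤ Y) (B≥1 : 1 ≤ B) where
  M S K0 Z : ℕ
  M = suc M'
  S = A * B
  K0 = suc E
  Z = Cz * Y ^ E

  small-p : ℕ → ℕ
  small-p p = p ^ (B * (M * (M * ((A ÷ p) + ∑ (upTo Z) (λ e → A ÷ p ^ suc (suc e)))))) * Z ^ (B * M)

  large-p : ℕ → ℕ
  large-p p = p ^ (K0 * (C2 * S ÷ (p * p))) * p ^ (K0 * (inW p * cnt p 0))

  private
   Z≥1 : 1 ≤ Z
   Z≥1 = *-mono-≤ Cz≥1 (pow≥1 E Y≥1)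

  module _ (h1 : ∀ {p} → p ∈ primes Z → p ≤ Y → ∀ k → cnt p k ≤ B * (M * ((A ÷ p ^ suc (k ÷ M)) + 1)))
   (h2 : ∀ {p} → p ∈ primes Z → ∀ k → Z < p ^ suc k → cnt p k ≡ 0) where

   small-bound : ∀ {p} → p ∈ primes Z → p ≤ Y → ∏ (upTo Z) (λ k → p ^ cnt p k) ≤ small-p p
   small-bound {p} p∈ p≤Y = begin
    ∏ (upTo Z) (λ k → p ^ cnt p k) ≡⟨ ∏-base (upTo Z) p (cnt p) ⟩
    p ^ ∑ (upTo Z) (cnt p) ≤⟨ pow-monoʳ p≥1 exps ⟩
    p ^ (B * (M * (M * t)) + B * M * c) ≡⟨ ^-distribˡ-+-* p (B * (M * (M * t))) (B * M * c) ⟩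
    p ^ (B * (M * (M * t))) * p ^ (B * M * c) ≡⟨ cong (p ^ (B * (M * (M * t))) *_) (trans (cong (p ^_) (*-comm (B * M) c)) (sym (^-*-assoc p c (B * M)))) ⟩
    p ^ (B * (M * (M * t))) * (p ^ c) ^ (B * M) ≤⟨ *-monoʳ-≤ (p ^ (B * (M * (M * t)))) (^-monoˡ-≤ (B * M) (count-powers p Z Z p≥1 Z≥1)) ⟩
    p ^ (B * (M * (M * t))) * Z ^ (B * M) ∎
    where
    open ≤-Reasoning
    p≥1 = prime≥1 (fst (primes⁻ {Z} p∈))
    g : ℕ → ℕ
    g e = A ÷ p ^ suc e
    t = (A ÷ p) + ∑ (upTo Z) (λ e → A ÷ p ^ suc (suc e))
    ind : ℕ → ℕ
    ind k = χ (p ^ suc k ≤? Z)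
    c = ∑ (upTo Z) ind
    -- The count vanishes unless p ^ (k + 1) ≤ Z, so the rounding term 1 may carry that indicator; p
    -- raised to the number of such k is at most Z.
    each : ∀ k → cnt p k ≤ B * M * g (k ÷ M) + B * M * ind k
    each k with p ^ suc k ≤? Z
    ... | no ¬h = ≤-trans (≤-reflexive (h2 p∈ k (≰⇒> ¬h))) z≤n
    ... | yes _ = ≤-trans (h1 p∈ p≤Y k) (≤-reflexive (lemma B M (g (k ÷ M))))
     where
     lemma : ∀ b m g → b * (m * (g + 1)) ≡ b * m * g + b * m * 1
     lemma = solve-∀
    anti : ∀ {i j} → i ≤ j → g j ≤ g i
    anti {i} {j} h = ÷-anti A (pow≥1 (suc i) p≥1) (pow-monoʳ p≥1 (s≤s h))
    gsum : ∑ (upTo Z) g ≤ t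
    gsum = ≤-trans (∑-upTo-mono g (n≤1+n Z)) (≤-reflexive (trans (∑-front Z g) (cong (λ z → (A ÷ z) + ∑ (upTo Z) (λ e → A ÷ p ^ suc (suc e))) (*-identityʳ p))))
    exps : ∑ (upTo Z) (cnt p) ≤ B * (M * (M * t)) + B * M * c
    exps = begin
     ∑ (upTo Z) (cnt p) ≤⟨ ∑-mono (upTo Z) (λ {k} _ → each k) ⟩
     ∑ (upTo Z) (λ k → B * M * g (k ÷ M) + B * M * ind k) ≡⟨ ∑-+ (upTo Z) _ _ ⟩
     ∑ (upTo Z) (λ k → B * M * g (k ÷ M)) + ∑ (upTo Z) (λ k → B * M * ind k) ≡⟨ cong₂ _+_ (∑-*ˡ (upTo Z) (B * M) (λ k → g (k ÷ M))) (∑-*ˡ (upTo Z) (B * M) ind) ⟩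
     B * M * ∑ (upTo Z) (λ k → g (k ÷ M)) + B * M * c ≤⟨ +-monoˡ-≤ (B * M * c) (*-monoʳ-≤ (B * M) (≤-trans (∑-upTo-mono (λ k → g (k ÷ M)) (m≤m*n Z M)) (∑-blocks M (s≤s z≤n) Z g anti))) ⟩
     B * M * (M * ∑ (upTo Z) g) + B * M * c ≤⟨ +-monoˡ-≤ (B * M * c) (*-monoʳ-≤ (B * M) (*-monoʳ-≤ M gsum)) ⟩
     B * M * (M * t) + B * M * c ≡⟨ cong (_+ B * M * c) (*-assoc B M (M * t)) ⟩
     B * (M * (M * t)) + B * M * c ∎

   module _ (h3 : ∀ {p} → p ∈ primes Z → Y < p → ∀ k → cnt p k ≤ cnt p 0)
    (h4 : ∀ {p} → p ∈ primes Z → Y < p → inW p ≡ 0 → cnt p 0 * (p * p) ≤ C2 * S)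
    (h5 : ∀ p → inW p ≡ 0 ⊎ inW p ≡ 1) where

    large-bound : ∀ {p} → p ∈ primes Z → Y < p → ∏ (upTo Z) (λ k → p ^ cnt p k) ≤ large-p p
    large-bound {p} p∈ Y<p = begin
     ∏ (upTo Z) (λ k → p ^ cnt p k) ≡⟨ ∏-base (upTo Z) p (cnt p) ⟩
     p ^ ∑ (upTo Z) (cnt p) ≤⟨ pow-monoʳ p≥1 (≤-trans (∑-mono (upTo Z) (λ {k} _ → each k)) (≤-reflexive (∑-*ˡ (upTo Z) (cnt p 0) ind))) ⟩
     p ^ (cnt p 0 * ∑ (upTo Z) ind) ≤⟨ pow-monoʳ p≥1 (*-monoʳ-≤ (cnt p 0) few) ⟩
     p ^ (cnt p 0 * K0) ≤⟨ pow-monoʳ p≥1 (split (h5 p)) ⟩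
     p ^ (K0 * (C2 * S ÷ (p * p)) + K0 * (inW p * cnt p 0)) ≡⟨ ^-distribˡ-+-* p (K0 * (C2 * S ÷ (p * p))) _ ⟩
     large-p p ∎
     where
     open ≤-Reasoning
     p≥1 = prime≥1 (fst (primes⁻ {Z} p∈))
     ind : ℕ → ℕ
     ind k = χ (p ^ suc k ≤? Z)
     each : ∀ k → cnt p k ≤ cnt p 0 * ind k
     each k with p ^ suc k ≤? Z
     ... | no ¬h = ≤-trans (≤-reflexive (h2 p∈ k (≰⇒> ¬h))) z≤n
     ... | yes _ = ≤-trans (h3 p∈ Y<p k) (≤-reflexive (sym (*-identityʳ (cnt p 0))))
     -- Since Z ≤ Y ^ (E + 1) and Y < p, at most E + 1 powers of p are bounded by Z.
     few : ∑ (upTo Z) ind ≤ K0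
     few with ∑ (upTo Z) ind ≤? K0
     ... | yes h = h
     ... | no ¬h = ⊥-elim (<⇒≱ (^-monoˡ-< (suc K0) Y<p) (begin
       p ^ suc K0 ≤⟨ pow-monoʳ p≥1 (≰⇒> ¬h) ⟩
       p ^ ∑ (upTo Z) ind ≤⟨ count-powers p Z Z p≥1 Z≥1 ⟩
       Cz * Y ^ E ≤⟨ *-monoˡ-≤ (Y ^ E) Cz≤Y ⟩
       Y ^ suc E ≤⟨ pow-monoʳ Y≥1 (n≤1+n K0) ⟩
       Y ^ suc K0 ∎))
     split : inW p ≡ 0 ⊎ inW p ≡ 1 → cnt p 0 * K0 ≤ K0 * (C2 * S ÷ (p * p)) + K0 * (inW p * cnt p 0)
     split (inj₁ e) = ≤-trans (≤-trans (≤-reflexive (*-comm (cnt p 0) K0)) (*-monoʳ-≤ K0 (÷-greatest (cnt p 0) (*-mono-≤ p≥1 p≥1) (h4 p∈ Y<p e)))) (m≤m+n (K0 * (C2 * S ÷ (p * p))) _)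
     split (inj₂ e) = ≤-trans (≤-reflexive (trans (*-comm (cnt p 0) K0) (cong (K0 *_) (trans (sym (+-identityʳ (cnt p 0))) (cong (_* cnt p 0) (sym e)))))) (m≤n+m _ (K0 * (C2 * S ÷ (p * p))))

    small-total : ∏ (primes Y) small-p ≤ (32768 ^ (M * M) * Y ^ (M * M) * 2 ^ (2 * (Cz + E) * M)) ^ S
    small-total = begin
     ∏ (primes Y) small-p
      ≡⟨ ∏-* (primes Y) _ _ ⟩
     ∏ (primes Y) (λ p → p ^ (B * (M * (M * t p)))) * ∏ (primes Y) (λ _ → Z ^ (B * M))
      ≤⟨ *-mono-≤ first (≤-trans (≤-reflexive (∏-const (primes Y) (Z ^ (B * M)))) second) ⟩
     ((32768 * Y) ^ (M * M)) ^ S * (2 ^ (2 * (Cz + E) * M)) ^ S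
      ≡⟨ sym (^-*-distrib S ((32768 * Y) ^ (M * M)) (2 ^ (2 * (Cz + E) * M))) ⟩
     ((32768 * Y) ^ (M * M) * 2 ^ (2 * (Cz + E) * M)) ^ S
      ≡⟨ cong (λ z → (z * 2 ^ (2 * (Cz + E) * M)) ^ S) (^-*-distrib (M * M) 32768 Y) ⟩
     (32768 ^ (M * M) * Y ^ (M * M) * 2 ^ (2 * (Cz + E) * M)) ^ S ∎
     where
     open ≤-Reasoning
     t : ℕ → ℕ
     t p = (A ÷ p) + ∑ (upTo Z) (λ e → A ÷ p ^ suc (suc e))
     first : ∏ (primes Y) (λ p → p ^ (B * (M * (M * t p)))) ≤ ((32768 * Y) ^ (M * M)) ^ S
     first = begin
      ∏ (primes Y) (λ p → p ^ (B * (M * (M * t p)))) ≡⟨ ∏-cong (primes Y) (λ {p} _ → trans (cong (p ^_) (lemma1 B M (t p))) (sym (^-*-assoc p (t p) (M * M * B)))) ⟩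
      ∏ (primes Y) (λ p → (p ^ t p) ^ (M * M * B)) ≡⟨ ∏-^ (primes Y) (λ p → p ^ t p) (M * M * B) ⟩
      ∏ (primes Y) (λ p → p ^ t p) ^ (M * M * B) ≤⟨ ^-monoˡ-≤ (M * M * B) pt ⟩
      ((32768 * Y) ^ A) ^ (M * M * B) ≡⟨ ^-*-assoc (32768 * Y) A (M * M * B) ⟩
      (32768 * Y) ^ (A * (M * M * B)) ≡⟨ cong ((32768 * Y) ^_) (lemma2 A (M * M) B) ⟩
      (32768 * Y) ^ (M * M * (A * B)) ≡⟨ sym (^-*-assoc (32768 * Y) (M * M) S) ⟩
      ((32768 * Y) ^ (M * M)) ^ S ∎
      where
      lemma1 : ∀ b m t → b * (m * (m * t)) ≡ t * (m * m * b)
      lemma1 = solve-∀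
      lemma2 : ∀ a m b → a * (m * b) ≡ m * (a * b)
      lemma2 = solve-∀
      pt : ∏ (primes Y) (λ p → p ^ t p) ≤ (32768 * Y) ^ A
      pt = begin
       ∏ (primes Y) (λ p → p ^ t p) ≡⟨ ∏-cong (primes Y) (λ {p} _ → ^-distribˡ-+-* p (A ÷ p) _) ⟩
       ∏ (primes Y) (λ p → p ^ (A ÷ p) * p ^ ∑ (upTo Z) (λ e → A ÷ p ^ suc (suc e))) ≡⟨ ∏-* (primes Y) _ _ ⟩
       ∏ (primes Y) (λ p → p ^ (A ÷ p)) * ∏ (primes Y) (λ p → p ^ ∑ (upTo Z) (λ e → A ÷ p ^ suc (suc e)))
        ≤⟨ *-mono-≤ (mertens-upper Y A (λ p → A ÷ p) Y≥1 (λ {p} _ → ≤-trans (≤-reflexive (*-comm p (A ÷ p))) (÷-≤ A p))) (∏-higher-powers Y Z A) ⟩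
       (8 * Y) ^ A * 4096 ^ A ≡⟨ sym (^-*-distrib A (8 * Y) 4096) ⟩
       (8 * Y * 4096) ^ A ≡⟨ cong (_^ A) (lemma3 Y) ⟩
       (32768 * Y) ^ A ∎
       where
       lemma3 : ∀ y → 8 * y * 4096 ≡ 32768 * y
       lemma3 = solve-∀
     second : (Z ^ (B * M)) ^ length (primes Y) ≤ (2 ^ (2 * (Cz + E) * M)) ^ S
     second = begin
      (Z ^ (B * M)) ^ length (primes Y) ≤⟨ pow-monoʳ (pow≥1 (B * M) Z≥1) (length-primes Y) ⟩
      (Z ^ (B * M)) ^ suc Y ≤⟨ ^-monoˡ-≤ (suc Y) (^-monoˡ-≤ (B * M) Z≤) ⟩
      ((2 ^ ((Cz + E) * Y)) ^ (B * M)) ^ suc Y ≡⟨ trans (cong (_^ suc Y) (^-*-assoc 2 ((Cz + E) * Y) (B * M))) (^-*-assoc 2 ((Cz + E) * Y * (B * M)) (suc Y)) ⟩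
      2 ^ ((Cz + E) * Y * (B * M) * suc Y) ≤⟨ ^-monoʳ-≤ 2 exps ⟩
      2 ^ (2 * (Cz + E) * M * S) ≡⟨ sym (^-*-assoc 2 (2 * (Cz + E) * M) S) ⟩
      (2 ^ (2 * (Cz + E) * M)) ^ S ∎
      where
      Z≤ : Z ≤ 2 ^ ((Cz + E) * Y)
      Z≤ = begin
       Cz * Y ^ E ≤⟨ *-mono-≤ (≤-trans (<⇒≤ (n<2^n Cz)) (^-monoʳ-≤ 2 (m≤m*n Cz Y {{>-nonZero Y≥1}}))) (^-monoˡ-≤ E (<⇒≤ (n<2^n Y))) ⟩
       2 ^ (Cz * Y) * (2 ^ Y) ^ E ≡⟨ cong (2 ^ (Cz * Y) *_) (trans (^-*-assoc 2 Y E) (cong (2 ^_) (*-comm Y E))) ⟩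
       2 ^ (Cz * Y) * 2 ^ (E * Y) ≡⟨ sym (^-distribˡ-+-* 2 (Cz * Y) (E * Y)) ⟩
       2 ^ (Cz * Y + E * Y) ≡⟨ cong (2 ^_) (sym (*-distribʳ-+ Y Cz E)) ⟩
       2 ^ ((Cz + E) * Y) ∎
      exps : (Cz + E) * Y * (B * M) * suc Y ≤ 2 * (Cz + E) * M * (A * B)
      exps = begin
       (Cz + E) * Y * (B * M) * suc Y ≤⟨ *-monoʳ-≤ ((Cz + E) * Y * (B * M)) (≤-trans (+-monoˡ-≤ Y Y≥1) (≤-reflexive (cong (Y +_) (sym (+-identityʳ Y))))) ⟩
       (Cz + E) * Y * (B * M) * (2 * Y) ≡⟨ lemma4 (Cz + E) Y B M ⟩
       2 * (Cz + E) * M * (Y * Y * B) ≤⟨ *-monoʳ-≤ (2 * (Cz + E) * M) (*-monoˡ-≤ B Y²≤A) ⟩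
       2 * (Cz + E) * M * (A * B) ∎
       where
       lemma4 : ∀ c y b m → c * y * (b * m) * (2 * y) ≡ 2 * c * m * (y * y * b)
       lemma4 = solve-∀

    all-primes : ∏ (primes Z) (λ p → ∏ (upTo Z) (λ k → p ^ cnt p k)) ≤ ∏ (primes Y) small-p * ∏ (primes Z) large-p
    all-primes = begin
     ∏ (primes Z) F ≡⟨ ∏-split-filter (λ p → p ≤? Y) (primes Z) F ⟩
     ∏ lo F * ∏ hi F ≤⟨ *-mono-≤ (∏-mono lo (λ m → let (p∈ , p≤) = lo⁻ m in small-bound p∈ p≤)) (∏-mono hi (λ m → let (p∈ , p>) = hi⁻ m in large-bound p∈ p>)) ⟩
     ∏ lo small-p * ∏ hi large-p ≤⟨ *-mono-≤
       (∏-inj lo (primes Y) small-p (Uniq.filter⁺ (λ p → p ≤? Y) (primes-Unique Z)) (λ m → let (p∈ , p≤) = lo⁻ m in primes⁺ (fst (primes⁻ {Z} p∈)) p≤)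
         (λ {p} m → *-mono-≤ (pow≥1 (B * (M * (M * ((A ÷ p) + ∑ (upTo Z) (λ e → A ÷ p ^ suc (suc e)))))) (prime≥1 (fst (primes⁻ {Y} m)))) (pow≥1 (B * M) Z≥1)))
       (∏-inj hi (primes Z) large-p (Uniq.filter⁺ (λ p → ¬? (p ≤? Y)) (primes-Unique Z)) (λ m → fst (hi⁻ m))
         (λ {p} m → *-mono-≤ (pow≥1 (K0 * (C2 * S ÷ (p * p))) (prime≥1 (fst (primes⁻ {Z} m)))) (pow≥1 (K0 * (inW p * cnt p 0)) (prime≥1 (fst (primes⁻ {Z} m)))))) ⟩
     ∏ (primes Y) small-p * ∏ (primes Z) large-p ∎
     where
     open ≤-Reasoning
     F : ℕ → ℕ
     F p = ∏ (upTo Z) (λ k → p ^ cnt p k)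
     lo = filter (λ p → p ≤? Y) (primes Z)
     hi = filter (λ p → ¬? (p ≤? Y)) (primes Z)
     lo⁻ : ∀ {p} → p ∈ lo → p ∈ primes Z × p ≤ Y
     lo⁻ = ∈-filter⁻ (λ p → p ≤? Y) {xs = primes Z}
     hi⁻ : ∀ {p} → p ∈ hi → p ∈ primes Z × Y < p
     hi⁻ m = let (a , b) = ∈-filter⁻ (λ p → ¬? (p ≤? Y)) {xs = primes Z} m in a , ≰⇒> b

    Cst : ℕ
    Cst = Δ2 * (32768 ^ (M * M) * 2 ^ (2 * (Cz + E) * M)) * 64 ^ (C2 * K0)

    module _ (h0 : A ^ S ≤ Δ2 ^ S * ∏ (primes Z) (λ p → ∏ (upTo Z) (λ k → p ^ cnt p k)))
     (h6 : ∀ {p} → p ∈ primes Z → inW p * cnt p 0 * p ≤ C2 * S) (A≥1 : 1 ≤ A) where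

     split-arith : ∀ D (w : ℕ → ℕ) → (∀ {p} → p ∈ primes Z → p * w p ≡ D) →
      A ^ D ≤ Cst ^ D * (Y ^ (M * M)) ^ D * ∏ (primes Z) (λ p → p ^ (inW p * w p)) ^ (K0 * C2)
     split-arith D w pw = root-≤ S (*-mono-≤ A≥1 B≥1) (begin
      (A ^ D) ^ S ≡⟨ pow-swap A D S ⟩
      (A ^ S) ^ D ≤⟨ ^-monoˡ-≤ D (≤-trans h0 (*-monoʳ-≤ (Δ2 ^ S) all-primes)) ⟩
      (Δ2 ^ S * (∏ (primes Y) small-p * ∏ (primes Z) large-p)) ^ D ≤⟨ ^-monoˡ-≤ D (*-monoʳ-≤ (Δ2 ^ S) (*-mono-≤ small-total large-total)) ⟩
      (Δ2 ^ S * (Q1 ^ S * ((64 ^ (C2 * K0)) ^ S * W0))) ^ D ≡⟨ cong (_^ D) (trans (lemma1 (Δ2 ^ S) (Q1 ^ S) ((64 ^ (C2 * K0)) ^ S) W0) (cong (_* W0) collect)) ⟩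
      ((Cst * Y ^ (M * M)) ^ S * W0) ^ D ≡⟨ ^-*-distrib D ((Cst * Y ^ (M * M)) ^ S) W0 ⟩
      ((Cst * Y ^ (M * M)) ^ S) ^ D * W0 ^ D ≤⟨ *-mono-≤ (≤-reflexive (pow-swap (Cst * Y ^ (M * M)) S D)) W0≤ ⟩
      ((Cst * Y ^ (M * M)) ^ D) ^ S * (W1 ^ (K0 * C2)) ^ S ≡⟨ sym (^-*-distrib S ((Cst * Y ^ (M * M)) ^ D) (W1 ^ (K0 * C2))) ⟩
      ((Cst * Y ^ (M * M)) ^ D * W1 ^ (K0 * C2)) ^ S ≡⟨ cong (λ z → (z * W1 ^ (K0 * C2)) ^ S) (^-*-distrib D Cst (Y ^ (M * M))) ⟩
      (Cst ^ D * (Y ^ (M * M)) ^ D * W1 ^ (K0 * C2)) ^ S ∎)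
      where
      open ≤-Reasoning
      Q1 = 32768 ^ (M * M) * Y ^ (M * M) * 2 ^ (2 * (Cz + E) * M)
      W0 = ∏ (primes Z) (λ p → p ^ (K0 * (inW p * cnt p 0)))
      W1 = ∏ (primes Z) (λ p → p ^ (inW p * w p))
      lemma1 : ∀ a b c d → a * (b * (c * d)) ≡ a * b * c * d
      lemma1 = solve-∀
      lemma2 : ∀ d a y b e → d * (a * y * b) * e ≡ d * (a * b) * e * y
      lemma2 = solve-∀
      collect : Δ2 ^ S * Q1 ^ S * (64 ^ (C2 * K0)) ^ S ≡ (Cst * Y ^ (M * M)) ^ S
      collect = trans (cong (_* (64 ^ (C2 * K0)) ^ S) (sym (^-*-distrib S Δ2 Q1))) (trans (sym (^-*-distrib S (Δ2 * Q1) (64 ^ (C2 * K0))))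
       (cong (_^ S) (lemma2 Δ2 (32768 ^ (M * M)) (Y ^ (M * M)) (2 ^ (2 * (Cz + E) * M)) (64 ^ (C2 * K0)))))
      large-total : ∏ (primes Z) large-p ≤ (64 ^ (C2 * K0)) ^ S * W0
      large-total = begin
       ∏ (primes Z) large-p ≡⟨ ∏-* (primes Z) _ _ ⟩
       ∏ (primes Z) (λ p → p ^ (K0 * (C2 * S ÷ (p * p)))) * W0 ≡⟨ cong (_* W0) (trans (∏-cong (primes Z) (λ {p} _ → trans (cong (p ^_) (*-comm K0 (C2 * S ÷ (p * p)))) (sym (^-*-assoc p (C2 * S ÷ (p * p)) K0)))) (∏-^ (primes Z) (λ p → p ^ (C2 * S ÷ (p * p))) K0)) ⟩
       ∏ (primes Z) (λ p → p ^ (C2 * S ÷ (p * p))) ^ K0 * W0 ≤⟨ *-monoˡ-≤ W0 (^-monoˡ-≤ K0 (∏-primes-squares Z (C2 * S))) ⟩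
       (64 ^ (C2 * S)) ^ K0 * W0 ≡⟨ cong (_* W0) (trans (^-*-assoc 64 (C2 * S) K0) (trans (cong (64 ^_) (lemma3 C2 S K0)) (sym (^-*-assoc 64 (C2 * K0) S)))) ⟩
       (64 ^ (C2 * K0)) ^ S * W0 ∎
       where
       lemma3 : ∀ c s k → c * s * k ≡ c * k * s
       lemma3 = solve-∀
      W0≤ : W0 ^ D ≤ (W1 ^ (K0 * C2)) ^ S
      W0≤ = begin
       W0 ^ D ≡⟨ sym (∏-^ (primes Z) _ D) ⟩
       ∏ (primes Z) (λ p → (p ^ (K0 * (inW p * cnt p 0))) ^ D) ≤⟨ ∏-mono (primes Z) (λ {p} m → each p m) ⟩
       ∏ (primes Z) (λ p → (p ^ (inW p * w p)) ^ (K0 * C2 * S)) ≡⟨ ∏-^ (primes Z) _ (K0 * C2 * S) ⟩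
       W1 ^ (K0 * C2 * S) ≡⟨ sym (^-*-assoc W1 (K0 * C2) S) ⟩
       (W1 ^ (K0 * C2)) ^ S ∎
       where
       each : ∀ p → p ∈ primes Z → (p ^ (K0 * (inW p * cnt p 0))) ^ D ≤ (p ^ (inW p * w p)) ^ (K0 * C2 * S)
       each p m = ≤-trans (≤-reflexive (^-*-assoc p (K0 * (inW p * cnt p 0)) D)) (≤-trans (pow-monoʳ (prime≥1 (fst (primes⁻ {Z} m))) (key (h5 p)))
         (≤-reflexive (sym (^-*-assoc p (inW p * w p) (K0 * C2 * S)))))
        where
        key : inW p ≡ 0 ⊎ inW p ≡ 1 → K0 * (inW p * cnt p 0) * D ≤ inW p * w p * (K0 * C2 * S)
        key (inj₁ e) rewrite e | *-zeroʳ K0 = z≤n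
        key (inj₂ e) = begin
         K0 * (inW p * cnt p 0) * D ≡⟨ cong (K0 * (inW p * cnt p 0) *_) (sym (pw m)) ⟩
         K0 * (inW p * cnt p 0) * (p * w p) ≡⟨ lemma4 K0 (inW p * cnt p 0) p (w p) ⟩
         w p * K0 * (inW p * cnt p 0 * p) ≤⟨ *-monoʳ-≤ (w p * K0) (h6 m) ⟩
         w p * K0 * (C2 * S) ≡⟨ lemma5 (w p) K0 C2 S ⟩
         1 * w p * (K0 * C2 * S) ≡⟨ cong (λ z → z * w p * (K0 * C2 * S)) (sym e) ⟩
         inW p * w p * (K0 * C2 * S) ∎
         where
         lemma4 : ∀ k c p w → k * c * (p * w) ≡ w * k * (c * p)
         lemma4 = solve-∀
         lemma5 : ∀ w k c s → w * k * (c * s) ≡ 1 * w * (k * c * s)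
         lemma5 = solve-∀

 ∑-cart : ∀ {A B C : Set} (f : A → B → C) (as : List A) (bs : List B) (h : C → ℕ) → ∑ (cartesianProductWith f as bs) h ≡ ∑ as (λ a → ∑ bs (λ b → h (f a b)))
 ∑-cart f [] bs h = refl
 ∑-cart f (a ∷ as) bs h = trans (∑-++ (map (f a) bs) _ h) (cong₂ _+_ (∑-map bs (f a) h) (∑-cart f as bs h))

 ÷-mono : ∀ {a b} q → 1 ≤ q → a ≤ b → a ÷ q ≤ b ÷ q
 ÷-mono {a} q q≥1 h = ÷-greatest (a ÷ q) q≥1 (≤-trans (÷-≤ a q) h)

 -- σ will be the side of the cells: small enough that nonzero differences inside a cell are
 -- invertible modulo p, and within 1 of failing this, so that q is comparable to σ ^ M.
 largest-below : ∀ C M q s → 1 < q → q ≤ suc (2 * (C * s)) ^ M → Σ ℕ λ σ → suc (2 * (C * σ)) ^ M < q × q ≤ suc (2 * (C * suc σ)) ^ M × σ ≤ s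
 largest-below C M q zero q>1 h = ⊥-elim (<⇒≱ q>1 (≤-trans h (≤-reflexive (trans (cong (λ z → suc (2 * z) ^ M) (*-zeroʳ C)) (^-zeroˡ M)))))
 largest-below C M q (suc s) q>1 h with q ≤? suc (2 * (C * s)) ^ M
 ... | yes h' = let (σ , a , b , c) = largest-below C M q s q>1 h' in σ , a , b , ≤-trans c (n≤1+n s)
 ... | no ¬h = s , ≰⇒> ¬h , h , n≤1+n s

 -- For σ ≥ 1 there are at most (A/σ + 1) ^ M cells holding M elements each, against q of the order
 -- σ ^ M. For σ = 0 the modulus q is itself bounded and the trivial count is enough.
 packing-arith : ∀ C M A c q cnt σ → 1 ≤ M → cnt ≤ A ^ M → (1 ≤ σ → cnt ≤ suc (A ÷ σ) ^ M * M) → σ ≤ c * A → q ≤ suc (2 * (C * suc σ)) ^ M →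
  cnt * q ≤ (suc (4 * C) ^ M * (suc c ^ M * M)) * A ^ M
 packing-arith C M A c q cnt zero M≥1 triv cells σ≤ q≤ = begin
  cnt * q ≤⟨ *-mono-≤ triv (≤-trans q≤ (^-monoˡ-≤ M (s≤s (≤-trans (≤-reflexive (cong (2 *_) (*-identityʳ C))) (*-monoˡ-≤ C {2} {4} (s≤s (s≤s z≤n))))))) ⟩
  A ^ M * suc (4 * C) ^ M ≡⟨ *-comm (A ^ M) (suc (4 * C) ^ M) ⟩
  suc (4 * C) ^ M * A ^ M ≤⟨ *-monoˡ-≤ (A ^ M) (m≤m*n (suc (4 * C) ^ M) (suc c ^ M * M) {{>-nonZero (*-mono-≤ (pow≥1 M (s≤s (z≤n {c}))) M≥1)}}) ⟩
  (suc (4 * C) ^ M * (suc c ^ M * M)) * A ^ M ∎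
  where open ≤-Reasoning
 packing-arith C M A c q cnt (suc σ') M≥1 triv cells σ≤ q≤ = begin
  cnt * q ≤⟨ *-mono-≤ (cells (s≤s z≤n)) q≤ ⟩
  (k ^ M * M) * suc (2 * (C * suc σ)) ^ M ≤⟨ *-monoʳ-≤ (k ^ M * M) (^-monoˡ-≤ M step) ⟩
  (k ^ M * M) * (suc (4 * C) * σ) ^ M ≡⟨ cong ((k ^ M * M) *_) (^-*-distrib M (suc (4 * C)) σ) ⟩
  (k ^ M * M) * (suc (4 * C) ^ M * σ ^ M) ≡⟨ lemma1 (k ^ M) M (suc (4 * C) ^ M) (σ ^ M) ⟩
  (suc (4 * C) ^ M * M) * (k ^ M * σ ^ M) ≡⟨ cong ((suc (4 * C) ^ M * M) *_) (sym (^-*-distrib M k σ)) ⟩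
  (suc (4 * C) ^ M * M) * (k * σ) ^ M ≤⟨ *-monoʳ-≤ (suc (4 * C) ^ M * M) (^-monoˡ-≤ M kσ) ⟩
  (suc (4 * C) ^ M * M) * (suc c * A) ^ M ≡⟨ cong ((suc (4 * C) ^ M * M) *_) (^-*-distrib M (suc c) A) ⟩
  (suc (4 * C) ^ M * M) * (suc c ^ M * A ^ M) ≡⟨ lemma2 (suc (4 * C) ^ M) M (suc c ^ M) (A ^ M) ⟩
  (suc (4 * C) ^ M * (suc c ^ M * M)) * A ^ M ∎
  where
  open ≤-Reasoning
  σ = suc σ'
  k = suc (A ÷ σ)
  lemma1 : ∀ a m b s → (a * m) * (b * s) ≡ (b * m) * (a * s)
  lemma1 = solve-∀
  lemma2 : ∀ a m b s → (a * m) * (b * s) ≡ (a * (b * m)) * s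
  lemma2 = solve-∀
  step : suc (2 * (C * suc σ)) ≤ suc (4 * C) * σ
  step = ≤-trans (m≤m+n _ (σ' + 2 * (C * σ'))) (≤-reflexive (lemma3 C σ'))
   where
   lemma3 : ∀ c s → suc (2 * (c * suc (suc s))) + (s + 2 * (c * s)) ≡ suc (4 * c) * suc s
   lemma3 = solve-∀
  kσ : k * σ ≤ suc c * A
  kσ = ≤-trans (+-mono-≤ σ≤ (÷-≤ A σ)) (≤-reflexive (+-comm (c * A) A))

 -- A is Y ^ (2M²), so that after the small primes have taken Y ^ (M²) as much again remains, which
 -- is at least Y.
 split-final : ∀ A Y D M Cst W → 1 ≤ Y → A ≡ Y ^ (M * M + M * M) → 1 ≤ M → A ^ D ≤ Cst ^ D * (Y ^ (M * M)) ^ D * W → Y ^ D ≤ Cst ^ D * W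
 split-final A Y D M Cst W Y≥1 refl M≥1 h = ≤-trans (^-monoˡ-≤ D (≤-trans (≤-reflexive (sym (*-identityʳ Y))) (pow-monoʳ Y≥1 (*-mono-≤ M≥1 M≥1))))
  (*-cancelʳ-≤' Q (pow≥1 D (pow≥1 (M * M) Y≥1)) (begin
   Q * Q ≡⟨ ^-*-distrib D (Y ^ (M * M)) (Y ^ (M * M)) ⟨
   (Y ^ (M * M) * Y ^ (M * M)) ^ D ≡⟨ cong (_^ D) (^-distribˡ-+-* Y (M * M) (M * M)) ⟨
   (Y ^ (M * M + M * M)) ^ D ≤⟨ h ⟩
   Cst ^ D * Q * W ≡⟨ lemma (Cst ^ D) Q W ⟩
   Cst ^ D * W * Q ∎))
  where
  open ≤-Reasoning
  Q = (Y ^ (M * M)) ^ D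
  lemma : ∀ a b c → a * b * c ≡ a * c * b
  lemma = solve-∀

 big-box : ∀ C c M A Δ → 1 ≤ A → suc (suc (2 * (C * (c * A))) ^ M) * Δ ≤ (suc (suc (2 * (C * c)) ^ M) * Δ) * A ^ M
 big-box C c M A Δ A≥1 = begin
  suc (suc (2 * (C * (c * A))) ^ M) * Δ ≤⟨ *-monoˡ-≤ Δ (+-mono-≤ (pow≥1 M A≥1) (≤-trans (^-monoˡ-≤ M step) (≤-reflexive (^-*-distrib M k A)))) ⟩
  (A ^ M + k ^ M * A ^ M) * Δ ≡⟨ lemma (A ^ M) (k ^ M) Δ ⟩
  (suc (k ^ M) * Δ) * A ^ M ∎
  where
  open ≤-Reasoning
  k = suc (2 * (C * c))
  step : suc (2 * (C * (c * A))) ≤ k * A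
  step = ≤-trans (+-monoˡ-≤ (2 * (C * (c * A))) A≥1) (≤-reflexive (lemma1 C c A))
   where
   lemma1 : ∀ C c A → A + 2 * (C * (c * A)) ≡ suc (2 * (C * c)) * A
   lemma1 = solve-∀
  lemma : ∀ a k d → (a + k * a) * d ≡ (suc k * d) * a
  lemma = solve-∀

 -- P, W, U and Q are the weighted products over all primes, over those with ρ ≥ 2, with exponents
 -- min(ρ, 2), and over those with ρ = 0. The lower bound for P and the upper bound for U are both X
 -- ^ D up to constants and cancel in P W = U Q, leaving W bounded by Q.
 block-arith1 : ∀ D κ Y X Cst C0 P W U Q → 1 ≤ X → X ^ D ≤ 16384 ^ D * P → U ≤ (C0 * X) ^ D → P * W ≡ U * Q → Y ^ D ≤ Cst ^ D * W ^ κ →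
  Y ^ D ≤ (Cst * (16384 * C0) ^ κ) ^ D * Q ^ κ
 block-arith1 D κ Y X Cst C0 P W U Q X≥1 ml up eq V = begin
  Y ^ D ≤⟨ V ⟩
  Cst ^ D * W ^ κ ≤⟨ *-monoʳ-≤ (Cst ^ D) (^-monoˡ-≤ κ W≤) ⟩
  Cst ^ D * ((16384 * C0) ^ D * Q) ^ κ ≡⟨ cong (Cst ^ D *_) (trans (^-*-distrib κ ((16384 * C0) ^ D) Q) (cong (_* Q ^ κ) (pow-swap (16384 * C0) D κ))) ⟩
  Cst ^ D * (((16384 * C0) ^ κ) ^ D * Q ^ κ) ≡⟨ *-assoc (Cst ^ D) (((16384 * C0) ^ κ) ^ D) (Q ^ κ) ⟨
  Cst ^ D * ((16384 * C0) ^ κ) ^ D * Q ^ κ ≡⟨ cong (_* Q ^ κ) (^-*-distrib D Cst ((16384 * C0) ^ κ)) ⟨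
  (Cst * (16384 * C0) ^ κ) ^ D * Q ^ κ ∎
  where
  open ≤-Reasoning
  lemma : ∀ a b c q → a * (b * c * q) ≡ a * b * q * c
  lemma = solve-∀
  W≤ : W ≤ (16384 * C0) ^ D * Q
  W≤ = *-cancelʳ-≤' (X ^ D) (pow≥1 D X≥1) (begin
   W * X ^ D ≤⟨ *-monoʳ-≤ W ml ⟩
   W * (16384 ^ D * P) ≡⟨ trans (*-comm W _) (trans (*-assoc (16384 ^ D) P W) (cong (16384 ^ D *_) eq)) ⟩
   16384 ^ D * (U * Q) ≤⟨ *-monoʳ-≤ (16384 ^ D) (*-monoˡ-≤ Q up) ⟩
   16384 ^ D * ((C0 * X) ^ D * Q) ≡⟨ cong (λ z → 16384 ^ D * (z * Q)) (^-*-distrib D C0 X) ⟩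
   16384 ^ D * (C0 ^ D * X ^ D * Q) ≡⟨ lemma (16384 ^ D) (C0 ^ D) (X ^ D) Q ⟩
   16384 ^ D * C0 ^ D * Q * X ^ D ≡⟨ cong (λ z → z * Q * X ^ D) (^-*-distrib D 16384 C0) ⟨
   (16384 * C0) ^ D * Q * X ^ D ∎)

 -- The exponent 2(κ + 1) of y is chosen so that rootless primes up to y, which contribute at most
 -- (8y) ^ D, account together with the constants for only half of it; the other half has to come
 -- from primes beyond y.
 block-arith2 : ∀ D κ y Z C1 E T Lo Hi Q → 2 ≤ y → C1 * 8 ^ κ ≤ y → Lo ≤ (8 * y) ^ D → Hi ≤ Z ^ T → Q ≡ Lo * Hi →
  Z ≤ (y ^ (2 * suc κ)) ^ suc E → (y ^ (2 * suc κ)) ^ D ≤ C1 ^ D * Q ^ κ → D ≤ 2 * suc E * κ * T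
 block-arith2 D κ y Z C1 E T Lo Hi Q y≥2 y-big lo hi refl Z≤ h = *-cancelˡ-≤ (suc κ) (pow-cancel {y} y≥2 (*-cancelˡ-≤' (y ^ (b * D)) (pow≥1 (b * D) y≥1) (begin
  y ^ (b * D) * y ^ (b * D) ≡⟨ ^-distribˡ-+-* y (b * D) (b * D) ⟨
  y ^ (b * D + b * D) ≡⟨ cong (y ^_) (lem1 b D) ⟩
  y ^ (2 * b * D) ≡⟨ ^-*-assoc y (2 * b) D ⟨
  (y ^ (2 * b)) ^ D ≤⟨ h ⟩
  C1 ^ D * (Lo * Hi) ^ κ ≡⟨ cong (C1 ^ D *_) (^-*-distrib κ Lo Hi) ⟩
  C1 ^ D * (Lo ^ κ * Hi ^ κ) ≤⟨ *-monoʳ-≤ (C1 ^ D) (*-mono-≤ (^-monoˡ-≤ κ lo) (^-monoˡ-≤ κ hi)) ⟩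
  C1 ^ D * (((8 * y) ^ D) ^ κ * (Z ^ T) ^ κ) ≡⟨ *-assoc (C1 ^ D) _ _ ⟨
  C1 ^ D * ((8 * y) ^ D) ^ κ * (Z ^ T) ^ κ ≤⟨ *-mono-≤ part1 part2 ⟩
  y ^ (b * D) * y ^ (b * (2 * suc E * κ * T)) ∎)))
  where
  open ≤-Reasoning
  b = suc κ
  y≥1 : 1 ≤ y
  y≥1 = ≤-trans (s≤s z≤n) y≥2
  lem1 : ∀ b D → b * D + b * D ≡ 2 * b * D
  lem1 = solve-∀
  lem2 : ∀ b e κ T → 2 * b * e * (T * κ) ≡ b * (2 * e * κ * T)
  lem2 = solve-∀
  part1 : C1 ^ D * ((8 * y) ^ D) ^ κ ≤ y ^ (b * D)
  part1 = begin
   C1 ^ D * ((8 * y) ^ D) ^ κ ≡⟨ cong (C1 ^ D *_) (pow-swap (8 * y) D κ) ⟩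
   C1 ^ D * ((8 * y) ^ κ) ^ D ≡⟨ ^-*-distrib D C1 ((8 * y) ^ κ) ⟨
   (C1 * (8 * y) ^ κ) ^ D ≡⟨ cong (λ z → (C1 * z) ^ D) (^-*-distrib κ 8 y) ⟩
   (C1 * (8 ^ κ * y ^ κ)) ^ D ≡⟨ cong (_^ D) (*-assoc C1 (8 ^ κ) (y ^ κ)) ⟨
   (C1 * 8 ^ κ * y ^ κ) ^ D ≤⟨ ^-monoˡ-≤ D (*-monoˡ-≤ (y ^ κ) y-big) ⟩
   (y ^ b) ^ D ≡⟨ ^-*-assoc y b D ⟩
   y ^ (b * D) ∎
  part2 : (Z ^ T) ^ κ ≤ y ^ (b * (2 * suc E * κ * T))
  part2 = begin
   (Z ^ T) ^ κ ≡⟨ ^-*-assoc Z T κ ⟩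
   Z ^ (T * κ) ≤⟨ ^-monoˡ-≤ (T * κ) Z≤ ⟩
   ((y ^ (2 * b)) ^ suc E) ^ (T * κ) ≡⟨ cong (_^ (T * κ)) (^-*-assoc y (2 * b) (suc E)) ⟩
   (y ^ (2 * b * suc E)) ^ (T * κ) ≡⟨ ^-*-assoc y (2 * b * suc E) (T * κ) ⟩
   y ^ (2 * b * suc E * (T * κ)) ≡⟨ cong (y ^_) (lem2 b (suc E) κ T) ⟩
   y ^ (b * (2 * suc E * κ * T)) ∎

 -- The upper bound sieve over blocks of primes

 map-Unique : ∀ {A B : Set} (f : A → B) (l : List A) → Unique l → (∀ {x y} → x ∈ l → y ∈ l → f x ≡ f y → x ≡ y) → Unique (map f l)
 map-Unique f [] u inj = []
 map-Unique f (x ∷ l) (px ∷ u) inj = All.tabulate (λ m e → let (y , y∈ , q) = ∈-map⁻ f m in All.lookup px y∈ (inj (here refl) (there y∈) (trans e q)))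
  ∷ map-Unique f l u (λ a b → inj (there a) (there b))

 range : ℕ → List ℕ
 range x = map suc (upTo x)

 range⁺ : ∀ {x e} → 1 ≤ e → e ≤ x → e ∈ range x
 range⁺ {x} {suc e} _ h = ∈-map⁺ suc (∈-upTo⁺ h)

 range⁻ : ∀ {x e} → e ∈ range x → 1 ≤ e × e ≤ x
 range⁻ {x} m with ∈-map⁻ suc m
 ... | i , i∈ , refl = s≤s z≤n , ∈-upTo⁻ i∈

 range-Unique : ∀ x → Unique (range x)
 range-Unique x = Uniq.map⁺ suc-injective (Uniq.upTo⁺ x)

 harmonic : ∀ D (w : ℕ → ℕ) → (∀ m → m * w m ≤ D) → ∀ k → ∑ (range (2 ^ k)) w ≤ suc k * D
 harmonic D w mw k = ≤-trans (≤-reflexive (∑-map (upTo (2 ^ k)) suc w)) (go k)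
  where
  open ≤-Reasoning
  go : ∀ k → ∑ (upTo (2 ^ k)) (λ i → w (suc i)) ≤ suc k * D
  go zero = +-monoˡ-≤ 0 (≤-trans (≤-reflexive (sym (+-identityʳ (w 1)))) (mw 1))
  go (suc k) = begin
   ∑ (upTo (2 ^ k + (2 ^ k + 0))) (λ i → w (suc i)) ≡⟨ cong (λ z → ∑ (upTo (2 ^ k + z)) (λ i → w (suc i))) (+-identityʳ (2 ^ k)) ⟩
   ∑ (upTo (2 ^ k + 2 ^ k)) (λ i → w (suc i)) ≡⟨ ∑-upTo-+ (2 ^ k) (2 ^ k) (λ i → w (suc i)) ⟩
   ∑ (upTo (2 ^ k)) (λ i → w (suc i)) + ∑ (upTo (2 ^ k)) (λ i → w (suc (i + 2 ^ k))) ≤⟨ +-mono-≤ (go k) half ⟩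
   suc k * D + D ≡⟨ +-comm (suc k * D) D ⟩
   suc (suc k) * D ∎
   where
   half : ∑ (upTo (2 ^ k)) (λ i → w (suc (i + 2 ^ k))) ≤ D
   half = begin
    ∑ (upTo (2 ^ k)) (λ i → w (suc (i + 2 ^ k))) ≤⟨ ∑-bound (upTo (2 ^ k)) (D ÷ 2 ^ k) (λ {i} _ → ÷-greatest (w (suc (i + 2 ^ k))) (pow≥1 k (s≤s z≤n))
                                (≤-trans (*-monoʳ-≤ (w (suc (i + 2 ^ k))) (≤-trans (m≤n+m (2 ^ k) i) (n≤1+n _))) (≤-trans (≤-reflexive (*-comm (w (suc (i + 2 ^ k))) _)) (mw (suc (i + 2 ^ k)))))) ⟩
    length (upTo (2 ^ k)) * (D ÷ 2 ^ k) ≡⟨ trans (cong (_* (D ÷ 2 ^ k)) (length-upTo (2 ^ k))) (*-comm (2 ^ k) (D ÷ 2 ^ k)) ⟩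
    D ÷ 2 ^ k * 2 ^ k ≤⟨ ÷-≤ D (2 ^ k) ⟩
    D ∎

 module _ (l k Ps : List ℕ) (D : ℕ) (w : ℕ → ℕ) (ul : Unique l) (uP : Unique Ps) (D≥1 : 1 ≤ D)
  (primeP : ∀ {p} → p ∈ Ps → Prime p) (free : ∀ {e p} → e ∈ l → p ∈ Ps → ¬ p ∣ e) (pos : ∀ {e} → e ∈ l → 1 ≤ e)
  (sub : ∀ {e} → e ∈ l → e ∈ k) (mul : ∀ {e p} → e ∈ l → p ∈ Ps → e * p ∈ k)
  (wk : ∀ {m} → m ∈ k → m * w m ≡ D) (wP : ∀ {p} → p ∈ Ps → p * w p ≡ D) (w1 : w 1 ≡ D) where

  private
   pairs : List (ℕ × ℕ)
   pairs = cartesianProduct l (1 ∷ Ps)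

   φ : ℕ × ℕ → ℕ
   φ (e , m) = e * m

   pairs⁻ : ∀ {z} → z ∈ pairs → fst z ∈ l × snd z ∈ 1 ∷ Ps
   pairs⁻ = ∈-cartesianProduct⁻ l (1 ∷ Ps)

   inj' : ∀ {e m e' m'} → e ∈ l → m ∈ 1 ∷ Ps → e' ∈ l → m' ∈ 1 ∷ Ps → e * m ≡ e' * m' → m ≡ m'
   inj' a (here refl) b (here refl) q = refl
   inj' {e} {.1} {e'} {p} a (here refl) b (there m') q = ⊥-elim (free a m' (divides e' (trans (sym (*-identityʳ e)) q)))
   inj' {e} {p} {e'} {.1} a (there m) b (here refl) q = ⊥-elim (free b m (divides e (trans (sym (*-identityʳ e')) (sym q))))
   inj' {e} {p} {e'} {p'} a (there m) b (there m') q = [ (λ d → ⊥-elim (free b m d)) , prime∣prime (primeP m) (primeP m') ]′ (euclidsLemma e' p' (primeP m) (divides e (sym q)))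

   m≥1 : ∀ {m} → m ∈ 1 ∷ Ps → 1 ≤ m
   m≥1 (here refl) = ≤-refl
   m≥1 (there m) = prime≥1 (primeP m)

   inj : ∀ {y z} → y ∈ pairs → z ∈ pairs → φ y ≡ φ z → y ≡ z
   inj {e , m} {e' , m'} y∈ z∈ q with pairs⁻ y∈ | pairs⁻ z∈
   ... | a , b | a' , b' with inj' a b a' b' q
   ... | refl = cong (_, m) (*-cancelʳ-≡ e e' m {{>-nonZero (m≥1 b)}} q)

   φ∈ : ∀ {z} → z ∈ pairs → φ z ∈ k
   φ∈ {e , m} z∈ with pairs⁻ z∈
   ... | a , here refl = subst (_∈ k) (sym (*-identityʳ e)) (sub a)
   ... | a , there m∈ = mul a m∈

   wm : ∀ {m} → m ∈ 1 ∷ Ps → m * w m ≡ D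
   wm (here refl) = trans (*-identityˡ (w 1)) w1
   wm (there m) = wP m

   mult : ∀ {e m} → e ∈ l → m ∈ 1 ∷ Ps → e * m ∈ k → D * w (e * m) ≡ w e * w m
   mult {e} {m} e∈ m∈ em∈ = *-cancelˡ-≡ (D * w (e * m)) (w e * w m) (e * m) {{>-nonZero (*-mono-≤ (pos e∈) (m≥1 m∈))}} (begin
    e * m * (D * w (e * m)) ≡⟨ *-left-comm (e * m) D (w (e * m)) ⟩
    D * (e * m * w (e * m)) ≡⟨ cong (D *_) (wk em∈) ⟩
    D * D ≡⟨ cong₂ _*_ (wk (sub e∈)) (wm m∈) ⟨
    e * w e * (m * w m) ≡⟨ lem2 e (w e) m (w m) ⟩
    e * m * (w e * w m) ∎)
    where
    open ≡-Reasoning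
    lem2 : ∀ a b c d → a * b * (c * d) ≡ a * c * (b * d)
    lem2 = solve-∀

  -- The products e·m with e in l and m = 1 or m in Ps are distinct elements of k.
  grow : ∑ l w * (D + ∑ Ps w) ≤ D * ∑ k w
  grow = begin
   ∑ l w * (D + ∑ Ps w) ≡⟨ cong (λ z → ∑ l w * (z + ∑ Ps w)) (sym w1) ⟩
   ∑ l w * ∑ (1 ∷ Ps) w ≡⟨ *-comm (∑ l w) (∑ (1 ∷ Ps) w) ⟩
   ∑ (1 ∷ Ps) w * ∑ l w ≡⟨ sym (∑-*ˡ l (∑ (1 ∷ Ps) w) w) ⟩
   ∑ l (λ e → ∑ (1 ∷ Ps) w * w e) ≡⟨ ∑-cong l (λ {e} _ → trans (*-comm (∑ (1 ∷ Ps) w) (w e)) (sym (∑-*ˡ (1 ∷ Ps) (w e) w))) ⟩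
   ∑ l (λ e → ∑ (1 ∷ Ps) (λ m → w e * w m)) ≡⟨ ∑-product l (λ z → w (fst z) * w (snd z)) ⟩
   ∑ pairs (λ z → w (fst z) * w (snd z)) ≡⟨ ∑-cong pairs (λ {z} z∈ → sym (mult (fst (pairs⁻ z∈)) (snd (pairs⁻ z∈)) (φ∈ z∈))) ⟩
   ∑ pairs (λ z → D * w (φ z)) ≡⟨ ∑-*ˡ pairs D (λ z → w (φ z)) ⟩
   D * ∑ pairs (λ z → w (φ z)) ≡⟨ cong (D *_) (sym (∑-map pairs φ w)) ⟩
   D * ∑ (map φ pairs) w ≤⟨ *-monoʳ-≤ D (∑-sub (map φ pairs) k w (map-Unique φ pairs (Uniq.cartesianProduct⁺ ul u1) inj)
                               (λ m → let (z , z∈ , q) = ∈-map⁻ φ m in subst (_∈ k) (sym q) (φ∈ z∈))) ⟩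
   D * ∑ k w ∎
   where
   open ≤-Reasoning
   u1 : Unique (1 ∷ Ps)
   u1 = All.tabulate (λ {p} p∈ e → <⇒≢ (prime≥2 (primeP p∈)) e) ∷ uP
   ∑-product : ∀ (l : List ℕ) (f : ℕ × ℕ → ℕ) → ∑ l (λ e → ∑ (1 ∷ Ps) (λ m → f (e , m))) ≡ ∑ (cartesianProduct l (1 ∷ Ps)) f
   ∑-product [] f = refl
   ∑-product (e ∷ l) f = trans (cong₂ _+_ (sym (∑-map (1 ∷ Ps) (e ,_) f)) (∑-product l f)) (sym (∑-++ (map (e ,_) (1 ∷ Ps)) _ f))

  grow-by : ∀ c → D ≤ c * ∑ Ps w → suc c * ∑ l w ≤ c * ∑ k w
  grow-by c h = *-cancelˡ-≤' D D≥1 (begin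
   D * (suc c * ∑ l w) ≡⟨ lem1 D c (∑ l w) ⟩
   (D + c * D) * ∑ l w ≤⟨ *-monoˡ-≤ (∑ l w) (+-monoˡ-≤ (c * D) h) ⟩
   (c * ∑ Ps w + c * D) * ∑ l w ≡⟨ lem2 c (∑ Ps w) D (∑ l w) ⟩
   c * (∑ l w * (D + ∑ Ps w)) ≤⟨ *-monoʳ-≤ c grow ⟩
   c * (D * ∑ k w) ≡⟨ *-left-comm c D (∑ k w) ⟩
   D * (c * ∑ k w) ∎)
   where
   open ≤-Reasoning
   lem1 : ∀ D c l → D * (suc c * l) ≡ (D + c * D) * l
   lem1 = solve-∀
   lem2 : ∀ c p D l → (c * p + c * D) * l ≡ c * (l * (D + p))
   lem2 = solve-∀

 -- ψ(z) = O(z) in multiplicative form: 8 ^ z for the primes themselves and 4096 ^ z for their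
 -- higher powers.
 chebyshev : ∀ x z → ∏ (primes x) (λ p → ∏ (upTo x) (λ k → p ^ χ (p ^ suc k ≤? z))) ≤ 32768 ^ z
 chebyshev zero z = pow≥1 z (s≤s z≤n)
 chebyshev (suc x) z = begin
  ∏ (primes (suc x)) (λ p → ∏ (upTo (suc x)) (λ k → p ^ χ (p ^ suc k ≤? z))) ≡⟨ ∏-cong (primes (suc x)) (λ {p} _ → ∏-base (upTo (suc x)) p (λ k → χ (p ^ suc k ≤? z))) ⟩
  ∏ (primes (suc x)) (λ p → p ^ ∑ (upTo (suc x)) (λ k → χ (p ^ suc k ≤? z))) ≤⟨ ∏-mono (primes (suc x)) (λ {p} p∈ → each p (fst (primes⁻ {suc x} p∈))) ⟩
  ∏ (primes (suc x)) (λ p → p ^ χ (p ≤? z) * p ^ ∑ (upTo x) (λ k → z ÷ p ^ suc (suc k))) ≡⟨ ∏-* (primes (suc x)) _ _ ⟩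
  ∏ (primes (suc x)) (λ p → p ^ χ (p ≤? z)) * ∏ (primes (suc x)) (λ p → p ^ ∑ (upTo x) (λ k → z ÷ p ^ suc (suc k))) ≤⟨ *-mono-≤ (∏-primes-χ (_≤? z) (suc x) z (λ _ h → h)) (∏-higher-powers (suc x) x z) ⟩
  8 ^ z * 4096 ^ z ≡⟨ sym (^-*-distrib z 8 4096) ⟩
  32768 ^ z ∎
  where
  open ≤-Reasoning
  each : ∀ p → Prime p → p ^ ∑ (upTo (suc x)) (λ k → χ (p ^ suc k ≤? z)) ≤ p ^ χ (p ≤? z) * p ^ ∑ (upTo x) (λ k → z ÷ p ^ suc (suc k))
  each p pr = ≤-trans (pow-monoʳ (prime≥1 pr) (begin
    ∑ (upTo (suc x)) (λ k → χ (p ^ suc k ≤? z)) ≡⟨ cong (λ n → ∑ (upTo n) (λ k → χ (p ^ suc k ≤? z))) (sym (+-comm x 1)) ⟩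
    ∑ (upTo (x + 1)) (λ k → χ (p ^ suc k ≤? z)) ≡⟨ ∑-upTo-+ x 1 (λ k → χ (p ^ suc k ≤? z)) ⟩
    χ (p ^ 1 ≤? z) + 0 + ∑ (upTo x) (λ k → χ (p ^ suc (k + 1) ≤? z)) ≤⟨ +-mono-≤ (≤-trans (≤-reflexive (+-identityʳ _)) (χ-mono (p ^ 1 ≤? z) (p ≤? z) (subst (_≤ z) (*-identityʳ p))))
                                       (∑-mono (upTo x) (λ {k} _ → ind k)) ⟩
    χ (p ≤? z) + ∑ (upTo x) (λ k → z ÷ p ^ suc (suc k)) ∎)) (≤-reflexive (^-distribˡ-+-* p (χ (p ≤? z)) (∑ (upTo x) (λ k → z ÷ p ^ suc (suc k)))))
   where
   ind : ∀ k → χ (p ^ suc (k + 1) ≤? z) ≤ z ÷ p ^ suc (suc k)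
   ind k with p ^ suc (k + 1) ≤? z
   ... | no _ = z≤n
   ... | yes h = ÷-greatest 1 (pow≥1 (suc (suc k)) (prime≥1 pr)) (≤-trans (≤-reflexive (trans (+-identityʳ _) (cong (λ n → p ^ suc n) (+-comm 1 k)))) h)

 -- Expand log d as the sum of Λ(q) over prime powers q dividing d and write d = e q. Closure under
 -- divisors puts e into l, so the total is at most ∑ ψ(x/e) over e in l, and ψ(x/e) = O(x/e). This
 -- is the passage from logarithmic density to a count.
 divisor-closed-product : ∀ x (l : List ℕ) → Unique l → (∀ {d} → d ∈ l → 1 ≤ d × d ≤ x) → (∀ {d e} → d ∈ l → e ∣ d → e ∈ l) →
  ∏ l (λ d → d) ≤ 32768 ^ ∑ l (λ e → x ÷ e)
 divisor-closed-product x l ul bd cl = begin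
  ∏ l (λ d → d) ≤⟨ ∏-mono l (λ {d} d∈ → pp-bound x x d (fst (bd d∈)) (small d∈)) ⟩
  ∏ l (λ d → ∏ (primes x) (λ p → ∏ (upTo x) (λ k → p ^ χ (p ^ suc k ∣? d)))) ≤⟨ ∏-mono l (λ {d} d∈ → ∏-mono (primes x) (λ {p} p∈ → ∏-mono (upTo x) (λ {k} _ → pow-monoʳ (prime≥1 (fst (primes⁻ {x} p∈))) (cofactor p k d∈)))) ⟩
  ∏ l (λ d → ∏ (primes x) (λ p → ∏ (upTo x) (λ k → p ^ ∑ l (λ e → χ (e * p ^ suc k ≟ d))))) ≡⟨ ∏-swap l (primes x) _ ⟩
  ∏ (primes x) (λ p → ∏ l (λ d → ∏ (upTo x) (λ k → p ^ ∑ l (λ e → χ (e * p ^ suc k ≟ d))))) ≡⟨ ∏-cong (primes x) (λ {p} _ → trans (∏-swap l (upTo x) _) (∏-cong (upTo x) (λ {k} _ → regroup p k))) ⟩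
  ∏ (primes x) (λ p → ∏ (upTo x) (λ k → ∏ l (λ e → p ^ ∑ l (λ d → χ (e * p ^ suc k ≟ d))))) ≤⟨ ∏-mono (primes x) (λ {p} p∈ → ∏-mono (upTo x) (λ {k} _ → ∏-mono l (λ {e} e∈ → pow-monoʳ (prime≥1 (fst (primes⁻ {x} p∈))) (unique p k e e∈)))) ⟩
  ∏ (primes x) (λ p → ∏ (upTo x) (λ k → ∏ l (λ e → p ^ χ (p ^ suc k ≤? x ÷ e)))) ≡⟨ ∏-cong (primes x) (λ {p} _ → ∏-swap (upTo x) l _) ⟩
  ∏ (primes x) (λ p → ∏ l (λ e → ∏ (upTo x) (λ k → p ^ χ (p ^ suc k ≤? x ÷ e)))) ≡⟨ ∏-swap (primes x) l _ ⟩
  ∏ l (λ e → ∏ (primes x) (λ p → ∏ (upTo x) (λ k → p ^ χ (p ^ suc k ≤? x ÷ e)))) ≤⟨ ∏-mono l (λ {e} _ → chebyshev x (x ÷ e)) ⟩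
  ∏ l (λ e → 32768 ^ (x ÷ e)) ≡⟨ ∏-base l 32768 (λ e → x ÷ e) ⟩
  32768 ^ ∑ l (λ e → x ÷ e) ∎
  where
  open ≤-Reasoning
  small : ∀ {d} → d ∈ l → ∀ p k → Prime p → p ^ suc k ∣ d → p ≤ x × k < x
  small d∈ p k pr dv = ≤-trans (m≤m*n p (p ^ k) {{>-nonZero (pow≥1 k (prime≥1 pr))}}) le , <-trans (n<1+n k) (<-≤-trans (n<p^n (suc k) (prime≥2 pr)) le)
   where
   le : p ^ suc k ≤ x
   le = ≤-trans (∣⇒≤ {{>-nonZero (fst (bd d∈))}} dv) (snd (bd d∈))
  cofactor : ∀ p k {d} → d ∈ l → χ (p ^ suc k ∣? d) ≤ ∑ l (λ e → χ (e * p ^ suc k ≟ d))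
  cofactor p k {d} d∈ with p ^ suc k ∣? d
  ... | no _ = z≤n
  ... | yes (divides e q) = ≤-trans (≤-reflexive (sym (χ-yes (e * p ^ suc k ≟ d) (sym q)))) (∑-∈ l {f = λ e → χ (e * p ^ suc k ≟ d)} (cl d∈ (divides (p ^ suc k) (trans q (*-comm e (p ^ suc k))))))
  regroup : ∀ p k → ∏ l (λ d → p ^ ∑ l (λ e → χ (e * p ^ suc k ≟ d))) ≡ ∏ l (λ e → p ^ ∑ l (λ d → χ (e * p ^ suc k ≟ d)))
  regroup p k = trans (∏-base l p (λ d → ∑ l (λ e → χ (e * p ^ suc k ≟ d)))) (trans (cong (p ^_) (∑-swap l l (λ d e → χ (e * p ^ suc k ≟ d)))) (sym (∏-base l p (λ e → ∑ l (λ d → χ (e * p ^ suc k ≟ d))))))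
  unique : ∀ p k e → e ∈ l → ∑ l (λ d → χ (e * p ^ suc k ≟ d)) ≤ χ (p ^ suc k ≤? x ÷ e)
  unique p k e e∈ with p ^ suc k ≤? x ÷ e
  ... | yes _ = ≤-trans (≤-reflexive (sym (length-filter-∑ (λ d → e * p ^ suc k ≟ d) l))) (at-most-one (Uniq.filter⁺ (λ d → e * p ^ suc k ≟ d) ul)
     (λ a b → trans (sym (snd (∈-filter⁻ (λ d → e * p ^ suc k ≟ d) {xs = l} a))) (snd (∈-filter⁻ (λ d → e * p ^ suc k ≟ d) {xs = l} b))))
  ... | no ¬h = ≤-reflexive (trans (∑-cong l (λ {d} d∈ → χ-no (e * p ^ suc k ≟ d) (λ q → ¬h (÷-greatest (p ^ suc k) (fst (bd e∈)) (≤-trans (≤-reflexive (trans (*-comm (p ^ suc k) e) q)) (snd (bd d∈))))))) (trans (∑-const l 0) (*-zeroʳ (length l))))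

 -- Fewer than 2 ^ h positive integers lie below 2 ^ h; every other element of l contributes a
 -- factor of at least 2 ^ h to the product.
 large-count : ∀ h (l : List ℕ) → Unique l → (∀ {d} → d ∈ l → 1 ≤ d) → Σ ℕ λ n → length l ≤ n + 2 ^ h × 2 ^ (h * n) ≤ ∏ l (λ d → d)
 large-count h l ul pos = ∑ l big , count , total
  where
  open ≤-Reasoning
  big small : ℕ → ℕ
  big d = χ (2 ^ h ≤? d)
  small d = χ (d <? 2 ^ h)
  one : ∀ d → 1 ≤ big d + small d
  one d with ≤-<-connex (2 ^ h) d
  ... | inj₁ q = ≤-trans (≤-reflexive (sym (χ-yes (2 ^ h ≤? d) q))) (m≤m+n (big d) (small d))
  ... | inj₂ q = ≤-trans (≤-reflexive (sym (χ-yes (d <? 2 ^ h) q))) (m≤n+m (small d) (big d))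
  few : ∑ l small ≤ 2 ^ h
  few = begin
   ∑ l small ≡⟨ sym (length-filter-∑ (_<? 2 ^ h) l) ⟩
   length (filter (_<? 2 ^ h) l) ≤⟨ inj-count (filter (_<? 2 ^ h) l) (upTo (2 ^ h)) (λ d → d) _≟_ (Uniq.filter⁺ (_<? 2 ^ h) ul) (λ _ _ e → e) (λ m → ∈-upTo⁺ (snd (∈-filter⁻ (_<? 2 ^ h) {xs = l} m))) ⟩
   length (upTo (2 ^ h)) ≡⟨ length-upTo (2 ^ h) ⟩
   2 ^ h ∎
  count : length l ≤ ∑ l big + 2 ^ h
  count = begin
   length l ≡⟨ sym (trans (∑-const l 1) (*-identityʳ (length l))) ⟩
   ∑ l (λ _ → 1) ≤⟨ ∑-mono l (λ {d} _ → one d) ⟩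
   ∑ l (λ d → big d + small d) ≡⟨ ∑-+ l big small ⟩
   ∑ l big + ∑ l small ≤⟨ +-monoʳ-≤ (∑ l big) few ⟩
   ∑ l big + 2 ^ h ∎
  total : 2 ^ (h * ∑ l big) ≤ ∏ l (λ d → d)
  total = begin
   2 ^ (h * ∑ l big) ≡⟨ sym (^-*-assoc 2 h (∑ l big)) ⟩
   (2 ^ h) ^ ∑ l big ≡⟨ sym (∏-base l (2 ^ h) big) ⟩
   ∏ l (λ d → (2 ^ h) ^ big d) ≤⟨ ∏-mono l (λ {d} d∈ → each d (pos d∈)) ⟩
   ∏ l (λ d → d) ∎
   where
   each : ∀ d → 1 ≤ d → (2 ^ h) ^ big d ≤ d
   each d d≥1 with 2 ^ h ≤? d
   ... | yes q = ≤-trans (≤-reflexive (*-identityʳ (2 ^ h))) q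
   ... | no _ = d≥1

 ∑-filter-χ : ∀ {A : Set} {P : A → Set} (P? : ∀ x → Dec (P x)) (f : A → ℕ) l → ∑ (filter P? l) f ≡ ∑ l (λ x → χ (P? x) * f x)
 ∑-filter-χ P? f [] = refl
 ∑-filter-χ P? f (x ∷ l) with P? x
 ... | yes _ = cong₂ _+_ (sym (+-identityʳ (f x))) (∑-filter-χ P? f l)
 ... | no _ = ∑-filter-χ P? f l

 ÷-exact : ∀ {m D} → 1 ≤ m → m ∣ D → m * (D ÷ m) ≡ D
 ÷-exact {m} {D} m≥1 (divides q e) = ≤-antisym (≤-trans (≤-reflexive (*-comm m (D ÷ m))) (÷-≤ D m))
  (≤-trans (≤-reflexive (trans e (*-comm q m))) (*-monoʳ-≤ m (÷-greatest q m≥1 (≤-reflexive (sym e)))))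

 2^⌊log₂⌋ : ∀ x → 1 ≤ x → 2 ^ ⌊log₂ x ⌋ ≤ x × x < 2 ^ suc ⌊log₂ x ⌋
 2^⌊log₂⌋ x x≥1 with search x (n<2^n x)
  where
  search : ∀ n → x < 2 ^ n → Σ ℕ λ m → 2 ^ m ≤ x × x < 2 ^ suc m
  search zero h = ⊥-elim (<⇒≱ h x≥1)
  search (suc n) h with 2 ^ n ≤? x
  ... | yes q = n , q , h
  ... | no ¬q = search n (≰⇒> ¬q)
 ... | m , lo , hi = subst (λ z → 2 ^ z ≤ x × x < 2 ^ suc z) (≤-antisym (≤-trans (≤-reflexive (sym (⌊log₂[2^n]⌋≡n m))) (⌊log₂⌋-mono-≤ lo)) (upper m x hi)) (lo , hi)
  where
  half< : ∀ n y → y < 2 * n → ⌊ y /2⌋ < n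
  half< n y h = *-cancelˡ-< 2 ⌊ y /2⌋ n (≤-<-trans (≤-trans (≤-reflexive (cong (⌊ y /2⌋ +_) (+-identityʳ ⌊ y /2⌋))) (≤-trans (+-monoʳ-≤ ⌊ y /2⌋ (⌊n/2⌋≤⌈n/2⌉ y)) (≤-reflexive (⌊n/2⌋+⌈n/2⌉≡n y)))) h)
  upper : ∀ m y → y < 2 ^ suc m → ⌊log₂ y ⌋ ≤ m
  upper zero zero h = z≤n
  upper zero (suc zero) h = z≤n
  upper zero (suc (suc y)) (s≤s (s≤s ()))
  upper (suc m) y h = ≤-trans (m≤n+m∸n ⌊log₂ y ⌋ 1) (s≤s (subst (_≤ m) (⌊log₂⌊n/2⌋⌋≡⌊log₂n⌋∸1 y) (upper m ⌊ y /2⌋ (half< (2 ^ suc m) y h))))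

 bracket : ∀ (f : ℕ → ℕ) ℓ n → f 0 ≤ ℓ → ℓ < f n → Σ ℕ λ j → f j ≤ ℓ × ℓ < f (suc j)
 bracket f ℓ zero lo hi = ⊥-elim (<⇒≱ hi lo)
 bracket f ℓ (suc n) lo hi with f n ≤? ℓ
 ... | yes h = n , h , hi
 ... | no ¬h = bracket f ℓ n lo (≰⇒> ¬h)

 bernoulli : ∀ c n → c ^ n * (c + n) ≤ c * suc c ^ n
 bernoulli c zero = ≤-reflexive (lemma c)
  where
  lemma : ∀ c → 1 * (c + 0) ≡ c * 1
  lemma = solve-∀
 bernoulli c (suc n) = begin
  c * c ^ n * (c + suc n) ≤⟨ m≤m+n _ (c ^ n * n) ⟩
  c * c ^ n * (c + suc n) + c ^ n * n ≡⟨ lem1 c (c ^ n) n ⟩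
  suc c * (c ^ n * (c + n)) ≤⟨ *-monoʳ-≤ (suc c) (bernoulli c n) ⟩
  suc c * (c * suc c ^ n) ≡⟨ lem2 c (suc c) (suc c ^ n) ⟩
  c * (suc c * suc c ^ n) ∎
  where
  open ≤-Reasoning
  lem1 : ∀ c p n → c * p * (c + suc n) + p * n ≡ suc c * (p * (c + n))
  lem1 = solve-∀
  lem2 : ∀ c s p → s * (c * p) ≡ c * (s * p)
  lem2 = solve-∀

 -- (1 + 1/c) ^ c ≥ 2 by Bernoulli's inequality, and 2 ^ K > K. Thus cK gains of 1 + 1/c outweigh
 -- one step of the exponent from K ^ J to K ^ (J + 1), which fixes q = cK.
 doubling : ∀ c K → 1 ≤ c → K * c ^ (c * K) ≤ suc c ^ (c * K)
 doubling c K c≥1 = begin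
  K * c ^ (c * K) ≤⟨ *-monoˡ-≤ (c ^ (c * K)) (<⇒≤ (n<2^n K)) ⟩
  2 ^ K * c ^ (c * K) ≡⟨ cong (2 ^ K *_) (sym (^-*-assoc c c K)) ⟩
  2 ^ K * (c ^ c) ^ K ≡⟨ sym (^-*-distrib K 2 (c ^ c)) ⟩
  (2 * c ^ c) ^ K ≤⟨ ^-monoˡ-≤ K two ⟩
  (suc c ^ c) ^ K ≡⟨ ^-*-assoc (suc c) c K ⟩
  suc c ^ (c * K) ∎
  where
  open ≤-Reasoning
  two : 2 * c ^ c ≤ suc c ^ c
  two = *-cancelˡ-≤' c c≥1 (≤-trans (≤-reflexive (lemma c (c ^ c))) (bernoulli c c))
   where
   lemma : ∀ c p → c * (2 * p) ≡ p * (c + c)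
   lemma = solve-∀

 -- In the first case A = O(√x), far better than a logarithmic saving. In the second the J blocks
 -- save ((c + 1)/c) ^ J, whose q-th power is at least K ^ J by `doubling`, and K ^ J is at least a
 -- constant times ℓ.
 count-arith : ∀ c K q b A s ℓ J x → q ≡ c * K → 1 ≤ c → 2 ≤ q → (A ≤ 2 * s ⊎ A * suc c ^ J ≤ 270 * x * c ^ J) → 1 ≤ s → s * s ≤ x → ℓ ≤ 3 * s → ℓ ≤ 2 * b * K ^ suc J →
  A ^ q * ℓ ≤ (3 * 2 ^ q + 2 * b * K * 270 ^ q) * x ^ q
 count-arith c K q b A s ℓ J x refl c≥1 q≥2 (inj₁ h) s≥1 ss ℓ≤ _ = begin
  A ^ q * ℓ ≤⟨ *-mono-≤ (^-monoˡ-≤ q h) ℓ≤ ⟩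
  (2 * s) ^ q * (3 * s) ≡⟨ cong (_* (3 * s)) (^-*-distrib q 2 s) ⟩
  2 ^ q * s ^ q * (3 * s) ≤⟨ *-monoʳ-≤ (2 ^ q * s ^ q) (*-monoʳ-≤ 3 (≤-trans (≤-reflexive (sym (*-identityʳ s))) (pow-monoʳ s≥1 (≤-trans (s≤s z≤n) q≥2)))) ⟩
  2 ^ q * s ^ q * (3 * s ^ q) ≡⟨ lemma (2 ^ q) (s ^ q) ⟩
  3 * 2 ^ q * (s ^ q * s ^ q) ≡⟨ cong (3 * 2 ^ q *_) (sym (^-*-distrib q s s)) ⟩
  3 * 2 ^ q * (s * s) ^ q ≤⟨ *-monoʳ-≤ (3 * 2 ^ q) (^-monoˡ-≤ q ss) ⟩
  3 * 2 ^ q * x ^ q ≤⟨ *-monoˡ-≤ (x ^ q) (m≤m+n (3 * 2 ^ q) (2 * b * K * 270 ^ q)) ⟩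
  (3 * 2 ^ q + 2 * b * K * 270 ^ q) * x ^ q ∎
  where
  open ≤-Reasoning
  lemma : ∀ t s → t * s * (3 * s) ≡ 3 * t * (s * s)
  lemma = solve-∀
 count-arith c K q b A s ℓ J x refl c≥1 q≥2 (inj₂ h) s≥1 ss _ ℓ≤ = *-cancelʳ-≤' (c ^ (J * q)) (pow≥1 (J * q) c≥1) (begin
  A ^ q * ℓ * c ^ (J * q) ≤⟨ *-monoˡ-≤ (c ^ (J * q)) (*-monoʳ-≤ (A ^ q) ℓ≤) ⟩
  A ^ q * (2 * b * (K * K ^ J)) * c ^ (J * q) ≡⟨ lem1 (A ^ q) b K (K ^ J) (c ^ (J * q)) ⟩
  2 * b * K * (A ^ q * (K ^ J * c ^ (J * q))) ≤⟨ *-monoʳ-≤ (2 * b * K) (*-monoʳ-≤ (A ^ q) K-pow) ⟩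
  2 * b * K * (A ^ q * (suc c ^ J) ^ q) ≡⟨ cong (2 * b * K *_) (sym (^-*-distrib q A (suc c ^ J))) ⟩
  2 * b * K * (A * suc c ^ J) ^ q ≤⟨ *-monoʳ-≤ (2 * b * K) (^-monoˡ-≤ q h) ⟩
  2 * b * K * (270 * x * c ^ J) ^ q ≡⟨ cong (2 * b * K *_) (trans (^-*-distrib q (270 * x) (c ^ J)) (cong₂ _*_ (^-*-distrib q 270 x) (^-*-assoc c J q))) ⟩
  2 * b * K * (270 ^ q * x ^ q * c ^ (J * q)) ≡⟨ lem2 (2 * b * K) (270 ^ q) (x ^ q) (c ^ (J * q)) ⟩
  2 * b * K * 270 ^ q * x ^ q * c ^ (J * q) ≤⟨ *-monoˡ-≤ (c ^ (J * q)) (*-monoˡ-≤ (x ^ q) (m≤n+m (2 * b * K * 270 ^ q) (3 * 2 ^ q))) ⟩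
  (3 * 2 ^ q + 2 * b * K * 270 ^ q) * x ^ q * c ^ (J * q) ∎)
  where
  open ≤-Reasoning
  lem1 : ∀ a b k j p → a * (2 * b * (k * j)) * p ≡ 2 * b * k * (a * (j * p))
  lem1 = solve-∀
  lem2 : ∀ a b c d → a * (b * c * d) ≡ a * b * c * d
  lem2 = solve-∀
  K-pow : K ^ J * c ^ (J * q) ≤ (suc c ^ J) ^ q
  K-pow = begin
   K ^ J * c ^ (J * q) ≡⟨ cong (K ^ J *_) (trans (cong (c ^_) (*-comm J q)) (sym (^-*-assoc c q J))) ⟩
   K ^ J * (c ^ q) ^ J ≡⟨ sym (^-*-distrib J K (c ^ q)) ⟩
   (K * c ^ q) ^ J ≤⟨ ^-monoˡ-≤ J (doubling c K c≥1) ⟩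
   (suc c ^ q) ^ J ≡⟨ pow-swap (suc c) q J ⟩
   (suc c ^ J) ^ q ∎

 -- With w p = D / p the hypothesis `block` says that the primes of 𝒬 in (y, y ^ K] have reciprocal
 -- sum at least 1/c.
 module Sieve (𝒬 : ℕ → Set) (𝒬? : ∀ p → Dec (𝒬 p)) (c K b : ℕ) (K≥2 : 2 ≤ K)
  (block : ∀ y → 2 ^ b ≤ y → ∀ D (w : ℕ → ℕ) → (∀ {p} → p ∈ primes (y ^ K) → p * w p ≡ D) → D ≤ c * ∑ (primes (y ^ K)) (λ p → χ ((y <? p) ×-dec 𝒬? p) * w p)) where

  in-block? : ∀ y p → Dec (y < p × 𝒬 p)
  in-block? y p = (y <? p) ×-dec 𝒬? p

  Clean : ℕ → ℕ → ℕ → Set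
  Clean lo hi e = All (λ p → ¬ ((lo < p × 𝒬 p) × p ∣ e)) (primes hi)

  clean? : ∀ lo hi e → Dec (Clean lo hi e)
  clean? lo hi e = All.all? (λ p → ¬? (in-block? lo p ×-dec (p ∣? e))) (primes hi)

  y : ℕ → ℕ
  y zero = 2 ^ b
  y (suc i) = y i ^ K

  y≥ : ∀ i → 2 ^ b ≤ y i
  y≥1 : ∀ i → 1 ≤ y i
  y-step : ∀ i → y i ≤ y (suc i)
  y≥ zero = ≤-refl
  y≥ (suc i) = ≤-trans (y≥ i) (y-step i)
  y≥1 i = ≤-trans (pow≥1 b (s≤s z≤n)) (y≥ i)
  y-step i = ≤-trans (≤-reflexive (sym (*-identityʳ (y i)))) (pow-monoʳ (y≥1 i) (≤-trans (s≤s z≤n) K≥2))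

  y-mono : ∀ {i j} → i ≤ j → y i ≤ y j
  y-mono {i} {j} h = subst (λ z → y i ≤ y z) (trans (+-comm (j ∸ i) i) (m+[n∸m]≡n h)) (go (j ∸ i))
   where
   go : ∀ d → y i ≤ y (d + i)
   go zero = ≤-refl
   go (suc d) = ≤-trans (go d) (y-step (d + i))

  y≡ : ∀ i → y i ≡ 2 ^ (b * K ^ i)
  y≡ zero = cong (2 ^_) (sym (*-identityʳ b))
  y≡ (suc i) = trans (cong (_^ K) (y≡ i)) (trans (^-*-assoc 2 (b * K ^ i) K) (cong (2 ^_) (trans (*-assoc b (K ^ i) K) (cong (b *_) (*-comm (K ^ i) K)))))

  module _ (x J : ℕ) (x≥1 : 1 ≤ x) (big : y J * y J ≤ x) where
   private
    B D hi : ℕ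
    B = x * x
    -- Every m ≤ x² divides D, so that m · w m = D holds exactly and w behaves like D times the
    -- reciprocal.
    D = B !
    hi = y J
    w : ℕ → ℕ
    w m = D ÷ m

    D≥1 : 1 ≤ D
    D≥1 = 1≤n! B

    w-exact : ∀ {m} → 1 ≤ m → m ≤ B → m * w m ≡ D
    w-exact m≥1 m≤B = ÷-exact m≥1 (≤⇒∣! m≥1 m≤B)

    x≤B : x ≤ B
    x≤B = m≤m*n x x {{>-nonZero x≥1}}

    hi≤x : hi ≤ x
    hi≤x = ≤-trans (m≤m*n hi hi {{>-nonZero (y≥1 J)}}) big

   S : ℕ → ℕ → List ℕ
   S i X = filter (clean? (y i) hi) (range X)

   private
    S⁻ : ∀ {i X e} → e ∈ S i X → (1 ≤ e × e ≤ X) × Clean (y i) hi e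
    S⁻ {i} {X} m = let (a , q) = ∈-filter⁻ (clean? (y i) hi) {xs = range X} m in range⁻ a , q

    S⁺ : ∀ {i X e} → 1 ≤ e → e ≤ X → Clean (y i) hi e → e ∈ S i X
    S⁺ {i} a b q = ∈-filter⁺ (clean? (y i) hi) (range⁺ a b) q

    -- Multiplication by a prime of the block enlarges the range. Because K ≥ 2 gives y i · y i ≤ y
    -- (i + 1), all enlargements together stay below y J · y J, hence the range below x².
    Xs : ℕ → ℕ
    Xs zero = x
    Xs (suc i) = Xs i * y (suc i)

    Xs≤ : ∀ i → Xs i ≤ x * (y i * y i)
    Xs≤ zero = m≤m*n x (y 0 * y 0) {{>-nonZero (*-mono-≤ (y≥1 0) (y≥1 0))}}
    Xs≤ (suc i) = begin
     Xs i * y (suc i) ≤⟨ *-monoˡ-≤ (y (suc i)) (Xs≤ i) ⟩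
     x * (y i * y i) * y (suc i) ≡⟨ *-assoc x (y i * y i) (y (suc i)) ⟩
     x * (y i * y i * y (suc i)) ≤⟨ *-monoʳ-≤ x (*-monoˡ-≤ (y (suc i)) (≤-trans (≤-reflexive (cong (y i *_) (sym (*-identityʳ (y i))))) (pow-monoʳ {y i} {2} (y≥1 i) K≥2))) ⟩
     x * (y (suc i) * y (suc i)) ∎
     where open ≤-Reasoning

    Xs≤B : ∀ {i} → i ≤ J → Xs i ≤ B
    Xs≤B {i} h = ≤-trans (Xs≤ i) (*-monoʳ-≤ x (≤-trans (*-mono-≤ (y-mono h) (y-mono h)) big))

    Xs-step : ∀ i → Xs i ≤ Xs (suc i)
    Xs-step i = m≤m*n (Xs i) (y (suc i)) {{>-nonZero (y≥1 (suc i))}}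

    step : ∀ i → suc i ≤ J → suc c * ∑ (S i (Xs i)) w ≤ c * ∑ (S (suc i) (Xs (suc i))) w
    step i i<J = grow-by (S i (Xs i)) (S (suc i) (Xs (suc i))) Ps D w (Uniq.filter⁺ (clean? (y i) hi) (range-Unique (Xs i))) (Uniq.filter⁺ (in-block? (y i)) (primes-Unique (y (suc i)))) D≥1
      (λ m → fst (Ps⁻ m)) free (λ m → fst (fst (S⁻ {i} {Xs i} m))) sub mul (λ m → let ((a , q) , _) = S⁻ {suc i} {Xs (suc i)} m in w-exact a (≤-trans q (Xs≤B i<J)))
      (λ m → let (pr , le , _) = Ps⁻ m in w-exact (prime≥1 pr) (≤-trans le y≤B)) (trans (sym (*-identityˡ (w 1))) (w-exact ≤-refl (≤-trans x≥1 x≤B))) c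
      (≤-trans (block (y i) (y≥ i) D w (λ m → let (pr , le) = primes⁻ {y (suc i)} m in w-exact (prime≥1 pr) (≤-trans le y≤B)))
       (≤-reflexive (cong (c *_) (sym (∑-filter-χ (in-block? (y i)) w (primes (y (suc i))))))))
     where
     y≤B : y (suc i) ≤ B
     y≤B = ≤-trans (y-mono i<J) (≤-trans hi≤x x≤B)
     Ps = filter (in-block? (y i)) (primes (y (suc i)))
     Ps⁻ : ∀ {p} → p ∈ Ps → Prime p × p ≤ y (suc i) × (y i < p × 𝒬 p)
     Ps⁻ m = let (a , q) = ∈-filter⁻ (in-block? (y i)) {xs = primes (y (suc i))} m; (pr , le) = primes⁻ {y (suc i)} a in pr , le , q
     free : ∀ {e p} → e ∈ S i (Xs i) → p ∈ Ps → ¬ p ∣ e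
     free e∈ p∈ d = let (pr , le , q) = Ps⁻ p∈ in All.lookup (snd (S⁻ {i} {Xs i} e∈)) (primes⁺ pr (≤-trans le (y-mono i<J))) (q , d)
     sub : ∀ {e} → e ∈ S i (Xs i) → e ∈ S (suc i) (Xs (suc i))
     sub e∈ = let ((a , b) , q) = S⁻ {i} {Xs i} e∈ in S⁺ {suc i} {Xs (suc i)} a (≤-trans b (Xs-step i)) (All.map (λ h z → h ((≤-<-trans (y-step i) (fst (fst z)) , snd (fst z)) , snd z)) q)
     mul : ∀ {e p} → e ∈ S i (Xs i) → p ∈ Ps → e * p ∈ S (suc i) (Xs (suc i))
     mul {e} {p} e∈ p∈ = let ((a , b) , q) = S⁻ {i} {Xs i} e∈; (pr , le , _) = Ps⁻ p∈ in S⁺ {suc i} {Xs (suc i)} (*-mono-≤ a (prime≥1 pr)) (*-mono-≤ b le)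
      (All.tabulate (λ {r} r∈ z → [ (λ d → All.lookup q r∈ ((≤-<-trans (y-step i) (fst (fst z)) , snd (fst z)) , d)) ,
       (λ d → <⇒≱ (fst (fst z)) (≤-trans (≤-reflexive (prime∣prime (fst (primes⁻ {hi} r∈)) pr d)) le)) ]′ (euclidsLemma e p (fst (primes⁻ {hi} r∈)) (snd z))))

    iterate : ∀ i → i ≤ J → suc c ^ i * ∑ (S 0 x) w ≤ c ^ i * ∑ (S i (Xs i)) w
    iterate zero h = ≤-refl
    iterate (suc i) h = begin
     suc c * suc c ^ i * ∑ (S 0 x) w ≡⟨ *-assoc (suc c) (suc c ^ i) _ ⟩
     suc c * (suc c ^ i * ∑ (S 0 x) w) ≤⟨ *-monoʳ-≤ (suc c) (iterate i (<⇒≤ h)) ⟩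
     suc c * (c ^ i * ∑ (S i (Xs i)) w) ≡⟨ *-left-comm (suc c) (c ^ i) (∑ (S i (Xs i)) w) ⟩
     c ^ i * (suc c * ∑ (S i (Xs i)) w) ≤⟨ *-monoʳ-≤ (c ^ i) (step i h) ⟩
     c ^ i * (c * ∑ (S (suc i) (Xs (suc i))) w) ≡⟨ lem2 (c ^ i) c (∑ (S (suc i) (Xs (suc i))) w) ⟩
     c * c ^ i * ∑ (S (suc i) (Xs (suc i))) w ∎
     where
     open ≤-Reasoning
     lem2 : ∀ a b c → a * (b * c) ≡ b * a * c
     lem2 = solve-∀

   -- After J blocks the reciprocal sum over clean integers is (c / (c + 1)) ^ J times a harmonic
   -- sum up to x². As the clean integers up to x are closed under divisors,
   -- `divisor-closed-product` and `large-count` turn this into a count; 15 is the exponent in 32768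
   -- = 2 ^ 15.
   sieve-bound : ∀ h k → x * x ≤ 2 ^ k → Σ ℕ λ n → length (S 0 x) ≤ n + 2 ^ h × h * n * suc c ^ J ≤ 15 * x * (c ^ J * suc k)
   sieve-bound h k B≤ = n , fst (snd lc) , *-cancelʳ-≤' D D≥1 (begin
     h * n * suc c ^ J * D ≤⟨ *-monoˡ-≤ D (*-monoˡ-≤ (suc c ^ J) hn) ⟩
     15 * H * suc c ^ J * D ≡⟨ lem1 H (suc c ^ J) D ⟩
     15 * (suc c ^ J * (H * D)) ≤⟨ *-monoʳ-≤ 15 (*-monoʳ-≤ (suc c ^ J) HD) ⟩
     15 * (suc c ^ J * (x * L)) ≡⟨ lem2 (suc c ^ J) x L ⟩
     15 * x * (suc c ^ J * L) ≤⟨ *-monoʳ-≤ (15 * x) (≤-trans (iterate J ≤-refl) (*-monoʳ-≤ (c ^ J) all)) ⟩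
     15 * x * (c ^ J * (suc k * D)) ≡⟨ lem3 (15 * x) (c ^ J) (suc k) D ⟩
     15 * x * (c ^ J * suc k) * D ∎)
    where
    open ≤-Reasoning
    l = S 0 x
    L = ∑ l w
    H = ∑ l (λ e → x ÷ e)
    lc = large-count h l (Uniq.filter⁺ (clean? (y 0) hi) (range-Unique x)) (λ m → fst (fst (S⁻ {0} {x} m)))
    n = fst lc
    lem1 : ∀ H s D → 15 * H * s * D ≡ 15 * (s * (H * D))
    lem1 = solve-∀
    lem2 : ∀ s x L → 15 * (s * (x * L)) ≡ 15 * x * (s * L)
    lem2 = solve-∀
    lem3 : ∀ a b c d → a * (b * (c * d)) ≡ a * (b * c) * d
    lem3 = solve-∀
    closed : ∀ {d e} → d ∈ l → e ∣ d → e ∈ l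
    closed {d} {e} d∈ ed = let ((a , b) , q) = S⁻ {0} {x} d∈ in S⁺ {0} (pos a ed) (≤-trans (∣⇒≤ {{>-nonZero a}} ed) b) (All.map (λ h z → h (fst z , ∣-trans (snd z) ed)) q)
     where
     pos : ∀ {e d} → 1 ≤ d → e ∣ d → 1 ≤ e
     pos {zero} d≥1 (divides q refl) = ≤-trans d≥1 (≤-reflexive (*-zeroʳ q))
     pos {suc e} d≥1 _ = s≤s z≤n
    hn : h * n ≤ 15 * H
    hn = pow-cancel {2} ≤-refl (≤-trans (snd (snd lc)) (≤-trans (divisor-closed-product x l (Uniq.filter⁺ (clean? (y 0) hi) (range-Unique x)) (λ m → fst (S⁻ {0} {x} m)) closed)
     (≤-reflexive (^-*-assoc 2 15 H))))
    HD : H * D ≤ x * L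
    HD = begin
     H * D ≡⟨ *-comm H D ⟩
     D * H ≡⟨ sym (∑-*ˡ l D (λ e → x ÷ e)) ⟩
     ∑ l (λ e → D * (x ÷ e)) ≤⟨ ∑-mono l (λ {e} e∈ → each e (fst (S⁻ {0} {x} e∈))) ⟩
     ∑ l (λ e → x * w e) ≡⟨ ∑-*ˡ l x w ⟩
     x * L ∎
     where
     each : ∀ e → 1 ≤ e × e ≤ x → D * (x ÷ e) ≤ x * w e
     each e (a , b) = begin
      D * (x ÷ e) ≡⟨ cong (_* (x ÷ e)) (sym (w-exact a (≤-trans b x≤B))) ⟩
      e * w e * (x ÷ e) ≡⟨ lem4 e (w e) (x ÷ e) ⟩
      x ÷ e * e * w e ≤⟨ *-monoˡ-≤ (w e) (÷-≤ x e) ⟩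
      x * w e ∎
      where
      lem4 : ∀ e w q → e * w * q ≡ q * e * w
      lem4 = solve-∀
    all : ∑ (S J (Xs J)) w ≤ suc k * D
    all = ≤-trans (∑-sub (S J (Xs J)) (range (2 ^ k)) w (Uniq.filter⁺ (clean? (y J) hi) (range-Unique (Xs J))) (λ m → let ((a , b) , _) = S⁻ {J} {Xs J} m in range⁺ a (≤-trans b (≤-trans (Xs≤B ≤-refl) B≤))))
     (harmonic D w (λ m → ≤-trans (≤-reflexive (*-comm m (w m))) (÷-≤ D m)) k)

  count-bound : 1 ≤ c → 1 ≤ b → Σ ℕ λ C → Σ ℕ λ x0 → ∀ x → x0 ≤ x → ∀ (l : List ℕ) → Unique l →
   (∀ {d} → d ∈ l → (1 ≤ d × d ≤ x) × (∀ {p} → Prime p → 𝒬 p → ¬ p ∣ d)) → length l ^ (c * K) * ⌊log₂ x ⌋ ≤ C * x ^ (c * K)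
  count-bound c≥1 b≥1 = 3 * 2 ^ q + 2 * b * K * 270 ^ q , 2 ^ (2 + 2 * b) , main
   where
   q = c * K
   main : ∀ x → 2 ^ (2 + 2 * b) ≤ x → ∀ (l : List ℕ) → Unique l → (∀ {d} → d ∈ l → (1 ≤ d × d ≤ x) × (∀ {p} → Prime p → 𝒬 p → ¬ p ∣ d)) →
    length l ^ q * ⌊log₂ x ⌋ ≤ (3 * 2 ^ q + 2 * b * K * 270 ^ q) * x ^ q
   main x x0≤x l ul prop = ≤-trans (*-monoˡ-≤ ℓ (^-monoˡ-≤ q len)) (count-arith c K q b A s ℓ J x refl c≥1 (≤-trans K≥2 (m≤n*m K c {{>-nonZero c≥1}})) cases (pow≥1 h (s≤s z≤n)) ss ℓ≤3s (<⇒≤ (snd (snd br))))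
    where
    open ≤-Reasoning
    ℓ = ⌊log₂ x ⌋
    x≥1 : 1 ≤ x
    x≥1 = ≤-trans (pow≥1 (2 + 2 * b) (s≤s z≤n)) x0≤x
    lo = fst (2^⌊log₂⌋ x x≥1)
    hi = snd (2^⌊log₂⌋ x x≥1)
    ℓ≥ : 2 + 2 * b ≤ ℓ
    ℓ≥ = ≤-pred (pow-cancel' (≤-<-trans x0≤x hi))
     where
     pow-cancel' : ∀ {i j} → 2 ^ i < 2 ^ j → i < j
     pow-cancel' {i} {j} h with i <? j
     ... | yes q = q
     ... | no ¬q = ⊥-elim (<⇒≱ h (^-monoʳ-≤ 2 (≮⇒≥ ¬q)))
    -- J blocks fit, as y J · y J = 2 ^ (2 b K ^ J) ≤ 2 ^ ℓ ≤ x; and ℓ < 2 b K ^ (J + 1) makes J as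
    -- large as the final bound demands.
    br = bracket (λ j → 2 * b * K ^ j) ℓ ℓ (≤-trans (≤-reflexive (*-identityʳ (2 * b))) (≤-trans (m≤n+m (2 * b) 2) ℓ≥))
     (<-≤-trans (n<p^n ℓ K≥2) (m≤n*m (K ^ ℓ) (2 * b) {{>-nonZero (*-mono-≤ {1} {2} (s≤s z≤n) b≥1)}}))
    J = fst br
    h = fst (halve ℓ)
    s = 2 ^ h
    ℓ≤ : ℓ ≤ suc (h + h)
    ℓ≤ = [ (λ e → ≤-trans (≤-reflexive e) (n≤1+n (h + h))) , (λ e → ≤-reflexive e) ]′ (snd (halve ℓ))
    hh≤ : h + h ≤ ℓ
    hh≤ = [ (λ e → ≤-reflexive (sym e)) , (λ e → ≤-trans (n≤1+n (h + h)) (≤-reflexive (sym e))) ]′ (snd (halve ℓ))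
    h≥1 : 1 ≤ h
    h≥1 = pos h (≤-trans (m≤m+n 2 (2 * b)) (≤-trans ℓ≥ ℓ≤))
     where
     pos : ∀ h → 2 ≤ suc (h + h) → 1 ≤ h
     pos zero (s≤s ())
     pos (suc h) _ = s≤s z≤n
    ss : s * s ≤ x
    ss = ≤-trans (≤-reflexive (sym (^-distribˡ-+-* 2 h h))) (≤-trans (^-monoʳ-≤ 2 hh≤) lo)
    three : suc (h + h) ≤ 3 * h
    three = ≤-trans (+-monoˡ-≤ (h + h) h≥1) (≤-reflexive (lemma h))
     where
     lemma : ∀ h → h + (h + h) ≡ 3 * h
     lemma = solve-∀
    ℓ≤3s : ℓ ≤ 3 * s
    ℓ≤3s = ≤-trans ℓ≤ (≤-trans three (*-monoʳ-≤ 3 (<⇒≤ (n<2^n h))))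
    big : y J * y J ≤ x
    big = begin
     y J * y J ≡⟨ cong₂ _*_ (y≡ J) (y≡ J) ⟩
     2 ^ (b * K ^ J) * 2 ^ (b * K ^ J) ≡⟨ sym (^-distribˡ-+-* 2 (b * K ^ J) (b * K ^ J)) ⟩
     2 ^ (b * K ^ J + b * K ^ J) ≡⟨ cong (2 ^_) (lemma b (K ^ J)) ⟩
     2 ^ (2 * b * K ^ J) ≤⟨ ^-monoʳ-≤ 2 (fst (snd br)) ⟩
     2 ^ ℓ ≤⟨ lo ⟩
     x ∎
     where
     lemma : ∀ b k → b * k + b * k ≡ 2 * b * k
     lemma = solve-∀
    k = suc ℓ + suc ℓ
    sb = sieve-bound x J x≥1 big h k (≤-trans (*-mono-≤ (<⇒≤ hi) (<⇒≤ hi)) (≤-reflexive (sym (^-distribˡ-+-* 2 (suc ℓ) (suc ℓ)))))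
    n = fst sb
    A = length (S x J x≥1 big 0 x)
    k≤ : suc k ≤ 9 * h
    k≤ = begin
     suc (suc ℓ + suc ℓ) ≤⟨ s≤s (+-mono-≤ (s≤s ℓ≤) (s≤s ℓ≤)) ⟩
     suc (suc (suc (h + h)) + suc (suc (h + h))) ≡⟨ lem1 h ⟩
     4 * h + 5 * 1 ≤⟨ +-monoʳ-≤ (4 * h) (*-monoʳ-≤ 5 h≥1) ⟩
     4 * h + 5 * h ≡⟨ lem2 h ⟩
     9 * h ∎
     where
     lem1 : ∀ h → suc (suc (suc (h + h)) + suc (suc (h + h))) ≡ 4 * h + 5 * 1
     lem1 = solve-∀
     lem2 : ∀ h → 4 * h + 5 * h ≡ 9 * h
     lem2 = solve-∀
    n-bound : n * suc c ^ J ≤ 135 * x * c ^ J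
    n-bound = *-cancelˡ-≤' h h≥1 (begin
     h * (n * suc c ^ J) ≡⟨ sym (*-assoc h n (suc c ^ J)) ⟩
     h * n * suc c ^ J ≤⟨ snd (snd sb) ⟩
     15 * x * (c ^ J * suc k) ≤⟨ *-monoʳ-≤ (15 * x) (*-monoʳ-≤ (c ^ J) k≤) ⟩
     15 * x * (c ^ J * (9 * h)) ≡⟨ lemma x (c ^ J) h ⟩
     h * (135 * x * c ^ J) ∎)
     where
     lemma : ∀ x p h → 15 * x * (p * (9 * h)) ≡ h * (135 * x * p)
     lemma = solve-∀
    cases : A ≤ 2 * s ⊎ A * suc c ^ J ≤ 270 * x * c ^ J
    cases = split A n s (suc c ^ J) (c ^ J) (fst (snd sb)) n-bound
     where
     split : ∀ A n s p r → A ≤ n + s → n * p ≤ 135 * x * r → A ≤ 2 * s ⊎ A * p ≤ 270 * x * r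
     split A n s p r h1 h2 with ≤-total n s
     ... | inj₁ q = inj₁ (≤-trans h1 (≤-trans (+-monoˡ-≤ s q) (≤-reflexive (cong (s +_) (sym (+-identityʳ s))))))
     ... | inj₂ q = inj₂ (≤-trans (*-monoˡ-≤ p (≤-trans h1 (+-monoʳ-≤ n q))) (≤-trans (≤-reflexive (*-distribʳ-+ p n n)) (≤-trans (+-mono-≤ h2 h2) (≤-reflexive (lemma x r)))))
      where
      lemma : ∀ x r → 135 * x * r + 135 * x * r ≡ 270 * x * r
      lemma = solve-∀
    len : length l ≤ A
    len = inj-count l (S x J x≥1 big 0 x) (λ d → d) _≟_ ul (λ _ _ e → e) (λ {d} d∈ → let ((a , a') , f) = prop d∈ in
     ∈-filter⁺ (clean? (y 0) (y J)) (range⁺ a a') (All.tabulate (λ {p} p∈ z → f (fst (primes⁻ {y J} p∈)) (snd (fst z)) (snd z))))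

-- Rings with a map from ℤ, their quotients, and ℤ[X, Y]

open import Data.Integer as Z using (ℤ; 0ℤ; 1ℤ; -1ℤ; +_; -[1+_]; ∣_∣)
import Data.Integer.Properties as ZP
open import Data.Integer.DivMod using (_%ℕ_; _/ℕ_; a≡a%ℕn+[a/ℕn]*n; n%ℕd<d)
open import Data.Integer.Divisibility.Signed as ZD using (divides; ∣ᵤ⇒∣; ∣⇒∣ᵤ) renaming (_∣_ to _∣ᶻ_; _∣?_ to _∣ᶻ?_)
open import Data.Vec using (zipWith; _∷ʳ_)

-- Equality is a setoid relation, so a quotient keeps carrier and operations and changes only `_≈_`.
-- The map ι supplies integer constants to the ring solver.
record ZRing : Set1 where
 field
  commutativeRing : CommutativeRing 0ℓ 0ℓ
 open CommutativeRing commutativeRing public hiding (zero)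
 field
  ι : ℤ → Carrier
  ι-+ : ∀ m n → ι (m Z.+ n) ≈ ι m + ι n
  ι-* : ∀ m n → ι (m Z.* n) ≈ ι m * ι n
  ι-1 : ι 1ℤ ≈ 1#

module RingOps (R : ZRing) where
 open ZRing R public
 open RingProps ring public using (x+x≈x⇒x≈0; -‿involutive)
 module ≈R = SetoidReasoning setoid

 ι-0 : ι 0ℤ ≈ 0#
 ι-0 = x+x≈x⇒x≈0 (ι 0ℤ) (sym (ι-+ 0ℤ 0ℤ))

 ι-neg : ∀ n → ι (Z.- n) ≈ - ι n
 ι-neg n = begin
  ι (Z.- n) ≈⟨ +-identityʳ _ ⟨
  ι (Z.- n) + 0# ≈⟨ +-congˡ (-‿inverseʳ (ι n)) ⟨
  ι (Z.- n) + (ι n - ι n) ≈⟨ +-assoc _ _ _ ⟨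
  ι (Z.- n) + ι n - ι n ≈⟨ +-congʳ (ι-+ (Z.- n) n) ⟨
  ι (Z.- n Z.+ n) - ι n ≈⟨ +-congʳ (reflexive (cong ι (ZP.+-inverseˡ n))) ⟩
  ι 0ℤ - ι n ≈⟨ +-congʳ ι-0 ⟩
  0# - ι n ≈⟨ +-identityˡ _ ⟩
  - ι n ∎
  where open ≈R

 ι-cong : ∀ {m n} → m ≡ n → ι m ≈ ι n
 ι-cong e = reflexive (cong ι e)

 x≈y⇒x-y≈0 : ∀ {x y} → x ≈ y → x - y ≈ 0#
 x≈y⇒x-y≈0 {x} {y} e = trans (+-congʳ e) (-‿inverseʳ y)

 x-y≈0⇒x≈y : ∀ {x y} → x - y ≈ 0# → x ≈ y
 x-y≈0⇒x≈y {x} {y} e = begin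
  x ≈⟨ +-identityʳ x ⟨
  x + 0# ≈⟨ +-congˡ (-‿inverseˡ y) ⟨
  x + (- y + y) ≈⟨ +-assoc _ _ _ ⟨
  x - y + y ≈⟨ +-congʳ e ⟩
  0# + y ≈⟨ +-identityˡ y ⟩
  y ∎
  where open ≈R

 almost = fromCommutativeRing commutativeRing

 ι-morphism : Z.+-*-rawRing -Raw-AlmostCommutative⟶ almost
 ι-morphism = record { ⟦_⟧ = ι ; +-homo = ι-+ ; *-homo = ι-* ; -‿homo = ι-neg ; 0-homo = ι-0 ; 1-homo = ι-1 }

 ι-≟ : ∀ m n → Maybe (ι m ≈ ι n)
 ι-≟ m n with m Z.≟ n
 ... | yes e = just (ι-cong e)
 ... | no _ = nothing

 open RingSolver Z.+-*-rawRing almost ι-morphism ι-≟ public using (solve; _:=_; _:+_; _:*_; _:-_; :-_; con)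

ℤ-ring : ZRing
ℤ-ring = record
 { commutativeRing = ZP.+-*-commutativeRing
 ; ι = λ z → z
 ; ι-+ = λ _ _ → Eq.refl
 ; ι-* = λ _ _ → Eq.refl
 ; ι-1 = Eq.refl
 }

record IsIdeal (R : ZRing) (I : ZRing.Carrier R → Set) : Set where
 open ZRing R
 field
  I-resp : ∀ {x y} → x ≈ y → I x → I y
  I-0 : I 0#
  I-+ : ∀ {x y} → I x → I y → I (x + y)
  I-* : ∀ x {y} → I y → I (x * y)

module Quotient (R : ZRing) (I : ZRing.Carrier R → Set) (isIdeal : IsIdeal R I) where
 open RingOps R
 open IsIdeal isIdeal

 -- A record rather than a definition, so that x and y can be inferred from x ~ y.
 record _~_ (x y : Carrier) : Set where
  constructor ⟪_⟫
  field difference : I (x - y)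
 open _~_ public

 ≈⇒~ : ∀ {x y} → x ≈ y → x ~ y
 ≈⇒~ e = ⟪ I-resp (sym (x≈y⇒x-y≈0 e)) I-0 ⟫

 ~-sym : ∀ {x y} → x ~ y → y ~ x
 ~-sym {x} {y} ⟪ h ⟫ = ⟪ I-resp (solve 2 (λ x y → con -1ℤ :* (x :- y) := y :- x) refl x y) (I-* (ι -1ℤ) h) ⟫

 ~-trans : ∀ {x y z} → x ~ y → y ~ z → x ~ z
 ~-trans {x} {y} {z} ⟪ h ⟫ ⟪ k ⟫ = ⟪ I-resp (solve 3 (λ x y z → (x :- y) :+ (y :- z) := x :- z) refl x y z) (I-+ h k) ⟫

 ~-+ : ∀ {x y u v} → x ~ y → u ~ v → (x + u) ~ (y + v)
 ~-+ {x} {y} {u} {v} ⟪ h ⟫ ⟪ k ⟫ = ⟪ I-resp (solve 4 (λ x y u v → (x :- y) :+ (u :- v) := (x :+ u) :- (y :+ v)) refl x y u v) (I-+ h k) ⟫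

 ~-* : ∀ {x y u v} → x ~ y → u ~ v → (x * u) ~ (y * v)
 ~-* {x} {y} {u} {v} ⟪ h ⟫ ⟪ k ⟫ = ⟪ I-resp (solve 4 (λ x y u v → (u :* (x :- y)) :+ (y :* (u :- v)) := (x :* u) :- (y :* v)) refl x y u v)
  (I-+ (I-* u h) (I-* y k)) ⟫

 ~-neg : ∀ {x y} → x ~ y → (- x) ~ (- y)
 ~-neg {x} {y} ⟪ h ⟫ = ⟪ I-resp (solve 2 (λ x y → con -1ℤ :* (x :- y) := (:- x) :- (:- y)) refl x y) (I-* (ι -1ℤ) h) ⟫

 quotient : ZRing
 quotient = record
  { commutativeRing = record
   { _≈_ = _~_ ; _+_ = _+_ ; _*_ = _*_ ; -_ = -_ ; 0# = 0# ; 1# = 1#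
   ; isCommutativeRing = record
    { isRing = record
     { +-isAbelianGroup = record
      { isGroup = record
       { isMonoid = record
        { isSemigroup = record
         { isMagma = record
          { isEquivalence = record { refl = ≈⇒~ refl ; sym = ~-sym ; trans = ~-trans }
          ; ∙-cong = ~-+ }
         ; assoc = λ x y z → ≈⇒~ (+-assoc x y z) }
        ; identity = (λ x → ≈⇒~ (+-identityˡ x)) , (λ x → ≈⇒~ (+-identityʳ x)) }
       ; inverse = (λ x → ≈⇒~ (-‿inverseˡ x)) , (λ x → ≈⇒~ (-‿inverseʳ x))
       ; ⁻¹-cong = ~-neg }
      ; comm = λ x y → ≈⇒~ (+-comm x y) }
     ; *-cong = ~-*
     ; *-assoc = λ x y z → ≈⇒~ (*-assoc x y z)
     ; *-identity = (λ x → ≈⇒~ (*-identityˡ x)) , (λ x → ≈⇒~ (*-identityʳ x))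
     ; distrib = (λ x y z → ≈⇒~ (distribˡ x y z)) , (λ x y z → ≈⇒~ (distribʳ x y z)) }
    ; *-comm = λ x y → ≈⇒~ (*-comm x y) } }
  ; ι = ι
  ; ι-+ = λ m n → ≈⇒~ (ι-+ m n)
  ; ι-* = λ m n → ≈⇒~ (ι-* m n)
  ; ι-1 = ≈⇒~ ι-1
  }

 ~0 : ∀ {x} → I x → x ~ 0#
 ~0 {x} h = ⟪ I-resp (trans (solve 1 (λ x → x := x :- con 0ℤ) refl x) (+-congˡ (-‿cong ι-0))) h ⟫

 ~0⁻ : ∀ {x} → x ~ 0# → I x
 ~0⁻ {x} ⟪ h ⟫ = I-resp (trans (+-congˡ (-‿cong (sym ι-0))) (solve 1 (λ x → x :- con 0ℤ := x) refl x)) h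

-- ℤ[X, Y], realised as shift operators on double sequences: two expressions are equal when they act equally.
data Expr : Set where
 con : ℤ → Expr
 𝕏 𝕐 : Expr
 _⊕_ _⊗_ : Expr → Expr → Expr

infixl 6 _⊕_
infixl 7 _⊗_

Seq : Set
Seq = ℕ → ℕ → ℤ

⟦_⟧ : Expr → Seq → Seq
⟦ con c ⟧ u i j = c Z.* u i j
⟦ 𝕏 ⟧ u i j = u (suc i) j
⟦ 𝕐 ⟧ u i j = u i (suc j)
⟦ e ⊕ f ⟧ u i j = ⟦ e ⟧ u i j Z.+ ⟦ f ⟧ u i j
⟦ e ⊗ f ⟧ u = ⟦ e ⟧ (⟦ f ⟧ u)

infix 4 _≐_ _≋_
_≐_ : Seq → Seq → Set
u ≐ v = ∀ i j → u i j ≡ v i j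

act-ext : ∀ e {u v} → u ≐ v → ⟦ e ⟧ u ≐ ⟦ e ⟧ v
act-ext (con c) h i j = cong (c Z.*_) (h i j)
act-ext 𝕏 h i j = h (suc i) j
act-ext 𝕐 h i j = h i (suc j)
act-ext (e ⊕ f) h i j = cong₂ Z._+_ (act-ext e h i j) (act-ext f h i j)
act-ext (e ⊗ f) h = act-ext e (act-ext f h)

act-+ : ∀ e u v → ⟦ e ⟧ (λ i j → u i j Z.+ v i j) ≐ (λ i j → ⟦ e ⟧ u i j Z.+ ⟦ e ⟧ v i j)
act-+ (con c) u v i j = ZP.*-distribˡ-+ c (u i j) (v i j)
act-+ 𝕏 u v i j = Eq.refl
act-+ 𝕐 u v i j = Eq.refl
act-+ (e ⊕ f) u v i j = Eq.trans (cong₂ Z._+_ (act-+ e u v i j) (act-+ f u v i j)) (lemma (⟦ e ⟧ u i j) (⟦ e ⟧ v i j) (⟦ f ⟧ u i j) (⟦ f ⟧ v i j))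
 where
 lemma : ∀ a b c d → (a Z.+ b) Z.+ (c Z.+ d) ≡ (a Z.+ c) Z.+ (b Z.+ d)
 lemma = solveZ
act-+ (e ⊗ f) u v i j = Eq.trans (act-ext e (act-+ f u v) i j) (act-+ e (⟦ f ⟧ u) (⟦ f ⟧ v) i j)

act-* : ∀ e c u → ⟦ e ⟧ (λ i j → c Z.* u i j) ≐ (λ i j → c Z.* ⟦ e ⟧ u i j)
act-* (con d) c u i j = lemma c d (u i j)
 where
 lemma : ∀ c d x → d Z.* (c Z.* x) ≡ c Z.* (d Z.* x)
 lemma = solveZ
act-* 𝕏 c u i j = Eq.refl
act-* 𝕐 c u i j = Eq.refl
act-* (e ⊕ f) c u i j = Eq.trans (cong₂ Z._+_ (act-* e c u i j) (act-* f c u i j)) (Eq.sym (ZP.*-distribˡ-+ c _ _))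
act-* (e ⊗ f) c u i j = Eq.trans (act-ext e (act-* f c u) i j) (act-* e c (⟦ f ⟧ u) i j)

act-𝕏 : ∀ e u → ⟦ e ⟧ (⟦ 𝕏 ⟧ u) ≐ ⟦ 𝕏 ⟧ (⟦ e ⟧ u)
act-𝕏 (con c) u i j = Eq.refl
act-𝕏 𝕏 u i j = Eq.refl
act-𝕏 𝕐 u i j = Eq.refl
act-𝕏 (e ⊕ f) u i j = cong₂ Z._+_ (act-𝕏 e u i j) (act-𝕏 f u i j)
act-𝕏 (e ⊗ f) u i j = Eq.trans (act-ext e (act-𝕏 f u) i j) (act-𝕏 e (⟦ f ⟧ u) i j)

act-𝕐 : ∀ e u → ⟦ e ⟧ (⟦ 𝕐 ⟧ u) ≐ ⟦ 𝕐 ⟧ (⟦ e ⟧ u)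
act-𝕐 (con c) u i j = Eq.refl
act-𝕐 𝕏 u i j = Eq.refl
act-𝕐 𝕐 u i j = Eq.refl
act-𝕐 (e ⊕ f) u i j = cong₂ Z._+_ (act-𝕐 e u i j) (act-𝕐 f u i j)
act-𝕐 (e ⊗ f) u i j = Eq.trans (act-ext e (act-𝕐 f u) i j) (act-𝕐 e (⟦ f ⟧ u) i j)

act-comm : ∀ e f u → ⟦ e ⟧ (⟦ f ⟧ u) ≐ ⟦ f ⟧ (⟦ e ⟧ u)
act-comm e (con c) u = act-* e c u
act-comm e 𝕏 u = act-𝕏 e u
act-comm e 𝕐 u = act-𝕐 e u
act-comm e (f ⊕ g) u i j = Eq.trans (act-+ e (⟦ f ⟧ u) (⟦ g ⟧ u) i j) (cong₂ Z._+_ (act-comm e f u i j) (act-comm e g u i j))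
act-comm e (f ⊗ g) u i j = Eq.trans (act-comm e f (⟦ g ⟧ u) i j) (act-ext f (act-comm e g u) i j)

record _≋_ (e f : Expr) : Set where
 constructor same
 field act≐ : ∀ u → ⟦ e ⟧ u ≐ ⟦ f ⟧ u
open _≋_ public

ℤ[X,Y] : ZRing
ℤ[X,Y] = record
 { commutativeRing = record
  { _≈_ = _≋_ ; _+_ = _⊕_ ; _*_ = _⊗_ ; -_ = con -1ℤ ⊗_ ; 0# = con 0ℤ ; 1# = con 1ℤ
  ; isCommutativeRing = record
   { isRing = record
    { +-isAbelianGroup = record
     { isGroup = record
      { isMonoid = record
       { isSemigroup = record
        { isMagma = record
         { isEquivalence = record
          { refl = same (λ _ _ _ → Eq.refl)
          ; sym = λ h → same (λ u i j → Eq.sym (act≐ h u i j))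
          ; trans = λ h k → same (λ u i j → Eq.trans (act≐ h u i j) (act≐ k u i j)) }
         ; ∙-cong = λ h k → same (λ u i j → cong₂ Z._+_ (act≐ h u i j) (act≐ k u i j)) }
        ; assoc = λ e f g → same (λ u i j → ZP.+-assoc (⟦ e ⟧ u i j) (⟦ f ⟧ u i j) (⟦ g ⟧ u i j)) }
       ; identity = (λ e → same (λ u i j → id0 (u i j) (⟦ e ⟧ u i j)))
             , (λ e → same (λ u i j → Eq.trans (ZP.+-comm (⟦ e ⟧ u i j) _) (id0 (u i j) (⟦ e ⟧ u i j)))) }
      ; inverse = (λ e → same (λ u i j → inv (u i j) (⟦ e ⟧ u i j)))
           , (λ e → same (λ u i j → Eq.trans (ZP.+-comm (⟦ e ⟧ u i j) _) (inv (u i j) (⟦ e ⟧ u i j))))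
      ; ⁻¹-cong = λ h → same (λ u i j → cong (-1ℤ Z.*_) (act≐ h u i j)) }
     ; comm = λ e f → same (λ u i j → ZP.+-comm (⟦ e ⟧ u i j) (⟦ f ⟧ u i j)) }
    ; *-cong = λ {e} {e'} {f} {f'} h k → same (λ u i j → Eq.trans (act-ext e (act≐ k u) i j) (act≐ h (⟦ f' ⟧ u) i j))
    ; *-assoc = λ e f g → same (λ u i j → Eq.refl)
    ; *-identity = (λ e → same (λ u i j → ZP.*-identityˡ _)) , (λ e → same (λ u i j → Eq.trans (act-* e 1ℤ u i j) (ZP.*-identityˡ _)))
    ; distrib = (λ e f g → same (λ u i j → act-+ e (⟦ f ⟧ u) (⟦ g ⟧ u) i j)) , (λ e f g → same (λ u i j → Eq.refl)) }
   ; *-comm = λ e f → same (act-comm e f) } }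
 ; ι = con
 ; ι-+ = λ m n → same (λ u i j → ZP.*-distribʳ-+ (u i j) m n)
 ; ι-* = λ m n → same (λ u i j → ZP.*-assoc m n (u i j))
 ; ι-1 = same (λ _ _ _ → Eq.refl)
 }
 where
 id0 : ∀ a b → 0ℤ Z.* a Z.+ b ≡ b
 id0 = solveZ
 inv : ∀ a b → -1ℤ Z.* b Z.+ b ≡ 0ℤ Z.* a
 inv = solveZ

-- Integer polynomials as coefficient lists

module PolyEval (R : ZRing) where
 open RingOps R

 ev : List ℤ → Carrier → Carrier
 ev [] x = 0#
 ev (c ∷ cs) x = ι c + x * ev cs x

 ev-cong : ∀ cs {x y} → x ≈ y → ev cs x ≈ ev cs y
 ev-cong [] h = refl
 ev-cong (c ∷ cs) h = +-congˡ (*-cong h (ev-cong cs h))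

 ev-zero : ∀ {cs} → All (_≡ 0ℤ) cs → ∀ x → ev cs x ≈ 0#
 ev-zero [] x = refl
 ev-zero (Eq.refl ∷ zs) x = trans (+-cong ι-0 (trans (*-congˡ (ev-zero zs x)) (zeroʳ x))) (+-identityˡ 0#)

addP : List ℤ → List ℤ → List ℤ
addP [] bs = bs
addP as [] = as
addP (a ∷ as) (b ∷ bs) = (a Z.+ b) ∷ addP as bs

scaleP : ℤ → List ℤ → List ℤ
scaleP c = map (c Z.*_)

mulP : List ℤ → List ℤ → List ℤ
mulP [] bs = []
mulP (a ∷ as) bs = addP (scaleP a bs) (0ℤ ∷ mulP as bs)

module PolyHom (R : ZRing) where
 open RingOps R
 open PolyEval R public
 open ≈R

 ev-addP : ∀ as bs x → ev (addP as bs) x ≈ ev as x + ev bs x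
 ev-addP [] bs x = sym (+-identityˡ _)
 ev-addP (a ∷ as) [] x = sym (+-identityʳ _)
 ev-addP (a ∷ as) (b ∷ bs) x = begin
  ι (a Z.+ b) + x * ev (addP as bs) x ≈⟨ +-cong (ι-+ a b) (*-congˡ (ev-addP as bs x)) ⟩
  ι a + ι b + x * (ev as x + ev bs x) ≈⟨ solve 5 (λ a b x p q → a :+ b :+ x :* (p :+ q) := a :+ x :* p :+ (b :+ x :* q)) refl (ι a) (ι b) x (ev as x) (ev bs x) ⟩
  (ι a + x * ev as x) + (ι b + x * ev bs x) ∎

 ev-scaleP : ∀ c bs x → ev (scaleP c bs) x ≈ ι c * ev bs x
 ev-scaleP c [] x = sym (zeroʳ _)
 ev-scaleP c (b ∷ bs) x = begin
  ι (c Z.* b) + x * ev (scaleP c bs) x ≈⟨ +-cong (ι-* c b) (*-congˡ (ev-scaleP c bs x)) ⟩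
  ι c * ι b + x * (ι c * ev bs x) ≈⟨ solve 4 (λ c b x q → c :* b :+ x :* (c :* q) := c :* (b :+ x :* q)) refl (ι c) (ι b) x (ev bs x) ⟩
  ι c * (ι b + x * ev bs x) ∎

 ev-mulP : ∀ as bs x → ev (mulP as bs) x ≈ ev as x * ev bs x
 ev-mulP [] bs x = sym (zeroˡ _)
 ev-mulP (a ∷ as) bs x = begin
  ev (addP (scaleP a bs) (0ℤ ∷ mulP as bs)) x ≈⟨ ev-addP (scaleP a bs) (0ℤ ∷ mulP as bs) x ⟩
  ev (scaleP a bs) x + (ι 0ℤ + x * ev (mulP as bs) x) ≈⟨ +-cong (ev-scaleP a bs x) (+-congˡ (*-congˡ (ev-mulP as bs x))) ⟩
  ι a * ev bs x + (ι 0ℤ + x * (ev as x * ev bs x)) ≈⟨ solve 4 (λ a b x p → a :* b :+ (con 0ℤ :+ x :* (p :* b)) := (a :+ x :* p) :* b) refl (ι a) (ev bs x) x (ev as x) ⟩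
  (ι a + x * ev as x) * ev bs x ∎

open PolyEval ℤ-ring public using () renaming (ev to evZ)

-- At t = |c| + 1 the constant term c is a multiple of |c| + 1, hence zero. The remaining value is t
-- times that of the tail, and t can be cancelled.
polynomial-identity : ∀ cs → (∀ t → evZ cs (+ suc t) ≡ 0ℤ) → All (_≡ 0ℤ) cs
polynomial-identity [] h = []
polynomial-identity (c ∷ cs) h = c≡0 ∷ polynomial-identity cs λ t →
 let e : + suc t Z.* evZ cs (+ suc t) ≡ 0ℤ
     e = Eq.trans (Eq.sym (ZP.+-identityˡ _)) (Eq.trans (cong (Z._+ (+ suc t Z.* evZ cs (+ suc t))) (Eq.sym c≡0)) (h t))
 in nz t (ZP.i*j≡0⇒i≡0∨j≡0 (+ suc t) e)
 where
 nz : ∀ t {z} → (+ suc t ≡ 0ℤ) ⊎ (z ≡ 0ℤ) → z ≡ 0ℤ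
 nz t (inj₂ e) = e
 T = ∣ c ∣
 q = evZ cs (+ suc T)
 c≡ : c ≡ Z.- (+ suc T Z.* q)
 c≡ = Eq.trans (Eq.sym (lemma c (+ suc T Z.* q))) (Eq.trans (cong (Z._- (+ suc T Z.* q)) (h T)) (ZP.+-identityˡ _))
  where
  lemma : ∀ a b → (a Z.+ b) Z.- b ≡ a
  lemma = solveZ
 T≡ : T ≡ suc T N.* ∣ q ∣
 T≡ = Eq.trans (cong ∣_∣ c≡) (Eq.trans (ZP.∣-i∣≡∣i∣ (+ suc T Z.* q)) (ZP.abs-* (+ suc T) q))
 small : ∀ T k → T ≡ suc T N.* k → T ≡ 0
 small T zero e = Eq.trans e (NP.*-zeroʳ T)
 small T (suc k) e = ⊥-elim (<⇒≱ (n<1+n T) (≤-trans (m≤m*n (suc T) (suc k)) (≤-reflexive (Eq.sym e))))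
 c≡0 : c ≡ 0ℤ
 c≡0 = ZP.∣i∣≡0⇒i≡0 (small T ∣ q ∣ T≡)

-- Identities between integer polynomials, Bézout's for instance, may thus be verified pointwise
-- over ℤ and used in every ring.
ev-transfer : ∀ (R : ZRing) cs x → (∀ t → evZ cs (+ suc t) ≡ 0ℤ) → ZRing._≈_ R (PolyEval.ev R cs x) (ZRing.0# R)
ev-transfer R cs x h = PolyEval.ev-zero R (polynomial-identity cs h) x

-- Lattice boxes and rings of finite rank over ℤ

∣i∣≥1 : ∀ {z} → z ≢ 0ℤ → 1 ≤ ∣ z ∣
∣i∣≥1 h = NP.n≢0⇒n>0 (λ e → h (ZP.∣i∣≡0⇒i≡0 e))

≢0-* : ∀ {a b} → a ≢ 0ℤ → b ≢ 0ℤ → a Z.* b ≢ 0ℤ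
≢0-* {a} a≢0 b≢0 h = [ a≢0 , b≢0 ]′ (ZP.i*j≡0⇒i≡0∨j≡0 a h)

‖_‖ : ∀ {m} → Vec ℤ m → ℕ
‖ [] ‖ = 0
‖ z ∷ v ‖ = ∣ z ∣ ⊔ ‖ v ‖

_+v_ : ∀ {m} → Vec ℤ m → Vec ℤ m → Vec ℤ m
_+v_ = zipWith Z._+_

_·v_ : ∀ {m} → ℤ → Vec ℤ m → Vec ℤ m
c ·v v = V.map (c Z.*_) v

0v : ∀ {m} → Vec ℤ m
0v = V.replicate _ 0ℤ

_-v_ : ∀ {m} → Vec ℤ m → Vec ℤ m → Vec ℤ m
u -v v = u +v (-1ℤ ·v v)

‖+‖ : ∀ {m} (u v : Vec ℤ m) → ‖ u +v v ‖ ≤ ‖ u ‖ N.+ ‖ v ‖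
‖+‖ [] [] = z≤n
‖+‖ (a ∷ u) (b ∷ v) = ⊔-lub
 (≤-trans (ZP.∣i+j∣≤∣i∣+∣j∣ a b) (+-mono-≤ (m≤m⊔n ∣ a ∣ ‖ u ‖) (m≤m⊔n ∣ b ∣ ‖ v ‖)))
 (≤-trans (‖+‖ u v) (+-mono-≤ (m≤n⊔m ∣ a ∣ ‖ u ‖) (m≤n⊔m ∣ b ∣ ‖ v ‖)))

‖·‖ : ∀ {m} c (v : Vec ℤ m) → ‖ c ·v v ‖ ≤ ∣ c ∣ N.* ‖ v ‖
‖·‖ c [] = z≤n
‖·‖ c (b ∷ v) = ⊔-lub
 (≤-trans (≤-reflexive (ZP.abs-* c b)) (*-monoʳ-≤ ∣ c ∣ (m≤m⊔n ∣ b ∣ ‖ v ‖)))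
 (≤-trans (‖·‖ c v) (*-monoʳ-≤ ∣ c ∣ (m≤n⊔m ∣ b ∣ ‖ v ‖)))

‖0‖ : ∀ m → ‖ 0v {m} ‖ ≡ 0
‖0‖ zero = Eq.refl
‖0‖ (suc m) = ‖0‖ m

‖‖-0 : ∀ {m} (v : Vec ℤ m) → ‖ v ‖ ≡ 0 → v ≡ 0v
‖‖-0 [] e = Eq.refl
‖‖-0 (z ∷ v) e = cong₂ _∷_ (ZP.∣i∣≡0⇒i≡0 (NP.n≤0⇒n≡0 (≤-trans (m≤m⊔n ∣ z ∣ ‖ v ‖) (≤-reflexive e))))
 (‖‖-0 v (NP.n≤0⇒n≡0 (≤-trans (m≤n⊔m ∣ z ∣ ‖ v ‖) (≤-reflexive e))))

-v-0 : ∀ {m} (u v : Vec ℤ m) → u -v v ≡ 0v → u ≡ v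
-v-0 [] [] e = Eq.refl
-v-0 (a ∷ u) (b ∷ v) e = cong₂ _∷_ (Eq.trans (lemma a b) (Eq.trans (cong (Z._+ b) (cong V.head e)) (ZP.+-identityˡ b))) (-v-0 u v (cong V.tail e))
 where
 lemma : ∀ a b → a ≡ (a Z.+ -1ℤ Z.* b) Z.+ b
 lemma = solveZ

ints : ℕ → List ℤ
ints Z = map (λ i → + i Z.- + Z) (upTo (suc (2 N.* Z)))

length-ints : ∀ Z → length (ints Z) ≡ suc (2 N.* Z)
length-ints Z = Eq.trans (length-map _ (upTo (suc (2 N.* Z)))) (length-upTo (suc (2 N.* Z)))

∈-ints : ∀ {Z z} → ∣ z ∣ ≤ Z → z ∈ ints Z
∈-ints {Z} {z} h = subst (_∈ ints Z) e (∈-map⁺ (λ i → + i Z.- + Z) (∈-upTo⁺ (s≤s lt)))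
 where
 k = ∣ z Z.+ + Z ∣
 lt : k ≤ 2 N.* Z
 lt = ≤-trans (ZP.∣i+j∣≤∣i∣+∣j∣ z (+ Z)) (≤-trans (+-monoˡ-≤ Z h) (≤-reflexive (cong (Z N.+_) (Eq.sym (NP.+-identityʳ Z)))))
 nonneg : ∀ z → ∣ z ∣ ≤ Z → 0ℤ Z.≤ z Z.+ + Z
 nonneg (+ n) _ = Z.+≤+ z≤n
 nonneg -[1+ n ] h = subst (0ℤ Z.≤_) (Eq.sym (ZP.⊖-≥ h)) (Z.+≤+ z≤n)
 e : + k Z.- + Z ≡ z
 e = Eq.trans (cong (Z._- + Z) (ZP.0≤i⇒+∣i∣≡i (nonneg z h))) (lemma z (+ Z))
  where
  lemma : ∀ a b → (a Z.+ b) Z.- b ≡ a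
  lemma = solveZ

∈-box : ∀ {m Z} (v : Vec ℤ m) → ‖ v ‖ ≤ Z → v ∈ vecs (ints Z) m
∈-box v h = ∈-vecs⁺ (go v h)
 where
 go : ∀ {m Z} (v : Vec ℤ m) → ‖ v ‖ ≤ Z → VAll.All (_∈ ints Z) v
 go [] h = VAll.[]
 go (z ∷ v) h = ∈-ints (≤-trans (m≤m⊔n ∣ z ∣ ‖ v ‖) h) VAll.∷ go v (≤-trans (m≤n⊔m ∣ z ∣ ‖ v ‖) h)

inj-box-count : ∀ {A : Set} (L : List A) m Z (f : A → Vec ℤ m) → Unique L → (∀ {x y} → x ∈ L → y ∈ L → f x ≡ f y → x ≡ y) →
 (∀ {x} → x ∈ L → ‖ f x ‖ ≤ Z) → length L ≤ suc (2 N.* Z) ^ m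
inj-box-count L m Z f u inj bd = ≤-trans (inj-count L (vecs (ints Z) m) f (≡-dec Z._≟_) u inj (λ {x} m∈ → ∈-box (f x) (bd m∈)))
 (≤-reflexive (Eq.trans (length-vecs (ints Z) m) (cong (_^ m) (length-ints Z))))

toZv : ∀ {m} → Vec ℕ m → Vec ℤ m
toZv = V.map (+_)

toZv-inj : ∀ {m} (u v : Vec ℕ m) → toZv u ≡ toZv v → u ≡ v
toZv-inj [] [] e = Eq.refl
toZv-inj (a ∷ u) (b ∷ v) e = cong₂ _∷_ (ZP.+-injective (cong V.head e)) (toZv-inj u v (cong V.tail e))

‖toZv‖ : ∀ {m L} (v : Vec ℕ m) → v ∈ vecs (upTo L) m → ‖ toZv v ‖ ≤ L
‖toZv‖ {m} {L} v h = go v (∈-vecs⁻ m h)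
 where
 go : ∀ {m} (v : Vec ℕ m) → VAll.All (_∈ upTo L) v → ‖ toZv v ‖ ≤ L
 go [] VAll.[] = z≤n
 go (a ∷ v) (p VAll.∷ ps) = ⊔-lub (<⇒≤ (∈-upTo⁻ p)) (go v ps)

length-box : ∀ L m → length (vecs (upTo L) m) ≡ L ^ m
length-box L m = Eq.trans (length-vecs (upTo L) m) (cong (_^ m) (length-upTo L))

box-Unique : ∀ L m → Unique (vecs (upTo L) m)
box-Unique L m = vecs-Unique m (Uniq.upTo⁺ L)

-- A pigeonhole count with the side L = 2W + 1 chosen so that 2(W + C s L) + 1 = (2 C s + 1) L; the
-- factor L ^ m then cancels exactly and the offset W disappears from the result.
cart-box-count : ∀ {Idx : Set} (is : List Idx) m W C s (code : Idx × Vec ℕ m → Vec ℤ m) → Unique is →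
 (∀ {x y} → x ∈ cartesianProduct is (vecs (upTo (suc (2 N.* W))) m) → y ∈ cartesianProduct is (vecs (upTo (suc (2 N.* W))) m) → code x ≡ code y → x ≡ y) →
 (∀ {x} → x ∈ cartesianProduct is (vecs (upTo (suc (2 N.* W))) m) → ‖ code x ‖ ≤ W N.+ C N.* (s N.* suc (2 N.* W))) →
 length is ≤ suc (2 N.* (C N.* s)) ^ m
cart-box-count is m W C s code u code-inj code-bd = *-cancelʳ-≤' (L ^ m) (pow≥1 m (s≤s z≤n)) (begin
 length is N.* L ^ m ≡⟨ cong (length is N.*_) (Eq.sym (length-box L m)) ⟩
 length is N.* length box ≡⟨ Eq.sym (length-cart _,_ is box) ⟩
 length (cartesianProduct is box) ≤⟨ inj-box-count (cartesianProduct is box) m (W N.+ C N.* (s N.* L)) code (Uniq.cartesianProduct⁺ u (box-Unique L m)) code-inj code-bd ⟩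
 suc (2 N.* (W N.+ C N.* (s N.* L))) ^ m ≡⟨ cong (_^ m) (lemma W C s) ⟩
 (suc (2 N.* (C N.* s)) N.* L) ^ m ≡⟨ ^-*-distrib m (suc (2 N.* (C N.* s))) L ⟩
 suc (2 N.* (C N.* s)) ^ m N.* L ^ m ∎)
 where
 open ≤-Reasoning
 L = suc (2 N.* W)
 box = vecs (upTo L) m
 lemma : ∀ w k s → suc (2 N.* (w N.+ k N.* (s N.* suc (2 N.* w)))) ≡ suc (2 N.* (k N.* s)) N.* suc (2 N.* w)
 lemma = solve-∀

module Linear (R : ZRing) where
 open RingOps R
 open ≈R

 lin : ∀ {m} → Vec ℤ m → Vec Carrier m → Carrier
 lin [] [] = 0#
 lin (c ∷ cs) (x ∷ xs) = ι c * x + lin cs xs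

 lin-+ : ∀ {m} (u v : Vec ℤ m) xs → lin (u +v v) xs ≈ lin u xs + lin v xs
 lin-+ [] [] [] = sym (+-identityˡ 0#)
 lin-+ (a ∷ u) (b ∷ v) (x ∷ xs) = begin
  ι (a Z.+ b) * x + lin (u +v v) xs ≈⟨ +-cong (*-congʳ (ι-+ a b)) (lin-+ u v xs) ⟩
  (ι a + ι b) * x + (lin u xs + lin v xs) ≈⟨ solve 5 (λ a b x p q → (a :+ b) :* x :+ (p :+ q) := (a :* x :+ p) :+ (b :* x :+ q)) refl (ι a) (ι b) x (lin u xs) (lin v xs) ⟩
  (ι a * x + lin u xs) + (ι b * x + lin v xs) ∎

 lin-· : ∀ {m} c (v : Vec ℤ m) xs → lin (c ·v v) xs ≈ ι c * lin v xs
 lin-· c [] [] = sym (zeroʳ (ι c))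
 lin-· c (b ∷ v) (x ∷ xs) = begin
  ι (c Z.* b) * x + lin (c ·v v) xs ≈⟨ +-cong (*-congʳ (ι-* c b)) (lin-· c v xs) ⟩
  ι c * ι b * x + ι c * lin v xs ≈⟨ solve 4 (λ c b x q → c :* b :* x :+ c :* q := c :* (b :* x :+ q)) refl (ι c) (ι b) x (lin v xs) ⟩
  ι c * (ι b * x + lin v xs) ∎

 lin-0 : ∀ {m} (xs : Vec Carrier m) → lin 0v xs ≈ 0#
 lin-0 [] = refl
 lin-0 (x ∷ xs) = trans (+-cong (trans (*-congʳ ι-0) (zeroˡ x)) (lin-0 xs)) (+-identityˡ 0#)

 lin-- : ∀ {m} (u v : Vec ℤ m) xs → lin (u -v v) xs ≈ lin u xs - lin v xs
 lin-- u v xs = begin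
  lin (u -v v) xs ≈⟨ lin-+ u (-1ℤ ·v v) xs ⟩
  lin u xs + lin (-1ℤ ·v v) xs ≈⟨ +-congˡ (lin-· -1ℤ v xs) ⟩
  lin u xs + ι -1ℤ * lin v xs ≈⟨ solve 2 (λ p q → p :+ con -1ℤ :* q := p :- q) refl (lin u xs) (lin v xs) ⟩
  lin u xs - lin v xs ∎

-- A domain of finite rank over ℤ: up to a common denominator Δ it is the lattice spanned by 1 and e.
record NumberRing : Set1 where
 field
  R : ZRing
 open RingOps R public
 open Linear R public
 field
  M' : ℕ
  e : Vec Carrier M'
  Δ : ℕ
  Δ≥1 : 1 ≤ Δ
 M : ℕ
 M = suc M'
 vec : Vec ℤ M → Carrier
 vec c = lin c (1# ∷ e)
 field
  span : ∀ a → Σ (Vec ℤ M) λ c → ι (+ Δ) * a ≈ vec c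
  indep : ∀ c → vec c ≈ 0# → c ≡ 0v
  torsion : ∀ n a → n ≢ 0ℤ → ι n * a ≈ 0# → a ≈ 0#
  -- Every nonzero element divides a nonzero integer, so that inverting the integers yields a field.
  inv : ∀ a → ¬ (a ≈ 0#) → ¬ ¬ (Σ ℤ λ m → m ≢ 0ℤ × Σ Carrier λ y → a * y ≈ ι m)

module NumberRingProps (𝓡 : NumberRing) where
 open NumberRing 𝓡 public

 δ : Carrier
 δ = ι (+ Δ)

 Δ≢0 : + Δ ≢ 0ℤ
 Δ≢0 h = <⇒≱ Δ≥1 (≤-reflexive (ZP.+-injective h))

 domain : ∀ {a b} → a * b ≈ 0# → ¬ (a ≈ 0#) → ¬ ¬ (b ≈ 0#)
 domain {a} {b} ab a≉0 k = inv a a≉0 λ { (m , m≢0 , y , ay) → k (torsion m b m≢0 (begin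
  ι m * b ≈⟨ *-congʳ ay ⟨
  a * y * b ≈⟨ solve 3 (λ a y b → a :* y :* b := y :* (a :* b)) refl a y b ⟩
  y * (a * b) ≈⟨ *-congˡ ab ⟩
  y * 0# ≈⟨ zeroʳ y ⟩
  0# ∎)) }
  where open ≈R

 vec≉0 : ∀ {c} → c ≢ 0v → ¬ (vec c ≈ 0#)
 vec≉0 c≢0 h = c≢0 (indep _ h)

 vec-inj : ∀ {c d} → vec c ≈ vec d → c ≡ d
 vec-inj {c} {d} h = -v-0 c d (indep _ (trans (lin-- c d (1# ∷ e)) (x≈y⇒x-y≈0 h)))

 Bdd : Carrier → ℕ → Set
 Bdd x t = Σ (Vec ℤ M) λ c → x ≈ vec c × ‖ c ‖ ≤ t

 private
  Bdd-+ : ∀ {x y s t} → Bdd x s → Bdd y t → Bdd (x + y) (s N.+ t)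
  Bdd-+ (c , ec , hc) (d , ed , hd) = c +v d , trans (+-cong ec ed) (sym (lin-+ c d _)) , ≤-trans (‖+‖ c d) (+-mono-≤ hc hd)

  Bdd-· : ∀ {x t} n → Bdd x t → Bdd (ι n * x) (∣ n ∣ N.* t)
  Bdd-· n (c , ec , hc) = n ·v c , trans (*-congˡ ec) (sym (lin-· n c _)) , ≤-trans (‖·‖ n c) (*-monoʳ-≤ ∣ n ∣ hc)

  Bdd-mono : ∀ {x s t} → s ≤ t → Bdd x s → Bdd x t
  Bdd-mono h (c , ec , hc) = c , ec , ≤-trans hc h

  Bdd-≈ : ∀ {x y t} → x ≈ y → Bdd y t → Bdd x t
  Bdd-≈ h (c , ec , hc) = c , trans h ec , hc

  lin-bound : ∀ {m} z (xs : Vec Carrier m) K → VAll.All (λ x → Bdd (z * x) K) xs → ∀ c → Bdd (z * lin c xs) (m N.* (‖ c ‖ N.* K))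
  lin-bound z [] K VAll.[] [] = 0v , trans (zeroʳ z) (sym (lin-0 (1# ∷ e))) , ≤-reflexive (‖0‖ M)
  lin-bound {suc m} z (x ∷ xs) K (b VAll.∷ bs) (c ∷ cs) = Bdd-≈
   (solve 4 (λ z c x l → z :* (c :* x :+ l) := c :* (z :* x) :+ z :* l) refl z (ι c) x (lin cs xs))
   (Bdd-mono (+-mono-≤ (*-monoˡ-≤ K (m≤m⊔n ∣ c ∣ ‖ cs ‖)) (*-monoʳ-≤ m (*-monoˡ-≤ K (m≤n⊔m ∣ c ∣ ‖ cs ‖))))
    (Bdd-+ (Bdd-· c b) (lin-bound z xs K bs cs)))

  uniform : ∀ {m} {A : Set} (P : A → ℕ → Set) → (∀ {x s t} → s ≤ t → P x s → P x t) → (∀ x → Σ ℕ (P x)) →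
   (xs : Vec A m) → Σ ℕ λ K → VAll.All (λ x → P x K) xs
  uniform P mono h [] = 0 , VAll.[]
  uniform P mono h (x ∷ xs) with h x | uniform P mono h xs
  ... | K , p | L , ps = K ⊔ L , mono (m≤m⊔n K L) p VAll.∷ VAll.map (mono (m≤n⊔m K L)) ps

 basis : Vec Carrier M
 basis = 1# ∷ e

 private
  structure : Σ ℕ λ K → VAll.All (λ x → VAll.All (λ y → Bdd (δ * x * y) K) basis) basis
  structure = uniform (λ x K → VAll.All (λ y → Bdd (δ * x * y) K) basis) (λ h → VAll.map (Bdd-mono h))
   (λ x → uniform (λ y K → Bdd (δ * x * y) K) Bdd-mono
    (λ y → let (c , ec) = span (x * y) in ‖ c ‖ , c , trans (*-assoc δ x y) ec , ≤-refl) basis) basis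

 abstract
  -- Assembled from the structure constants of the basis: the coordinates of Δ a b are at most C
  -- times the norms of a and b. The factor Δ compensates for the basis spanning only up to Δ.
  C : ℕ
  C = M N.* M N.* fst structure

  mult : ∀ a b → Bdd (δ * (vec a * vec b)) (C N.* (‖ a ‖ N.* ‖ b ‖))
  mult a b = Bdd-≈ (solve 3 (λ d a b → d :* (a :* b) := d :* b :* a) refl δ (vec a) (vec b))
   (Bdd-mono (≤-reflexive (lemma M (fst structure) ‖ a ‖ ‖ b ‖))
    (lin-bound (δ * vec b) basis (M N.* (‖ b ‖ N.* fst structure)) rows a))
   where
   lemma : ∀ m k a b → m N.* (a N.* (m N.* (b N.* k))) ≡ m N.* m N.* k N.* (a N.* b)
   lemma = solve-∀
   rows : VAll.All (λ x → Bdd (δ * vec b * x) (M N.* (‖ b ‖ N.* fst structure))) basis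
   rows = VAll.map (λ {x} r → Bdd-≈ (solve 3 (λ d b x → d :* b :* x := d :* x :* b) refl δ (vec b) x)
    (lin-bound (δ * x) basis (fst structure) r b)) (snd structure)

 -- The elements Δ(ab + f i), with b in a large box, are pairwise distinct and lie in a slightly larger box.
 liouville : ∀ α s → ‖ α ‖ ≤ s → α ≢ 0v → (J : Carrier → Set) → (∀ {x y} → x ≈ y → J x → J y) → (∀ x → J (δ * (vec α * x))) →
  ∀ {Idx : Set} (is : List Idx) → Unique is → (f : Idx → Carrier) →
  (∀ {i i'} → i ∈ is → i' ∈ is → J (δ * (f i - f i')) → i ≡ i') → length is ≤ suc (2 N.* (C N.* s)) ^ M
 liouville α s αs α≢0 J J-resp Jα {Idx} is u f sep = cart-box-count is M W C s code u code-inj code-bd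
  where
  c : Idx → Vec ℤ M
  c i = fst (span (f i))
  W = ∑ is (λ i → ‖ c i ‖)
  L = suc (2 N.* W)
  box = vecs (upTo L) M
  pairs = cartesianProduct is box
  d : Vec ℕ M → Vec ℤ M
  d b = fst (mult α (toZv b))
  code : Idx × Vec ℕ M → Vec ℤ M
  code (i , b) = c i +v d b
  code-bd : ∀ {x} → x ∈ pairs → ‖ code x ‖ ≤ W N.+ C N.* (s N.* L)
  code-bd {i , b} m with ∈-cartesianProduct⁻ is box m
  ... | i∈ , b∈ = ≤-trans (‖+‖ (c i) (d b)) (+-mono-≤ (∑-∈ is i∈)
     (≤-trans (snd (snd (mult α (toZv b)))) (*-monoʳ-≤ C (*-mono-≤ αs (‖toZv‖ b b∈)))))
  vec-code : ∀ i b → vec (code (i , b)) ≈ δ * f i + δ * (vec α * vec (toZv b))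
  vec-code i b = trans (lin-+ (c i) (d b) basis) (+-cong (sym (snd (span (f i)))) (sym (fst (snd (mult α (toZv b))))))
  code-inj : ∀ {x y} → x ∈ pairs → y ∈ pairs → code x ≡ code y → x ≡ y
  code-inj {i , b} {i' , b'} mx my eq with ∈-cartesianProduct⁻ is box mx | ∈-cartesianProduct⁻ is box my
  ... | i∈ , b∈ | i'∈ , b'∈ = cong₂ _,_ i≡ b≡
   where
   B = vec (toZv b)
   B' = vec (toZv b')
   E : δ * f i + δ * (vec α * B) ≈ δ * f i' + δ * (vec α * B')
   E = trans (sym (vec-code i b)) (trans (reflexive (cong vec eq)) (vec-code i' b'))
   step : δ * (vec α * (B' - B)) ≈ δ * (f i - f i')
   step = begin
    δ * (vec α * (B' - B))
     ≈⟨ solve 5 (λ d a b b' x → d :* (a :* (b' :- b)) := (d :* x :+ d :* (a :* b')) :- (d :* x :+ d :* (a :* b))) refl δ (vec α) B B' (f i') ⟩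
    (δ * f i' + δ * (vec α * B')) - (δ * f i' + δ * (vec α * B)) ≈⟨ +-congʳ E ⟨
    (δ * f i + δ * (vec α * B)) - (δ * f i' + δ * (vec α * B))
     ≈⟨ solve 5 (λ d a b x y → (d :* x :+ d :* (a :* b)) :- (d :* y :+ d :* (a :* b)) := d :* (x :- y)) refl δ (vec α) B (f i) (f i') ⟩
    δ * (f i - f i') ∎
    where open ≈R
   i≡ : i ≡ i'
   i≡ = sep i∈ i'∈ (J-resp step (Jα (B' - B)))
   zero' : δ * (vec α * (B' - B)) ≈ 0#
   zero' = trans step (trans (*-congˡ (x≈y⇒x-y≈0 (reflexive (cong f i≡)))) (zeroʳ δ))
   b≡ : b ≡ b'
   b≡ with ≡-dec N._≟_ b b'
   ... | yes p = p
   ... | no ¬p = ⊥-elim (domain (torsion (+ Δ) _ Δ≢0 zero') (vec≉0 α≢0)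
       (λ h → ¬p (Eq.sym (toZv-inj b' b (vec-inj (x-y≈0⇒x≈y h))))))

-- Pseudo-division, Bézout relations and linear recurrences

data SnocView {m : ℕ} : Vec ℤ (suc m) → Set where
 _∷ʳ'_ : (v : Vec ℤ m) (z : ℤ) → SnocView (v ∷ʳ z)

snocView : ∀ {m} (v : Vec ℤ (suc m)) → SnocView v
snocView {zero} (z ∷ []) = [] ∷ʳ' z
snocView {suc m} (x ∷ v) with snocView v
... | w ∷ʳ' z = (x ∷ w) ∷ʳ' z

module VecEval (R : ZRing) where
 open RingOps R
 open PolyHom R public

 evv : ∀ {m} → Vec ℤ m → Carrier → Carrier
 evv v x = ev (toList v) x

 pw : Carrier → ℕ → Carrier
 pw x zero = 1#
 pw x (suc k) = x * pw x k

 evv-∷ʳ : ∀ {m} (v : Vec ℤ m) c x → evv (v ∷ʳ c) x ≈ evv v x + ι c * pw x m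
 evv-∷ʳ [] c x = trans (+-congˡ (zeroʳ x)) (trans (+-comm _ _) (+-congˡ (sym (*-identityʳ (ι c)))))
 evv-∷ʳ {suc m} (a ∷ v) c x = begin
  ι a + x * evv (v ∷ʳ c) x ≈⟨ +-congˡ (*-congˡ (evv-∷ʳ v c x)) ⟩
  ι a + x * (evv v x + ι c * pw x m) ≈⟨ solve 5 (λ a x p c q → a :+ x :* (p :+ c :* q) := a :+ x :* p :+ c :* (x :* q)) refl (ι a) x (evv v x) (ι c) (pw x m) ⟩
  (ι a + x * evv v x) + ι c * (x * pw x m) ∎
  where open ≈R

 evv-+ : ∀ {m} (u v : Vec ℤ m) x → evv (u +v v) x ≈ evv u x + evv v x
 evv-+ [] [] x = sym (+-identityˡ 0#)
 evv-+ (a ∷ u) (b ∷ v) x = begin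
  ι (a Z.+ b) + x * evv (u +v v) x ≈⟨ +-cong (ι-+ a b) (*-congˡ (evv-+ u v x)) ⟩
  ι a + ι b + x * (evv u x + evv v x) ≈⟨ solve 5 (λ a b x p q → a :+ b :+ x :* (p :+ q) := a :+ x :* p :+ (b :+ x :* q)) refl (ι a) (ι b) x (evv u x) (evv v x) ⟩
  (ι a + x * evv u x) + (ι b + x * evv v x) ∎
  where open ≈R

 evv-· : ∀ {m} c (v : Vec ℤ m) x → evv (c ·v v) x ≈ ι c * evv v x
 evv-· c [] x = sym (zeroʳ (ι c))
 evv-· c (b ∷ v) x = begin
  ι (c Z.* b) + x * evv (c ·v v) x ≈⟨ +-cong (ι-* c b) (*-congˡ (evv-· c v x)) ⟩
  ι c * ι b + x * (ι c * evv v x) ≈⟨ solve 4 (λ c b x q → c :* b :+ x :* (c :* q) := c :* (b :+ x :* q)) refl (ι c) (ι b) x (evv v x) ⟩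
  ι c * (ι b + x * evv v x) ∎
  where open ≈R

 evv-0 : ∀ m x → evv (0v {m}) x ≈ 0#
 evv-0 zero x = refl
 evv-0 (suc m) x = trans (+-cong ι-0 (trans (*-congˡ (evv-0 m x)) (zeroʳ x))) (+-identityˡ 0#)

open VecEval ℤ-ring public using () renaming (evv to eval; pw to pwZ; ev-addP to evZ-addP; ev-mulP to evZ-mulP; ev-scaleP to evZ-scaleP; evv-∷ʳ to eval-∷ʳ; evv-+ to eval-+; evv-· to eval-·; evv-0 to eval-0)

pwZ≢0 : ∀ {z} k → z ≢ 0ℤ → pwZ z k ≢ 0ℤ
pwZ≢0 zero h ()
pwZ≢0 (suc k) h = ≢0-* h (pwZ≢0 k h)

prime≢0 : ∀ {p} → Prime p → + p ≢ 0ℤ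
prime≢0 pr h = <⇒≱ (prime≥1 pr) (≤-reflexive (ZP.+-injective h))

pseudo-divide : ∀ {k n} (c : Vec ℤ (suc k)) (l : ℤ) (f : Vec ℤ (suc n)) →
 Σ ℕ λ j → Σ (Vec ℤ n) λ h → Σ (Vec ℤ (suc k)) λ r → ∀ t → (l Z.^ j) Z.* eval f t ≡ eval (c ∷ʳ l) t Z.* eval h t Z.+ eval r t
pseudo-divide {k} c l (z ∷ []) = 0 , [] , z ∷ 0v , λ t → Eq.trans (lem1 z t (eval (c ∷ʳ l) t)) (cong (λ y → eval (c ∷ʳ l) t Z.* 0ℤ Z.+ (z Z.+ t Z.* y)) (Eq.sym (eval-0 k t)))
 where
 lem1 : ∀ z t a → 1ℤ Z.* (z Z.+ t Z.* 0ℤ) ≡ a Z.* 0ℤ Z.+ (z Z.+ t Z.* 0ℤ)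
 lem1 = solveZ
pseudo-divide {k} {suc n} c l (f0 ∷ fs) with pseudo-divide c l fs
... | j , h , r , eq with snocView r
... | r0 ∷ʳ' top = suc j , top ∷ (l ·v h) , r' , λ t → begin
  (l Z.* l Z.^ j) Z.* (f0 Z.+ t Z.* eval fs t) ≡⟨ lem2 l (l Z.^ j) f0 t (eval fs t) ⟩
  l Z.* (z Z.+ t Z.* ((l Z.^ j) Z.* eval fs t)) ≡⟨ cong (λ y → l Z.* (z Z.+ t Z.* y)) (Eq.trans (eq t)
                               (cong (λ y → eval (c ∷ʳ l) t Z.* eval h t Z.+ y) (eval-∷ʳ r0 top t))) ⟩
  l Z.* (z Z.+ t Z.* (cl t Z.* eval h t Z.+ (eval r0 t Z.+ top Z.* pwZ t k)))
   ≡⟨ cong (λ y → l Z.* (z Z.+ t Z.* (y Z.* eval h t Z.+ (eval r0 t Z.+ top Z.* pwZ t k)))) (eval-∷ʳ c l t) ⟩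
  l Z.* (z Z.+ t Z.* ((eval c t Z.+ l Z.* (t Z.* pwZ t k)) Z.* eval h t Z.+ (eval r0 t Z.+ top Z.* pwZ t k)))
   ≡⟨ lem3 l z t (eval c t) (pwZ t k) (eval h t) (eval r0 t) top ⟩
  (eval c t Z.+ l Z.* (t Z.* pwZ t k)) Z.* (top Z.+ t Z.* (l Z.* eval h t)) Z.+ (l Z.* (z Z.+ t Z.* eval r0 t) Z.+ (Z.- top) Z.* eval c t)
   ≡⟨ cong₂ Z._+_ (cong₂ Z._*_ (Eq.sym (eval-∷ʳ c l t)) (cong (λ y → top Z.+ t Z.* y) (Eq.sym (eval-· l h t))))
      (Eq.sym (Eq.trans (eval-+ (l ·v (z ∷ r0)) ((Z.- top) ·v c) t) (cong₂ Z._+_ (eval-· l (z ∷ r0) t) (eval-· (Z.- top) c t)))) ⟩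
  cl t Z.* eval (top ∷ (l ·v h)) t Z.+ eval r' t ∎
 where
 open Eq.≡-Reasoning
 z = (l Z.^ j) Z.* f0
 cl = eval (c ∷ʳ l)
 r' = (l ·v (z ∷ r0)) +v ((Z.- top) ·v c)
 lem2 : ∀ l lj f t e → (l Z.* lj) Z.* (f Z.+ t Z.* e) ≡ l Z.* (lj Z.* f Z.+ t Z.* (lj Z.* e))
 lem2 = solveZ
 lem3 : ∀ l z t c p h r top → l Z.* (z Z.+ t Z.* ((c Z.+ l Z.* (t Z.* p)) Z.* h Z.+ (r Z.+ top Z.* p)))
    ≡ (c Z.+ l Z.* (t Z.* p)) Z.* (top Z.+ t Z.* (l Z.* h)) Z.+ (l Z.* (z Z.+ t Z.* r) Z.+ (Z.- top) Z.* c)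
 lem3 = solveZ

pad : ∀ {k N} → k ≤ N → Vec ℤ k → Vec ℤ N
pad {N = N} _ [] = 0v
pad (s≤s h) (c ∷ v) = c ∷ pad h v

pad-ev : ∀ {k N} (h : k ≤ N) (v : Vec ℤ k) t → eval (pad h v) t ≡ eval v t
pad-ev {N = N} z≤n [] t = eval-0 N t
pad-ev (s≤s h) (c ∷ v) t = cong (λ y → c Z.+ t Z.* y) (pad-ev h v t)

-- A multiple c·F of F is a product of two polynomials of degree < N.
ProperFactor : ∀ {N} → Vec ℤ (suc N) → Set
ProperFactor {N} F = Σ ℤ λ c → c ≢ 0ℤ × Σ (Vec ℤ N) λ g → Σ (Vec ℤ N) λ h → ∀ t → c Z.* eval F t ≡ eval g t Z.* eval h t

Bezout : ∀ {N} → Vec ℤ (suc N) → Vec ℤ N → Set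
Bezout F a = Σ (List ℤ) λ y → Σ (List ℤ) λ h → Σ ℤ λ m → m ≢ 0ℤ × (∀ t → eval a t Z.* evZ y t Z.+ eval F t Z.* evZ h t ≡ m)

pow≢0 : ∀ l j → l ≢ 0ℤ → l Z.^ j ≢ 0ℤ
pow≢0 l zero h ()
pow≢0 l (suc j) h e with ZP.i*j≡0⇒i≡0∨j≡0 l e
... | inj₁ z = h z
... | inj₂ z = pow≢0 l j h z

-- Euclid's algorithm by pseudo-division of F, carrying the cofactors y and h along. A zero
-- remainder under a nonconstant divisor exhibits a factor of F; a nonzero constant is the integer m
-- of the relation.
bezout : ∀ {N} (F : Vec ℤ (suc N)) (a : Vec ℤ N) → a ≢ 0v → Bezout F a ⊎ ProperFactor F
bezout {N} F a a≢0 = euclid N N ≤-refl ≤-refl a a≢0 (1ℤ ∷ []) [] (λ t → lem0 (eval a t) (eval F t) t)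
 where
 lem0 : ∀ a F t → a Z.* (1ℤ Z.+ t Z.* 0ℤ) Z.+ F Z.* 0ℤ ≡ a
 lem0 = solveZ
 euclid : ∀ fuel k → k ≤ fuel → k ≤ N → (c : Vec ℤ k) → c ≢ 0v → (y h : List ℤ) → (∀ t → eval a t Z.* evZ y t Z.+ eval F t Z.* evZ h t ≡ eval c t) →
  Bezout F a ⊎ ProperFactor F
 euclid fuel zero _ k≤N [] c≢0 y h eq = ⊥-elim (c≢0 Eq.refl)
 euclid (suc fuel) (suc k) (s≤s lt) k≤N c c≢0 y h eq with snocView c
 euclid (suc fuel) (suc k) (s≤s lt) k≤N .(c0 ∷ʳ l) c≢0 y h eq | c0 ∷ʳ' l with l Z.≟ 0ℤ
 ... | yes Eq.refl = euclid fuel k lt (≤-trans (n≤1+n k) k≤N) c0 (λ e → c≢0 (Eq.trans (cong (_∷ʳ 0ℤ) e) (snoc0 k))) y h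
    (λ t → Eq.trans (eq t) (Eq.trans (eval-∷ʳ c0 0ℤ t) (lem1 (eval c0 t) (pwZ t k))))
  where
  snoc0 : ∀ k → 0v {k} ∷ʳ 0ℤ ≡ 0v
  snoc0 zero = Eq.refl
  snoc0 (suc k) = cong (0ℤ ∷_) (snoc0 k)
  lem1 : ∀ a p → a Z.+ 0ℤ Z.* p ≡ a
  lem1 = solveZ
 euclid (suc fuel) (suc zero) (s≤s lt) k≤N .([] ∷ʳ l) c≢0 y h eq | [] ∷ʳ' l | no l≢0 = inj₁ (y , h , l , l≢0 , λ t → Eq.trans (eq t) (lem1 l t))
  where
  lem1 : ∀ l t → l Z.+ t Z.* 0ℤ ≡ l
  lem1 = solveZ
 euclid (suc fuel) (suc (suc k)) (s≤s lt) k≤N .(c0 ∷ʳ l) c≢0 y h eq | c0 ∷ʳ' l | no l≢0 with pseudo-divide c0 l F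
 ... | j , q , r , div with ≡-dec Z._≟_ r 0v
 ... | yes Eq.refl = inj₂ (l Z.^ j , pow≢0 l j l≢0 , pad k≤N (c0 ∷ʳ l) , q , λ t → Eq.trans (div t)
      (Eq.trans (cong (λ y → eval (c0 ∷ʳ l) t Z.* eval q t Z.+ y) (eval-0 (suc k) t)) (Eq.trans (ZP.+-identityʳ _) (cong (Z._* eval q t) (Eq.sym (pad-ev k≤N (c0 ∷ʳ l) t))))))
 ... | no r≢0 = euclid fuel (suc k) lt (≤-trans (n≤1+n _) k≤N) r r≢0 (scaleP -1ℤ (mulP y (toList q)))
      (addP (l Z.^ j ∷ []) (scaleP -1ℤ (mulP h (toList q)))) comb
  where
  open Eq.≡-Reasoning
  lem2 : ∀ a y F h q lj t → a Z.* (-1ℤ Z.* (y Z.* q)) Z.+ F Z.* ((lj Z.+ t Z.* 0ℤ) Z.+ -1ℤ Z.* (h Z.* q)) ≡ lj Z.* F Z.- (a Z.* y Z.+ F Z.* h) Z.* q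
  lem2 = solveZ
  lem3 : ∀ c q r → (c Z.* q Z.+ r) Z.- c Z.* q ≡ r
  lem3 = solveZ
  comb : ∀ t → eval a t Z.* evZ (scaleP -1ℤ (mulP y (toList q))) t Z.+ eval F t Z.* evZ (addP (l Z.^ j ∷ []) (scaleP -1ℤ (mulP h (toList q)))) t ≡ eval r t
  comb t = begin
   eval a t Z.* evZ (scaleP -1ℤ (mulP y (toList q))) t Z.+ eval F t Z.* evZ (addP (l Z.^ j ∷ []) (scaleP -1ℤ (mulP h (toList q)))) t
    ≡⟨ cong₂ (λ u v → eval a t Z.* u Z.+ eval F t Z.* v)
       (Eq.trans (evZ-scaleP -1ℤ (mulP y (toList q)) t) (cong (-1ℤ Z.*_) (evZ-mulP y (toList q) t)))
       (Eq.trans (evZ-addP (l Z.^ j ∷ []) (scaleP -1ℤ (mulP h (toList q))) t) (cong (Z._+_ (evZ (l Z.^ j ∷ []) t))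
        (Eq.trans (evZ-scaleP -1ℤ (mulP h (toList q)) t) (cong (-1ℤ Z.*_) (evZ-mulP h (toList q) t))))) ⟩
   eval a t Z.* (-1ℤ Z.* (evZ y t Z.* eval q t)) Z.+ eval F t Z.* ((l Z.^ j Z.+ t Z.* 0ℤ) Z.+ -1ℤ Z.* (evZ h t Z.* eval q t))
    ≡⟨ lem2 (eval a t) (evZ y t) (eval F t) (evZ h t) (eval q t) (l Z.^ j) t ⟩
   (l Z.^ j) Z.* eval F t Z.- (eval a t Z.* evZ y t Z.+ eval F t Z.* evZ h t) Z.* eval q t
    ≡⟨ cong₂ (λ u v → u Z.- v Z.* eval q t) (div t) (eq t) ⟩
   (eval (c0 ∷ʳ l) t Z.* eval q t Z.+ eval r t) Z.- eval (c0 ∷ʳ l) t Z.* eval q t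
    ≡⟨ lem3 (eval (c0 ∷ʳ l) t) (eval q t) (eval r t) ⟩
   eval r t ∎

bezout-transfer : ∀ (R : ZRing) {N} (F : Vec ℤ (suc N)) (a : Vec ℤ N) ((y , h , m , _) : Bezout F a) x → let open RingOps R; open VecEval R in
 evv a x * ev y x + evv F x * ev h x ≈ ι m
bezout-transfer R F a (y , h , m , _ , eq) x = x-y≈0⇒x≈y (trans (sym hom) (ev-transfer R L x (λ t → Eq.trans (homℤ (+ suc t)) (Eq.trans (cong (Z._- m) (eq (+ suc t))) (ZP.+-inverseʳ m)))))
 where
 open RingOps R
 open VecEval R
 L = addP (addP (mulP (toList a) y) (mulP (toList F) h)) (Z.- m ∷ [])
 hom : ev L x ≈ evv a x * ev y x + evv F x * ev h x - ι m
 hom = trans (ev-addP (addP (mulP (toList a) y) (mulP (toList F) h)) (Z.- m ∷ []) x)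
  (+-cong (trans (ev-addP (mulP (toList a) y) (mulP (toList F) h) x) (+-cong (ev-mulP (toList a) y x) (ev-mulP (toList F) h x)))
   (trans (+-cong (ι-neg m) (zeroʳ x)) (+-identityʳ _)))
 homℤ : ∀ t → evZ L t ≡ eval a t Z.* evZ y t Z.+ eval F t Z.* evZ h t Z.- m
 homℤ t = Eq.trans (evZ-addP (addP (mulP (toList a) y) (mulP (toList F) h)) (Z.- m ∷ []) t)
  (cong₂ Z._+_ (Eq.trans (evZ-addP (mulP (toList a) y) (mulP (toList F) h) t) (cong₂ Z._+_ (evZ-mulP (toList a) y t) (evZ-mulP (toList F) h t)))
   (lem1 m t))
  where
  lem1 : ∀ m t → Z.- m Z.+ t Z.* 0ℤ ≡ Z.- m
  lem1 = solveZ

-- The sequence with characteristic polynomial g ∷ʳ 1 and initial values 0, …, 0, 1.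
wsum : List ℤ → (ℕ → ℤ) → ℕ → ℤ
wsum [] f k = 0ℤ
wsum (c ∷ cs) f k = c Z.* f k Z.+ wsum cs f (suc k)

at : ∀ {m} → Vec ℤ m → ℕ → ℤ
at [] i = 0ℤ
at (x ∷ s) zero = x
at (x ∷ s) (suc i) = at s i

at-∷ʳ-< : ∀ {m} (s : Vec ℤ m) z {i} → i < m → at (s ∷ʳ z) i ≡ at s i
at-∷ʳ-< (x ∷ s) z {zero} _ = Eq.refl
at-∷ʳ-< (x ∷ s) z {suc i} (s≤s h) = at-∷ʳ-< s z h

at-∷ʳ-last : ∀ {m} (s : Vec ℤ m) z → at (s ∷ʳ z) m ≡ z
at-∷ʳ-last [] z = Eq.refl
at-∷ʳ-last (x ∷ s) z = at-∷ʳ-last s z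

at-0 : ∀ m i → at (0v {m}) i ≡ 0ℤ
at-0 zero i = Eq.refl
at-0 (suc m) zero = Eq.refl
at-0 (suc m) (suc i) = at-0 m i

wsum-cong : ∀ {m} (c : Vec ℤ m) f h k l → (∀ {i} → i < m → f (i N.+ k) ≡ h (i N.+ l)) → wsum (toList c) f k ≡ wsum (toList c) h l
wsum-cong [] f h k l eq = Eq.refl
wsum-cong (c ∷ v) f h k l eq = cong₂ Z._+_ (cong (c Z.*_) (eq (s≤s z≤n)))
 (wsum-cong v f h (suc k) (suc l) (λ {i} lt → Eq.trans (cong f (+-suc i k)) (Eq.trans (eq (s≤s lt)) (cong h (Eq.sym (+-suc i l))))))

wsum-∷ʳ : ∀ {m} (c : Vec ℤ m) z f k → wsum (toList (c ∷ʳ z)) f k ≡ wsum (toList c) f k Z.+ z Z.* f (m N.+ k)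
wsum-∷ʳ [] z f k = Eq.trans (ZP.+-identityʳ (z Z.* f k)) (Eq.sym (ZP.+-identityˡ (z Z.* f k)))
wsum-∷ʳ {suc m} (c ∷ v) z f k = Eq.trans (cong (λ y → c Z.* f k Z.+ y) (Eq.trans (wsum-∷ʳ v z f (suc k)) (cong (λ y → wsum (toList v) f (suc k) Z.+ z Z.* f y) (+-suc m k))))
 (Eq.sym (ZP.+-assoc (c Z.* f k) _ _))

wsum-0 : ∀ cs {m} (c : Vec ℤ m) f k → toList c ≡ cs → (∀ {i} → i < m → f (i N.+ k) ≡ 0ℤ) → wsum cs f k ≡ 0ℤ
wsum-0 _ [] f k Eq.refl h = Eq.refl
wsum-0 _ (c ∷ v) f k Eq.refl h = cong₂ Z._+_ (Eq.trans (cong (c Z.*_) (h (s≤s z≤n))) (ZP.*-zeroʳ c))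
 (wsum-0 (toList v) v f (suc k) Eq.refl (λ {i} lt → Eq.trans (cong f (+-suc i k)) (h (s≤s lt))))

module Recurrence {n : ℕ} (g : Vec ℤ (suc n)) where
 step : Vec ℤ (suc n) → Vec ℤ (suc n)
 step s = V.tail s ∷ʳ (Z.- wsum (toList g) (at s) 0)

 st : ℕ → Vec ℤ (suc n)
 st zero = 0v {n} ∷ʳ 1ℤ
 st (suc k) = step (st k)

 fund : ℕ → ℤ
 fund k = at (st k) 0

 at-tail : ∀ (s : Vec ℤ (suc n)) i → at (V.tail s) i ≡ at s (suc i)
 at-tail (x ∷ s) i = Eq.refl

 at-st : ∀ i k → i ≤ n → at (st k) i ≡ fund (i N.+ k)
 at-st zero k h = Eq.refl
 at-st (suc i) k h = Eq.trans (Eq.sym (at-tail (st k) i)) (Eq.trans (Eq.sym (at-∷ʳ-< (V.tail (st k)) _ h))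
  (Eq.trans (at-st i (suc k) (≤-trans (n≤1+n i) h)) (cong fund (+-suc i k))))

 fund-rec : ∀ k → wsum (toList (g ∷ʳ 1ℤ)) fund k ≡ 0ℤ
 fund-rec k = Eq.trans (wsum-∷ʳ g 1ℤ fund k) (Eq.trans (cong₂ (λ x y → x Z.+ 1ℤ Z.* y)
   (wsum-cong g fund (at (st k)) k 0 (λ {i} lt → Eq.sym (Eq.trans (cong (at (st k)) (NP.+-identityʳ i)) (at-st i k (≤-pred lt)))))
   new) (lemma (wsum (toList g) (at (st k)) 0)))
  where
  lemma : ∀ a → a Z.+ 1ℤ Z.* (Z.- a) ≡ 0ℤ
  lemma = solveZ
  new : fund (suc n N.+ k) ≡ Z.- wsum (toList g) (at (st k)) 0
  new = Eq.trans (cong fund (Eq.sym (+-suc n k))) (Eq.trans (Eq.sym (at-st n (suc k) ≤-refl)) (at-∷ʳ-last (V.tail (st k)) _))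

 fund-< : ∀ {i} → i < n → fund i ≡ 0ℤ
 fund-< {i} h = Eq.trans (cong fund (Eq.sym (NP.+-identityʳ i))) (Eq.trans (Eq.sym (at-st i 0 (<⇒≤ h)))
  (Eq.trans (at-∷ʳ-< (0v {n}) 1ℤ h) (at-0 n i)))

 fund-n : fund n ≡ 1ℤ
 fund-n = Eq.trans (cong fund (Eq.sym (NP.+-identityʳ n))) (Eq.trans (Eq.sym (at-st n 0 ≤-refl)) (at-∷ʳ-last (0v {n}) 1ℤ))

 -- Read at position n - m, the initial zeros of the sequence hide every coefficient except the
 -- last, which meets `fund n` = 1. Hence 1, X, ..., X ^ n are independent modulo G.
 fund-faithful : ∀ m (c : Vec ℤ m) → m ≤ suc n → (∀ k → wsum (toList c) fund k ≡ 0ℤ) → c ≡ 0v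
 fund-faithful zero [] h eq = Eq.refl
 fund-faithful (suc m) c h eq with snocView c
 ... | c0 ∷ʳ' l = Eq.trans (cong₂ _∷ʳ_ (fund-faithful m c0 (≤-trans (n≤1+n m) h)
     (λ k → Eq.trans (lemma _ (fund (m N.+ k))) (Eq.trans (cong (λ z → (wsum (toList c0) fund k Z.+ z Z.* fund (m N.+ k)) Z.- z Z.* fund (m N.+ k)) (Eq.sym l≡0))
       (Eq.trans (cong (λ y → y Z.- l Z.* fund (m N.+ k)) (Eq.trans (Eq.sym (wsum-∷ʳ c0 l fund k)) (eq k))) (cong (λ z → 0ℤ Z.- z Z.* fund (m N.+ k)) l≡0))))) l≡0) (snoc0 m)
  where
  snoc0 : ∀ k → 0v {k} ∷ʳ 0ℤ ≡ 0v
  snoc0 zero = Eq.refl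
  snoc0 (suc k) = cong (0ℤ ∷_) (snoc0 k)
  lemma : ∀ a p → a ≡ (a Z.+ 0ℤ Z.* p) Z.- 0ℤ Z.* p
  lemma = solveZ
  j = n ∸ m
  m+j : m N.+ j ≡ n
  m+j = m+[n∸m]≡n (≤-pred h)
  l≡0 : l ≡ 0ℤ
  l≡0 = begin
   l ≡⟨ ZP.*-identityʳ l ⟨
   l Z.* 1ℤ ≡⟨ cong (l Z.*_) (Eq.trans (cong fund m+j) fund-n) ⟨
   l Z.* fund (m N.+ j) ≡⟨ ZP.+-identityˡ _ ⟨
   0ℤ Z.+ l Z.* fund (m N.+ j) ≡⟨ cong (λ y → y Z.+ l Z.* fund (m N.+ j)) (wsum-0 (toList c0) c0 fund j Eq.refl
                     (λ {i} lt → fund-< (<-≤-trans (NP.+-monoˡ-< j lt) (≤-reflexive m+j)))) ⟨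
   wsum (toList c0) fund j Z.+ l Z.* fund (m N.+ j) ≡⟨ wsum-∷ʳ c0 l fund j ⟨
   wsum (toList (c0 ∷ʳ l)) fund j ≡⟨ eq j ⟩
   0ℤ ∎
   where open Eq.≡-Reasoning

-- Roots modulo p and the ring ℤ[T]/(G)

prime-∣-* : ∀ {p} a b → Prime p → + p ∣ᶻ a Z.* b → + p ∣ᶻ a ⊎ + p ∣ᶻ b
prime-∣-* {p} a b pr d with euclidsLemma ∣ a ∣ ∣ b ∣ pr (subst (p ∣ℕ_) (ZP.abs-* a b) (∣⇒∣ᵤ d))
... | inj₁ e = inj₁ (∣ᵤ⇒∣ e)
... | inj₂ e = inj₂ (∣ᵤ⇒∣ e)

∣pos-diff∣ : ∀ {n i j} → i < n → j < n → ∣ + i Z.- + j ∣ < n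
∣pos-diff∣ {n} {i} {j} i<n j<n = subst (_< n) (Eq.sym (cong ∣_∣ (ZP.m-n≡m⊖n i j))) (bound i j i<n j<n)
 where
 bound : ∀ i j → i < n → j < n → ∣ i Z.⊖ j ∣ < n
 bound i j i<n j<n with ≤-total i j
 ... | inj₁ h = subst (_< n) (Eq.sym (ZP.∣⊖∣-≤ h)) (≤-<-trans (m∸n≤m j i) j<n)
 ... | inj₂ h = subst (_< n) (Eq.sym (Eq.trans (ZP.∣m⊖n∣≡∣n⊖m∣ i j) (ZP.∣⊖∣-≤ h))) (≤-<-trans (m∸n≤m i j) i<n)

small-∣ : ∀ {p i j} → i < p → j < p → + p ∣ᶻ + i Z.- + j → i ≡ j
small-∣ {p} {i} {j} i<p j<p d with ∣ + i Z.- + j ∣ in eq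
... | zero = ZP.+-injective (ZP.i-j≡0⇒i≡j (+ i) (+ j) (ZP.∣i∣≡0⇒i≡0 eq))
... | suc k = ⊥-elim (<⇒≱ (∣pos-diff∣ i<p j<p) (ND.∣⇒≤ {{subst NonZero (Eq.sym eq) _}} (∣⇒∣ᵤ d)))

%ℕ-≡⇒∣ : ∀ a b p .{{_ : NonZero p}} → a %ℕ p ≡ b %ℕ p → + p ∣ᶻ a Z.- b
%ℕ-≡⇒∣ a b p e = divides (a /ℕ p Z.- b /ℕ p) (begin
 a Z.- b ≡⟨ cong₂ Z._-_ (a≡a%ℕn+[a/ℕn]*n a p) (a≡a%ℕn+[a/ℕn]*n b p) ⟩
 (+ (a %ℕ p) Z.+ a /ℕ p Z.* + p) Z.- (+ (b %ℕ p) Z.+ b /ℕ p Z.* + p) ≡⟨ cong (λ z → (+ z Z.+ a /ℕ p Z.* + p) Z.- (+ (b %ℕ p) Z.+ b /ℕ p Z.* + p)) e ⟩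
 (+ (b %ℕ p) Z.+ a /ℕ p Z.* + p) Z.- (+ (b %ℕ p) Z.+ b /ℕ p Z.* + p) ≡⟨ lemma (+ (b %ℕ p)) (a /ℕ p) (b /ℕ p) (+ p) ⟩
 (a /ℕ p Z.- b /ℕ p) Z.* + p ∎)
 where
 open Eq.≡-Reasoning
 lemma : ∀ r x y p → (r Z.+ x Z.* p) Z.- (r Z.+ y Z.* p) ≡ (x Z.- y) Z.* p
 lemma = solveZ

module Roots {n : ℕ} (g : Vec ℤ (suc n)) where
 G : Vec ℤ (suc (suc n))
 G = g ∷ʳ 1ℤ

 roots : ℕ → List ℕ
 roots p = filter (λ r → p ∣ℕ? ∣ eval G (+ r) ∣) (upTo p)

 ρ2 : ℕ → ℕ
 ρ2 p = length (take 2 (roots p))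

 roots⁻ : ∀ {p r} → r ∈ roots p → r < p × (+ p ∣ᶻ eval G (+ r))
 roots⁻ {p} m with ∈-filter⁻ (λ r → p ∣ℕ? ∣ eval G (+ r) ∣) {xs = upTo p} m
 ... | a , b = ∈-upTo⁻ a , ∣ᵤ⇒∣ b

 roots⁺ : ∀ {p r} → r < p → + p ∣ᶻ eval G (+ r) → r ∈ roots p
 roots⁺ {p} lt d = ∈-filter⁺ (λ r → p ∣ℕ? ∣ eval G (+ r) ∣) (∈-upTo⁺ lt) (∣⇒∣ᵤ d)

module TwoGenerators (R : ZRing) (a b : ZRing.Carrier R) where
 open RingOps R

 ⟨a,b⟩ : Carrier → Set
 ⟨a,b⟩ e = Σ Carrier λ h → Σ Carrier λ k → e ≈ a * h + b * k

 isIdeal : IsIdeal R ⟨a,b⟩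
 isIdeal = record
  { I-resp = λ { e (h , k , q) → h , k , trans (sym e) q }
  ; I-0 = 0# , 0# , sym (trans (+-cong (zeroʳ a) (zeroʳ b)) (+-identityˡ 0#))
  ; I-+ = λ { (h , k , q) (h' , k' , r) → h + h' , k + k' , trans (+-cong q r)
    (solve 6 (λ a b h k h' k' → a :* h :+ b :* k :+ (a :* h' :+ b :* k') := a :* (h :+ h') :+ b :* (k :+ k')) refl a b h k h' k') }
  ; I-* = λ { x (h , k , q) → x * h , x * k , trans (*-congˡ q)
    (solve 5 (λ a b x h k → x :* (a :* h :+ b :* k) := a :* (x :* h) :+ b :* (x :* k)) refl a b x h k) }
  }

 a∈ : ⟨a,b⟩ a
 a∈ = 1# , 0# , sym (trans (+-cong (*-identityʳ a) (zeroʳ b)) (+-identityʳ a))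

 b∈ : ⟨a,b⟩ b
 b∈ = 0# , 1# , sym (trans (+-cong (zeroʳ a) (*-identityʳ b)) (+-identityˡ b))

module MonicRelation (R : ZRing) {n : ℕ} (g : Vec ℤ (suc n)) (x : ZRing.Carrier R)
 (gx : ZRing._≈_ R (VecEval.evv R (g ∷ʳ 1ℤ) x) (ZRing.0# R)) where
 open RingOps R
 open Linear R
 open VecEval R

 geo : Carrier → ∀ m → Vec Carrier m
 geo y zero = []
 geo y (suc m) = y ∷ geo (x * y) m

 lin-geo : ∀ {m} (c : Vec ℤ m) y → lin c (geo y m) ≈ evv c x * y
 lin-geo [] y = sym (zeroˡ y)
 lin-geo {suc m} (c ∷ v) y = trans (+-congˡ (lin-geo v (x * y)))
  (solve 4 (λ c x e y → c :* y :+ e :* (x :* y) := (c :+ x :* e) :* y) refl (ι c) x (evv v x) y)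

 lin-basis : ∀ (c : Vec ℤ (suc n)) → lin c (1# ∷ geo (x * 1#) n) ≈ evv c x
 lin-basis c = trans (lin-geo c 1#) (*-identityʳ (evv c x))

 reduce-x : ∀ (c : Vec ℤ (suc n)) → Σ (Vec ℤ (suc n)) λ c' → x * evv c x ≈ evv c' x
 reduce-x c with snocView c
 ... | c0 ∷ʳ' top = (0ℤ ∷ c0) +v ((Z.- top) ·v g) , (begin
  x * evv (c0 ∷ʳ top) x ≈⟨ *-congˡ (evv-∷ʳ c0 top x) ⟩
  x * (evv c0 x + ι top * pw x n)
   ≈⟨ solve 5 (λ x c t p q → x :* (c :+ t :* p) := (con 0ℤ :+ x :* c) :+ (:- t) :* q :+ t :* (q :+ con 1ℤ :* (x :* p))) refl x (evv c0 x) (ι top) (pw x n) (evv g x) ⟩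
  (ι 0ℤ + x * evv c0 x) + (- ι top) * evv g x + ι top * (evv g x + ι 1ℤ * pw x (suc n))
   ≈⟨ +-cong (+-congˡ (*-congʳ (sym (ι-neg top)))) (*-congˡ (trans (sym (evv-∷ʳ g 1ℤ x)) gx)) ⟩
  evv (0ℤ ∷ c0) x + ι (Z.- top) * evv g x + ι top * 0# ≈⟨ trans (+-congˡ (zeroʳ (ι top))) (+-identityʳ _) ⟩
  evv (0ℤ ∷ c0) x + ι (Z.- top) * evv g x ≈⟨ +-congˡ (evv-· (Z.- top) g x) ⟨
  evv (0ℤ ∷ c0) x + evv ((Z.- top) ·v g) x ≈⟨ evv-+ (0ℤ ∷ c0) ((Z.- top) ·v g) x ⟨
  evv ((0ℤ ∷ c0) +v ((Z.- top) ·v g)) x ∎)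
  where open ≈R

 one : 1# ≈ evv (1ℤ ∷ 0v {n}) x
 one = sym (trans (+-cong ι-1 (trans (*-congˡ (evv-0 n x)) (zeroʳ x))) (+-identityʳ _))

 inverse' : ¬ ProperFactor (g ∷ʳ 1ℤ) → ∀ a (c : Vec ℤ (suc n)) → a ≈ evv c x → c ≢ 0v → Σ ℤ λ m → m ≢ 0ℤ × Σ Carrier λ y → a * y ≈ ι m
 inverse' irr a c p c≢0 with bezout (g ∷ʳ 1ℤ) c c≢0
 ... | inj₂ f = ⊥-elim (irr f)
 ... | inj₁ B@(y , h , m , m≢0 , _) = m , m≢0 , ev y x , (begin
   a * ev y x ≈⟨ *-congʳ p ⟩
   evv c x * ev y x ≈⟨ +-identityʳ _ ⟨
   evv c x * ev y x + 0# ≈⟨ +-congˡ (trans (*-congʳ gx) (zeroˡ (ev h x))) ⟨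
   evv c x * ev y x + evv (g ∷ʳ 1ℤ) x * ev h x ≈⟨ bezout-transfer R (g ∷ʳ 1ℤ) c B x ⟩
   ι m ∎)
  where open ≈R

·v-cancel : ∀ {m} z (c : Vec ℤ m) → z ≢ 0ℤ → z ·v c ≡ 0v → c ≡ 0v
·v-cancel z [] h e = Eq.refl
·v-cancel z (c ∷ v) h e with ZP.i*j≡0⇒i≡0∨j≡0 z (cong V.head e)
... | inj₁ z≡0 = ⊥-elim (h z≡0)
... | inj₂ c≡0 = cong₂ _∷_ c≡0 (·v-cancel z v h (cong V.tail e))

monic-numberRing : ∀ (R : ZRing) {n} (g : Vec ℤ (suc n)) x → let open RingOps R; open VecEval R in
 evv (g ∷ʳ 1ℤ) x ≈ 0# → ¬ ProperFactor (g ∷ʳ 1ℤ) → (∀ a → Σ (Vec ℤ (suc n)) λ c → a ≈ evv c x) →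
 (∀ (c : Vec ℤ (suc n)) → evv c x ≈ 0# → c ≡ 0v) → NumberRing
monic-numberRing R {n} g x gx irr span1 evv-indep = record
 { R = R
 ; M' = n
 ; e = geo (x * 1#) n
 ; Δ = 1
 ; Δ≥1 = s≤s z≤n
 ; span = λ a → let (c , p) = span1 a in c , trans (trans (*-congʳ ι-1) (*-identityˡ a)) (trans p (sym (lin-basis c)))
 ; indep = λ c h → evv-indep c (trans (sym (lin-basis c)) h)
 ; torsion = λ z a z≢0 h → let (c , p) = span1 a in
   trans p (evv≡0 (·v-cancel z c z≢0 (evv-indep (z ·v c) (trans (evv-· z c x) (trans (*-congˡ (sym p)) h)))))
 ; inv = λ a a≉0 k → let (c , p) = span1 a in k (inverse' irr a c p (λ c≡0 → a≉0 (trans p (evv≡0 c≡0))))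
 }
 where
 open RingOps R
 open VecEval R
 open MonicRelation R g x gx
 evv≡0 : ∀ {c : Vec ℤ (suc n)} → c ≡ 0v → evv c x ≈ 0#
 evv≡0 Eq.refl = evv-0 (suc n) x

act-ev𝕏 : ∀ cs u i j → ⟦ PolyEval.ev ℤ[X,Y] cs 𝕏 ⟧ u i j ≡ wsum cs (λ a → u a j) i
act-ev𝕏 [] u i j = Eq.refl
act-ev𝕏 (c ∷ cs) u i j = cong (λ z → c Z.* u i j Z.+ z) (act-ev𝕏 cs u (suc i) j)

act-ev𝕐 : ∀ cs u i j → ⟦ PolyEval.ev ℤ[X,Y] cs 𝕐 ⟧ u i j ≡ wsum cs (λ b → u i b) j
act-ev𝕐 [] u i j = Eq.refl
act-ev𝕐 (c ∷ cs) u i j = cong (λ z → c Z.* u i j Z.+ z) (act-ev𝕐 cs u i (suc j))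

act-0 : ∀ e {u} → (∀ i j → u i j ≡ 0ℤ) → ∀ i j → ⟦ e ⟧ u i j ≡ 0ℤ
act-0 e {u} h i j = Eq.trans (act-ext e {u} {λ i j → 0ℤ Z.* u i j} (λ i j → h i j) i j) (act-* e 0ℤ u i j)

module _ (R : ZRing) (I : ZRing.Carrier R → Set) (isIdeal : IsIdeal R I) where
 open Quotient R I isIdeal using (quotient)

 quotient-ev : ∀ cs x → PolyEval.ev quotient cs x ≡ PolyEval.ev R cs x
 quotient-ev [] x = Eq.refl
 quotient-ev (c ∷ cs) x = cong (λ z → ZRing._+_ R (ZRing.ι R c) (ZRing._*_ R x z)) (quotient-ev cs x)

 quotient-lin : ∀ {m} (c : Vec ℤ m) xs → Linear.lin quotient c xs ≡ Linear.lin R c xs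
 quotient-lin [] [] = Eq.refl
 quotient-lin (c ∷ v) (x ∷ xs) = cong (λ z → ZRing._+_ R (ZRing._*_ R (ZRing.ι R c) x) z) (quotient-lin v xs)

record IsExprHom (R : ZRing) (φ : Expr → ZRing.Carrier R) : Set where
 open ZRing R
 field
  φ-con : ∀ z → φ (con z) ≈ ι z
  φ-⊕ : ∀ e f → φ (e ⊕ f) ≈ φ e + φ f
  φ-⊗ : ∀ e f → φ (e ⊗ f) ≈ φ e * φ f

module _ (R : ZRing) (φ : Expr → ZRing.Carrier R) (hom : IsExprHom R φ) {n : ℕ} (g : Vec ℤ (suc n)) where
 open RingOps R
 open VecEval R
 open IsExprHom hom

 univariate-span : evv (g ∷ʳ 1ℤ) (φ 𝕏) ≈ 0# → φ 𝕐 ≈ 1# → ∀ e → Σ (Vec ℤ (suc n)) λ c → φ e ≈ evv c (φ 𝕏)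
 univariate-span gx y1 e = let (c , p) = reduce e (1ℤ ∷ 0v) in c , trans (trans (sym (*-identityʳ (φ e))) (*-congˡ one)) p
  where
  open MonicRelation R g (φ 𝕏) gx
  x = φ 𝕏
  reduce : ∀ e (c : Vec ℤ (suc n)) → Σ (Vec ℤ (suc n)) λ c' → φ e * evv c x ≈ evv c' x
  reduce (con z) c = z ·v c , trans (*-congʳ (φ-con z)) (sym (evv-· z c x))
  reduce 𝕏 c = reduce-x c
  reduce 𝕐 c = c , trans (*-congʳ y1) (*-identityˡ (evv c x))
  reduce (e ⊕ f) c with reduce e c | reduce f c
  ... | a , p | b , q = a +v b , trans (*-congʳ (φ-⊕ e f)) (trans (distribʳ (evv c x) (φ e) (φ f)) (trans (+-cong p q) (sym (evv-+ a b x))))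
  reduce (e ⊗ f) c with reduce f c
  ... | b , q with reduce e b
  ... | a , p = a , trans (*-congʳ (φ-⊗ e f)) (trans (*-assoc (φ e) (φ f) (evv c x)) (trans (*-congˡ q) p))

-- ℤ[T]/(G) is obtained from ℤ[X, Y] by imposing Y = 1, so that one polynomial ring serves for one
-- root and for two. Independence is tested by acting on the recurrence sequence, which the ideal
-- annihilates.
module UnivariateRing {n : ℕ} (g : Vec ℤ (suc n)) (irr : ¬ ProperFactor (g ∷ʳ 1ℤ)) where
 open Roots g public

 GX : Expr
 GX = VecEval.evv ℤ[X,Y] G 𝕏

 Y-1 : Expr
 Y-1 = ZRing._-_ ℤ[X,Y] 𝕐 (con 1ℤ)

 open TwoGenerators ℤ[X,Y] GX Y-1 using (isIdeal; a∈; b∈) renaming (⟨a,b⟩ to I) public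
 open Quotient ℤ[X,Y] I isIdeal using (quotient; ⟪_⟫; ~0; ~0⁻; difference) public
 open RingOps quotient
 open VecEval quotient

 GX≈0 : evv G 𝕏 ≈ 0#
 GX≈0 = subst (_≈ 0#) (Eq.sym (quotient-ev ℤ[X,Y] I isIdeal (toList G) 𝕏)) (~0 a∈)

 Y≈1 : 𝕐 ≈ 1#
 Y≈1 = ⟪ b∈ ⟫

 φ : IsExprHom quotient (λ e → e)
 φ = record { φ-con = λ _ → refl ; φ-⊕ = λ _ _ → refl ; φ-⊗ = λ _ _ → refl }

 span1 : ∀ e → Σ (Vec ℤ (suc n)) λ c → e ≈ evv c 𝕏
 span1 = univariate-span quotient (λ e → e) φ g GX≈0 Y≈1

 private
  open Recurrence g

  u0 : Seq
  u0 i j = fund i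

  I-act : ∀ {e} → I e → ∀ i j → ⟦ e ⟧ u0 i j ≡ 0ℤ
  I-act {e} (h , h' , q) i j = Eq.trans (act≐ q u0 i j) (cong₂ Z._+_
   (Eq.trans (act-comm GX h u0 i j) (act-0 h (λ i j → Eq.trans (act-ev𝕏 (toList G) u0 i j) (fund-rec i)) i j))
   (Eq.trans (act-comm Y-1 h' u0 i j) (act-0 h' (λ i j → lemma (fund i)) i j)))
   where
   lemma : ∀ a → a Z.+ -1ℤ Z.* (1ℤ Z.* a) ≡ 0ℤ
   lemma = solveZ

 evv-indep : ∀ (c : Vec ℤ (suc n)) → evv c 𝕏 ≈ 0# → c ≡ 0v
 evv-indep c h = fund-faithful (suc n) c ≤-refl
  (λ k → Eq.trans (Eq.sym (act-ev𝕏 (toList c) u0 k 0)) (I-act (subst I (quotient-ev ℤ[X,Y] I isIdeal (toList c) 𝕏) (~0⁻ h)) k 0))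

 numberRing : NumberRing
 numberRing = monic-numberRing quotient g 𝕏 GX≈0 irr span1 evv-indep

-- The larger sieve in ℤ[T]/(G)

‖diff‖ : ∀ {m A} (b c : Vec ℕ m) → b ∈ vecs (upTo A) m → c ∈ vecs (upTo A) m → ‖ toZv b -v toZv c ‖ ≤ A
‖diff‖ {m} {A} b c b∈ c∈ = go b c (∈-vecs⁻ m b∈) (∈-vecs⁻ m c∈)
 where
 entry : ∀ x y → x < A → y < A → ∣ + x Z.+ -1ℤ Z.* + y ∣ ≤ A
 entry x y x<A y<A = ≤-trans (≤-reflexive (cong (λ z → ∣ + x Z.+ z ∣) (ZP.-1*i≡-i (+ y)))) (<⇒≤ (∣pos-diff∣ x<A y<A))
 go : ∀ {m} (b c : Vec ℕ m) → VAll.All (_∈ upTo A) b → VAll.All (_∈ upTo A) c → ‖ toZv b -v toZv c ‖ ≤ A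
 go [] [] _ _ = z≤n
 go (x ∷ b) (y ∷ c) (p VAll.∷ ps) (q VAll.∷ qs) = ⊔-lub (entry x y (∈-upTo⁻ p) (∈-upTo⁻ q)) (go b c ps qs)

sub-eq : ∀ a b w x y {u v} → u ≡ a Z.* w Z.+ x → v ≡ b Z.* w Z.+ y → u Z.- v ≡ (a Z.- b) Z.* w Z.+ (x Z.- y)
sub-eq a b w x y Eq.refl Eq.refl = lemma a b w x y
 where
 lemma : ∀ a b w x y → (a Z.* w Z.+ x) Z.- (b Z.* w Z.+ y) ≡ (a Z.- b) Z.* w Z.+ (x Z.- y)
 lemma = solveZ

sub-eq0 : ∀ a b w x y {u v} → x ≡ y → u ≡ a Z.* w Z.+ x → v ≡ b Z.* w Z.+ y → u Z.- v ≡ (a Z.- b) Z.* w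
sub-eq0 a b w x .x Eq.refl Eq.refl Eq.refl = lemma a b w x
 where
 lemma : ∀ a b w x → (a Z.* w Z.+ x) Z.- (b Z.* w Z.+ x) ≡ (a Z.- b) Z.* w
 lemma = solveZ

-- `val r` evaluates a representative at `x0` = r. It need not respect equality in a quotient; for r
-- a root modulo p it does so modulo p, which enters the larger sieve as `rt-hom`.
record Valuation (R : ZRing) : Set where
 open ZRing R
 field
  val : ℤ → Carrier → ℤ
  val-+ : ∀ r x y → val r (x + y) ≡ val r x Z.+ val r y
  val-* : ∀ r x y → val r (x * y) ≡ val r x Z.* val r y
  val-- : ∀ r x → val r (- x) ≡ Z.- val r x
  val-ι : ∀ r z → val r (ι z) ≡ z
  x0 : Carrier
  val-x : ∀ r → val r x0 ≡ r

module Separation (R : ZRing) (ν : Valuation R) where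
 open RingOps R
 open Valuation ν

 -- Vanishes at the place (p , r) but, for distinct places, not at (q , s).
 factor : ℕ → Place → Carrier
 factor q (p , r) with q N.≟ p
 ... | yes _ = x0 - ι (+ r)
 ... | no _ = ι (+ p)

 val-sub : ∀ r x y → val r (x - y) ≡ val r x Z.- val r y
 val-sub r x y = Eq.trans (val-+ r x (- y)) (cong (λ z → val r x Z.+ z) (val-- r y))

 val-x-ι : ∀ s r → val s (x0 - ι r) ≡ s Z.- r
 val-x-ι s r = Eq.trans (val-sub s x0 (ι r)) (cong₂ Z._-_ (val-x s) (val-ι s r))

 factor-vanishes : ∀ q pl → + fst pl ∣ᶻ val (+ snd pl) (factor q pl)
 factor-vanishes q (p , r) with q N.≟ p
 ... | yes _ = subst (+ p ∣ᶻ_) (Eq.sym (Eq.trans (val-x-ι (+ r) (+ r)) (ZP.+-inverseʳ (+ r)))) (divides 0ℤ Eq.refl)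
 ... | no _ = subst (+ p ∣ᶻ_) (Eq.sym (val-ι (+ r) (+ p))) (divides 1ℤ (Eq.sym (ZP.*-identityˡ (+ p))))

 factor-nonvanishing : ∀ q s pl → Prime q → Prime (fst pl) → s < q → snd pl < fst pl → (q , s) ≢ pl → ¬ (+ q ∣ᶻ val (+ s) (factor q pl))
 factor-nonvanishing q s (p , r) qr pr s<q r<p neq d with q N.≟ p
 ... | yes Eq.refl = neq (cong (q ,_) (small-∣ s<q r<p (subst (+ q ∣ᶻ_) (val-x-ι (+ s) (+ r)) d)))
 ... | no q≢p = q≢p (prime∣prime qr pr (∣⇒∣ᵤ (subst (+ q ∣ᶻ_) (val-ι (+ s) (+ p)) d)))

 W : ℕ → List Place → Carrier
 W q [] = ι 1ℤ
 W q (pl ∷ vl) = factor q pl * W q vl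

 W-vanishes : ∀ q {pl vl} → pl ∈ vl → + fst pl ∣ᶻ val (+ snd pl) (W q vl)
 W-vanishes q {vl = pl ∷ vl} (here Eq.refl) = subst (+ fst pl ∣ᶻ_) (Eq.sym (val-* _ (factor q pl) (W q vl))) (ZD.∣m⇒∣m*n _ (factor-vanishes q pl))
 W-vanishes q {pl} {vl = pl' ∷ vl} (there m) = subst (+ fst pl ∣ᶻ_) (Eq.sym (val-* _ (factor q pl') (W q vl))) (ZD.∣n⇒∣m*n (val (+ snd pl) (factor q pl')) (W-vanishes q m))

 Good : Place → Set
 Good (p , r) = Prime p × r < p

 W-nonvanishing : ∀ q s vl → Good (q , s) → All Good vl → All ((q , s) ≢_) vl → ¬ (+ q ∣ᶻ val (+ s) (W q vl))
 W-nonvanishing q s [] (qr , s<q) _ _ d = <⇒≱ (prime≥2 qr) (ND.∣⇒≤ (∣⇒∣ᵤ (subst (+ q ∣ᶻ_) (val-ι (+ s) 1ℤ) d)))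
 W-nonvanishing q s (pl ∷ vl) good (g ∷ gs) (n ∷ ns) d with prime-∣-* (val (+ s) (factor q pl)) (val (+ s) (W q vl)) (fst good) (subst (+ q ∣ᶻ_) (val-* (+ s) (factor q pl) (W q vl)) d)
 ... | inj₁ e = factor-nonvanishing q s pl (fst good) (fst g) (snd good) (snd g) n e
 ... | inj₂ e = W-nonvanishing q s vl good gs ns e

 -- A mixed radix expansion: the weight `W q vl` of the first digit vanishes at all later places but
 -- not at its own.
 rep : List Place → List ℕ → Carrier
 rep [] js = 0#
 rep (pl ∷ vl) [] = 0#
 rep ((q , s) ∷ vl) (j ∷ js) = ι (+ j) * W q vl + rep vl js

 private
  val-rep : ∀ t q s vl j js → val t (rep ((q , s) ∷ vl) (j ∷ js)) ≡ + j Z.* val t (W q vl) Z.+ val t (rep vl js)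
  val-rep t q s vl j js = Eq.trans (val-+ t _ _) (cong (Z._+ val t (rep vl js)) (Eq.trans (val-* t _ _) (cong (Z._* val t (W q vl)) (val-ι t (+ j)))))

 -- A form of the Chinese remainder theorem. At the places of the tail the first digit is invisible,
 -- so the tails agree by induction; the first place then reads off the first digit.
 separated : ∀ vl → Unique vl → All Good vl → ∀ {js js'} → js ∈ idx vl → js' ∈ idx vl →
  (∀ {pl} → pl ∈ vl → + fst pl ∣ᶻ val (+ snd pl) (rep vl js) Z.- val (+ snd pl) (rep vl js')) → js ≡ js'
 separated [] u gs (here Eq.refl) (here Eq.refl) h = Eq.refl
 separated ((q , s) ∷ vl) (px ∷ u) (g ∷ gs) m m' h
  with ∈-cartesianProductWith⁻ _∷_ (upTo q) (idx vl) m | ∈-cartesianProductWith⁻ _∷_ (upTo q) (idx vl) m'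
 ... | j , js , j∈ , js∈ , Eq.refl | j' , js' , j'∈ , js'∈ , Eq.refl = cong₂ _∷_ j≡ js≡
  where
  diff : ∀ t → val t (rep ((q , s) ∷ vl) (j ∷ js)) Z.- val t (rep ((q , s) ∷ vl) (j' ∷ js'))
     ≡ (+ j Z.- + j') Z.* val t (W q vl) Z.+ (val t (rep vl js) Z.- val t (rep vl js'))
  diff t = sub-eq (+ j) (+ j') (val t (W q vl)) (val t (rep vl js)) (val t (rep vl js')) (val-rep t q s vl j js) (val-rep t q s vl j' js')
  js≡ : js ≡ js'
  js≡ = separated vl u gs js∈ js'∈ (λ {pl} pl∈ → ZD.∣m+n∣m⇒∣n (subst (+ fst pl ∣ᶻ_) (diff (+ snd pl)) (h (there pl∈)))
   (ZD.∣n⇒∣m*n (+ j Z.- + j') (W-vanishes q pl∈)))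
  top : + q ∣ᶻ (+ j Z.- + j') Z.* val (+ s) (W q vl)
  top = subst (+ q ∣ᶻ_) (sub-eq0 (+ j) (+ j') (val (+ s) (W q vl)) (val (+ s) (rep vl js)) (val (+ s) (rep vl js')) (cong (λ z → val (+ s) (rep vl z)) js≡)
   (val-rep (+ s) q s vl j js) (val-rep (+ s) q s vl j' js')) (h (here Eq.refl))
  j≡ : j ≡ j'
  j≡ = [ small-∣ (∈-upTo⁻ j∈) (∈-upTo⁻ j'∈) , (λ e → ⊥-elim (W-nonvanishing q s vl g gs px e)) ]′
   (prime-∣-* (+ j Z.- + j') (val (+ s) (W q vl)) (fst g) top)

places : (ℕ → List ℕ) → List ℕ → List Place
places rt = concatMap (λ p → map (p ,_) (rt p))

places⁻ : ∀ rt ps {pl} → pl ∈ places rt ps → fst pl ∈ ps × snd pl ∈ rt (fst pl)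
places⁻ rt ps m with find (∈-concatMap⁻ (λ p → map (p ,_) (rt p)) {xs = ps} m)
... | p , p∈ , m' with ∈-map⁻ (p ,_) m'
... | r , r∈ , Eq.refl = p∈ , r∈

places-Unique : ∀ rt ps → Unique ps → (∀ p → Unique (rt p)) → Unique (places rt ps)
places-Unique rt [] [] ur = []
places-Unique rt (p ∷ ps) (px ∷ u) ur = Uniq.++⁺ (Uniq.map⁺ (λ { Eq.refl → Eq.refl }) (ur p)) (places-Unique rt ps u ur) disj
 where
 disj : ∀ {pl} → ¬ (pl ∈ map (p ,_) (rt p) × pl ∈ places rt ps)
 disj (m , m') with ∈-map⁻ (p ,_) m
 ... | r , _ , Eq.refl = All.lookup px (fst (places⁻ rt ps m')) Eq.refl

∏-places : ∀ rt ps (f : Place → ℕ) → ∏ (places rt ps) f ≡ ∏ ps (λ p → ∏ (rt p) (λ r → f (p , r)))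
∏-places rt ps f = Eq.trans (∏-concatMap ps (λ p → map (p ,_) (rt p)) f) (∏-cong ps (λ {p} _ → ∏-map (rt p) (p ,_) f))

module LargerSieve (𝓡 : NumberRing) (Δ≡1 : NumberRing.Δ 𝓡 ≡ 1) (ν : Valuation (NumberRing.R 𝓡))
 (rt : ℕ → List ℕ) (rt-Unique : ∀ p → Unique (rt p)) (rt-length : ∀ p → length (rt p) ≤ 2)
 (rt-< : ∀ {p r} → r ∈ rt p → r < p)
 (rt-hom : ∀ {p r} → r ∈ rt p → ∀ {x y} → NumberRing._≈_ 𝓡 x y → + p ∣ᶻ Valuation.val ν (+ r) x Z.- Valuation.val ν (+ r) y) where
 open NumberRingProps 𝓡
 open Valuation ν
 open Separation (NumberRing.R 𝓡) ν

 res : Place → Vec ℕ M → ℕ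
 res (zero , r) b = 0
 res (suc p , r) b = val (+ r) (vec (toZv b)) %ℕ suc p

 private
  collide : ∀ {p r} → r ∈ rt p → ∀ b c → res (p , r) b ≡ res (p , r) c → + p ∣ᶻ val (+ r) (vec (toZv b -v toZv c))
  collide {zero} m b c e = ⊥-elim (<⇒≱ (rt-< m) z≤n)
  collide {suc p} {r} m b c e = subst (+ suc p ∣ᶻ_) (lemma (val (+ r) (vec (toZv b -v toZv c))) (val (+ r) (vec (toZv b) - vec (toZv c))))
   (ZD.∣m∣n⇒∣m+n (rt-hom m (lin-- (toZv b) (toZv c) basis))
    (subst (+ suc p ∣ᶻ_) (Eq.sym (val-sub (+ r) _ _)) (%ℕ-≡⇒∣ (val (+ r) (vec (toZv b))) (val (+ r) (vec (toZv c))) (suc p) e)))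
   where
   lemma : ∀ a b → (a Z.- b) Z.+ b ≡ a
   lemma = solveZ

 -- The difference of b and c is a nonzero vector of norm at most A vanishing at all places of
 -- collision. The elements vanishing there have at least ∏ p classes, while `liouville` bounds that
 -- number in terms of A.
 pair-bound : ∀ A ps → Unique ps → (∀ {p} → p ∈ ps → Prime p) → ∀ {b c} → b ∈ vecs (upTo A) M → c ∈ vecs (upTo A) M → b ≢ c →
  ∏ (places rt ps) (λ pl → fst pl ^ χ (res pl b N.≟ res pl c)) ≤ suc (2 N.* (C N.* A)) ^ M
 pair-bound A ps ups prs {b} {c} b∈ c∈ b≢c = ≤-trans (≤-reflexive (Eq.trans (∏-filter-χ hit? fst PL) (Eq.sym (length-idx VL))))
  (liouville α A (‖diff‖ b c b∈ c∈) α≢0 J J-resp Jα (idx VL) (idx-Unique VL) (rep VL) sep)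
  where
  PL = places rt ps
  hit? : ∀ pl → Dec (res pl b ≡ res pl c)
  hit? pl = res pl b N.≟ res pl c
  VL = filter hit? PL
  α = toZv b -v toZv c
  α≢0 : α ≢ 0v
  α≢0 e = b≢c (toZv-inj b c (-v-0 (toZv b) (toZv c) e))
  VL⁻ : ∀ {pl} → pl ∈ VL → (fst pl ∈ ps × snd pl ∈ rt (fst pl)) × res pl b ≡ res pl c
  VL⁻ m = let (m1 , e) = ∈-filter⁻ hit? {xs = PL} m in places⁻ rt ps m1 , e
  J : Carrier → Set
  J x = ∀ {pl} → pl ∈ VL → + fst pl ∣ᶻ val (+ snd pl) x
  J-resp : ∀ {x y} → x ≈ y → J x → J y
  J-resp {x} {y} e h {pl} m = subst (+ fst pl ∣ᶻ_) (lemma (val (+ snd pl) y) (val (+ snd pl) x)) (ZD.∣m∣n⇒∣m+n (rt-hom (snd (fst (VL⁻ m))) (sym e)) (h m))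
   where
   lemma : ∀ a b → (a Z.- b) Z.+ b ≡ a
   lemma = solveZ
  Jα : ∀ x → J (δ * (vec α * x))
  Jα x {pl} m = subst (+ fst pl ∣ᶻ_) (Eq.sym (Eq.trans (val-* _ δ (vec α * x)) (cong (λ z → val (+ snd pl) δ Z.* z) (val-* _ (vec α) x))))
   (ZD.∣n⇒∣m*n (val (+ snd pl) δ) (ZD.∣m⇒∣m*n (val (+ snd pl) x) (collide (snd (fst (VL⁻ m))) b c (snd (VL⁻ m)))))
  good : All Good VL
  good = All.tabulate (λ {pl} m → prs (fst (fst (VL⁻ m))) , rt-< (snd (fst (VL⁻ m))))
  sep : ∀ {js js'} → js ∈ idx VL → js' ∈ idx VL → J (δ * (rep VL js - rep VL js')) → js ≡ js'
  sep {js} {js'} m m' h = separated VL (Uniq.filter⁺ hit? (places-Unique rt ps ups rt-Unique)) good m m'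
   (λ {pl} pl∈ → subst (+ fst pl ∣ᶻ_) (unit (+ snd pl)) (h pl∈))
   where
   unit : ∀ r → val r (δ * (rep VL js - rep VL js')) ≡ val r (rep VL js) Z.- val r (rep VL js')
   unit r = Eq.trans (val-* r δ _) (Eq.trans (cong₂ Z._*_ (Eq.trans (val-ι r (+ Δ)) (cong +_ Δ≡1)) (val-sub r _ _)) (ZP.*-identityˡ _))

 larger-sieve : Σ ℕ λ C0 → ∀ X D (w : ℕ → ℕ) → 1 ≤ X → (∀ {p} → p ∈ primes X → p N.* w p ≡ D) →
  ∏ (primes X) (λ p → p ^ (length (rt p) N.* w p)) ≤ (C0 N.* X) ^ D
 larger-sieve = 64 N.* (suc (2 N.* C) ^ M N.* 2 ^ M) , main
  where
  module _ (X D : ℕ) (w : ℕ → ℕ) (X≥1 : 1 ≤ X) (pw : ∀ {p} → p ∈ primes X → p N.* w p ≡ D) where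
   PL = places rt (primes X)
   -- A ^ M lies between X and 2 ^ M · X: the box is large enough to pay for the diagonal, yet K
   -- remains O(X).
   near = nearest-power M' X X≥1
   A = fst near
   A≥1 = fst (snd near)
   K = suc (2 N.* (C N.* A)) ^ M
   res< : ∀ {pl} → pl ∈ PL → ∀ b → res pl b < fst pl
   res< {zero , r} m b = ⊥-elim (<⇒≱ (rt-< (snd (places⁻ rt (primes X) m))) z≤n)
   res< {suc p , r} m b = n%ℕd<d (val (+ r) (vec (toZv b))) (suc p)
   total : ∏ PL fst ≤ 64 ^ X
   total = begin
    ∏ PL fst ≡⟨ ∏-places rt (primes X) fst ⟩
    ∏ (primes X) (λ p → ∏ (rt p) (λ _ → p)) ≡⟨ ∏-cong (primes X) (λ {p} _ → ∏-const (rt p) p) ⟩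
    ∏ (primes X) (λ p → p ^ length (rt p)) ≤⟨ ∏-mono (primes X) (λ {p} m → pow-monoʳ (prime≥1 (fst (primes⁻ {X} m))) (rt-length p)) ⟩
    ∏ (primes X) (λ p → p ^ 2) ≡⟨ ∏-^ (primes X) (λ p → p) 2 ⟩
    ∏ (primes X) (λ p → p) ^ 2 ≤⟨ ^-monoˡ-≤ 2 (primorial≤ X) ⟩
    (8 ^ X) ^ 2 ≡⟨ Eq.trans (^-*-assoc 8 X 2) (Eq.trans (cong (8 ^_) (NP.*-comm X 2)) (Eq.sym (^-*-assoc 8 2 X))) ⟩
    64 ^ X ∎
    where open ≤-Reasoning
   main : ∏ (primes X) (λ p → p ^ (length (rt p) N.* w p)) ≤ (64 N.* (suc (2 N.* C) ^ M N.* 2 ^ M) N.* X) ^ D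
   main = begin
    ∏ (primes X) (λ p → p ^ (length (rt p) N.* w p)) ≡⟨ ∏-cong (primes X) (λ {p} _ → Eq.trans (cong (p ^_) (NP.*-comm (length (rt p)) (w p))) (Eq.sym (Eq.trans (∏-const (rt p) (p ^ w p)) (^-*-assoc p (w p) (length (rt p)))))) ⟩
    ∏ (primes X) (λ p → ∏ (rt p) (λ _ → p ^ w p)) ≡⟨ ∏-places rt (primes X) (λ pl → fst pl ^ w (fst pl)) ⟨
    ∏ PL (λ pl → fst pl ^ w (fst pl)) ≤⟨ larger-sieve-count (≡-dec N._≟_) (vecs (upTo A) M) (box-Unique A M) PL res K X (A ^ M) D w
                                 (length-box A M) (pow≥1 M A≥1) (fst (snd (snd near))) (pow≥1 M (s≤s z≤n)) total res<
                                 (λ m → pw (fst (places⁻ rt (primes X) m)))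
                                 (pair-bound A (primes X) (primes-Unique X) (λ m → fst (primes⁻ {X} m))) ⟩
    (64 N.* K) ^ D ≤⟨ ^-monoˡ-≤ D (*-monoʳ-≤ 64 K≤) ⟩
    (64 N.* (suc (2 N.* C) ^ M N.* (2 ^ M N.* X))) ^ D ≡⟨ cong (_^ D) (assoc4 64 (suc (2 N.* C) ^ M) (2 ^ M) X) ⟩
    (64 N.* (suc (2 N.* C) ^ M N.* 2 ^ M) N.* X) ^ D ∎
    where
    open ≤-Reasoning
    assoc4 : ∀ a b c d → a N.* (b N.* (c N.* d)) ≡ a N.* (b N.* c) N.* d
    assoc4 = solve-∀
    K≤' : ∀ m c A x → 1 ≤ A → A ^ m ≤ 2 ^ m N.* x → suc (2 N.* (c N.* A)) ^ m ≤ suc (2 N.* c) ^ m N.* (2 ^ m N.* x)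
    K≤' m c A x A≥1 h = ≤-trans (^-monoˡ-≤ m (≤-trans (+-monoˡ-≤ (2 N.* (c N.* A)) A≥1) (≤-reflexive (lemma c A))))
     (≤-trans (≤-reflexive (^-*-distrib m (suc (2 N.* c)) A)) (*-monoʳ-≤ (suc (2 N.* c) ^ m) h))
     where
     lemma : ∀ c A → A N.+ 2 N.* (c N.* A) ≡ suc (2 N.* c) N.* A
     lemma = solve-∀
    K≤ : K ≤ suc (2 N.* C) ^ M N.* (2 ^ M N.* X)
    K≤ = K≤' M C A X A≥1 (snd (snd (snd near)))

-- Divisibility by prime powers in a ring of finite rank

least : ∀ {ℓ} (P : ℕ → Set ℓ) m → P m → ¬ ¬ (Σ ℕ λ k → P k × (∀ j → j < k → ¬ P j))
least P m pm k = go m m ≤-refl pm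
 where
 go : ∀ f m → m ≤ f → P m → ⊥
 go zero .zero z≤n pm = k (zero , pm , λ _ ())
 go (suc f) m h pm = k (m , pm , λ j j<m pj → go f j (≤-pred (<-≤-trans j<m h)) pj)

prime-bezout : ∀ {p} n → Prime p → ¬ (+ p ∣ᶻ n) → Σ ℤ λ u → Σ ℤ λ v → u Z.* n Z.+ v Z.* + p ≡ 1ℤ
prime-bezout {p} n pr ¬d = fromAbs n (abs-case (coprime-Bézout cop))
 where
 cop : Coprime p ∣ n ∣
 cop {d} (d∣p , d∣n) with prime⇒irreducible pr d∣p
 ... | inj₁ e = e
 ... | inj₂ Eq.refl = ⊥-elim (¬d (∣ᵤ⇒∣ d∣n))
 abs-case : Bézout.Identity 1 p ∣ n ∣ → Σ ℤ λ u → Σ ℤ λ v → u Z.* + ∣ n ∣ Z.+ v Z.* + p ≡ 1ℤ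
 abs-case (Bézout.+- x y eq) = Z.- (+ y) , + x , Eq.trans (lemma (+ y) (+ ∣ n ∣) (+ x) (+ p)) (Eq.trans (cong (Z._- (+ y Z.* + ∣ n ∣)) (Eq.trans (Eq.sym (ZP.pos-* x p)) (cong +_ (Eq.sym eq)))) (Eq.trans (cong (λ z → z Z.- (+ y Z.* + ∣ n ∣)) (Eq.trans (ZP.pos-+ 1 (y N.* ∣ n ∣)) (cong (λ z → 1ℤ Z.+ z) (ZP.pos-* y ∣ n ∣)))) (lemma2 (+ y Z.* + ∣ n ∣))))
  where
  lemma : ∀ y n x p → (Z.- y) Z.* n Z.+ x Z.* p ≡ x Z.* p Z.- y Z.* n
  lemma = solveZ
  lemma2 : ∀ a → (1ℤ Z.+ a) Z.- a ≡ 1ℤ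
  lemma2 = solveZ
 abs-case (Bézout.-+ x y eq) = + y , Z.- (+ x) , Eq.trans (lemma (+ y) (+ ∣ n ∣) (+ x) (+ p)) (Eq.trans (cong (Z._- (+ x Z.* + p)) (Eq.trans (Eq.sym (ZP.pos-* y ∣ n ∣)) (cong +_ (Eq.sym eq)))) (Eq.trans (cong (λ z → z Z.- (+ x Z.* + p)) (Eq.trans (ZP.pos-+ 1 (x N.* p)) (cong (λ z → 1ℤ Z.+ z) (ZP.pos-* x p)))) (lemma2 (+ x Z.* + p))))
  where
  lemma : ∀ y n x p → y Z.* n Z.+ (Z.- x) Z.* p ≡ y Z.* n Z.- x Z.* p
  lemma = solveZ
  lemma2 : ∀ a → (1ℤ Z.+ a) Z.- a ≡ 1ℤ
  lemma2 = solveZ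
 fromAbs : ∀ n → (Σ ℤ λ u → Σ ℤ λ v → u Z.* + ∣ n ∣ Z.+ v Z.* + p ≡ 1ℤ) → Σ ℤ λ u → Σ ℤ λ v → u Z.* n Z.+ v Z.* + p ≡ 1ℤ
 fromAbs (+ n) r = r
 fromAbs -[1+ n ] (u , v , e) = Z.- u , v , Eq.trans (lemma u (+ suc n) v (+ p)) e
  where
  lemma : ∀ u n v p → (Z.- u) Z.* (Z.- n) Z.+ v Z.* p ≡ u Z.* n Z.+ v Z.* p
  lemma = solveZ

prime-power-bezout : ∀ {p} n k → Prime p → ¬ (+ p ∣ᶻ n) → Σ ℤ λ u → Σ ℤ λ v → u Z.* n Z.+ v Z.* + (p ^ k) ≡ 1ℤ
prime-power-bezout {p} n zero pr ¬d = 0ℤ , 1ℤ , Eq.refl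
prime-power-bezout {p} n (suc k) pr ¬d = combine (prime-bezout n pr ¬d) (prime-power-bezout n k pr ¬d)
 where
 combine : (Σ ℤ λ u → Σ ℤ λ v → u Z.* n Z.+ v Z.* + p ≡ 1ℤ) → (Σ ℤ λ u → Σ ℤ λ v → u Z.* n Z.+ v Z.* + (p ^ k) ≡ 1ℤ) →
  Σ ℤ λ u → Σ ℤ λ v → u Z.* n Z.+ v Z.* + (p ^ suc k) ≡ 1ℤ
 combine (u , v , e) (u' , v' , e') = u Z.* (u' Z.* n Z.+ v' Z.* + (p ^ k)) Z.+ v Z.* + p Z.* u' , v Z.* v' , Eq.trans (cong (λ z → (u Z.* (u' Z.* n Z.+ v' Z.* + (p ^ k)) Z.+ v Z.* + p Z.* u') Z.* n Z.+ (v Z.* v') Z.* z) (ZP.pos-* p (p ^ k)))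
  (Eq.trans (lemma u v u' v' n (+ p) (+ (p ^ k))) (Eq.trans (cong₂ Z._*_ e e') Eq.refl))
  where
  lemma : ∀ u v u' v' n p q → (u Z.* (u' Z.* n Z.+ v' Z.* q) Z.+ v Z.* p Z.* u') Z.* n Z.+ (v Z.* v') Z.* (p Z.* q) ≡ (u Z.* n Z.+ v Z.* p) Z.* (u' Z.* n Z.+ v' Z.* q)
  lemma = solveZ

-- A box of side L has L ^ (m + 1) points, but there are only (2KL + 1) ^ m possible codes, too few
-- once L exceeds (2K + 1) ^ m.
no-linear-injection : ∀ m K (code : Vec ℕ (suc m) → Vec ℤ m) → (∀ n n' → code n ≡ code n' → n ≡ n') →
 (∀ L {n} → n ∈ vecs (upTo L) (suc m) → ‖ code n ‖ ≤ K N.* L) → ⊥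
no-linear-injection m K code inj bd = <⇒≱ (n<1+n T) (*-cancelʳ-≤' (L ^ m) (pow≥1 m (s≤s z≤n)) (begin
 L N.* L ^ m ≡⟨ length-box L (suc m) ⟨
 length (vecs (upTo L) (suc m)) ≤⟨ inj-box-count (vecs (upTo L) (suc m)) m (K N.* L) code (box-Unique L (suc m)) (λ _ _ e → inj _ _ e) (bd L) ⟩
 suc (2 N.* (K N.* L)) ^ m ≤⟨ ^-monoˡ-≤ m (≤-trans (m≤m+n _ T) (≤-reflexive (lemma K T))) ⟩
 (suc (2 N.* K) N.* L) ^ m ≡⟨ ^-*-distrib m (suc (2 N.* K)) L ⟩
 T N.* L ^ m ∎))
 where
 open ≤-Reasoning
 T = suc (2 N.* K) ^ m
 L = suc T
 lemma : ∀ k t → suc (2 N.* (k N.* suc t)) N.+ t ≡ suc (2 N.* k) N.* suc t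
 lemma = solve-∀

TorsionFree : ZRing → Set
TorsionFree R = ∀ n a → n ≢ 0ℤ → ι n * a ≈ 0# → a ≈ 0#
 where open RingOps R

module Divisibility (R : ZRing) (torsion : TorsionFree R) where
 open RingOps R
 open Linear R

 Div : ℤ → Carrier → Set
 Div q a = Σ Carrier λ c → a ≈ ι q * c

 Div-≈ : ∀ {q a b} → a ≈ b → Div q a → Div q b
 Div-≈ e (c , h) = c , trans (sym e) h

 Div-+ : ∀ {q a b} → Div q a → Div q b → Div q (a + b)
 Div-+ {q} (c , h) (d , k) = c + d , trans (+-cong h k) (sym (distribˡ (ι q) c d))

 Div-* : ∀ {q a} x → Div q a → Div q (x * a)
 Div-* {q} {a} x (c , h) = x * c , trans (*-congˡ h) (solve 3 (λ x q c → x :* (q :* c) := q :* (x :* c)) refl x (ι q) c)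

 Div-self : ∀ q a → Div q (ι q * a)
 Div-self q a = a , refl

 cancel : ∀ {n a b} → n ≢ 0ℤ → ι n * a ≈ ι n * b → a ≈ b
 cancel {n} {a} {b} n≢0 h = x-y≈0⇒x≈y (torsion n (a - b) n≢0 (trans (solve 3 (λ n a b → n :* (a :- b) := n :* a :- n :* b) refl (ι n) a b) (x≈y⇒x-y≈0 h)))

 Div-coprime : ∀ {q n a} → (Σ ℤ λ u → Σ ℤ λ v → u Z.* n Z.+ v Z.* q ≡ 1ℤ) → Div q (ι n * a) → Div q a
 Div-coprime {q} {n} {a} (u , v , e) h = Div-≈ (begin
   ι u * (ι n * a) + ι v * (ι q * a) ≈⟨ solve 5 (λ u n v q a → u :* (n :* a) :+ v :* (q :* a) := (u :* n :+ v :* q) :* a) refl (ι u) (ι n) (ι v) (ι q) a ⟩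
   (ι u * ι n + ι v * ι q) * a ≈⟨ *-congʳ (+-cong (ι-* u n) (ι-* v q)) ⟨
   (ι (u Z.* n) + ι (v Z.* q)) * a ≈⟨ *-congʳ (ι-+ (u Z.* n) (v Z.* q)) ⟨
   ι (u Z.* n Z.+ v Z.* q) * a ≈⟨ *-congʳ (trans (ι-cong e) ι-1) ⟩
   1# * a ≈⟨ *-identityˡ a ⟩
   a ∎) (Div-+ (Div-* (ι u) h) (Div-* (ι v) (Div-self q a)))
  where open ≈R

 Div-power : ∀ {p} → Prime p → ∀ k n b → ¬ Div (+ p) b → Div (+ (p ^ k)) (ι n * b) → + (p ^ k) ∣ᶻ n
 Div-power {p} pr zero n b ¬b h = divides n (Eq.sym (ZP.*-identityʳ n))
 Div-power {p} pr (suc k) n b ¬b (c , h) with + p ∣ᶻ? n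
 ... | no ¬d = ⊥-elim (¬b (Div-coprime (prime-bezout n pr ¬d) (ι (+ (p ^ k)) * c , trans h (trans (*-congʳ (trans (ι-cong (ZP.pos-* p (p ^ k))) (ι-* (+ p) (+ (p ^ k))))) (*-assoc _ _ c)))))
 ... | yes (divides n' Eq.refl) = up (Div-power pr k n' b ¬b (c , cancel (prime≢0 pr) (begin
   ι (+ p) * (ι n' * b) ≈⟨ solve 3 (λ p n b → p :* (n :* b) := n :* p :* b) refl (ι (+ p)) (ι n') b ⟩
   ι n' * ι (+ p) * b ≈⟨ *-congʳ (ι-* n' (+ p)) ⟨
   ι (n' Z.* + p) * b ≈⟨ h ⟩
   ι (+ (p ^ suc k)) * c ≈⟨ *-congʳ (trans (ι-cong (ZP.pos-* p (p ^ k))) (ι-* (+ p) (+ (p ^ k)))) ⟩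
   ι (+ p) * ι (+ (p ^ k)) * c ≈⟨ *-assoc _ _ c ⟩
   ι (+ p) * (ι (+ (p ^ k)) * c) ∎)))
  where
  open ≈R
  up : + (p ^ k) ∣ᶻ n' → + (p ^ suc k) ∣ᶻ (n' Z.* + p)
  up (divides q e) = divides q (Eq.trans (cong (Z._* + p) e) (Eq.trans (lemma q (+ (p ^ k)) (+ p)) (cong (q Z.*_) (Eq.sym (ZP.pos-* p (p ^ k))))))
   where
   lemma : ∀ a b c → a Z.* b Z.* c ≡ a Z.* (c Z.* b)
   lemma = solveZ

 prodV : ∀ {m} → (Carrier → Carrier) → Vec Carrier m → Carrier
 prodV h [] = 1#
 prodV h (a ∷ as) = h a * prodV h as

 skip : ∀ {m} → Fin m → (Carrier → Carrier) → Vec Carrier m → Carrier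
 skip zero h (a ∷ as) = prodV h as
 skip (suc i) h (a ∷ as) = h a * skip i h as

 prodV-∣ : ∀ {m} (as : Vec Carrier m) j → Σ Carrier λ r → prodV (λ z → z) as ≈ lookup as j * r
 prodV-∣ (a ∷ as) zero = prodV (λ z → z) as , refl
 prodV-∣ (a ∷ as) (suc j) = let (r , e) = prodV-∣ as j in a * r , trans (*-congˡ e) (solve 3 (λ a b r → a :* (b :* r) := b :* (a :* r)) refl a (lookup as j) r)

 skip-∣ : ∀ {m} (as : Vec Carrier m) i j → j ≢ i → Σ Carrier λ r → skip i (λ z → z) as ≈ lookup as j * r
 skip-∣ (a ∷ as) zero zero j≢i = ⊥-elim (j≢i Eq.refl)
 skip-∣ (a ∷ as) zero (suc j) j≢i = prodV-∣ as j
 skip-∣ (a ∷ as) (suc i) zero j≢i = skip i (λ z → z) as , refl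
 skip-∣ (a ∷ as) (suc i) (suc j) j≢i = let (r , e) = skip-∣ as i j (λ e → j≢i (cong suc e)) in
  a * r , trans (*-congˡ e) (solve 3 (λ a b r → a :* (b :* r) := b :* (a :* r)) refl a (lookup as j) r)

 private
  cong-step : ∀ {c u v x y} → (Σ Carrier λ r → u - v ≈ c * r) → (Σ Carrier λ r → x - y ≈ c * r) → Σ Carrier λ r → u * x - v * y ≈ c * r
  cong-step {c} {u} {v} {x} {y} (r , e) (s , f) = r * x + v * s , (begin
   u * x - v * y ≈⟨ solve 4 (λ u v x y → u :* x :- v :* y := (u :- v) :* x :+ v :* (x :- y)) refl u v x y ⟩
   (u - v) * x + v * (x - y) ≈⟨ +-cong (*-congʳ e) (*-congˡ f) ⟩
   c * r * x + v * (c * s) ≈⟨ solve 5 (λ c r x v s → c :* r :* x :+ v :* (c :* s) := c :* (r :* x :+ v :* s)) refl c r x v s ⟩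
   c * (r * x + v * s) ∎)
   where open ≈R

  zero-diff : ∀ c x → Σ Carrier λ r → x - x ≈ c * r
  zero-diff c x = 0# , trans (-‿inverseʳ x) (sym (zeroʳ c))

 prodV-cong : ∀ {m c} {h1 h2 : Carrier → Carrier} → (∀ z → Σ Carrier λ r → h1 z - h2 z ≈ c * r) → (as : Vec Carrier m) →
  Σ Carrier λ r → prodV h1 as - prodV h2 as ≈ c * r
 prodV-cong {c = c} h [] = zero-diff c 1#
 prodV-cong h (a ∷ as) = cong-step (h a) (prodV-cong h as)

 skip-cong : ∀ {m c} {h1 h2 : Carrier → Carrier} → (∀ z → Σ Carrier λ r → h1 z - h2 z ≈ c * r) → ∀ i (as : Vec Carrier m) →
  Σ Carrier λ r → skip i h1 as - skip i h2 as ≈ c * r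
 skip-cong h zero (a ∷ as) = prodV-cong h as
 skip-cong h (suc i) (a ∷ as) = cong-step (h a) (skip-cong h i as)

 Div-lin : ∀ {m q} Q (ns : Vec ℤ m) bs → (∀ j → Div q (Q * lookup bs j)) → Div q (Q * lin ns bs)
 Div-lin {q = q} Q [] [] h = 0# , trans (zeroʳ Q) (sym (zeroʳ (ι q)))
 Div-lin Q (n ∷ ns) (b ∷ bs) h = Div-≈ (solve 4 (λ Q n b l → n :* (Q :* b) :+ Q :* l := Q :* (n :* b :+ l)) refl Q (ι n) b (lin ns bs))
  (Div-+ (Div-* (ι n) (h zero)) (Div-lin Q ns bs (λ j → h (suc j))))

 Div-extract : ∀ {m q} Q (ns : Vec ℤ m) bs i → (∀ j → j ≢ i → Div q (Q * lookup bs j)) → Div q (Q * lin ns bs - ι (lookup ns i) * (Q * lookup bs i))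
 Div-extract Q (n ∷ ns) (b ∷ bs) zero h = Div-≈ (solve 4 (λ Q n b l → Q :* l := Q :* (n :* b :+ l) :- n :* (Q :* b)) refl Q (ι n) b (lin ns bs))
  (Div-lin Q ns bs (λ j → h (suc j) (λ ())))
 Div-extract Q (n ∷ ns) (b ∷ bs) (suc i) h = Div-≈ (solve 5 (λ Q n b l t → n :* (Q :* b) :+ (Q :* l :- t) := Q :* (n :* b :+ l) :- t) refl Q (ι n) b (lin ns bs) (ι (lookup ns i) * (Q * lookup bs i)))
  (Div-+ (Div-* (ι n) (h zero (λ ()))) (Div-extract Q ns bs i (λ j j≢i → h (suc j) (λ { Eq.refl → j≢i Eq.refl }))))

‖·‖-≡ : ∀ {m} c (v : Vec ℤ m) → ‖ c ·v v ‖ ≡ ∣ c ∣ N.* ‖ v ‖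
‖·‖-≡ c [] = Eq.sym (NP.*-zeroʳ ∣ c ∣)
‖·‖-≡ c (b ∷ v) = Eq.trans (cong₂ _⊔_ (ZP.abs-* c b) (‖·‖-≡ c v)) (Eq.sym (NP.*-distribˡ-⊔ ∣ c ∣ ∣ b ∣ ‖ v ‖))

divide-vec : ∀ {m p} (ns : Vec ℤ m) → (∀ i → + p ∣ᶻ lookup ns i) → Σ (Vec ℤ m) λ ns' → ns ≡ (+ p) ·v ns'
divide-vec [] h = [] , Eq.refl
divide-vec {p = p} (n ∷ ns) h with h zero | divide-vec ns (λ i → h (suc i))
... | divides q e | ns' , e' = q ∷ ns' , cong₂ _∷_ (Eq.trans e (ZP.*-comm q (+ p))) e'

·v-0 : ∀ m c → c ·v 0v {m} ≡ 0v
·v-0 zero c = Eq.refl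
·v-0 (suc m) c = cong₂ _∷_ (ZP.*-zeroʳ c) (·v-0 m c)

combine : ∀ {k m} → Vec ℕ k → Vec (Vec ℤ m) k → Vec ℤ m
combine [] [] = 0v
combine (n ∷ ns) (β ∷ βs) = ((+ n) ·v β) +v combine ns βs

Σ‖_‖ : ∀ {k m} → Vec (Vec ℤ m) k → ℕ
Σ‖ [] ‖ = 0
Σ‖ β ∷ βs ‖ = ‖ β ‖ N.+ Σ‖ βs ‖

combine-bound : ∀ {k m} L (ns : Vec ℕ k) (βs : Vec (Vec ℤ m) k) → VAll.All (_∈ upTo L) ns → ‖ combine ns βs ‖ ≤ Σ‖ βs ‖ N.* L
combine-bound {m = m} L [] [] _ = ≤-reflexive (‖0‖ m)
combine-bound L (n ∷ ns) (β ∷ βs) (p VAll.∷ ps) = begin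
 ‖ ((+ n) ·v β) +v combine ns βs ‖ ≤⟨ ‖+‖ ((+ n) ·v β) (combine ns βs) ⟩
 ‖ (+ n) ·v β ‖ N.+ ‖ combine ns βs ‖ ≤⟨ +-mono-≤ (≤-trans (‖·‖ (+ n) β) (≤-trans (*-monoˡ-≤ ‖ β ‖ (<⇒≤ (∈-upTo⁻ p))) (≤-reflexive (NP.*-comm L ‖ β ‖)))) (combine-bound L ns βs ps) ⟩
 ‖ β ‖ N.* L N.+ Σ‖ βs ‖ N.* L ≡⟨ NP.*-distribʳ-+ L ‖ β ‖ Σ‖ βs ‖ ⟨
 (‖ β ‖ N.+ Σ‖ βs ‖) N.* L ∎
 where open ≤-Reasoning

module Eigen (𝓡 : NumberRing) where
 open NumberRingProps 𝓡
 open Divisibility R torsion public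

 private
  βs : ∀ {k} → Vec Carrier k → Vec (Vec ℤ M) k
  βs = V.map (λ b → fst (span b))

  vec-combine : ∀ {k} (ns : Vec ℕ k) (bs : Vec Carrier k) → vec (combine ns (βs bs)) ≈ δ * lin (toZv ns) bs
  vec-combine [] [] = trans (lin-0 basis) (sym (zeroʳ δ))
  vec-combine (n ∷ ns) (b ∷ bs) = begin
   vec (((+ n) ·v fst (span b)) +v combine ns (βs bs)) ≈⟨ lin-+ ((+ n) ·v fst (span b)) (combine ns (βs bs)) basis ⟩
   vec ((+ n) ·v fst (span b)) + vec (combine ns (βs bs)) ≈⟨ +-cong (trans (lin-· (+ n) (fst (span b)) basis) (*-congˡ (sym (snd (span b))))) (vec-combine ns bs) ⟩
   ι (+ n) * (δ * b) + δ * lin (toZv ns) bs ≈⟨ solve 4 (λ n d b l → n :* (d :* b) :+ d :* l := d :* (n :* b :+ l)) refl (ι (+ n)) δ b (lin (toZv ns) bs) ⟩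
   δ * (ι (+ n) * b + lin (toZv ns) bs) ∎
   where open ≈R

 -- Counting takes the place of linear algebra: independence of M + 1 elements would map the boxes
 -- of dimension M + 1 injectively and linearly into a lattice of rank M.
 dependent : (bs : Vec Carrier (suc M)) → (∀ ns → lin ns bs ≈ 0# → ns ≡ 0v) → ⊥
 dependent bs ind = no-linear-injection M Σ‖ βs bs ‖ (λ ns → combine ns (βs bs)) inj (λ L {ns} ns∈ → combine-bound L ns (βs bs) (∈-vecs⁻ (suc M) ns∈))
  where
  inj : ∀ n n' → combine n (βs bs) ≡ combine n' (βs bs) → n ≡ n'
  inj n n' e = toZv-inj n n' (-v-0 (toZv n) (toZv n') (ind (toZv n -v toZv n') (trans (lin-- (toZv n) (toZv n') bs)
   (x≈y⇒x-y≈0 (cancel Δ≢0 (trans (sym (vec-combine n bs)) (trans (reflexive (cong vec e)) (vec-combine n' bs))))))))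

 -- A relation among the bᵢ, multiplied by ∏_{j ≠ i} aⱼ, isolates its i-th term modulo p^k.
 eigen : ∀ {p} → Prime p → ∀ k (as bs : Vec Carrier (suc M)) → (∀ i → Div (+ (p ^ k)) (lookup as i * lookup bs i)) →
  (∀ i → ¬ Div (+ (p ^ k)) (skip i (λ z → z - lookup as i) as * lookup bs i)) → ⊥
 eigen {p} pr k as bs ab none = dependent bs (λ ns h → indep' ‖ ns ‖ ns ≤-refl h)
  where
  coeff-∣ : ∀ ns → lin ns bs ≈ 0# → ∀ i → + p ∣ᶻ lookup ns i
  coeff-∣ ns rel i with + p ∣ᶻ? lookup ns i
  ... | yes d = d
  ... | no ¬d = ⊥-elim (none i (Div-≈ (solve 3 (λ Q Q' b → Q :* b :+ con -1ℤ :* ((Q :- Q') :* b) := Q' :* b) refl Q Q' b)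
      (Div-+ Qb (Div-* (ι -1ℤ) (Div-≈ (trans (solve 3 (λ r a b → r :* (a :* b) := a :* r :* b) refl (fst QQ) (lookup as i) b) (*-congʳ (sym (snd QQ)))) (Div-* (fst QQ) (ab i)))))))
   where
   b = lookup bs i
   Q = skip i (λ z → z) as
   Q' = skip i (λ z → z - lookup as i) as
   QQ : Σ Carrier λ r → Q - Q' ≈ lookup as i * r
   QQ = skip-cong (λ z → 1# , trans (solve 2 (λ z a → z :- (z :- a) := a) refl z (lookup as i)) (sym (*-identityʳ _))) i as
   others : ∀ j → j ≢ i → Div (+ (p ^ k)) (Q * lookup bs j)
   others j j≢i = let (r , e) = skip-∣ as i j j≢i in
    Div-≈ (trans (solve 3 (λ r a b → r :* (a :* b) := a :* r :* b) refl r (lookup as j) (lookup bs j)) (*-congʳ (sym e))) (Div-* r (ab j))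
   Qb : Div (+ (p ^ k)) (Q * b)
   Qb = Div-coprime (prime-power-bezout (lookup ns i) k pr ¬d) (Div-≈
    (trans (solve 2 (λ x t → con -1ℤ :* (x :- t) := t :- x) refl (Q * lin ns bs) (ι (lookup ns i) * (Q * b)))
     (trans (+-congˡ (-‿cong (trans (*-congˡ rel) (zeroʳ Q)))) (trans (+-congˡ (-‿cong (sym ι-0))) (solve 1 (λ t → t :- con 0ℤ := t) refl (ι (lookup ns i) * (Q * b))))))
    (Div-* (ι -1ℤ) (Div-extract Q ns bs i others)))
  -- Every coefficient of a relation is divisible by p, and torsion-freeness permits division by p;
  -- descent on the norm leaves only the zero relation.
  indep' : ∀ f ns → ‖ ns ‖ ≤ f → lin ns bs ≈ 0# → ns ≡ 0v
  indep' zero ns h rel = ‖‖-0 ns (NP.n≤0⇒n≡0 h)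
  indep' (suc f) ns h rel with divide-vec ns (coeff-∣ ns rel)
  ... | ns' , Eq.refl = Eq.trans (cong ((+ p) ·v_) (indep' f ns' small (torsion (+ p) _ (prime≢0 pr) (trans (sym (lin-· (+ p) ns' bs)) rel)))) (·v-0 (suc M) (+ p))
   where
   half : ∀ x → 2 N.* x ≤ suc f → x ≤ f
   half zero h = z≤n
   half (suc x) (s≤s h) = ≤-trans (≤-trans (s≤s (m≤m+n x (x N.+ 0))) (≤-reflexive (Eq.sym (+-suc x (x N.+ 0))))) h
   small : ‖ ns' ‖ ≤ f
   small = half ‖ ns' ‖ (≤-trans (*-monoˡ-≤ ‖ ns' ‖ (prime≥2 pr)) (≤-trans (≤-reflexive (Eq.sym (‖·‖-≡ (+ p) ns'))) h))

-- Norms of elements and the primes dividing them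

module PolyDiff (R : ZRing) where
 open RingOps R
 open PolyEval R

 ev-diff : ∀ cs x y → Σ Carrier λ q → ev cs x - ev cs y ≈ (x - y) * q
 ev-diff [] x y = 0# , trans (-‿inverseʳ 0#) (sym (zeroʳ (x - y)))
 ev-diff (c ∷ cs) x y = let (q , e) = ev-diff cs x y in x * q + ev cs y , (begin
  (ι c + x * ev cs x) - (ι c + y * ev cs y) ≈⟨ solve 5 (λ c x y p q → (c :+ x :* p) :- (c :+ y :* q) := x :* (p :- q) :+ (x :- y) :* q) refl (ι c) x y (ev cs x) (ev cs y) ⟩
  x * (ev cs x - ev cs y) + (x - y) * ev cs y ≈⟨ +-congʳ (*-congˡ e) ⟩
  x * ((x - y) * q) + (x - y) * ev cs y ≈⟨ solve 4 (λ x y q p → x :* ((x :- y) :* q) :+ (x :- y) :* p := (x :- y) :* (x :* q :+ p)) refl x y q (ev cs y) ⟩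
  (x - y) * (x * q + ev cs y) ∎)
  where open ≈R

 ev-ι : ∀ cs r → ev cs (ι r) ≈ ι (evZ cs r)
 ev-ι [] r = sym ι-0
 ev-ι (c ∷ cs) r = trans (+-congˡ (trans (*-congˡ (ev-ι cs r)) (sym (ι-* r (evZ cs r))))) (sym (ι-+ c _))

module NormFacts (𝓡 : NumberRing) where
 open NumberRingProps 𝓡 public
 open Eigen 𝓡 public

 -- m is the least positive integer in the ideal (a).
 record Norm (a : Carrier) : Set where
  field
   m : ℕ
   m≥1 : 1 ≤ m
   cof : Carrier
   a*cof : a * cof ≈ ι (+ m)
   prim : ∀ p → Prime p → p ∣ℕ m → ¬ Div (+ p) cof

 -- Minimality yields `prim`: if p divided both m and the cofactor, m / p would be a smaller
 -- positive integer in (a).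
 norm : ∀ a → ¬ (a ≈ 0#) → ¬ ¬ Norm a
 norm a a≉0 = ¬¬-bind (inv a a≉0) λ { (z , z≢0 , y , ay) → ¬¬-bind (least P ∣ z ∣ (begin-with z z≢0 y ay)) λ { (m , (m≥1 , b , ab) , min) k →
   k (record { m = m ; m≥1 = m≥1 ; cof = b ; a*cof = ab ; prim = λ { p pr (ND.divides m' e) (c , bc) → min m' (smaller p pr m' m≥1 e)
    (pos m' p m≥1 e , c , cancel {+ p} {a * c} {ι (+ m')} (prime≢0 pr) (begin
     ι (+ p) * (a * c) ≈⟨ solve 3 (λ p a c → p :* (a :* c) := a :* (p :* c)) refl (ι (+ p)) a c ⟩
     a * (ι (+ p) * c) ≈⟨ *-congˡ bc ⟨
     a * b ≈⟨ ab ⟩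
     ι (+ m) ≈⟨ trans (ι-cong (Eq.trans (cong +_ (Eq.trans e (NP.*-comm m' p))) (ZP.pos-* p m'))) (ι-* (+ p) (+ m')) ⟩
     ι (+ p) * ι (+ m') ∎)) } }) } }
  where
  open ≈R
  P : ℕ → Set
  P m = 1 ≤ m × Σ Carrier λ b → a * b ≈ ι (+ m)
  begin-with : ∀ z → z ≢ 0ℤ → ∀ y → a * y ≈ ι z → P ∣ z ∣
  begin-with (+ zero) z≢0 y e = ⊥-elim (z≢0 Eq.refl)
  begin-with (+ suc n) z≢0 y e = s≤s z≤n , y , e
  begin-with -[1+ n ] z≢0 y e = s≤s z≤n , ι -1ℤ * y , trans (solve 2 (λ a y → a :* (con -1ℤ :* y) := con -1ℤ :* (a :* y)) refl a y)
   (trans (*-congˡ e) (trans (sym (ι-* -1ℤ -[1+ n ])) (ι-cong (ZP.-1*i≡-i -[1+ n ]))))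
  pos : ∀ {m} m' p → 1 ≤ m → m ≡ m' N.* p → 1 ≤ m'
  pos zero p h e = ⊥-elim (<⇒≱ h (≤-reflexive e))
  pos (suc _) p h e = s≤s z≤n
  smaller : ∀ {m} p → Prime p → ∀ m' → 1 ≤ m → m ≡ m' N.* p → m' < m
  smaller p pr m' h e = <-≤-trans (NP.m<m*n m' p {{>-nonZero (pos m' p h e)}} (prime≥2 pr)) (≤-reflexive (Eq.sym e))

 ι-inj : ∀ n → ι n ≈ 0# → n ≡ 0ℤ
 ι-inj n h = cong V.head (indep (n ∷ 0v) (trans (ι-vec n) h))
  where
  ι-vec : ∀ n → vec (n ∷ 0v) ≈ ι n
  ι-vec n = trans (+-cong (*-identityʳ (ι n)) (lin-0 e)) (+-identityʳ (ι n))

 private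
  ι-vec : ∀ n → vec (n ∷ 0v) ≈ ι n
  ι-vec n = trans (+-cong (*-identityʳ (ι n)) (lin-0 e)) (+-identityʳ (ι n))

 -- a = (C+1)A + η with ‖η‖ ≤ A has an inverse of size O(1/A), so its multiples that are integers are ≫ A.
 norm-lower : ∀ A η → ‖ η ‖ ≤ A → ∀ a → a ≈ ι (+ (suc C N.* A)) + vec η → (ν : Norm a) → A ≤ Δ N.* Δ N.* Norm.m ν
 norm-lower A η ηA a ea ν = final ‖ β ‖ C (Δ N.* Δ) Δ m ‖β‖≥1 (≤-trans (≤-reflexive (Eq.sym (Eq.trans (‖·‖-≡ k β) (cong (N._* ‖ β ‖) ∣k∣)))) bound) Δ≥1
  where
  open Norm ν
  β = fst (span cof)
  k = + Δ Z.* + (suc C N.* A)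
  ∣k∣ : ∣ k ∣ ≡ Δ N.* (suc C N.* A)
  ∣k∣ = ZP.abs-* (+ Δ) (+ (suc C N.* A))
  γ = fst (mult η β)
  β≢0 : β ≢ 0v
  β≢0 e0 = <⇒≱ m≥1 (≤-reflexive (ZP.+-injective (ι-inj (+ m) (trans (sym a*cof) (trans (*-congˡ cof≈0) (zeroʳ a))))))
   where
   cof≈0 : cof ≈ 0#
   cof≈0 = torsion (+ Δ) cof Δ≢0 (trans (snd (span cof)) (trans (reflexive (cong vec e0)) (lin-0 basis)))
  ‖β‖≥1 : 1 ≤ ‖ β ‖
  ‖β‖≥1 with ‖ β ‖ in eq
  ... | zero = ⊥-elim (β≢0 (‖‖-0 β eq))
  ... | suc _ = s≤s z≤n
  t = + (Δ N.* Δ N.* m)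
  main : k ·v β ≡ (t ∷ 0v) -v γ
  main = vec-inj (begin
   vec (k ·v β) ≈⟨ lin-· k β basis ⟩
   ι k * vec β ≈⟨ *-cong (ι-* (+ Δ) (+ (suc C N.* A))) (sym (snd (span cof))) ⟩
   δ * c * (δ * cof) ≈⟨ solve 4 (λ d c b h → d :* c :* (d :* b) := d :* ((c :+ h) :* (d :* b)) :- d :* (h :* (d :* b))) refl δ c cof (vec η) ⟩
   δ * ((c + vec η) * (δ * cof)) - δ * (vec η * (δ * cof)) ≈⟨ +-cong (*-congˡ (*-congʳ (sym ea))) (-‿cong (trans (*-congˡ (*-congˡ (snd (span cof)))) (fst (snd (mult η β))))) ⟩
   δ * (a * (δ * cof)) - vec γ ≈⟨ +-congʳ (solve 3 (λ d a b → d :* (a :* (d :* b)) := d :* d :* (a :* b)) refl δ a cof) ⟩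
   δ * δ * (a * cof) - vec γ ≈⟨ +-congʳ (trans (*-cong (sym (ι-* (+ Δ) (+ Δ))) a*cof) (sym (ι-* (+ Δ Z.* + Δ) (+ m)))) ⟩
   ι (+ Δ Z.* + Δ Z.* + m) - vec γ ≈⟨ +-congʳ (ι-cong (Eq.trans (cong (Z._* + m) (Eq.sym (ZP.pos-* Δ Δ))) (Eq.sym (ZP.pos-* (Δ N.* Δ) m)))) ⟩
   ι t - vec γ ≈⟨ +-congʳ (ι-vec t) ⟨
   vec (t ∷ 0v) - vec γ ≈⟨ lin-- (t ∷ 0v) γ basis ⟨
   vec ((t ∷ 0v) -v γ) ∎)
   where
   open ≈R
   c = ι (+ (suc C N.* A))
  bound : ‖ k ·v β ‖ ≤ Δ N.* Δ N.* m N.+ C N.* (A N.* ‖ β ‖)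
  bound = ≤-trans (≤-reflexive (cong ‖_‖ main)) (≤-trans (‖+‖ (t ∷ 0v) (-1ℤ ·v γ)) (+-mono-≤
   (≤-reflexive (Eq.trans (cong (∣ t ∣ ⊔_) (‖0‖ M')) (NP.⊔-identityʳ ∣ t ∣)))
   (≤-trans (‖·‖ -1ℤ γ) (≤-trans (≤-reflexive (NP.+-identityʳ ‖ γ ‖)) (≤-trans (snd (snd (mult η β))) (*-monoʳ-≤ C (*-monoˡ-≤ ‖ β ‖ ηA)))))))
  final : ∀ B c D d m → 1 ≤ B → d N.* (suc c N.* A) N.* B ≤ D N.* m N.+ c N.* (A N.* B) → 1 ≤ d → A ≤ D N.* m
  final B c D d m B≥1 h d≥1 = ≤-trans (m≤m*n A B {{>-nonZero B≥1}}) (NP.+-cancelʳ-≤ (c N.* (A N.* B)) (A N.* B) (D N.* m)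
   (≤-trans (≤-reflexive (lemma A B c)) (≤-trans (*-monoˡ-≤ B (m≤n*m (suc c N.* A) d {{>-nonZero d≥1}})) h)))
   where
   lemma : ∀ A B c → A N.* B N.+ c N.* (A N.* B) ≡ suc c N.* A N.* B
   lemma = solve-∀

 -- Consider the x for which p ^ k divides x b. They include all Δ α x, but among the integers only
 -- multiples of p ^ k, since p does not divide b. Even after multiplication by Δ about p ^ k / Δ
 -- integers stay incongruent, and `liouville` applies.
 prime-power-bound : ∀ {p} → Prime p → ∀ k α s → ‖ α ‖ ≤ s → α ≢ 0v → ∀ b → Div (+ (p ^ k)) (vec α * b) → ¬ Div (+ p) b →
  p ^ k ≤ suc (suc (2 N.* (C N.* s)) ^ M) N.* Δ
 prime-power-bound {p} pr k α s αs α≢0 b ab ¬b = ≤-trans (<⇒≤ (<-÷ (p ^ k) Δ Δ≥1)) (*-monoˡ-≤ Δ (s≤s (≤-trans (≤-reflexive (Eq.sym (length-upTo L)))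
  (liouville α s αs α≢0 J (λ e → Div-≈ (*-congʳ e)) Jα (upTo L) (Uniq.upTo⁺ L) (λ i → ι (+ i)) sep))))
  where
  L = p ^ k ÷ Δ
  J : Carrier → Set
  J x = Div (+ (p ^ k)) (x * b)
  Jα : ∀ x → J (δ * (vec α * x))
  Jα x = Div-≈ (solve 4 (λ d a x b → d :* x :* (a :* b) := d :* (a :* x) :* b) refl δ (vec α) x b) (Div-* (δ * x) ab)
  sep : ∀ {i i'} → i ∈ upTo L → i' ∈ upTo L → J (δ * (ι (+ i) - ι (+ i'))) → i ≡ i'
  sep {i} {i'} m m' h = ZP.+-injective (ZP.i-j≡0⇒i≡j (+ i) (+ i') (ZP.∣i∣≡0⇒i≡0 (small ∣ + i Z.- + i' ∣ (∣pos-diff∣ (∈-upTo⁻ m) (∈-upTo⁻ m'))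
    (subst (p ^ k ∣ℕ_) (ZP.abs-* (+ Δ) (+ i Z.- + i')) (∣⇒∣ᵤ (Div-power pr k (+ Δ Z.* (+ i Z.- + i')) b ¬b (Div-≈ (*-congʳ (begin
     δ * (ι (+ i) - ι (+ i')) ≈⟨ *-congˡ (+-congˡ (ι-neg (+ i'))) ⟨
     δ * (ι (+ i) + ι (Z.- + i')) ≈⟨ *-congˡ (ι-+ (+ i) (Z.- + i')) ⟨
     δ * ι (+ i Z.- + i') ≈⟨ ι-* (+ Δ) (+ i Z.- + i') ⟨
     ι (+ Δ Z.* (+ i Z.- + i')) ∎)) h)))))))
   where
   open ≈R
   small : ∀ d → d < L → p ^ k ∣ℕ Δ N.* d → d ≡ 0
   small zero lt dv = Eq.refl
   small (suc d) lt dv = ⊥-elim (<⇒≱ (<-≤-trans (NP.*-monoʳ-< Δ {{>-nonZero Δ≥1}} lt) (≤-trans (≤-reflexive (NP.*-comm Δ L)) (÷-≤ (p ^ k) Δ)))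
    (ND.∣⇒≤ {{>-nonZero (*-mono-≤ Δ≥1 (s≤s (z≤n {d})))}} dv))

list-to-vec : ∀ {A : Set} (F : List A) → Unique F → ∀ {k} → length F ≡ k →
 Σ (Vec A k) λ v → (∀ i → lookup v i ∈ F) × (∀ i j → j ≢ i → lookup v j ≢ lookup v i)
list-to-vec [] u Eq.refl = [] , (λ ()) , (λ ())
list-to-vec (x ∷ F) (px ∷ u) {suc k} e with list-to-vec F u (suc-injective e)
... | v , mem , dis = x ∷ v , mem' , dis'
 where
 mem' : ∀ i → lookup (x ∷ v) i ∈ x ∷ F
 mem' zero = here Eq.refl
 mem' (suc i) = there (mem i)
 dis' : ∀ i j → j ≢ i → lookup (x ∷ v) j ≢ lookup (x ∷ v) i
 dis' zero zero h = ⊥-elim (h Eq.refl)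
 dis' zero (suc j) h = λ e → All.lookup px (mem j) (Eq.sym e)
 dis' (suc i) zero h = All.lookup px (mem i)
 dis' (suc i) (suc j) h = dis i j (λ e → h (cong suc e))

module Packing (𝓡 : NumberRing) where
 open NormFacts 𝓡 public

 -- The factors of the product over j ≠ i are cancelled one by one, s counting those still present.
 -- Letting K depend on s covers both a cancellation without loss and one that loses a fixed power
 -- of p per factor.
 skip-elim : ∀ {m} (h : Carrier → Carrier) (b : Carrier) (K : ℕ → Carrier → Set) → (∀ {s t t'} → t ≈ t' → K s t → K s t') →
  (i : Fin (suc m)) (as : Vec Carrier (suc m)) → (∀ j → j ≢ i → ∀ s t → K (suc s) (h (lookup as j) * t) → ¬ ¬ K s t) →
  ∀ s → K (m N.+ s) (skip i h as * b) → ¬ ¬ K s b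
 skip-elim {m} h b K resp i as step s kb = go i as step s kb
  where
  prodV-elim : ∀ {m} (as : Vec Carrier m) → (∀ j → ∀ s t → K (suc s) (h (lookup as j) * t) → ¬ ¬ K s t) → ∀ s → K (m N.+ s) (prodV h as * b) → ¬ ¬ K s b
  prodV-elim [] step s kb k = k (resp (*-identityˡ b) kb)
  prodV-elim (a ∷ as) step s kb k = step zero _ _ (resp (*-assoc (h a) (prodV h as) b) kb) λ kb' → prodV-elim as (λ j → step (suc j)) s kb' k
  go : ∀ {m} (i : Fin (suc m)) (as : Vec Carrier (suc m)) → (∀ j → j ≢ i → ∀ s t → K (suc s) (h (lookup as j) * t) → ¬ ¬ K s t) →
   ∀ s → K (m N.+ s) (skip i h as * b) → ¬ ¬ K s b
  go zero (a ∷ as) step s kb = prodV-elim as (λ j → step (suc j) (λ ())) s kb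
  go {suc m} (suc i) (a ∷ as) step s kb k = step zero (λ ()) _ _ (resp (*-assoc (h a) (skip i h as) b) kb)
   λ kb' → go i as (λ j j≢i → step (suc j) (λ { Eq.refl → j≢i Eq.refl })) s kb' k

 module Mod (c : Carrier) (p : ℕ) where
  J : Carrier → Set
  J t = Σ Carrier λ u → Σ Carrier λ v → t ≈ c * u + ι (+ p) * v

  J-resp : ∀ {s t} → s ≈ t → J s → J t
  J-resp e (u , v , h) = u , v , trans (sym e) h

  J-+ : ∀ {s t} → J s → J t → J (s + t)
  J-+ (u , v , h) (u' , v' , h') = u + u' , v + v' , trans (+-cong h h')
   (solve 6 (λ c p u v u' v' → c :* u :+ p :* v :+ (c :* u' :+ p :* v') := c :* (u :+ u') :+ p :* (v :+ v')) refl c (ι (+ p)) u v u' v')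

  J-* : ∀ s {t} → J t → J (s * t)
  J-* s (u , v , h) = s * u , s * v , trans (*-congˡ h) (solve 5 (λ s c p u v → s :* (c :* u :+ p :* v) := c :* (s :* u) :+ p :* (s :* v)) refl s c (ι (+ p)) u v)

  J-c : ∀ s → J (c * s)
  J-c s = s , 0# , sym (trans (+-congˡ (zeroʳ (ι (+ p)))) (+-identityʳ (c * s)))

  J-p : ∀ s → J (ι (+ p) * s)
  J-p s = 0# , s , sym (trans (+-congʳ (zeroʳ c)) (+-identityˡ (ι (+ p) * s)))

  J-coprime : Prime p → ∀ {n t} → ¬ (+ p ∣ᶻ n) → J (ι n * t) → J t
  J-coprime pr {n} {t} ¬d h = let (u , v , e) = prime-bezout n pr ¬d in J-resp (begin
    ι u * (ι n * t) + ι (+ p) * (ι v * t) ≈⟨ solve 5 (λ u n v p t → u :* (n :* t) :+ p :* (v :* t) := (u :* n :+ v :* p) :* t) refl (ι u) (ι n) (ι v) (ι (+ p)) t ⟩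
    (ι u * ι n + ι v * ι (+ p)) * t ≈⟨ *-congʳ (trans (+-cong (sym (ι-* u n)) (sym (ι-* v (+ p)))) (sym (ι-+ (u Z.* n) (v Z.* + p)))) ⟩
    ι (u Z.* n Z.+ v Z.* + p) * t ≈⟨ *-congʳ (trans (ι-cong e) ι-1) ⟩
    1# * t ≈⟨ *-identityˡ t ⟩
    t ∎) (J-+ (J-* (ι u) h) (J-p (ι v * t)))
   where open ≈R

  J-int : Prime p → ¬ J 1# → ∀ {n} → J (ι n) → + p ∣ᶻ n
  J-int pr ¬1 {n} h with + p ∣ᶻ? n
  ... | yes d = d
  ... | no ¬d = ⊥-elim (¬1 (J-coprime pr ¬d (J-resp (sym (*-identityʳ (ι n))) h)))

  cancel-mod : J 1# → ∀ t → Div (+ p) (c * t) → Div (+ p) t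
  cancel-mod (u , v , h) t d = Div-≈ (begin
   u * (c * t) + ι (+ p) * (v * t) ≈⟨ solve 5 (λ u c t p v → u :* (c :* t) :+ p :* (v :* t) := (c :* u :+ p :* v) :* t) refl u c t (ι (+ p)) v ⟩
   (c * u + ι (+ p) * v) * t ≈⟨ *-congʳ h ⟨
   1# * t ≈⟨ *-identityˡ t ⟩
   t ∎) (Div-+ (Div-* u d) (Div-self (+ p) (v * t)))
   where open ≈R

 Invertible : Carrier → ℕ → Set
 Invertible c p = ¬ ¬ Mod.J c p 1#

 private
  ι-sub : ∀ a b → ι (a Z.- b) ≈ ι a - ι b
  ι-sub a b = trans (ι-+ a (Z.- b)) (+-congˡ (ι-neg b))

  p^1 : ∀ {p t} → Div (+ (p ^ 1)) t → Div (+ p) t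
  p^1 {p} {t} = subst (λ z → Div (+ z) t) (NP.*-identityʳ p)

  p^1⁻ : ∀ {p t} → Div (+ p) t → Div (+ (p ^ 1)) t
  p^1⁻ {p} {t} = subst (λ z → Div (+ z) t) (Eq.sym (NP.*-identityʳ p))

 -- If γ and p generated a proper ideal, the integers 0, ..., p - 1 would be incongruent modulo it,
 -- against the index bound of `liouville`.
 invertible1 : ∀ {p} → Prime p → ¬ (+ p ∣ᶻ + Δ) → ∀ γ σ → ‖ γ ‖ ≤ σ → γ ≢ 0v → suc (2 N.* (C N.* σ)) ^ M < p → Invertible (vec γ) p
 invertible1 {p} pr ¬Δ γ σ γσ γ≢0 big ¬1 = <⇒≱ big (≤-trans (≤-reflexive (Eq.sym (length-upTo p)))
  (liouville γ σ γσ γ≢0 J J-resp (λ x → J-* δ (J-c x)) (upTo p) (Uniq.upTo⁺ p) (λ i → ι (+ i))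
   (λ {i} {i'} m m' h → small-∣ (∈-upTo⁻ m) (∈-upTo⁻ m') (J-int pr ¬1 (J-resp (sym (ι-sub (+ i) (+ i'))) (J-coprime pr ¬Δ h))))))
  where open Mod (vec γ) p

 module TwoRoots {n : ℕ} (g : Vec ℤ (suc n)) (x y z : Carrier) (D0 : ℤ)
  (gx : VecEval.evv R (g ∷ʳ 1ℤ) x ≈ 0#) (gy : VecEval.evv R (g ∷ʳ 1ℤ) y ≈ 0#) (xyz : (x - y) * z ≈ ι D0) where
  open Roots g
  open PolyDiff R

  -- If both x and y are congruent to integers r and s modulo a proper ideal above p, then r and s are two roots of g modulo p.
  invertible2 : ∀ {p} → Prime p → ¬ (+ p ∣ᶻ + Δ) → ¬ (+ p ∣ᶻ D0) → length (roots p) ≤ 1 → ∀ γ σ → ‖ γ ‖ ≤ σ → γ ≢ 0v →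
   suc (2 N.* (C N.* σ)) ^ M < p N.* p → Invertible (vec γ) p
  invertible2 {p} pr ¬Δ ¬D0 few γ σ γσ γ≢0 big ¬1 = lem (Σ ℤ λ r → J (x - ι r)) λ where
    (no none) → index x (λ r h → none (r , h))
    (yes (r , xr)) → lem (Σ ℤ λ s → J (y - ι s)) λ where
     (no none) → index y (λ s h → none (s , h))
     (yes (s , ys)) → two-roots r s xr ys
   where
   open Mod (vec γ) p
   p≥1 = prime≥1 pr
   instance
    p-nonZero : NonZero p
    p-nonZero = >-nonZero p≥1
   root-mod : ∀ t → VecEval.evv R G t ≈ 0# → ∀ r → J (t - ι r) → + p ∣ᶻ eval G r
   root-mod t gt r h = J-int pr ¬1 (J-resp (begin
     (- fst d) * (t - ι r) ≈⟨ solve 2 (λ q e → (:- q) :* e := con -1ℤ :* (e :* q)) refl (fst d) (t - ι r) ⟩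
     ι -1ℤ * ((t - ι r) * fst d) ≈⟨ *-congˡ (snd d) ⟨
     ι -1ℤ * (PolyEval.ev R (toList G) t - PolyEval.ev R (toList G) (ι r)) ≈⟨ *-congˡ (+-cong (trans gt (sym ι-0)) (-‿cong (ev-ι (toList G) r))) ⟩
     ι -1ℤ * (ι 0ℤ - ι (eval G r)) ≈⟨ solve 1 (λ e → con -1ℤ :* (con 0ℤ :- e) := e) refl (ι (eval G r)) ⟩
     ι (eval G r) ∎) (J-* (- fst d) h))
    where
    open ≈R
    d = ev-diff (toList G) t (ι r)
   reduce-rep : ∀ t r → J (t - ι r) → J (t - ι (+ (r %ℕ p)))
   reduce-rep t r h = J-resp (begin
     (t - ι r) + ι (+ p) * ι q ≈⟨ +-congˡ (ι-* (+ p) q) ⟨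
     (t - ι r) + ι (+ p Z.* q) ≈⟨ +-congʳ (+-congˡ (-‿cong (ι-cong (a≡a%ℕn+[a/ℕn]*n r p)))) ⟩
     (t - ι (+ (r %ℕ p) Z.+ q Z.* + p)) + ι (+ p Z.* q) ≈⟨ +-cong (+-congˡ (-‿cong (ι-+ (+ (r %ℕ p)) (q Z.* + p)))) (ι-cong (ZP.*-comm (+ p) q)) ⟩
     (t - (ι (+ (r %ℕ p)) + ι (q Z.* + p))) + ι (q Z.* + p) ≈⟨ solve 3 (λ t r q → (t :- (r :+ q)) :+ q := t :- r) refl t (ι (+ (r %ℕ p))) (ι (q Z.* + p)) ⟩
     t - ι (+ (r %ℕ p)) ∎) (J-+ h (J-p (ι q)))
    where
    open ≈R
    q = r /ℕ p
   two-roots : ∀ r s → J (x - ι r) → J (y - ι s) → ⊥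
   two-roots r s xr ys = different (≡-from-few few (roots⁺ (n%ℕd<d r p) (root-mod x gx (+ (r %ℕ p)) xr')) (roots⁺ (n%ℕd<d s p) (root-mod y gy (+ (s %ℕ p)) ys')))
    where
    xr' = reduce-rep x r xr
    ys' = reduce-rep y s ys
    ≡-from-few : ∀ {A : Set} {l : List A} → length l ≤ 1 → ∀ {a b} → a ∈ l → b ∈ l → a ≡ b
    ≡-from-few {l = _ ∷ []} _ (here Eq.refl) (here Eq.refl) = Eq.refl
    ≡-from-few {l = _ ∷ _ ∷ _} (s≤s ()) _ _
    -- A common residue of x and y would put (x - y) z = D0 into the ideal, so that p would divide
    -- D0.
    different : r %ℕ p ≢ s %ℕ p
    different e = ¬D0 (J-int pr ¬1 (J-resp (begin
      z * ((x - ι (+ (r %ℕ p))) + ι -1ℤ * (y - ι (+ (s %ℕ p)))) ≈⟨ *-congˡ (+-congˡ (*-congˡ (+-congˡ (-‿cong (ι-cong (cong +_ (Eq.sym e))))))) ⟩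
      z * ((x - ι (+ (r %ℕ p))) + ι -1ℤ * (y - ι (+ (r %ℕ p)))) ≈⟨ solve 4 (λ z x y r → z :* ((x :- r) :+ con -1ℤ :* (y :- r)) := (x :- y) :* z) refl z x y (ι (+ (r %ℕ p))) ⟩
      (x - y) * z ≈⟨ xyz ⟩
      ι D0 ∎) (J-* z (J-+ xr' (J-* (ι -1ℤ) ys')))))
     where open ≈R
   -- When θ is congruent to no integer, the p² elements i + jθ with i, j < p are pairwise
   -- incongruent, exceeding the index bound.
   index : ∀ θ → (∀ r → ¬ J (θ - ι r)) → ⊥
   index θ none = <⇒≱ big (≤-trans (≤-reflexive (Eq.sym (Eq.trans (length-cart _,_ (upTo p) (upTo p)) (cong₂ N._*_ (length-upTo p) (length-upTo p)))))
    (liouville γ σ γσ γ≢0 J J-resp (λ t → J-* δ (J-c t)) (cartesianProduct (upTo p) (upTo p)) (Uniq.cartesianProduct⁺ (Uniq.upTo⁺ p) (Uniq.upTo⁺ p)) f sep))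
    where
    f : ℕ × ℕ → Carrier
    f (i , j) = ι (+ i) + ι (+ j) * θ
    sep : ∀ {a b} → a ∈ cartesianProduct (upTo p) (upTo p) → b ∈ cartesianProduct (upTo p) (upTo p) → J (δ * (f a - f b)) → a ≡ b
    sep {i , j} {i' , j'} ma mb h = cong₂ _,_ i≡ j≡
     where
     open ≈R
     ia = ∈-cartesianProduct⁻ (upTo p) (upTo p) ma
     ib = ∈-cartesianProduct⁻ (upTo p) (upTo p) mb
     di = + i Z.- + i'
     dj = + j Z.- + j'
     h' : J (ι di + ι dj * θ)
     h' = J-resp (trans (solve 5 (λ i i' j j' t → (i :+ j :* t) :- (i' :+ j' :* t) := (i :- i') :+ (j :- j') :* t) refl (ι (+ i)) (ι (+ i')) (ι (+ j)) (ι (+ j')) θ)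
      (+-cong (sym (ι-sub (+ i) (+ i'))) (*-congʳ (sym (ι-sub (+ j) (+ j')))))) (J-coprime pr ¬Δ h)
     dj∣ : + p ∣ᶻ dj
     dj∣ with + p ∣ᶻ? dj
     ... | yes d = d
     ... | no ¬d = let (u , v , e) = prime-bezout dj pr ¬d in ⊥-elim (none (Z.- (u Z.* di)) (J-resp (begin
        ι u * (ι di + ι dj * θ) + ι (+ p) * (ι v * θ) ≈⟨ solve 6 (λ u i j t p v → u :* (i :+ j :* t) :+ p :* (v :* t) := u :* i :+ (u :* j :+ v :* p) :* t) refl (ι u) (ι di) (ι dj) θ (ι (+ p)) (ι v) ⟩
        ι u * ι di + (ι u * ι dj + ι v * ι (+ p)) * θ ≈⟨ +-cong (sym (ι-* u di)) (*-congʳ (trans (+-cong (sym (ι-* u dj)) (sym (ι-* v (+ p)))) (trans (sym (ι-+ (u Z.* dj) (v Z.* + p))) (ι-cong e)))) ⟩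
        ι (u Z.* di) + ι 1ℤ * θ ≈⟨ solve 2 (λ a t → a :+ con 1ℤ :* t := t :- (:- a)) refl (ι (u Z.* di)) θ ⟩
        θ - (- ι (u Z.* di)) ≈⟨ +-congˡ (-‿cong (ι-neg (u Z.* di))) ⟨
        θ - ι (Z.- (u Z.* di)) ∎) (J-+ (J-* (ι u) h') (J-p (ι v * θ)))))
     j≡ : j ≡ j'
     j≡ = small-∣ (∈-upTo⁻ (snd ia)) (∈-upTo⁻ (snd ib)) dj∣
     i≡ : i ≡ i'
     i≡ = small-∣ (∈-upTo⁻ (fst ia)) (∈-upTo⁻ (fst ib)) (J-int pr ¬1 (J-resp (begin
      ι di + ι dj * θ ≈⟨ +-congˡ (*-congʳ (trans (ι-cong (Eq.trans (cong (λ j → + j Z.- + j') j≡) (ZP.+-inverseʳ (+ j')))) ι-0)) ⟩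
      ι di + 0# * θ ≈⟨ trans (+-congˡ (zeroˡ θ)) (+-identityʳ (ι di)) ⟩
      ι di ∎) h'))

 -- `eigen` with k = 1: the differences are invertible modulo p, so cancelling them would leave p
 -- dividing some bᵢ.
 packed : ∀ {p} → Prime p → (as bs : Vec Carrier (suc M)) → (∀ i → Div (+ p) (lookup as i * lookup bs i)) → (∀ i → ¬ Div (+ p) (lookup bs i)) →
  (∀ i j → j ≢ i → Invertible (lookup as j - lookup as i) p) → ⊥
 packed {p} pr as bs ab ¬b invt = eigen pr 1 as bs (λ i → p^1⁻ (ab i)) (λ i d →
  skip-elim (λ z → z - lookup as i) (lookup bs i) (λ _ t → Div (+ p) t) Div-≈ i as
   (λ j j≢i s t dt k → invt i j j≢i (λ one → k (Mod.cancel-mod (lookup as j - lookup as i) p one t dt))) 0 (p^1 d) (¬b i))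

 -- Dividing by an integer 0 < |n| < p^(e+1) loses at most p^e.
 Div-integer : ∀ {p} → Prime p → ∀ e l n t → n ≢ 0ℤ → ∣ n ∣ < p ^ suc e → Div (+ (p ^ (e N.+ l))) (ι n * t) → Div (+ (p ^ l)) t
 Div-integer {p} pr e l n t n≢0 lt d with + p ∣ᶻ? n
 ... | no ¬d = weaken e (Div-coprime (prime-power-bezout n (e N.+ l) pr ¬d) d)
  where
  weaken : ∀ e → Div (+ (p ^ (e N.+ l))) t → Div (+ (p ^ l)) t
  weaken e (c , h) = ι (+ (p ^ e)) * c , trans h (trans (*-congʳ (trans (ι-cong (Eq.trans (cong +_ (Eq.trans (cong (p ^_) (NP.+-comm e l)) (^-distribˡ-+-* p l e))) (ZP.pos-* (p ^ l) (p ^ e)))) (ι-* _ _))) (*-assoc _ _ c))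
 Div-integer {p} pr zero l n t n≢0 lt d | yes p∣n = ⊥-elim (<⇒≱ lt (≤-trans (≤-reflexive (NP.*-identityʳ p)) (ND.∣⇒≤ {{>-nonZero (∣i∣≥1 n≢0)}} (∣⇒∣ᵤ p∣n))))
 Div-integer {p} pr (suc e) l n t n≢0 lt (c , h) | yes (divides n' Eq.refl) = Div-integer pr e l n' t (λ { Eq.refl → n≢0 Eq.refl })
   (NP.*-cancelʳ-< p ∣ n' ∣ (p ^ suc e) (≤-trans (≤-reflexive (cong suc (Eq.sym (ZP.abs-* n' (+ p))))) (≤-trans lt (≤-reflexive (NP.*-comm p (p ^ suc e))))))
   (c , cancel (prime≢0 pr) (begin
    ι (+ p) * (ι n' * t) ≈⟨ solve 3 (λ p n t → p :* (n :* t) := n :* p :* t) refl (ι (+ p)) (ι n') t ⟩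
    ι n' * ι (+ p) * t ≈⟨ *-congʳ (ι-* n' (+ p)) ⟨
    ι (n' Z.* + p) * t ≈⟨ h ⟩
    ι (+ (p N.* p ^ (e N.+ l))) * c ≈⟨ *-congʳ (trans (ι-cong (ZP.pos-* p (p ^ (e N.+ l)))) (ι-* (+ p) _)) ⟩
    ι (+ p) * ι (+ (p ^ (e N.+ l))) * c ≈⟨ *-assoc _ _ c ⟩
    ι (+ p) * (ι (+ (p ^ (e N.+ l))) * c) ∎))
  where
  open ≈R

 -- The M differences met for each i are nonzero integers below p ^ (e + 1), each costing at most p
 -- ^ e. Starting from p ^ (M e + 1), one factor p survives and would divide bᵢ.
 on-a-line : ∀ {p} → Prime p → ∀ e (ts : Vec ℤ (suc M)) (as bs : Vec Carrier (suc M)) →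
  (∀ i j → lookup as j - lookup as i ≈ ι (lookup ts j Z.- lookup ts i)) →
  (∀ i → Div (+ (p ^ (M N.* e N.+ 1))) (lookup as i * lookup bs i)) → (∀ i → ¬ Div (+ p) (lookup bs i)) →
  (∀ i j → j ≢ i → lookup ts j Z.- lookup ts i ≢ 0ℤ × ∣ lookup ts j Z.- lookup ts i ∣ < p ^ suc e) → ⊥
 on-a-line {p} pr e ts as bs diff ab ¬b close = eigen pr (M N.* e N.+ 1) as bs ab (λ i d →
  skip-elim (λ z → z - lookup as i) (lookup bs i) (λ s t → Div (+ (p ^ (s N.* e N.+ 1))) t) Div-≈ i as
   (λ j j≢i s t dt k → k (Div-integer pr e (s N.* e N.+ 1) (lookup ts j Z.- lookup ts i) t (fst (close i j j≢i)) (snd (close i j j≢i))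
    (Div-≈ (*-congʳ (diff i j)) (subst (λ z → Div (+ (p ^ z)) ((lookup as j - lookup as i) * t)) (NP.+-assoc e (s N.* e) 1) dt)))) 0
   (subst (λ z → Div (+ (p ^ (z N.* e N.+ 1))) (skip i (λ z → z - lookup as i) as * lookup bs i)) (Eq.sym (NP.+-identityʳ M)) d)
   (λ b0 → ¬b i (p^1 b0)))

-- Counting prime factors of norms over a box

same-cell : ∀ {i j q} → 1 ≤ q → i ÷ q ≡ j ÷ q → ∣ + i Z.- + j ∣ < q
same-cell {i} {j} {q} q≥1 e = subst (_< q) (Eq.sym (cong ∣_∣ (ZP.m-n≡m⊖n i j))) (bound i j e)
 where
 half : ∀ i j → i ≤ j → i ÷ q ≡ j ÷ q → j ∸ i < q
 half i j h e = NP.+-cancelˡ-< i (j ∸ i) q (≤-trans (≤-reflexive (cong suc (m+[n∸m]≡n h))) (≤-trans (<-÷ j q q≥1)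
  (≤-trans (≤-reflexive (NP.+-comm q (j ÷ q N.* q))) (+-monoˡ-≤ q (≤-trans (≤-reflexive (cong (N._* q) (Eq.sym e))) (÷-≤ i q))))))
 bound : ∀ i j → i ÷ q ≡ j ÷ q → ∣ i Z.⊖ j ∣ < q
 bound i j e with ≤-total i j
 ... | inj₁ h = subst (_< q) (Eq.sym (ZP.∣⊖∣-≤ h)) (half i j h e)
 ... | inj₂ h = subst (_< q) (Eq.sym (Eq.trans (ZP.∣m⊖n∣≡∣n⊖m∣ i j) (ZP.∣⊖∣-≤ h))) (half j i h (Eq.sym e))

same-cells : ∀ {m q} → 1 ≤ q → (u v : Vec ℕ m) → V.map (_÷ q) u ≡ V.map (_÷ q) v → ‖ toZv u -v toZv v ‖ ≤ q
same-cells q≥1 [] [] e = z≤n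
same-cells q≥1 (a ∷ u) (b ∷ v) e = ⊔-lub
 (≤-trans (≤-reflexive (cong (λ z → ∣ + a Z.+ z ∣) (ZP.-1*i≡-i (+ b)))) (<⇒≤ (same-cell q≥1 (cong V.head e))))
 (same-cells q≥1 u v (cong V.tail e))

cells-∈ : ∀ {A q} → 1 ≤ q → ∀ {m} (u : Vec ℕ m) → VAll.All (_∈ upTo A) u → V.map (_÷ q) u ∈ vecs (upTo (suc (A ÷ q))) m
cells-∈ {A} {q} q≥1 u h = ∈-vecs⁺ (go u h)
 where
 go : ∀ {m} (u : Vec ℕ m) → VAll.All (_∈ upTo A) u → VAll.All (_∈ upTo (suc (A ÷ q))) (V.map (_÷ q) u)
 go [] VAll.[] = VAll.[]
 go (a ∷ u) (p VAll.∷ ps) = ∈-upTo⁺ (s≤s (÷-mono q q≥1 (<⇒≤ (∈-upTo⁻ p)))) VAll.∷ go u ps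

record TwoRootsRing {n : ℕ} (g : Vec ℤ (suc n)) : Set1 where
 field
  𝓡 : NumberRing
 open NumberRing 𝓡
 field
  x y z : Carrier
  D0 : ℤ
  D0≢0 : D0 ≢ 0ℤ
  gx : VecEval.evv R (g ∷ʳ 1ℤ) x ≈ 0#
  gy : VecEval.evv R (g ∷ʳ 1ℤ) y ≈ 0#
  xyz : (x - y) * z ≈ ι D0

module SplitPrimes {n : ℕ} (g : Vec ℤ (suc n)) (𝓣 : TwoRootsRing g) where
 open TwoRootsRing 𝓣
 open Packing 𝓡
 open TwoRoots g x y z D0 gx gy xyz
 open Roots g

 c0 : ℕ
 -- The shift (C + 1) A plus coordinates below A.
 c0 = suc (suc C)

 K : ℕ → ℕ
 K s = suc (2 N.* (C N.* s)) ^ M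

 private
  Div-norm : ∀ {a} (ν : Norm a) q → q ∣ℕ Norm.m ν → Div (+ q) (a * Norm.cof ν)
  Div-norm {a} ν q (ND.divides m' e) = ι (+ m') , trans (Norm.a*cof ν) (trans (ι-cong (Eq.trans (cong +_ (Eq.trans e (NP.*-comm m' q))) (ZP.pos-* q m'))) (ι-* (+ q) (+ m')))

  Invertible-≈ : ∀ {c c' p} → c ≈ c' → Invertible c p → Invertible c' p
  Invertible-≈ e h k = h (λ { (u , v , q) → k (u , v , trans q (+-congʳ (*-congʳ e))) })

  vec-- : ∀ u v → vec u - vec v ≈ vec (u -v v)
  vec-- u v = sym (lin-- u v basis)

 module Box (A : ℕ) (A≥1 : 1 ≤ A) where
  box : List (Vec ℕ M)
  box = vecs (upTo A) M

  -- The shift makes the integer part dominate multiplication by the remaining coordinates, which is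
  -- the hypothesis of `norm-lower`.
  a : Vec ℕ M → Carrier
  a τ = ι (+ (suc C N.* A)) + vec (toZv τ)

  α : Vec ℕ M → Vec ℤ M
  α τ = (+ (suc C N.* A) ∷ 0v) +v toZv τ

  a≈ : ∀ τ → a τ ≈ vec (α τ)
  a≈ τ = sym (trans (lin-+ (+ (suc C N.* A) ∷ 0v) (toZv τ) basis) (+-congʳ (trans (+-cong (*-identityʳ _) (lin-0 e)) (+-identityʳ _))))

  ‖α‖ : ∀ {τ} → τ ∈ box → ‖ α τ ‖ ≤ c0 N.* A
  ‖α‖ {τ} τ∈ = ≤-trans (‖+‖ (+ (suc C N.* A) ∷ 0v) (toZv τ)) (≤-trans (+-mono-≤
   (≤-reflexive (Eq.trans (cong (suc C N.* A ⊔_) (‖0‖ M')) (NP.⊔-identityʳ (suc C N.* A)))) (‖toZv‖ τ τ∈)) (≤-reflexive (NP.+-comm (suc C N.* A) A)))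

  α≢0 : ∀ τ → α τ ≢ 0v
  α≢0 (t ∷ τ) e = <⇒≱ (≤-trans A≥1 (≤-trans (m≤n*m A (suc C)) (m≤m+n (suc C N.* A) t))) (≤-reflexive (ZP.+-injective (cong V.head e)))

  a≉0 : ∀ τ → ¬ (a τ ≈ 0#)
  a≉0 τ h = vec≉0 (α≢0 τ) (trans (sym (a≈ τ)) h)

  a-diff : ∀ τ τ' → a τ - a τ' ≈ vec (toZv τ -v toZv τ')
  a-diff τ τ' = trans (solve 3 (λ k u v → (k :+ u) :- (k :+ v) := u :- v) refl (ι (+ (suc C N.* A))) (vec (toZv τ)) (vec (toZv τ'))) (vec-- (toZv τ) (toZv τ'))

  module WithNorms (μ : Vec ℕ M → ℕ) (νs : ∀ {τ} → τ ∈ box → Σ (Norm (a τ)) λ ν → μ τ ≡ Norm.m ν) where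

   cnt : ℕ → ℕ → ℕ
   cnt p k = ∑ box (λ τ → χ (p ^ suc k ∣ℕ? μ τ))

   μ≥1 : ∀ {τ} → τ ∈ box → 1 ≤ μ τ
   μ≥1 τ∈ = let (ν , e) = νs τ∈ in subst (1 ≤_) (Eq.sym e) (Norm.m≥1 ν)

   power-bound : ∀ {τ} → τ ∈ box → ∀ p k → Prime p → p ^ suc k ∣ℕ μ τ → p ^ suc k ≤ suc (K (c0 N.* A)) N.* Δ
   power-bound {τ} τ∈ p k pr d = let (ν , e) = νs τ∈ in
    prime-power-bound pr (suc k) (α τ) (c0 N.* A) (‖α‖ τ∈) (α≢0 τ) (Norm.cof ν)
     (Div-≈ (*-congʳ (a≈ τ)) (Div-norm ν (p ^ suc k) (subst (p ^ suc k ∣ℕ_) e d)))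
     (Norm.prim ν p pr (ND.∣-trans (ND.m∣m*n (p ^ k)) (subst (p ^ suc k ∣ℕ_) e d)))

   lower : ∀ {τ} → τ ∈ box → A ≤ Δ N.* Δ N.* μ τ
   lower {τ} τ∈ = let (ν , e) = νs τ∈ in subst (λ z → A ≤ Δ N.* Δ N.* z) (Eq.sym e) (norm-lower A (toZv τ) (‖toZv‖ τ τ∈) (a τ) refl ν)

   product-bound : ∀ Z → suc (K (c0 N.* A)) N.* Δ ≤ Z → A ^ (A ^ M) ≤ (Δ N.* Δ) ^ (A ^ M) N.* ∏ (primes Z) (λ p → ∏ (upTo Z) (λ k → p ^ cnt p k))
   product-bound Z Z≥ = begin
    A ^ (A ^ M) ≡⟨ cong (A ^_) (Eq.sym (length-box A M)) ⟩
    A ^ length box ≡⟨ Eq.sym (∏-const box A) ⟩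
    ∏ box (λ _ → A) ≤⟨ ∏-mono box lower ⟩
    ∏ box (λ τ → Δ N.* Δ N.* μ τ) ≡⟨ ∏-* box (λ _ → Δ N.* Δ) μ ⟩
    ∏ box (λ _ → Δ N.* Δ) N.* ∏ box μ ≡⟨ cong (N._* ∏ box μ) (Eq.trans (∏-const box (Δ N.* Δ)) (cong ((Δ N.* Δ) ^_) (length-box A M))) ⟩
    (Δ N.* Δ) ^ (A ^ M) N.* ∏ box μ ≤⟨ *-monoʳ-≤ ((Δ N.* Δ) ^ (A ^ M)) (∏-mono box (λ {τ} τ∈ → pp-bound Z Z (μ τ) (μ≥1 τ∈) (small τ∈))) ⟩
    (Δ N.* Δ) ^ (A ^ M) N.* ∏ box (λ τ → ∏ (primes Z) (λ p → ∏ (upTo Z) (λ k → p ^ χ (p ^ suc k ∣ℕ? μ τ)))) ≡⟨ cong ((Δ N.* Δ) ^ (A ^ M) N.*_) regroup ⟩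
    (Δ N.* Δ) ^ (A ^ M) N.* ∏ (primes Z) (λ p → ∏ (upTo Z) (λ k → p ^ cnt p k)) ∎
    where
    open ≤-Reasoning
    small : ∀ {τ} → τ ∈ box → ∀ p k → Prime p → p ^ suc k ∣ℕ μ τ → p ≤ Z × k < Z
    small τ∈ p k pr d = ≤-trans (m≤m*n p (p ^ k) {{>-nonZero (pow≥1 k (prime≥1 pr))}}) pk≤ , NP.<-trans (n<1+n k) (<-≤-trans (n<p^n (suc k) (prime≥2 pr)) pk≤)
     where
     pk≤ : p ^ suc k ≤ Z
     pk≤ = ≤-trans (power-bound τ∈ p k pr d) Z≥
    regroup : ∏ box (λ τ → ∏ (primes Z) (λ p → ∏ (upTo Z) (λ k → p ^ χ (p ^ suc k ∣ℕ? μ τ)))) ≡ ∏ (primes Z) (λ p → ∏ (upTo Z) (λ k → p ^ cnt p k))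
    regroup = Eq.trans (∏-swap box (primes Z) (λ τ p → ∏ (upTo Z) (λ k → p ^ χ (p ^ suc k ∣ℕ? μ τ)))) (∏-cong (primes Z) (λ {p} _ →
     Eq.trans (∏-swap box (upTo Z) (λ τ k → p ^ χ (p ^ suc k ∣ℕ? μ τ))) (∏-cong (upTo Z) (λ {k} _ → ∏-base box p (λ τ → χ (p ^ suc k ∣ℕ? μ τ))))))

   cnt-zero : ∀ {p} k → Prime p → suc (K (c0 N.* A)) N.* Δ < p ^ suc k → cnt p k ≡ 0
   cnt-zero {p} k pr big = Eq.trans (∑-cong box (λ {τ} τ∈ → χ-no (p ^ suc k ∣ℕ? μ τ) (λ d → <⇒≱ big (power-bound τ∈ p k pr d)))) (Eq.trans (∑-const box 0) (NP.*-zeroʳ (length box)))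

   cnt-mono : ∀ {p} k → cnt p k ≤ cnt p 0
   cnt-mono {p} k = ∑-mono box (λ {τ} _ → χ-mono (p ^ suc k ∣ℕ? μ τ) (p ^ 1 ∣ℕ? μ τ) (λ d → ND.∣-trans (ND.∣-trans (ND.∣-reflexive (NP.*-identityʳ p)) (ND.m∣m*n (p ^ k))) d))

   -- With e = k ÷ M one has M e + 1 ≤ k + 1. By `on-a-line` a segment of length p ^ (e + 1)
   -- therefore contains at most M parameters t whose norm is divisible by p ^ (k + 1).
   line-count : ∀ {p} → Prime p → ∀ k (ε : Vec ℕ M') → ε ∈ vecs (upTo A) M' → ∑ (upTo A) (λ t → χ (p ^ suc k ∣ℕ? μ (t ∷ ε))) ≤ M N.* ((A ÷ p ^ suc (k ÷ M)) N.+ 1)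
   line-count {p} pr k ε ε∈ = begin
    ∑ (upTo A) (λ t → χ (p ^ suc k ∣ℕ? μ (t ∷ ε))) ≡⟨ Eq.sym (length-filter-∑ P? (upTo A)) ⟩
    length L ≤⟨ fibre-count L (upTo (suc (A ÷ q))) (λ t c → t ÷ q ≡ c) (λ t c → t ÷ q N.≟ c) M cover fib ⟩
    length (upTo (suc (A ÷ q))) N.* M ≡⟨ cong (N._* M) (length-upTo (suc (A ÷ q))) ⟩
    suc (A ÷ q) N.* M ≡⟨ Eq.trans (NP.*-comm (suc (A ÷ q)) M) (cong (M N.*_) (NP.+-comm 1 (A ÷ q))) ⟩
    M N.* ((A ÷ q) N.+ 1) ∎
    where
    open ≤-Reasoning
    e' = k ÷ M
    q = p ^ suc e'
    q≥1 = pow≥1 (suc e') (prime≥1 pr)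
    P? : ∀ t → Dec (p ^ suc k ∣ℕ μ (t ∷ ε))
    P? t = p ^ suc k ∣ℕ? μ (t ∷ ε)
    L = filter P? (upTo A)
    cover : ∀ {t} → t ∈ L → ∃ λ c → c ∈ upTo (suc (A ÷ q)) × t ÷ q ≡ c
    cover {t} m = t ÷ q , ∈-upTo⁺ (s≤s (÷-mono q q≥1 (<⇒≤ (∈-upTo⁻ (fst (∈-filter⁻ P? {xs = upTo A} m)))))) , Eq.refl
    fib : ∀ {c} → c ∈ upTo (suc (A ÷ q)) → length (filter (λ t → t ÷ q N.≟ c) L) ≤ M
    fib {c} _ = fibre-by-contradiction (filter (λ t → t ÷ q N.≟ c) L) (Uniq.filter⁺ (λ t → t ÷ q N.≟ c) (Uniq.filter⁺ P? (Uniq.upTo⁺ A))) M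
     {P = λ t → (t ∈ upTo A × p ^ suc k ∣ℕ μ (t ∷ ε)) × t ÷ q ≡ c}
     (λ m → let (m1 , e1) = ∈-filter⁻ (λ t → t ÷ q N.≟ c) {xs = L} m in ∈-filter⁻ P? {xs = upTo A} m1 , e1) contra
     where
     contra : (F : List ℕ) → Unique F → length F ≡ suc M → (∀ {t} → t ∈ F → (t ∈ upTo A × p ^ suc k ∣ℕ μ (t ∷ ε)) × t ÷ q ≡ c) → ⊥
     contra F uF lF prop with list-to-vec F uF lF
     ... | ts , mem , dis = on-a-line pr e' (V.map +_ ts) as bs diff ab ¬b close
      where
      dd : ∀ i → p ^ suc k ∣ℕ μ (lookup ts i ∷ ε)
      dd i = snd (fst (prop (mem i)))
      bx : ∀ i → (lookup ts i ∷ ε) ∈ box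
      bx i = ∈-cartesianProductWith⁺ _∷_ (fst (fst (prop (mem i)))) ε∈
      as = V.map (λ t → a (t ∷ ε)) ts
      bs = V.tabulate (λ i → Norm.cof (fst (νs (bx i))))
      bs≡ : ∀ i → lookup bs i ≡ Norm.cof (fst (νs (bx i)))
      bs≡ i = lookup∘tabulate (λ i → Norm.cof (fst (νs (bx i)))) i
      diff : ∀ i j → lookup as j - lookup as i ≈ ι (lookup (V.map +_ ts) j Z.- lookup (V.map +_ ts) i)
      diff i j rewrite lookup-map j (λ t → a (t ∷ ε)) ts | lookup-map i (λ t → a (t ∷ ε)) ts | lookup-map j +_ ts | lookup-map i +_ ts =
       trans (solve 5 (λ k s t u v → (k :+ (s :* u :+ v)) :- (k :+ (t :* u :+ v)) := (s :- t) :* u) refl (ι (+ (suc C N.* A))) (ι (+ lookup ts j)) (ι (+ lookup ts i)) 1# (lin (toZv ε) e))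
        (trans (*-identityʳ _) (sym (trans (ι-+ (+ lookup ts j) (Z.- (+ lookup ts i))) (+-congˡ (ι-neg (+ lookup ts i))))))
      ab : ∀ i → Div (+ (p ^ (M N.* e' N.+ 1))) (lookup as i * lookup bs i)
      ab i rewrite lookup-map i (λ t → a (t ∷ ε)) ts | bs≡ i = let (ν , e1) = νs (bx i) in
       Div-norm ν (p ^ (M N.* e' N.+ 1)) (ND.∣-trans (pow-∣ p (≤-trans (≤-reflexive (NP.+-comm (M N.* e') 1)) (s≤s (≤-trans (≤-reflexive (NP.*-comm M e')) (÷-≤ k M))))) (subst (p ^ suc k ∣ℕ_) e1 (dd i)))
       where
       pow-∣ : ∀ p {i j} → i ≤ j → p ^ i ∣ℕ p ^ j
       pow-∣ p {i} {j} h = subst (λ z → p ^ i ∣ℕ p ^ z) (m+[n∸m]≡n h) (subst (p ^ i ∣ℕ_) (Eq.sym (^-distribˡ-+-* p i (j ∸ i))) (ND.m∣m*n (p ^ (j ∸ i))))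
      ¬b : ∀ i → ¬ Div (+ p) (lookup bs i)
      ¬b i rewrite bs≡ i = let (ν , e1) = νs (bx i) in Norm.prim ν p pr (ND.∣-trans (ND.m∣m*n (p ^ k)) (subst (p ^ suc k ∣ℕ_) e1 (dd i)))
      close : ∀ i j → j ≢ i → lookup (V.map +_ ts) j Z.- lookup (V.map +_ ts) i ≢ 0ℤ × ∣ lookup (V.map +_ ts) j Z.- lookup (V.map +_ ts) i ∣ < p ^ suc e'
      close i j j≢i rewrite lookup-map j +_ ts | lookup-map i +_ ts = (λ z0 → dis i j j≢i (ZP.+-injective (ZP.i-j≡0⇒i≡j (+ lookup ts j) (+ lookup ts i) z0)))
       , same-cell q≥1 (Eq.trans (snd (prop (mem j))) (Eq.sym (snd (prop (mem i)))))

   cnt-small : ∀ {p} → Prime p → ∀ k → cnt p k ≤ A ^ M' N.* (M N.* ((A ÷ p ^ suc (k ÷ M)) N.+ 1))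
   cnt-small {p} pr k = begin
    ∑ box (λ τ → χ (p ^ suc k ∣ℕ? μ τ)) ≡⟨ ∑-cart _∷_ (upTo A) (vecs (upTo A) M') (λ τ → χ (p ^ suc k ∣ℕ? μ τ)) ⟩
    ∑ (upTo A) (λ t → ∑ (vecs (upTo A) M') (λ ε → χ (p ^ suc k ∣ℕ? μ (t ∷ ε)))) ≡⟨ ∑-swap (upTo A) (vecs (upTo A) M') (λ t ε → χ (p ^ suc k ∣ℕ? μ (t ∷ ε))) ⟩
    ∑ (vecs (upTo A) M') (λ ε → ∑ (upTo A) (λ t → χ (p ^ suc k ∣ℕ? μ (t ∷ ε)))) ≤⟨ ∑-bound (vecs (upTo A) M') (M N.* ((A ÷ p ^ suc (k ÷ M)) N.+ 1)) (λ {ε} ε∈ → line-count pr k ε ε∈) ⟩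
    length (vecs (upTo A) M') N.* (M N.* ((A ÷ p ^ suc (k ÷ M)) N.+ 1)) ≡⟨ cong (N._* (M N.* ((A ÷ p ^ suc (k ÷ M)) N.+ 1))) (length-box A M') ⟩
    A ^ M' N.* (M N.* ((A ÷ p ^ suc (k ÷ M)) N.+ 1)) ∎
    where open ≤-Reasoning

   C2 : ℕ
   C2 = suc (4 N.* C) ^ M N.* (suc c0 ^ M N.* M)

   -- Used with q = p for primes with two roots and with q = p² for the others. The box is cut into
   -- cells of side σ, the largest with K σ < q; by `packed` each holds at most M elements whose
   -- norm is divisible by p.
   cnt-packed : ∀ {p} → Prime p → ∀ q → 1 < q → (∀ γ σ → ‖ γ ‖ ≤ σ → γ ≢ 0v → K σ < q → Invertible (vec γ) p) → cnt p 0 N.* q ≤ C2 N.* A ^ M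
   cnt-packed {p} pr q q>1 invt with q ≤? K (c0 N.* A)
   -- Here the elements of the box are themselves invertible modulo p, so p divides no norm at all.
   ... | no ¬h = ≤-trans (≤-reflexive (cong (N._* q) none)) z≤n
    where
    none : cnt p 0 ≡ 0
    none = Eq.trans (∑-cong box (λ {τ} τ∈ → χ-no (p ^ 1 ∣ℕ? μ τ) (λ d → let (ν , e1) = νs τ∈; d' = subst (_∣ℕ Norm.m ν) (NP.*-identityʳ p) (subst (p ^ 1 ∣ℕ_) e1 d) in
     Invertible-≈ (sym (a≈ τ)) (invt (α τ) (c0 N.* A) (‖α‖ τ∈) (α≢0 τ) (≰⇒> ¬h)) (λ one → Norm.prim ν p pr d' (Mod.cancel-mod (a τ) p one (Norm.cof ν) (Div-norm ν p d'))))))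
     (Eq.trans (∑-const box 0) (NP.*-zeroʳ (length box)))
   ... | yes h with largest-below C M q (c0 N.* A) q>1 h
   ... | σ , Kσ<q , q≤ , σ≤ = packing-arith C M A c0 q (cnt p 0) σ (s≤s z≤n) trivial cells σ≤ q≤
    where
    trivial : cnt p 0 ≤ A ^ M
    trivial = ≤-trans (∑-bound box 1 (λ {τ} _ → χ≤1 (p ^ 1 ∣ℕ? μ τ))) (≤-reflexive (Eq.trans (NP.*-identityʳ (length box)) (length-box A M)))
    P? : ∀ τ → Dec (p ^ 1 ∣ℕ μ τ)
    P? τ = p ^ 1 ∣ℕ? μ τ
    L = filter P? box
    module _ (σ≥1 : 1 ≤ σ) where
     R? : ∀ (τ c : Vec ℕ M) → Dec (V.map (_÷ σ) τ ≡ c)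
     R? τ c = ≡-dec N._≟_ (V.map (_÷ σ) τ) c
     cover : ∀ {τ} → τ ∈ L → ∃ λ c → c ∈ vecs (upTo (suc (A ÷ σ))) M × V.map (_÷ σ) τ ≡ c
     cover {τ} m = V.map (_÷ σ) τ , cells-∈ σ≥1 τ (∈-vecs⁻ M (fst (∈-filter⁻ P? {xs = box} m))) , Eq.refl
     fib : ∀ {c} → c ∈ vecs (upTo (suc (A ÷ σ))) M → length (filter (λ τ → R? τ c) L) ≤ M
     fib {c} _ = fibre-by-contradiction (filter (λ τ → R? τ c) L) (Uniq.filter⁺ (λ τ → R? τ c) (Uniq.filter⁺ P? (box-Unique A M))) M
      {P = λ τ → (τ ∈ box × p ^ 1 ∣ℕ μ τ) × V.map (_÷ σ) τ ≡ c}
      (λ m → let (m1 , e1) = ∈-filter⁻ (λ τ → R? τ c) {xs = L} m in ∈-filter⁻ P? {xs = box} m1 , e1) contra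
      where
      contra : (F : List (Vec ℕ M)) → Unique F → length F ≡ suc M → (∀ {τ} → τ ∈ F → (τ ∈ box × p ^ 1 ∣ℕ μ τ) × V.map (_÷ σ) τ ≡ c) → ⊥
      contra F uF lF prop with list-to-vec F uF lF
      ... | τs , mem , dis = packed pr as bs ab ¬b far
       where
       bx : ∀ i → lookup τs i ∈ box
       bx i = fst (fst (prop (mem i)))
       as = V.map a τs
       bs = V.tabulate (λ i → Norm.cof (fst (νs (bx i))))
       bs≡ : ∀ i → lookup bs i ≡ Norm.cof (fst (νs (bx i)))
       bs≡ i = lookup∘tabulate (λ i → Norm.cof (fst (νs (bx i)))) i
       dd : ∀ i → p ∣ℕ Norm.m (fst (νs (bx i)))
       dd i = subst (_∣ℕ Norm.m (fst (νs (bx i)))) (NP.*-identityʳ p) (subst (p ^ 1 ∣ℕ_) (snd (νs (bx i))) (snd (fst (prop (mem i)))))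
       ab : ∀ i → Div (+ p) (lookup as i * lookup bs i)
       ab i rewrite lookup-map i a τs | bs≡ i = Div-norm (fst (νs (bx i))) p (dd i)
       ¬b : ∀ i → ¬ Div (+ p) (lookup bs i)
       ¬b i rewrite bs≡ i = Norm.prim (fst (νs (bx i))) p pr (dd i)
       far : ∀ i j → j ≢ i → Invertible (lookup as j - lookup as i) p
       far i j j≢i rewrite lookup-map i a τs | lookup-map j a τs = Invertible-≈ (sym (a-diff (lookup τs j) (lookup τs i)))
        (invt (toZv (lookup τs j) -v toZv (lookup τs i)) σ
         (same-cells σ≥1 (lookup τs j) (lookup τs i) (Eq.trans (snd (prop (mem j))) (Eq.sym (snd (prop (mem i))))))
         (λ z0 → dis i j j≢i (toZv-inj _ _ (-v-0 _ _ z0))) Kσ<q)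
     cells : cnt p 0 ≤ suc (A ÷ σ) ^ M N.* M
     cells = ≤-trans (≤-reflexive (Eq.sym (length-filter-∑ P? box))) (≤-trans
      (fibre-count L (vecs (upTo (suc (A ÷ σ))) M) (λ τ c → V.map (_÷ σ) τ ≡ c) R? M cover fib)
      (≤-reflexive (cong (N._* M) (length-box (suc (A ÷ σ)) M))))

module SplitLower {n : ℕ} (g : Vec ℤ (suc n)) (𝓣 : TwoRootsRing g) where
 open TwoRootsRing 𝓣
 open Packing 𝓡
 open TwoRoots g x y z D0 gx gy xyz
 open Roots g
 open SplitPrimes g 𝓣

 -- With A = Y ^ (2M²) the bound O(A ^ M) for prime powers in norms becomes Cz · Y ^ E. Y0 exceeds Δ
 -- and |D0|, so that primes beyond Y divide neither.
 E Cz Y0 C3 κ Cst : ℕ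
 E = (M N.* M N.+ M N.* M) N.* M
 Cz = suc (suc (2 N.* (C N.* c0)) ^ M) N.* Δ
 Y0 = suc (Cz N.+ (Δ N.+ ∣ D0 ∣))
 C3 = suc (4 N.* C) ^ M N.* (suc c0 ^ M N.* M)
 κ = suc E N.* C3
 Cst = Δ N.* Δ N.* (32768 ^ (M N.* M) N.* 2 ^ (2 N.* (Cz N.+ E) N.* M)) N.* 64 ^ (C3 N.* suc E)

 Cz≥1 : 1 ≤ Cz
 Cz≥1 = ≤-trans Δ≥1 (m≤n*m Δ (suc (suc (2 N.* (C N.* c0)) ^ M)))

 two : ∀ p → Dec (2 ≤ length (roots p))
 two p = 2 ≤? length (roots p)

 module _ (Y : ℕ) (Y≥Y0 : Y0 ≤ Y) where
  private
   A Z : ℕ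
   A = Y ^ (M N.* M N.+ M N.* M)
   Z = Cz N.* Y ^ E
   Y≥1 : 1 ≤ Y
   Y≥1 = ≤-trans (s≤s z≤n) Y≥Y0
   A≥1 : 1 ≤ A
   A≥1 = pow≥1 (M N.* M N.+ M N.* M) Y≥1
   Y²≤A : Y N.* Y ≤ A
   Y²≤A = ≤-trans (≤-reflexive (cong (Y N.*_) (Eq.sym (NP.*-identityʳ Y)))) (pow-monoʳ {Y} {2} Y≥1 (+-mono-≤ {1} {M N.* M} {1} (s≤s z≤n) (s≤s z≤n)))
   Cz≤Y : Cz ≤ Y
   Cz≤Y = ≤-trans (≤-trans (m≤m+n Cz (Δ N.+ ∣ D0 ∣)) (n≤1+n _)) Y≥Y0
   ¬∣Δ : ∀ {p} → Y < p → ¬ (+ p ∣ᶻ + Δ)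
   ¬∣Δ Y<p d = <⇒≱ Y<p (≤-trans (ND.∣⇒≤ {{>-nonZero Δ≥1}} (∣⇒∣ᵤ d)) (≤-trans (≤-trans (m≤m+n Δ ∣ D0 ∣) (≤-trans (m≤n+m _ Cz) (n≤1+n _))) Y≥Y0))
   ¬∣D0 : ∀ {p} → Y < p → ¬ (+ p ∣ᶻ D0)
   ¬∣D0 Y<p d = <⇒≱ Y<p (≤-trans (ND.∣⇒≤ {{≢-nonZero (λ e → D0≢0 (ZP.∣i∣≡0⇒i≡0 e))}} (∣⇒∣ᵤ d)) (≤-trans (≤-trans (m≤n+m ∣ D0 ∣ Δ) (≤-trans (m≤n+m _ Cz) (n≤1+n _))) Y≥Y0))
   inW? : ∀ p → Dec (Y < p × 2 ≤ length (roots p))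
   inW? p = (Y <? p) ×-dec two p
   inW : ℕ → ℕ
   inW p = χ (inW? p)
   open Box A A≥1

   module _ (ns : All (λ τ → Norm (a τ)) box) where
    open import Data.List.Membership.DecPropositional (≡-dec {n = M} N._≟_) using (_∈?_)

    -- Norms are given on the box only; 0 is the default value elsewhere.
    norm-of : ∀ τ → Dec (τ ∈ box) → ℕ
    norm-of τ (yes m) = Norm.m (All.lookup ns m)
    norm-of τ (no _) = 0

    is-norm : ∀ {τ} → τ ∈ box → (d : Dec (τ ∈ box)) → Σ (Norm (a τ)) λ ν → norm-of τ d ≡ Norm.m ν
    is-norm m (yes m') = All.lookup ns m' , Eq.refl
    is-norm m (no ¬m) = ⊥-elim (¬m m)

    open WithNorms (λ τ → norm-of τ (τ ∈? box)) (λ {τ} m → is-norm m (τ ∈? box))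

    Z≥ : suc (K (c0 N.* A)) N.* Δ ≤ Z
    Z≥ = ≤-trans (big-box C c0 M A Δ A≥1) (≤-reflexive (cong (Cz N.*_) (^-*-assoc Y (M N.* M N.+ M N.* M) M)))

    0or1 : ∀ {P : Set} (d : Dec P) → χ d ≡ 0 ⊎ χ d ≡ 1
    0or1 (yes _) = inj₂ Eq.refl
    0or1 (no _) = inj₁ Eq.refl

    h4 : ∀ {p} → p ∈ primes Z → Y < p → inW p ≡ 0 → cnt p 0 N.* (p N.* p) ≤ C3 N.* (A N.* A ^ M')
    h4 {p} p∈ Y<p e = cnt-packed pr (p N.* p) (*-mono-≤ {1} {p} (prime≥1 pr) (prime≥2 pr)) (invertible2 pr (¬∣Δ Y<p) (¬∣D0 Y<p) few)
     where
     pr = fst (primes⁻ {Z} p∈)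
     few : length (roots p) ≤ 1
     few = ≤-pred (≰⇒> (λ h → NP.1+n≢0 (Eq.trans (Eq.sym (χ-yes (inW? p) (Y<p , h))) e)))

    h6 : ∀ {p} → p ∈ primes Z → inW p N.* cnt p 0 N.* p ≤ C3 N.* (A N.* A ^ M')
    h6 {p} p∈ = [ (λ e → ≤-trans (≤-reflexive (cong (λ k → k N.* cnt p 0 N.* p) e)) z≤n) , large ]′ (0or1 (inW? p))
     where
     pr = fst (primes⁻ {Z} p∈)
     yes! : ∀ {P : Set} (d : Dec P) → χ d ≡ 1 → P
     yes! (yes x) _ = x
     large : inW p ≡ 1 → inW p N.* cnt p 0 N.* p ≤ C3 N.* (A N.* A ^ M')
     large e = ≤-trans (≤-reflexive (cong (N._* p) (Eq.trans (cong (N._* cnt p 0) e) (NP.*-identityˡ (cnt p 0)))))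
      (cnt-packed pr p (prime≥2 pr) (invertible1 pr (¬∣Δ (fst (yes! (inW? p) e)))))

    open SplitArith M' A Y Cz E C3 (Δ N.* Δ) (A ^ M') cnt inW Y≥1 Y²≤A Cz≥1 Cz≤Y (pow≥1 M' A≥1) using (split-arith)

    with-norms : ∀ D (w : ℕ → ℕ) → (∀ {p} → p ∈ primes Z → p N.* w p ≡ D) → Y ^ D ≤ Cst ^ D N.* ∏ (primes Z) (λ p → p ^ (inW p N.* w p)) ^ κ
    with-norms D w pw = split-final A Y D M Cst (∏ (primes Z) (λ p → p ^ (inW p N.* w p)) ^ κ) Y≥1 Eq.refl (s≤s z≤n)
     (split-arith (λ {p} p∈ _ k → cnt-small (fst (primes⁻ {Z} p∈)) k) (λ {p} p∈ k big → cnt-zero k (fst (primes⁻ {Z} p∈)) (≤-<-trans Z≥ big))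
      (λ {p} _ _ k → cnt-mono {p} k) h4 (λ p → 0or1 (inW? p)) (product-bound Z Z≥) h6 A≥1 D w pw)

  -- In additive form: log Y ≤ O(1) + κ ∑ (log p)/p over the p ≤ Z with ρ(p) ≥ 2. The double
  -- negation around the norms is removed by the decidability of this inequality.
  split-lower : ∀ D (w : ℕ → ℕ) → (∀ {p} → p ∈ primes Z → p N.* w p ≡ D) →
   Y ^ D ≤ Cst ^ D N.* ∏ (primes Z) (λ p → p ^ (χ (two p) N.* w p)) ^ κ
  split-lower D w pw = ≤-trans (decidable-stable (_ ≤? _) (¬¬-bind (¬¬-All box (λ {τ} _ → norm (a τ) (a≉0 τ))) (λ ns k → k (with-norms ns D w pw))))
   (*-monoʳ-≤ (Cst ^ D) (^-monoˡ-≤ κ (∏-mono (primes Z) (λ {p} p∈ → pow-monoʳ (prime≥1 (fst (primes⁻ {Z} p∈))) (*-monoˡ-≤ (w p) (χ-mono (inW? p) (two p) snd))))))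

-- Construction of a domain containing two roots

module Elimination (R : ZRing) where
 open RingOps R
 open Linear R

 Eliminated : ∀ {m} → Vec ℤ (suc m) → Vec Carrier (suc m) → Set
 Eliminated {m} c xs = Σ (Vec Carrier m) λ xs' → Σ ℤ λ l → l ≢ 0ℤ × (∀ d → Σ (Vec ℤ m) λ d' → Σ ℤ λ s → ι l * lin d xs ≈ lin d' xs' + ι s * lin c xs)

 keep-head : ∀ {m} c0 x0 (c : Vec ℤ (suc m)) xs → ((xs' , _) : Eliminated c xs) →
  Σ ℤ λ l → l ≢ 0ℤ × (∀ d → Σ (Vec ℤ (suc m)) λ d' → Σ ℤ λ s → ι l * lin d (x0 ∷ xs) ≈ lin d' (x0 ∷ xs') + ι s * lin (c0 ∷ c) (x0 ∷ xs))
 keep-head c0 x0 c xs (xs' , l , l≢0 , el) = l , l≢0 , λ { (d0 ∷ ds) → let (d' , s , h) = el ds in (l Z.* d0 Z.- s Z.* c0) ∷ d' , s , (begin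
  ι l * (ι d0 * x0 + lin ds xs) ≈⟨ solve 4 (λ l d x p → l :* (d :* x :+ p) := l :* d :* x :+ l :* p) refl (ι l) (ι d0) x0 (lin ds xs) ⟩
  ι l * ι d0 * x0 + ι l * lin ds xs ≈⟨ +-congˡ h ⟩
  ι l * ι d0 * x0 + (lin d' xs' + ι s * lin c xs)
   ≈⟨ solve 7 (λ l d x p s q c → l :* d :* x :+ (p :+ s :* q) := (l :* d :- s :* c) :* x :+ p :+ s :* (c :* x :+ q)) refl (ι l) (ι d0) x0 (lin d' xs') (ι s) (lin c xs) (ι c0) ⟩
  (ι l * ι d0 - ι s * ι c0) * x0 + lin d' xs' + ι s * (ι c0 * x0 + lin c xs)
   ≈⟨ +-congʳ (+-congʳ (*-congʳ (sym (trans (ι-+ (l Z.* d0) (Z.- (s Z.* c0))) (+-cong (ι-* l d0) (trans (ι-neg (s Z.* c0)) (-‿cong (ι-* s c0)))))))) ⟩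
  ι (l Z.* d0 Z.- s Z.* c0) * x0 + lin d' xs' + ι s * (ι c0 * x0 + lin c xs) ∎) }
  where open ≈R

 eliminate : ∀ {m} (c : Vec ℤ (suc m)) xs → c ≢ 0v → Eliminated c xs
 eliminate {m} (c0 ∷ c) (x0 ∷ xs) c≢0 with ≡-dec Z._≟_ c 0v
 eliminate {m} (c0 ∷ c) (x0 ∷ xs) c≢0 | yes Eq.refl = xs , c0 , (λ { Eq.refl → c≢0 Eq.refl }) , λ { (d0 ∷ ds) → c0 ·v ds , d0 , (begin
  ι c0 * (ι d0 * x0 + lin ds xs) ≈⟨ solve 4 (λ c d x p → c :* (d :* x :+ p) := c :* p :+ d :* (c :* x)) refl (ι c0) (ι d0) x0 (lin ds xs) ⟩
  ι c0 * lin ds xs + ι d0 * (ι c0 * x0) ≈⟨ +-cong (sym (lin-· c0 ds xs)) (*-congˡ (sym (trans (+-congˡ (lin-0 xs)) (+-identityʳ _)))) ⟩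
  lin (c0 ·v ds) xs + ι d0 * (ι c0 * x0 + lin 0v xs) ∎) }
  where open ≈R
 eliminate {zero} (c0 ∷ []) (x0 ∷ []) c≢0 | no h = ⊥-elim (h Eq.refl)
 eliminate {suc m} (c0 ∷ c) (x0 ∷ xs) c≢0 | no h = x0 ∷ fst (eliminate c xs h) , keep-head c0 x0 c xs (eliminate c xs h)

module Minimal (R : ZRing) (I0 : ZRing.Carrier R → Set) where
 open RingOps R
 open Linear R
 open Elimination R

 -- An ideal over I0 whose quotient is torsion-free, contains ℤ and is spanned, up to Δ, by 1 and m
 -- further elements. Minimising m stands in for choosing an irreducible factor over a number field.
 record Datum (m : ℕ) : Set1 where
  field
   I : Carrier → Set
   isIdeal : IsIdeal R I
   base : ∀ {a} → I0 a → I a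
   sat : ∀ n a → n ≢ 0ℤ → I (ι n * a) → I a
   proper : ∀ n → I (ι n) → n ≡ 0ℤ
   e : Vec Carrier m
   Δ : ℤ
   Δ≢0 : Δ ≢ 0ℤ
   span : ∀ a → Σ (Vec ℤ (suc m)) λ c → I (ι Δ * a - lin c (1# ∷ e))
  open IsIdeal isIdeal public

 -- A nonzero relation cannot involve 1 alone, since I contains no nonzero integer; so another
 -- generator can be eliminated and 1 retained.
 shrink : ∀ {m} (𝓓 : Datum m) (c : Vec ℤ (suc m)) → c ≢ 0v → Datum.I 𝓓 (lin c (1# ∷ Datum.e 𝓓)) → Σ ℕ λ k → k < m × Datum k
 shrink {m} 𝓓 (c0 ∷ c) c≢0 h with ≡-dec Z._≟_ c 0v
 ... | yes Eq.refl = ⊥-elim (c≢0 (cong (_∷ 0v) (Datum.proper 𝓓 c0 (Datum.I-resp 𝓓 (trans (+-cong (*-identityʳ (ι c0)) (lin-0 (Datum.e 𝓓))) (+-identityʳ (ι c0))) h))))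
 shrink {zero} 𝓓 (c0 ∷ []) c≢0 h | no ¬z = ⊥-elim (¬z Eq.refl)
 shrink {suc m} 𝓓 (c0 ∷ c) c≢0 h | no ¬z = m , ≤-refl , record
  { I = I ; isIdeal = isIdeal ; base = base ; sat = sat ; proper = proper
  ; e = fst el ; Δ = l Z.* Δ ; Δ≢0 = ≢0-* l≢0 Δ≢0
  ; span = λ a → let (d , p) = span a; (d' , s , q) = rewr d in d' , I-resp (begin
    ι l * (ι Δ * a - lin d (1# ∷ e)) + ι s * lin (c0 ∷ c) (1# ∷ e)
     ≈⟨ solve 5 (λ l D a p t → l :* (D :* a :- p) :+ t := l :* D :* a :- (l :* p :- t)) refl (ι l) (ι Δ) a (lin d (1# ∷ e)) (ι s * lin (c0 ∷ c) (1# ∷ e)) ⟩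
    ι l * ι Δ * a - (ι l * lin d (1# ∷ e) - ι s * lin (c0 ∷ c) (1# ∷ e))
     ≈⟨ +-cong (*-congʳ (sym (ι-* l Δ))) (-‿cong (+-congʳ q)) ⟩
    ι (l Z.* Δ) * a - (lin d' (1# ∷ fst el) + ι s * lin (c0 ∷ c) (1# ∷ e) - ι s * lin (c0 ∷ c) (1# ∷ e))
     ≈⟨ +-congˡ (-‿cong (solve 2 (λ p t → p :+ t :- t := p) refl (lin d' (1# ∷ fst el)) (ι s * lin (c0 ∷ c) (1# ∷ e)))) ⟩
    ι (l Z.* Δ) * a - lin d' (1# ∷ fst el) ∎) (I-+ (I-* (ι l) p) (I-* (ι s) h)) }
  where
  open ≈R
  open Datum 𝓓
  el = eliminate c e ¬z
  kh = keep-head c0 1# c e el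
  l = fst kh
  l≢0 = fst (snd kh)
  rewr = snd (snd kh)

 -- Passing to the ideal of those x for which some integer multiple lies in (a) keeps all properties unless (a) meets ℤ.
 adjoin : ∀ {m} (𝓓 : Datum m) a → (∀ n → n ≢ 0ℤ → ∀ y → ¬ Datum.I 𝓓 (a * y - ι n)) → Datum m
 adjoin 𝓓 a none = record
  { I = I'
  ; isIdeal = record
   { I-resp = λ { e (n , n≢0 , y , h) → n , n≢0 , y , I-resp (+-congʳ (*-congˡ e)) h }
   ; I-0 = I⊆ I-0
   ; I-+ = λ { {s} {t} (n , n≢0 , y , h) (n' , n'≢0 , y' , h') → n Z.* n' , ≢0-* n≢0 n'≢0 , ι n' * y + ι n * y' ,
     I-resp (trans (solve 7 (λ n n' s t a y y' → n' :* (n :* s :- a :* y) :+ n :* (n' :* t :- a :* y') := n :* n' :* (s :+ t) :- a :* (n' :* y :+ n :* y')) refl (ι n) (ι n') s t a y y')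
      (+-congʳ (*-congʳ (sym (ι-* n n'))))) (I-+ (I-* (ι n') h) (I-* (ι n) h')) }
   ; I-* = λ { s {t} (n , n≢0 , y , h) → n , n≢0 , s * y , I-resp (solve 5 (λ s n t a y → s :* (n :* t :- a :* y) := n :* (s :* t) :- a :* (s :* y)) refl s (ι n) t a y) (I-* s h) }
   }
  ; base = λ h → I⊆ (base h)
  ; sat = λ { n b n≢0 (m , m≢0 , y , h) → m Z.* n , ≢0-* m≢0 n≢0 , y , I-resp (+-congʳ (trans (sym (*-assoc (ι m) (ι n) b)) (*-congʳ (sym (ι-* m n))))) h }
  ; proper = λ { n (m , m≢0 , y , h) → prop n m m≢0 y h }
  ; e = e ; Δ = Δ ; Δ≢0 = Δ≢0
  ; span = λ b → let (c , h) = span b in c , I⊆ h }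
  where
  open Datum 𝓓
  I' : Carrier → Set
  I' x = Σ ℤ λ n → n ≢ 0ℤ × Σ Carrier λ y → I (ι n * x - a * y)
  I⊆ : ∀ {x} → I x → I' x
  I⊆ {x} h = 1ℤ , (λ ()) , ι 0ℤ , I-resp (solve 2 (λ x a → x := con 1ℤ :* x :- a :* con 0ℤ) refl x a) h
  prop : ∀ n m → m ≢ 0ℤ → ∀ y → I (ι m * ι n - a * y) → n ≡ 0ℤ
  prop n m m≢0 y h with n Z.≟ 0ℤ
  ... | yes p = p
  ... | no n≢0 = ⊥-elim (none (m Z.* n) (≢0-* m≢0 n≢0) y (I-resp (trans (solve 4 (λ m n a y → con -1ℤ :* (m :* n :- a :* y) := a :* y :- m :* n) refl (ι m) (ι n) a y)
     (+-congˡ (-‿cong (sym (ι-* m n))))) (I-* (ι -1ℤ) h)))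

 Independent : ∀ {m} → Datum m → Set
 Independent 𝓓 = ∀ c → Datum.I 𝓓 (lin c (1# ∷ Datum.e 𝓓)) → c ≡ 0v

 Inverses : ∀ {m} → Datum m → Set
 Inverses 𝓓 = ∀ a → ¬ Datum.I 𝓓 a → ¬ ¬ (Σ ℤ λ n → n ≢ 0ℤ × Σ Carrier λ y → Datum.I 𝓓 (a * y - ι n))

 -- At minimal m a relation among the generators would permit `shrink`. If some a outside I had no
 -- nonzero integer among its multiples modulo I, `adjoin` would preserve the datum while turning
 -- the coordinates of a into a relation, again permitting `shrink`.
 minimal : ∀ {m} → Datum m → ¬ ¬ (Σ ℕ λ k → Σ (Datum k) λ 𝓓 → Independent 𝓓 × Inverses 𝓓)
 minimal {m} 𝓓0 = ¬¬-bind (least Datum m 𝓓0) λ { (k , 𝓓 , min) r → r (k , 𝓓 , indep 𝓓 min , inverse 𝓓 min) }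
  where
  indep : ∀ {k} (𝓓 : Datum k) → (∀ j → j < k → ¬ Datum j) → Independent 𝓓
  indep 𝓓 min c h with ≡-dec Z._≟_ c 0v
  ... | yes p = p
  ... | no c≢0 = let (j , j<k , 𝓓') = shrink 𝓓 c c≢0 h in ⊥-elim (min j j<k 𝓓')
  inverse : ∀ {k} (𝓓 : Datum k) → (∀ j → j < k → ¬ Datum j) → Inverses 𝓓
  inverse 𝓓 min a a∉ none = let (c , p) = span a; (j , j<k , 𝓓″) = shrink 𝓓' c (c≢0 c p) (in' c p) in min j j<k 𝓓″
   where
   open Datum 𝓓
   𝓓' = adjoin 𝓓 a (λ n n≢0 y h → none (n , n≢0 , y , h))
   c≢0 : ∀ c → I (ι Δ * a - lin c (1# ∷ e)) → c ≢ 0v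
   c≢0 _ p Eq.refl = a∉ (sat Δ a Δ≢0 (I-resp (trans (+-congˡ (-‿cong (trans (lin-0 (1# ∷ e)) (sym ι-0)))) (solve 1 (λ t → t :- con 0ℤ := t) refl (ι Δ * a))) p))
   in' : ∀ c → I (ι Δ * a - lin c (1# ∷ e)) → Datum.I 𝓓' (lin c (1# ∷ e))
   in' c p = 1ℤ , (λ ()) , ι Δ , I-resp (solve 3 (λ D a l → con -1ℤ :* (D :* a :- l) := con 1ℤ :* l :- a :* D) refl (ι Δ) a (lin c (1# ∷ e))) (I-* (ι -1ℤ) p)

top : ∀ {m} → Vec ℤ (suc m) → ℤ
top (a ∷ []) = a
top (a ∷ b ∷ v) = top (b ∷ v)

top-∷ʳ : ∀ {m} (v : Vec ℤ m) l → top (v ∷ʳ l) ≡ l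
top-∷ʳ [] l = Eq.refl
top-∷ʳ (a ∷ []) l = Eq.refl
top-∷ʳ (a ∷ b ∷ v) l = top-∷ʳ (b ∷ v) l

top-+ : ∀ {m} (u v : Vec ℤ (suc m)) → top (u +v v) ≡ top u Z.+ top v
top-+ (a ∷ []) (b ∷ []) = Eq.refl
top-+ (a ∷ a' ∷ u) (b ∷ b' ∷ v) = top-+ (a' ∷ u) (b' ∷ v)

top-0 : ∀ m → top (0v {suc m}) ≡ 0ℤ
top-0 zero = Eq.refl
top-0 (suc m) = top-0 m

derivative : ∀ {m} → Vec ℤ (suc m) → Vec ℤ m
derivative {zero} (c ∷ []) = []
derivative {suc m} (c ∷ v) = v +v (0ℤ ∷ derivative v)

top-derivative : ∀ {m} (v : Vec ℤ (suc (suc m))) → top (derivative v) ≡ + suc m Z.* top v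
top-derivative {zero} (c ∷ d ∷ []) = Eq.trans (ZP.+-identityʳ d) (Eq.sym (ZP.*-identityˡ d))
top-derivative {suc m} (c ∷ v@(_ ∷ _)) = Eq.trans (top-+ v (0ℤ ∷ derivative v)) (Eq.trans (cong (λ z → top v Z.+ z) (Eq.trans (shift (derivative v)) (top-derivative v))) (lemma (top v) (+ suc m)))
 where
 shift : ∀ {m} (u : Vec ℤ (suc m)) → top (0ℤ ∷ u) ≡ top u
 shift (_ ∷ _) = Eq.refl
 lemma : ∀ t m → t Z.+ m Z.* t ≡ (1ℤ Z.+ m) Z.* t
 lemma = solveZ

module Taylor (R : ZRing) where
 open RingOps R
 open VecEval R

 taylor : ∀ {m} (v : Vec ℤ (suc m)) x y → Σ Carrier λ q → evv v y ≈ evv v x + (y - x) * (evv (derivative v) x + (y - x) * q)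
 taylor {zero} (c ∷ []) x y = ι 0ℤ , trans (+-congˡ (trans (*-congˡ (sym ι-0)) refl)) (trans (solve 3 (λ c x y → c :+ y :* con 0ℤ := (c :+ x :* con 0ℤ) :+ (y :- x) :* (con 0ℤ :+ (y :- x) :* con 0ℤ)) refl (ι c) x y)
  (+-cong (+-congˡ (*-congˡ ι-0)) (*-congˡ (+-congʳ ι-0))))
 taylor {suc m} (c ∷ v) x y = let (q , h) = taylor v x y; p = evv v x; p' = evv (derivative v) x in p' + x * q + (y - x) * q , (begin
  ι c + y * evv v y ≈⟨ +-congˡ (*-congˡ h) ⟩
  ι c + y * (p + (y - x) * (p' + (y - x) * q))
   ≈⟨ solve 6 (λ c x y p d q → c :+ y :* (p :+ (y :- x) :* (d :+ (y :- x) :* q)) := (c :+ x :* p) :+ (y :- x) :* ((p :+ (con 0ℤ :+ x :* d)) :+ (y :- x) :* (d :+ x :* q :+ (y :- x) :* q))) refl (ι c) x y p p' q ⟩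
  (ι c + x * p) + (y - x) * ((p + (ι 0ℤ + x * p')) + (y - x) * (p' + x * q + (y - x) * q))
   ≈⟨ +-congˡ (*-congˡ (+-congʳ (evv-+ v (0ℤ ∷ derivative v) x))) ⟨
  (ι c + x * p) + (y - x) * (evv (v +v (0ℤ ∷ derivative v)) x + (y - x) * (p' + x * q + (y - x) * q)) ∎)
  where open ≈R

module _ (R : ZRing) (I0 : ZRing.Carrier R → Set) {k : ℕ} (𝓓 : Minimal.Datum R I0 k) where
 open RingOps R
 open Linear R
 open Minimal R I0
 open Datum 𝓓
 private
  module Q = Quotient R I isIdeal

 quotient-numberRing : Independent 𝓓 → Inverses 𝓓 → NumberRing
 quotient-numberRing indep inverse = record
  { R = Q.quotient
  ; M' = k
  ; e = e
  ; Δ = ∣ Δ ∣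
  ; Δ≥1 = ∣i∣≥1 Δ≢0
  ; span = λ a → let (c , h) = span a; (s , es) = sign Δ in s ·v c , Q.⟪ subst (λ z → I (ι (+ ∣ Δ ∣) * a - z)) (Eq.sym (quotient-lin R I isIdeal (s ·v c) (1# ∷ e)))
    (I-resp (trans (solve 4 (λ s D a l → s :* (D :* a :- l) := s :* D :* a :- s :* l) refl (ι s) (ι Δ) a (lin c (1# ∷ e)))
     (+-cong (*-congʳ (trans (sym (ι-* s Δ)) (ι-cong (Eq.sym es)))) (-‿cong (sym (lin-· s c (1# ∷ e)))))) (I-* (ι s) h)) ⟫
  ; indep = λ c h → indep c (subst I (quotient-lin R I isIdeal c (1# ∷ e)) (Q.~0⁻ h))
  ; torsion = λ n a n≢0 h → Q.~0 (sat n a n≢0 (Q.~0⁻ h))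
  ; inv = λ a a≁0 r → inverse a (λ h → a≁0 (Q.~0 h)) (λ { (n , n≢0 , y , h) → r (n , n≢0 , y , Q.⟪ h ⟫) })
  }
  where
  sign : ∀ z → Σ ℤ λ s → + ∣ z ∣ ≡ s Z.* z
  sign (+ n) = 1ℤ , Eq.sym (ZP.*-identityˡ (+ n))
  sign -[1+ n ] = -1ℤ , Eq.sym (ZP.-1*i≡-i -[1+ n ])

module _ (R : ZRing) (I0 : ZRing.Carrier R → Set) (isIdeal0 : IsIdeal R I0) {n : ℕ} (g : Vec ℤ (suc n)) (irr : ¬ ProperFactor (g ∷ʳ 1ℤ)) where
 open RingOps R
 open Linear R
 open VecEval R
 open Taylor R
 open IsIdeal isIdeal0
 open Minimal R I0

 -- Taylor's formula writes the divided difference as G'(x) + (y - x) q2, and it lies in the ideal;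
 -- so G'(x) becomes a multiple of x - y. Bézout for G and G' makes a multiple of G'(x) equal to a
 -- nonzero integer, which x - y then divides: the two roots differ modulo almost every prime.
 two-roots-ring : (sat : ∀ n a → n ≢ 0ℤ → I0 (ι n * a) → I0 a) (proper : ∀ n → I0 (ι n) → n ≡ 0ℤ)
  (x y : Carrier) → I0 (evv (g ∷ʳ 1ℤ) x) → I0 (evv (g ∷ʳ 1ℤ) y) → (∀ q → evv (g ∷ʳ 1ℤ) y - evv (g ∷ʳ 1ℤ) x ≈ (y - x) * q → I0 q) →
  ∀ {m} (e0 : Vec Carrier m) → (∀ a → Σ (Vec ℤ (suc m)) λ c → I0 (a - lin c (1# ∷ e0))) → ¬ ¬ TwoRootsRing g
 two-roots-ring sat proper x y Gx Gy divided e0 span = ¬¬-bind (minimal 𝓓0) λ { (k , 𝓓 , indep , inverse) r → r (assemble 𝓓 indep inverse) }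
  where
  G = g ∷ʳ 1ℤ
  𝓓0 : Datum _
  𝓓0 = record { I = I0 ; isIdeal = isIdeal0 ; base = λ h → h ; sat = sat ; proper = proper ; e = e0 ; Δ = 1ℤ ; Δ≢0 = λ ()
   ; span = λ a → let (c , h) = span a in c , I-resp (+-congʳ (trans (sym (*-identityˡ a)) (*-congʳ (sym ι-1)))) h }
  tay = taylor G x y
  q2 = fst tay
  G' = derivative G
  q = evv G' x + (y - x) * q2
  q∈ : I0 q
  q∈ = divided q (trans (+-congʳ (snd tay)) (solve 2 (λ a b → a :+ b :- a := b) refl (evv G x) ((y - x) * q)))
  G'≢0 : G' ≢ 0v
  G'≢0 h = one≢ (Eq.trans (Eq.sym (Eq.trans (top-derivative G) (Eq.trans (cong (+ suc n Z.*_) (top-∷ʳ g 1ℤ)) (ZP.*-identityʳ (+ suc n))))) (Eq.trans (cong top h) (top-0 n)))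
   where
   one≢ : + suc n ≢ 0ℤ
   one≢ ()
  B : Bezout G G'
  B = [ (λ b → b) , (λ f → ⊥-elim (irr f)) ]′ (bezout G G' G'≢0)
  b = ev (fst B) x
  h = ev (fst (snd B)) x
  D1 = fst (snd (snd B))
  combination : (x - y) * (q2 * b) - ι D1 ≈ (- ι 1ℤ) * b * q + (- h) * evv G x
  combination = begin
   (x - y) * (q2 * b) - ι D1 ≈⟨ +-congˡ (-‿cong (bezout-transfer R G G' B x)) ⟨
   (x - y) * (q2 * b) - (evv G' x * b + evv G x * h)
    ≈⟨ solve 7 (λ x y q b d G h → (x :- y) :* (q :* b) :- (d :* b :+ G :* h) := (:- con 1ℤ) :* b :* (d :+ (y :- x) :* q) :+ (:- h) :* G) refl x y q2 b (evv G' x) (evv G x) h ⟩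
   (- ι 1ℤ) * b * q + (- h) * evv G x ∎
   where open ≈R
  assemble : ∀ {k} (𝓓 : Datum k) → Independent 𝓓 → Inverses 𝓓 → TwoRootsRing g
  assemble 𝓓 indep inverse = record
   { 𝓡 = quotient-numberRing R I0 𝓓 indep inverse
   ; x = x ; y = y ; z = q2 * b ; D0 = D1 ; D0≢0 = fst (snd (snd (snd B)))
   ; gx = zero' x Gx
   ; gy = zero' y Gy
   ; xyz = Q.⟪ 𝓘.I-resp (sym combination) (𝓘.base (I-+ (I-* ((- ι 1ℤ) * b) q∈) (I-* (- h) Gx))) ⟫ }
   where
   module 𝓘 = Datum 𝓓
   module Q = Quotient R 𝓘.I 𝓘.isIdeal
   zero' : ∀ t → I0 (evv G t) → PolyEval.ev Q.quotient (toList G) t Q.~ 0#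
   zero' t Gt = subst (Q._~ 0#) (Eq.sym (quotient-ev R 𝓘.I 𝓘.isIdeal (toList G) t)) (Q.~0 (𝓘.base Gt))

module _ (R : ZRing) where
 open RingOps R
 open Linear R

 lin-++ : ∀ {k m} (u : Vec ℤ k) (v : Vec ℤ m) xs ys → lin (u V.++ v) (xs V.++ ys) ≈ lin u xs + lin v ys
 lin-++ [] v [] ys = sym (+-identityˡ (lin v ys))
 lin-++ (c ∷ u) v (x ∷ xs) ys = trans (+-congˡ (lin-++ u v xs ys)) (sym (+-assoc (ι c * x) (lin u xs) (lin v ys)))

module _ (R : ZRing) (φ : Expr → ZRing.Carrier R) (hom : IsExprHom R φ) {n : ℕ} (g : Vec ℤ (suc n)) where
 open RingOps R
 open VecEval R
 open Linear R
 open IsExprHom hom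

 module _ (gx : evv (g ∷ʳ 1ℤ) (φ 𝕏) ≈ 0#) (gy : evv (g ∷ʳ 1ℤ) (φ 𝕐) ≈ 0#) where
  open MonicRelation R g (φ 𝕏) gx
  private
   x = φ 𝕏
   y = φ 𝕐
   Row = Vec ℤ (suc n)

   ev2 : ∀ {m} → Vec Row m → Carrier
   ev2 [] = 0#
   ev2 (r ∷ rs) = evv r x + y * ev2 rs

   add2 : ∀ {m} → Vec Row m → Vec Row m → Vec Row m
   add2 = V.zipWith _+v_

   ev2-+ : ∀ {m} (rs ss : Vec Row m) → ev2 (add2 rs ss) ≈ ev2 rs + ev2 ss
   ev2-+ [] [] = sym (+-identityˡ 0#)
   ev2-+ (r ∷ rs) (s ∷ ss) = trans (+-cong (evv-+ r s x) (*-congˡ (ev2-+ rs ss)))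
    (solve 5 (λ a b y p q → (a :+ b) :+ y :* (p :+ q) := (a :+ y :* p) :+ (b :+ y :* q)) refl (evv r x) (evv s x) y (ev2 rs) (ev2 ss))

   ev2-map : ∀ {m} t (f : Row → Row) → (∀ r → t * evv r x ≈ evv (f r) x) → (rs : Vec Row m) → t * ev2 rs ≈ ev2 (V.map f rs)
   ev2-map t f h [] = zeroʳ t
   ev2-map t f h (r ∷ rs) = trans (solve 4 (λ t a y p → t :* (a :+ y :* p) := t :* a :+ y :* (t :* p)) refl t (evv r x) y (ev2 rs)) (+-cong (h r) (*-congˡ (ev2-map t f h rs)))

   ev2-∷ʳ : ∀ {m} (rs : Vec Row m) r → ev2 (rs V.∷ʳ r) ≈ ev2 rs + evv r x * pw y m
   ev2-∷ʳ [] r = trans (+-congˡ (zeroʳ y)) (trans (+-comm (evv r x) 0#) (+-congˡ (sym (*-identityʳ (evv r x)))))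
   ev2-∷ʳ {suc m} (s ∷ rs) r = trans (+-congˡ (*-congˡ (ev2-∷ʳ rs r)))
    (solve 5 (λ a y p r q → a :+ y :* (p :+ r :* q) := (a :+ y :* p) :+ r :* (y :* q)) refl (evv s x) y (ev2 rs) (evv r x) (pw y m))

   ev2-scale : ∀ {m} (c : Vec ℤ m) r → ev2 (V.map (_·v r) c) ≈ evv c y * evv r x
   ev2-scale [] r = sym (zeroˡ (evv r x))
   ev2-scale (c ∷ v) r = trans (+-cong (evv-· c r x) (*-congˡ (ev2-scale v r)))
    (solve 4 (λ c r y p → c :* r :+ y :* (p :* r) := (c :+ y :* p) :* r) refl (ι c) (evv r x) y (evv v y))

   reduce-y : ∀ (rs : Vec Row (suc n)) → Σ (Vec Row (suc n)) λ rs' → y * ev2 rs ≈ ev2 rs'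
   reduce-y rs with V.initLast rs
   ... | rs0 , r , Eq.refl = add2 (0v ∷ rs0) (V.map (_·v r) (-1ℤ ·v g)) , (begin
     y * ev2 (rs0 V.∷ʳ r) ≈⟨ *-congˡ (ev2-∷ʳ rs0 r) ⟩
     y * (ev2 rs0 + evv r x * pw y n)
      ≈⟨ solve 5 (λ y p r q g → y :* (p :+ r :* q) := (con 0ℤ :+ y :* p) :+ (con -1ℤ :* g) :* r :+ r :* (g :+ con 1ℤ :* (y :* q))) refl y (ev2 rs0) (evv r x) (pw y n) (evv g y) ⟩
     (ι 0ℤ + y * ev2 rs0) + (ι -1ℤ * evv g y) * evv r x + evv r x * (evv g y + ι 1ℤ * pw y (suc n))
      ≈⟨ +-cong (+-cong (+-congʳ (trans ι-0 (sym (evv-0 (suc n) x)))) (*-congʳ (sym (evv-· -1ℤ g y)))) (*-congˡ (trans (sym (evv-∷ʳ g 1ℤ y)) gy)) ⟩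
     ev2 (0v ∷ rs0) + evv (-1ℤ ·v g) y * evv r x + evv r x * 0# ≈⟨ trans (+-congˡ (zeroʳ (evv r x))) (+-identityʳ _) ⟩
     ev2 (0v ∷ rs0) + evv (-1ℤ ·v g) y * evv r x ≈⟨ +-congˡ (ev2-scale (-1ℤ ·v g) r) ⟨
     ev2 (0v ∷ rs0) + ev2 (V.map (_·v r) (-1ℤ ·v g)) ≈⟨ ev2-+ (0v ∷ rs0) (V.map (_·v r) (-1ℤ ·v g)) ⟨
     ev2 (add2 (0v ∷ rs0) (V.map (_·v r) (-1ℤ ·v g))) ∎)
    where open ≈R

   reduce : ∀ e (rs : Vec Row (suc n)) → Σ (Vec Row (suc n)) λ rs' → φ e * ev2 rs ≈ ev2 rs'
   reduce (con z) rs = V.map (z ·v_) rs , trans (*-congʳ (φ-con z)) (ev2-map (ι z) (z ·v_) (λ r → sym (evv-· z r x)) rs)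
   reduce 𝕏 rs = V.map (λ r → fst (reduce-x r)) rs , ev2-map x (λ r → fst (reduce-x r)) (λ r → snd (reduce-x r)) rs
   reduce 𝕐 rs = reduce-y rs
   reduce (e ⊕ f) rs with reduce e rs | reduce f rs
   ... | a , p | b , q = add2 a b , trans (*-congʳ (φ-⊕ e f)) (trans (distribʳ (ev2 rs) (φ e) (φ f)) (trans (+-cong p q) (sym (ev2-+ a b))))
   reduce (e ⊗ f) rs with reduce f rs
   ... | b , q with reduce e b
   ... | a , p = a , trans (*-congʳ (φ-⊗ e f)) (trans (*-assoc (φ e) (φ f) (ev2 rs)) (trans (*-congˡ q) p))

   one2 : 1# ≈ ev2 ((1ℤ ∷ 0v) ∷ V.replicate n 0v)
   one2 = trans one (trans (sym (+-identityʳ _)) (+-congˡ (sym (trans (*-congˡ (zeros n)) (zeroʳ y)))))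
    where
    zeros : ∀ m → ev2 (V.replicate m 0v) ≈ 0#
    zeros zero = refl
    zeros (suc m) = trans (+-cong (evv-0 (suc n) x) (trans (*-congˡ (zeros m)) (zeroʳ y))) (+-identityˡ 0#)

   grid : Carrier → ∀ m → Vec Carrier (m N.* suc n)
   grid t zero = []
   grid t (suc m) = geo t (suc n) V.++ grid (y * t) m

   lin-grid : ∀ {m} (rs : Vec Row m) t → lin (V.concat rs) (grid t m) ≈ ev2 rs * t
   lin-grid [] t = sym (zeroˡ t)
   lin-grid {suc m} (r ∷ rs) t = trans (lin-++ R r (V.concat rs) (geo t (suc n)) (grid (y * t) m)) (trans (+-cong (lin-geo r t) (lin-grid rs (y * t)))
    (solve 4 (λ r t p y → r :* t :+ p :* (y :* t) := (r :+ y :* p) :* t) refl (evv r x) t (ev2 rs) y))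

  -- The (n + 1)² monomials in x and y of degree at most n in each, with 1 in front.
  bivariate-span : Σ ℕ λ m → Σ (Vec Carrier m) λ e0 → ∀ e → Σ (Vec ℤ (suc m)) λ c → φ e ≈ lin c (1# ∷ e0)
  bivariate-span = n N.+ n N.* suc n , geo (x * 1#) n V.++ grid (y * 1#) n , λ e → let (rs , p) = reduce e ((1ℤ ∷ 0v) ∷ V.replicate n 0v) in
   V.concat rs , trans (sym (*-identityʳ (φ e))) (trans (*-congˡ one2) (trans p (trans (sym (*-identityʳ (ev2 rs))) (sym (lin-grid rs 1#)))))

wsum-scale : ∀ cs (f : ℕ → ℤ) z k → wsum cs (λ a → f a Z.* z) k ≡ wsum cs f k Z.* z
wsum-scale [] f z k = Eq.refl
wsum-scale (c ∷ cs) f z k = Eq.trans (cong (λ t → c Z.* (f k Z.* z) Z.+ t) (wsum-scale cs f z (suc k))) (lemma c (f k) z (wsum cs f (suc k)))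
 where
 lemma : ∀ c f z w → c Z.* (f Z.* z) Z.+ w Z.* z ≡ (c Z.* f Z.+ w) Z.* z
 lemma = solveZ

wsum-ext : ∀ cs {f h : ℕ → ℤ} → (∀ a → f a ≡ h a) → ∀ k → wsum cs f k ≡ wsum cs h k
wsum-ext [] e k = Eq.refl
wsum-ext (c ∷ cs) e k = cong₂ (λ s t → c Z.* s Z.+ t) (e k) (wsum-ext cs e (suc k))

-- The ideal from which `minimal` starts. It contains G(X), G(Y) and (G(Y) - G(X)) / (Y - X), the
-- last because its product with Y - X kills v ⊗ v. Being an annihilator of an integer sequence, it
-- is saturated for free.
module BivariateRing {n : ℕ} (g : Vec ℤ (suc (suc n))) where
 open Recurrence g
 private
  G = g ∷ʳ 1ℤ

  vv : Seq
  vv i j = fund i Z.* fund j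

  Y-X : Expr
  Y-X = ZRing._-_ ℤ[X,Y] 𝕐 𝕏

 I1 : Expr → Set
 I1 e = ∀ i j → ⟦ e ⟧ vv i j ≡ 0ℤ

 -- The annihilator of (Y − X) v ⊗ v, with v the fundamental solution of the recurrence G.
 I0 : Expr → Set
 I0 e = ∀ i j → ⟦ e ⟧ (⟦ Y-X ⟧ vv) i j ≡ 0ℤ

 annihilator : ∀ w → IsIdeal ℤ[X,Y] (λ e → ∀ i j → ⟦ e ⟧ w i j ≡ 0ℤ)
 annihilator w = record
  { I-resp = λ h p i j → Eq.trans (Eq.sym (act≐ h w i j)) (p i j)
  ; I-0 = λ i j → Eq.refl
  ; I-+ = λ p q i j → cong₂ Z._+_ (p i j) (q i j)
  ; I-* = λ e p → act-0 e p }

 sat : ∀ m a → m ≢ 0ℤ → I0 (con m ⊗ a) → I0 a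
 sat m a m≢0 h i j = [ (λ z → ⊥-elim (m≢0 z)) , (λ z → z) ]′ (ZP.i*j≡0⇒i≡0∨j≡0 m (h i j))

 -- At (n + 1, n) the sequence (Y - X) v ⊗ v equals v(n + 1)² - v(n + 2) v(n) = 1, by the initial
 -- values of v; an integer annihilating it is therefore zero.
 proper : ∀ m → I0 (con m) → m ≡ 0ℤ
 proper m h = Eq.trans (Eq.sym (Eq.trans (cong (m Z.*_) unit) (ZP.*-identityʳ m))) (h (suc n) n)
  where
  unit : ⟦ Y-X ⟧ vv (suc n) n ≡ 1ℤ
  unit = Eq.trans (cong₂ (λ a b → a Z.* a Z.+ -1ℤ Z.* (fund (suc (suc n)) Z.* b)) fund-n (fund-< ≤-refl)) (cong (λ z → 1ℤ Z.+ -1ℤ Z.* z) (ZP.*-zeroʳ (fund (suc (suc n)))))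

 GX∈I1 : I1 (VecEval.evv ℤ[X,Y] G 𝕏)
 GX∈I1 i j = Eq.trans (act-ev𝕏 (toList G) vv i j) (Eq.trans (wsum-scale (toList G) fund (fund j) i) (cong (Z._* fund j) (fund-rec i)))

 GY∈I1 : I1 (VecEval.evv ℤ[X,Y] G 𝕐)
 GY∈I1 i j = Eq.trans (act-ev𝕐 (toList G) vv i j) (Eq.trans (wsum-ext (toList G) (λ b → ZP.*-comm (fund i) (fund b)) j)
  (Eq.trans (wsum-scale (toList G) fund (fund i) j) (cong (Z._* fund i) (fund-rec j))))

 I1⊆I0 : ∀ e → I1 e → I0 e
 I1⊆I0 e h i j = Eq.trans (act-comm e Y-X vv i j) (act-0 Y-X h i j)

 divided : ∀ q → ZRing._-_ ℤ[X,Y] (VecEval.evv ℤ[X,Y] G 𝕐) (VecEval.evv ℤ[X,Y] G 𝕏) ≋ (Y-X ⊗ q) → I0 q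
 divided q h i j = Eq.trans (act-comm q Y-X vv i j) (Eq.trans (Eq.sym (act≐ h vv i j)) (cong₂ Z._+_ (GY∈I1 i j) (cong (-1ℤ Z.*_) (GX∈I1 i j))))

 private
  module Q = Quotient ℤ[X,Y] I0 (annihilator (⟦ Y-X ⟧ vv))

  φ : IsExprHom Q.quotient (λ e → e)
  φ = record { φ-con = λ _ → Q.≈⇒~ (ZRing.refl ℤ[X,Y]) ; φ-⊕ = λ _ _ → Q.≈⇒~ (ZRing.refl ℤ[X,Y]) ; φ-⊗ = λ _ _ → Q.≈⇒~ (ZRing.refl ℤ[X,Y]) }

  vanish : ∀ t → I1 (PolyEval.ev ℤ[X,Y] (toList G) t) → PolyEval.ev Q.quotient (toList G) t Q.~ con 0ℤ
  vanish t h = subst (Q._~ con 0ℤ) (Eq.sym (quotient-ev ℤ[X,Y] I0 (annihilator (⟦ Y-X ⟧ vv)) (toList G) t)) (Q.~0 (I1⊆I0 (PolyEval.ev ℤ[X,Y] (toList G) t) h))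

  spanned = bivariate-span Q.quotient (λ e → e) φ g (vanish 𝕏 GX∈I1) (vanish 𝕐 GY∈I1)

 twoRootsRing : ¬ ProperFactor G → ¬ ¬ TwoRootsRing g
 twoRootsRing irr = two-roots-ring ℤ[X,Y] I0 (annihilator (⟦ Y-X ⟧ vv)) g irr sat proper 𝕏 𝕐 (I1⊆I0 (VecEval.evv ℤ[X,Y] G 𝕏) GX∈I1) (I1⊆I0 (VecEval.evv ℤ[X,Y] G 𝕐) GY∈I1) divided
  (fst (snd spanned)) (λ a → let (c , h) = snd (snd spanned) a in c ,
   subst (λ z → I0 (ZRing._-_ ℤ[X,Y] a z)) (quotient-lin ℤ[X,Y] I0 (annihilator (⟦ Y-X ⟧ vv)) c (con 1ℤ ∷ fst (snd spanned))) (Q.difference h))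

-- Binary forms

module Homogeneous (R : ZRing) where
 open RingOps R
 open VecEval R

 form : ∀ {N} → Vec ℤ (suc N) → Carrier → Carrier → Carrier
 form {zero} (c ∷ []) x z = ι c
 form {suc N} (c ∷ v) x z = ι c * pw z (suc N) + x * form v x z

 pw-cong : ∀ {x y} k → x ≈ y → pw x k ≈ pw y k
 pw-cong zero h = refl
 pw-cong (suc k) h = *-cong h (pw-cong k h)

 pw-* : ∀ x y k → pw (x * y) k ≈ pw x k * pw y k
 pw-* x y zero = sym (*-identityˡ 1#)
 pw-* x y (suc k) = trans (*-congˡ (pw-* x y k)) (solve 4 (λ x y p q → (x :* y) :* (p :* q) := (x :* p) :* (y :* q)) refl x y (pw x k) (pw y k))

 pw-+ : ∀ x i j → pw x (i N.+ j) ≈ pw x i * pw x j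
 pw-+ x zero j = sym (*-identityˡ (pw x j))
 pw-+ x (suc i) j = trans (*-congˡ (pw-+ x i j)) (sym (*-assoc x (pw x i) (pw x j)))

 pw-pw : ∀ x k n → pw (pw x k) n ≈ pw x (n N.* k)
 pw-pw x k zero = refl
 pw-pw x k (suc n) = trans (*-congˡ (pw-pw x k n)) (sym (pw-+ x k (n N.* k)))

 pw-1 : ∀ k → pw 1# k ≈ 1#
 pw-1 zero = refl
 pw-1 (suc k) = trans (*-identityˡ (pw 1# k)) (pw-1 k)

 pw-ι : ∀ z k → pw (ι z) k ≈ ι (pwZ z k)
 pw-ι z zero = sym ι-1
 pw-ι z (suc k) = trans (*-congˡ (pw-ι z k)) (sym (ι-* z (pwZ z k)))

 form-scale : ∀ {N} (v : Vec ℤ (suc N)) s x z → form v (s * x) (s * z) ≈ pw s N * form v x z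
 form-scale {zero} (c ∷ []) s x z = sym (*-identityˡ (ι c))
 form-scale {suc N} (c ∷ v) s x z = trans (+-cong (*-congˡ (pw-* s z (suc N))) (*-congˡ (form-scale v s x z)))
  (solve 7 (λ c s p q x f y → c :* ((s :* p) :* q) :+ s :* x :* (p :* f) := (s :* p) :* (c :* q :+ x :* f)) refl (ι c) s (pw s N) (pw z (suc N)) x (form v x z) z)

 form-cong : ∀ {N} (v : Vec ℤ (suc N)) {x x' z z'} → x ≈ x' → z ≈ z' → form v x z ≈ form v x' z'
 form-cong {zero} (c ∷ []) h k = refl
 form-cong {suc N} (c ∷ v) h k = +-cong (*-congˡ (pw-cong (suc N) k)) (*-cong h (form-cong v h k))

 form-1 : ∀ {N} (v : Vec ℤ (suc N)) x → form v x 1# ≈ evv v x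
 form-1 {zero} (c ∷ []) x = sym (trans (+-congˡ (zeroʳ x)) (+-identityʳ (ι c)))
 form-1 {suc N} (c ∷ v) x = +-cong (trans (*-congˡ (pw-1 (suc N))) (*-identityʳ (ι c))) (*-congˡ (form-1 v x))

open Homogeneous ℤ-ring public using () renaming (form to formZ; pw-* to pwZ-*; pw-pw to pwZ-pw; form-scale to formZ-scale; form-1 to formZ-1)

form-ι : ∀ (R : ZRing) {N} (v : Vec ℤ (suc N)) T Z → ZRing._≈_ R (Homogeneous.form R v (ZRing.ι R T) (ZRing.ι R Z)) (ZRing.ι R (formZ v T Z))
form-ι R {zero} (c ∷ []) T Z = ZRing.refl R
form-ι R {suc N} (c ∷ v) T Z = trans (+-cong (trans (*-congˡ (pw-ι Z (suc N))) (sym (ι-* c (pwZ Z (suc N))))) (trans (*-congˡ (form-ι R v T Z)) (sym (ι-* T (formZ v T Z)))))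
 (sym (ι-+ (c Z.* pwZ Z (suc N)) (T Z.* formZ v T Z)))
 where
 open RingOps R
 open Homogeneous R

open import Data.Nat using (_+_; _*_; _≟_; _≥_)
open import Data.Nat.Properties hiding (_≟_; _≤?_; _<?_)
open import Data.Nat.Divisibility using (_∣_)
open import Data.Rational as ℚ using (ℚ; 0ℚ; 1ℚ; mkℚ; toℚᵘ)
import Data.Rational.Properties as ℚP
import Data.Rational.Unnormalised as ℚᵘ
import Data.Rational.Unnormalised.Properties as ℚᵘP
open import Relation.Binary.PropositionalEquality using (refl; sym; trans; module ≡-Reasoning)

-- Rootless primes in every block

∈-take : ∀ {A : Set} k (l : List A) {a} → a ∈ take k l → a ∈ l
∈-take (suc k) (b ∷ l) (here e) = here e
∈-take (suc k) (b ∷ l) (there m) = there (∈-take k l m)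

value : ℤ → Expr → ℤ
value r (con c) = c
value r 𝕏 = r
value r 𝕐 = 1ℤ
value r (e ⊕ f) = value r e Z.+ value r f
value r (e ⊗ f) = value r e Z.* value r f

value-act : ∀ r e i j → ⟦ e ⟧ (λ i _ → pwZ r i) i j ≡ value r e Z.* pwZ r i
value-act r (con c) i j = refl
value-act r 𝕏 i j = refl
value-act r 𝕐 i j = sym (ZP.*-identityˡ (pwZ r i))
value-act r (e ⊕ f) i j = trans (cong₂ Z._+_ (value-act r e i j) (value-act r f i j)) (sym (ZP.*-distribʳ-+ (pwZ r i) (value r e) (value r f)))
value-act r (e ⊗ f) i j = trans (act-ext e (value-act r f) i j) (trans (act-* e (value r f) (λ i _ → pwZ r i) i j)
 (trans (cong (value r f Z.*_) (value-act r e i j)) (lemma (value r e) (value r f) (pwZ r i))))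
 where
 lemma : ∀ a b c → b Z.* (a Z.* c) ≡ a Z.* b Z.* c
 lemma = solveZ

-- The sequence r ^ i, constant in j, is an eigenvector of every operator e with eigenvalue
-- `value r e`; operators that act equally have equal eigenvalues.
value-≋ : ∀ r {e f} → e ≋ f → value r e ≡ value r f
value-≋ r {e} {f} h = trans (sym (at-0' e)) (trans (act≐ h (λ i _ → pwZ r i) 0 0) (at-0' f))
 where
 at-0' : ∀ e → ⟦ e ⟧ (λ i _ → pwZ r i) 0 0 ≡ value r e
 at-0' e = trans (value-act r e 0 0) (ZP.*-identityʳ (value r e))

value-ev : ∀ r cs → value r (PolyEval.ev ℤ[X,Y] cs 𝕏) ≡ evZ cs r
value-ev r [] = refl
value-ev r (c ∷ cs) = cong (λ z → c Z.+ r Z.* z) (value-ev r cs)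

module _ {n : ℕ} (g : Vec ℤ (suc n)) (irr : ¬ ProperFactor (g ∷ʳ 1ℤ)) where
 open UnivariateRing g irr

 private
  ν : Valuation (NumberRing.R numberRing)
  ν = record { val = value ; val-+ = λ _ _ _ → refl ; val-* = λ _ _ _ → refl ; val-- = λ r e → ZP.-1*i≡-i (value r e) ; val-ι = λ _ _ → refl
   ; x0 = 𝕏 ; val-x = λ _ → refl }

  value-root : ∀ {p r} → r ∈ take 2 (roots p) → ∀ {e f} → NumberRing._≈_ numberRing e f → + p ∣ᶻ value (+ r) e Z.- value (+ r) f
  value-root {p} {r} m {e} {f} h = let (a , b , eq) = difference h in
   subst (+ p ∣ᶻ_) (sym (trans (cong (λ z → value (+ r) e Z.+ z) (sym (ZP.-1*i≡-i (value (+ r) f)))) (trans (value-≋ (+ r) eq)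
    (trans (cong (λ z → z Z.* value (+ r) a Z.+ 0ℤ Z.* value (+ r) b) (value-ev (+ r) (toList G))) (ZP.+-identityʳ _)))))
    (ZD.∣m⇒∣m*n (value (+ r) a) (snd (roots⁻ {p} (∈-take 2 (roots p) m))))

 roots-upper : Σ ℕ λ C0 → ∀ X D (w : ℕ → ℕ) → 1 ≤ X → (∀ {p} → p ∈ primes X → p * w p ≡ D) → ∏ (primes X) (λ p → p ^ (ρ2 p * w p)) ≤ (C0 * X) ^ D
 roots-upper = LargerSieve.larger-sieve numberRing refl ν (λ p → take 2 (roots p))
  (λ p → Uniq.take⁺ 2 (Uniq.filter⁺ (λ r → p ∣ℕ? ∣ eval G (+ r) ∣) (Uniq.upTo⁺ p))) (λ p → ∑-take 2 (roots p)) (λ {p} m → fst (roots⁻ {p} (∈-take 2 (roots p) m))) value-root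

module Rootless {n : ℕ} (g : Vec ℤ (suc n)) where
 open Roots g

 rootless? : ∀ p → Dec (length (roots p) ≡ 0)
 rootless? p = length (roots p) ≟ 0

 two? : ∀ p → Dec (2 ≤ length (roots p))
 two? p = 2 ≤? length (roots p)

 in-block? : ∀ y p → Dec (y < p × length (roots p) ≡ 0)
 in-block? y p = (y <? p) ×-dec rootless? p

 -- For w p = D / p: the rootless primes in (y, y ^ K] have reciprocal sum at least 1/c.
 Blocks : Set
 Blocks = Σ ℕ λ c → Σ ℕ λ K → Σ ℕ λ y0 → ∀ y → y0 ≤ y → ∀ D (w : ℕ → ℕ) → (∀ {p} → p ∈ primes (y ^ K) → p * w p ≡ D) →
  D ≤ c * ∑ (primes (y ^ K)) (λ p → χ (in-block? y p) * w p)

 private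
  balance : ∀ {A : Set} (l : List A) → 1 + χ (2 ≤? length l) ≡ length (take 2 l) + χ (length l ≟ 0)
  balance [] = refl
  balance (_ ∷ []) = refl
  balance (_ ∷ _ ∷ l) = cong (1 N.+_) (χ-yes (2 ≤? suc (suc (length l))) (s≤s (s≤s z≤n)))

 product-balance : ∀ (l : List ℕ) (w : ℕ → ℕ) → ∏ l (λ p → p ^ w p) * ∏ l (λ p → p ^ (χ (two? p) * w p)) ≡ ∏ l (λ p → p ^ (ρ2 p * w p)) * ∏ l (λ p → p ^ (χ (rootless? p) * w p))
 product-balance l w = trans (sym (∏-* l _ _)) (trans (∏-cong l (λ {p} _ → trans (sym (^-distribˡ-+-* p (w p) (χ (two? p) * w p)))
  (trans (cong (p ^_) (trans (cong (_* w p) (balance (roots p))) (*-distribʳ-+ (w p) (ρ2 p) (χ (rootless? p))))) (^-distribˡ-+-* p (ρ2 p * w p) (χ (rootless? p) * w p))))) (∏-* l _ _))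

 split-at : ∀ y Z D (w : ℕ → ℕ) → 1 ≤ y → (∀ {p} → p ∈ primes Z → p * w p ≡ D) →
  Σ ℕ λ Lo → Σ ℕ λ Hi → Lo ≤ (8 * y) ^ D × Hi ≤ Z ^ ∑ (primes Z) (λ p → χ (in-block? y p) * w p) × ∏ (primes Z) (λ p → p ^ (χ (rootless? p) * w p)) ≡ Lo * Hi
 split-at y Z D w y≥1 pw = ∏ (primes Z) lo , ∏ (primes Z) hi , low , high , trans (∏-cong (primes Z) (λ {p} _ → each p)) (∏-* (primes Z) lo hi)
  where
  open ≤-Reasoning
  below? : ∀ p → Dec (p ≤ y × length (roots p) ≡ 0)
  below? p = (p ≤? y) ×-dec rootless? p
  lo hi : ℕ → ℕ
  lo p = p ^ (χ (below? p) * w p)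
  hi p = p ^ (χ (in-block? y p) * w p)
  cases : ∀ p → χ (rootless? p) ≡ χ (below? p) + χ (in-block? y p)
  cases p with ≤-<-connex p y
  ... | inj₁ h = sym (trans (cong₂ _+_ (same-χ (below? p) (rootless? p) snd (h ,_)) (χ-no (in-block? y p) (λ q → <⇒≱ (fst q) h))) (+-identityʳ _))
   where
   same-χ : ∀ {P Q : Set} (d : Dec P) (e : Dec Q) → (P → Q) → (Q → P) → χ d ≡ χ e
   same-χ d e f h = ≤-antisym (χ-mono d e f) (χ-mono e d h)
  ... | inj₂ h = sym (cong₂ _+_ (χ-no (below? p) (λ q → <⇒≱ h (fst q))) (≤-antisym (χ-mono (in-block? y p) (rootless? p) snd) (χ-mono (rootless? p) (in-block? y p) (h ,_))))
  each : ∀ p → p ^ (χ (rootless? p) * w p) ≡ lo p * hi p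
  each p = trans (cong (p ^_) (trans (cong (_* w p) (cases p)) (*-distribʳ-+ (w p) (χ (below? p)) (χ (in-block? y p))))) (^-distribˡ-+-* p (χ (below? p) * w p) (χ (in-block? y p) * w p))
  high : ∏ (primes Z) hi ≤ Z ^ ∑ (primes Z) (λ p → χ (in-block? y p) * w p)
  high = ≤-trans (∏-mono (primes Z) (λ {p} p∈ → ^-monoˡ-≤ (χ (in-block? y p) * w p) (snd (primes⁻ {Z} p∈)))) (≤-reflexive (∏-base (primes Z) Z (λ p → χ (in-block? y p) * w p)))
  small? : ∀ p → Dec (p ≤ Z)
  small? p = p ≤? Z
  low : ∏ (primes Z) lo ≤ (8 * y) ^ D
  low = begin
   ∏ (primes Z) lo ≤⟨ ∏-mono (primes Z) (λ {p} p∈ → ≤-reflexive (lo≡ p (snd (primes⁻ {Z} p∈)))) ⟩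
   ∏ (primes Z) f ≡⟨ ∏-split-filter (λ p → p ≤? y) (primes Z) f ⟩
   ∏ (filter (λ p → p ≤? y) (primes Z)) f * ∏ (filter (λ p → ¬? (p ≤? y)) (primes Z)) f
    ≤⟨ *-mono-≤ (∏-inj (filter (λ p → p ≤? y) (primes Z)) (primes y) f (Uniq.filter⁺ (λ p → p ≤? y) (primes-Unique Z))
       (λ m → let (a , b) = ∈-filter⁻ (λ p → p ≤? y) {xs = primes Z} m in primes⁺ (fst (primes⁻ {Z} a)) b) (λ {p} p∈ → pow≥1 (e p) (prime≥1 (fst (primes⁻ {y} p∈)))))
      (∏-bound (filter (λ p → ¬? (p ≤? y)) (primes Z)) 1 (λ {p} m → ≤-reflexive (cong (λ z → p ^ (z * w' p)) (χ-no (below? p) (λ q → snd (∈-filter⁻ (λ p → ¬? (p ≤? y)) {xs = primes Z} m) (fst q)))))) ⟩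
   ∏ (primes y) f * 1 ^ length (filter (λ p → ¬? (p ≤? y)) (primes Z)) ≡⟨ trans (cong (∏ (primes y) f *_) (^-zeroˡ (length (filter (λ p → ¬? (p ≤? y)) (primes Z))))) (*-identityʳ (∏ (primes y) f)) ⟩
   ∏ (primes y) f ≤⟨ mertens-upper y D e y≥1 e≤ ⟩
   (8 * y) ^ D ∎
   where
   w' e f : ℕ → ℕ
   -- The equation p · w p = D is known only up to Z, so w is cut off there before Mertens' estimate
   -- is applied to all primes up to y.
   w' p = χ (small? p) * w p
   e p = χ (below? p) * w' p
   f p = p ^ e p
   lo≡ : ∀ p → p ≤ Z → lo p ≡ f p
   lo≡ p h = cong (λ z → p ^ (χ (below? p) * z)) (sym (trans (cong (_* w p) (χ-yes (small? p) h)) (*-identityˡ (w p))))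
   e≤ : ∀ {p} → p ∈ primes y → p * e p ≤ D
   e≤ {p} p∈ = ≤-trans (*-monoʳ-≤ p (≤-trans (*-monoˡ-≤ (w' p) (χ≤1 (below? p))) (≤-reflexive (*-identityˡ (w' p))))) (pw' (small? p))
    where
    pw' : (d : Dec (p ≤ Z)) → p * (χ d * w p) ≤ D
    pw' (yes h) = ≤-trans (≤-reflexive (cong (p *_) (*-identityˡ (w p)))) (≤-reflexive (pw (primes⁺ (fst (primes⁻ {y} p∈)) h)))
    pw' (no _) = ≤-trans (≤-reflexive (*-zeroʳ p)) z≤n

module _ {n : ℕ} (g : Vec ℤ (suc (suc n))) (irr : ¬ ProperFactor (g ∷ʳ 1ℤ)) where
 open Roots g
 open Rootless g

 blocks : ¬ ¬ Blocks
 blocks = ¬¬-bind (BivariateRing.twoRootsRing g irr) (λ 𝓣 r → r (from 𝓣))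
  where
  from : TwoRootsRing g → Blocks
  from 𝓣 = 2 * suc E * κ , K , y0 , main
   where
   open SplitLower g 𝓣 using (E; Cz; Cz≥1; Y0; κ; Cst; split-lower)
   C0 = fst (roots-upper g irr)
   C1 = Cst * (16384 * C0) ^ κ
   K y0 : ℕ
   K = 2 * suc κ * suc E
   y0 = 2 + (C1 * 8 ^ κ + (Y0 + Cz))
   main : ∀ y → y0 ≤ y → ∀ D (w : ℕ → ℕ) → (∀ {p} → p ∈ primes (y ^ K) → p * w p ≡ D) → D ≤ 2 * suc E * κ * ∑ (primes (y ^ K)) (λ p → χ (in-block? y p) * w p)
   main y h D w pw = ≤-trans (block-arith2 D κ y Z C1 E (∑ (primes Z) t) (fst sp) (fst (snd sp)) Q y≥2 C1≤ (fst (snd (snd sp))) (fst (snd (snd (snd sp)))) (snd (snd (snd (snd sp)))) Z≤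
     (block-arith1 D κ Y Z Cst C0 (∏ (primes Z) (λ p → p ^ w p)) (∏ (primes Z) (λ p → p ^ (χ (two? p) * w p))) (∏ (primes Z) (λ p → p ^ (ρ2 p * w p))) Q Z≥1
      (mertens-lower Z D w Z≥1 pw') (snd (roots-upper g irr) Z D w Z≥1 pw') (product-balance (primes Z) w) (split-lower Y Y≥Y0 D w pw')))
     (*-monoʳ-≤ (2 * suc E * κ) (∑-sub (primes Z) (primes (y ^ K)) t (primes-Unique Z) (λ m → let (pr , le) = primes⁻ {Z} m in primes⁺ pr (≤-trans le Z≤K))))
    where
    t : ℕ → ℕ
    t p = χ (in-block? y p) * w p
    y≥2 : 2 ≤ y
    y≥2 = ≤-trans (m≤m+n 2 _) h
    rest : C1 * 8 ^ κ + (Y0 + Cz) ≤ y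
    rest = ≤-trans (m≤n+m _ 2) h
    C1≤ : C1 * 8 ^ κ ≤ y
    C1≤ = ≤-trans (m≤m+n _ (Y0 + Cz)) rest
    Y Z : ℕ
    Y = y ^ (2 * suc κ)
    Z = Cz * Y ^ E
    y≥1 : 1 ≤ y
    y≥1 = ≤-trans (s≤s z≤n) y≥2
    y≤Y : y ≤ Y
    y≤Y = ≤-trans (≤-reflexive (sym (*-identityʳ y))) (pow-monoʳ {y} {1} {2 * suc κ} y≥1 (s≤s z≤n))
    Y≥Y0 : Y0 ≤ Y
    Y≥Y0 = ≤-trans (≤-trans (m≤m+n Y0 Cz) (m≤n+m _ (C1 * 8 ^ κ))) (≤-trans rest y≤Y)
    Cz≤Y : Cz ≤ Y
    Cz≤Y = ≤-trans (≤-trans (m≤n+m Cz Y0) (m≤n+m _ (C1 * 8 ^ κ))) (≤-trans rest y≤Y)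
    Z≥1 : 1 ≤ Z
    Z≥1 = *-mono-≤ Cz≥1 (pow≥1 E (≤-trans y≥1 y≤Y))
    Z≤ : Z ≤ Y ^ suc E
    Z≤ = *-monoˡ-≤ (Y ^ E) Cz≤Y
    Z≤K : Z ≤ y ^ K
    Z≤K = ≤-trans Z≤ (≤-reflexive (^-*-assoc y (2 * suc κ) (suc E)))
    pw' : ∀ {p} → p ∈ primes Z → p * w p ≡ D
    pw' m = let (pr , le) = primes⁻ {Z} m in pw (primes⁺ pr (≤-trans le Z≤K))
    Q = ∏ (primes Z) (λ p → p ^ (χ (rootless? p) * w p))
    sp = split-at y Z D w y≥1 pw'

-- From rational points to roots modulo p

ιℚ-homo : ∀ (_∙_ : ℤ → ℤ → ℤ) (_∙ᵘ_ : ℚᵘ.ℚᵘ → ℚᵘ.ℚᵘ → ℚᵘ.ℚᵘ) (_∙ℚ_ : ℚ → ℚ → ℚ) →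
 (∀ p q → toℚᵘ (p ∙ℚ q) ℚᵘ.≃ (toℚᵘ p ∙ᵘ toℚᵘ q)) → (∀ {p p' q q'} → p ℚᵘ.≃ p' → q ℚᵘ.≃ q' → (p ∙ᵘ q) ℚᵘ.≃ (p' ∙ᵘ q')) →
 (∀ a b → ℚᵘ.mkℚᵘ (a ∙ b) 0 ℚᵘ.≃ (ℚᵘ.mkℚᵘ a 0 ∙ᵘ ℚᵘ.mkℚᵘ b 0)) → ∀ a b → ιℚ (a ∙ b) ≡ ιℚ a ∙ℚ ιℚ b
ιℚ-homo _∙_ _∙ᵘ_ _∙ℚ_ h cg base a b = ℚP.toℚᵘ-injective (ℚᵘP.≃-trans (ℚP.toℚᵘ-fromℚᵘ (ℚᵘ.mkℚᵘ (a ∙ b) 0)) (ℚᵘP.≃-trans (base a b)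
 (ℚᵘP.≃-trans (cg (ℚᵘP.≃-sym (ℚP.toℚᵘ-fromℚᵘ (ℚᵘ.mkℚᵘ a 0))) (ℚᵘP.≃-sym (ℚP.toℚᵘ-fromℚᵘ (ℚᵘ.mkℚᵘ b 0)))) (ℚᵘP.≃-sym (h (ιℚ a) (ιℚ b))))))

ℚ-ring : ZRing
ℚ-ring = record
 { commutativeRing = ℚP.+-*-commutativeRing
 ; ι = ιℚ
 ; ι-+ = ιℚ-homo Z._+_ ℚᵘ._+_ ℚ._+_ ℚP.toℚᵘ-homo-+ ℚᵘP.+-cong (λ a b → ℚᵘ.*≡* (lem1 a b))
 ; ι-* = ιℚ-homo Z._*_ ℚᵘ._*_ ℚ._*_ ℚP.toℚᵘ-homo-* ℚᵘP.*-cong (λ a b → ℚᵘ.*≡* refl)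
 ; ι-1 = refl
 }
 where
 lem1 : ∀ a b → (a Z.+ b) Z.* 1ℤ ≡ (a Z.* 1ℤ Z.+ b Z.* 1ℤ) Z.* 1ℤ
 lem1 = solveZ

ιℚ-injective : ∀ a b → ιℚ a ≡ ιℚ b → a ≡ b
ιℚ-injective a b e with ℚᵘP.≃-trans (ℚᵘP.≃-sym (ℚP.toℚᵘ-fromℚᵘ (ℚᵘ.mkℚᵘ a 0))) (ℚᵘP.≃-trans (ℚᵘP.≃-reflexive (cong toℚᵘ e)) (ℚP.toℚᵘ-fromℚᵘ (ℚᵘ.mkℚᵘ b 0)))
... | ℚᵘ.*≡* h = trans (sym (ZP.*-identityʳ a)) (trans h (ZP.*-identityʳ b))

clear-denominator : ∀ q → Σ ℕ λ m → 1 ≤ m × Σ ℤ λ z → ιℚ (+ m) ℚ.* q ≡ ιℚ z × (z ≡ 0ℤ → q ≡ 0ℚ)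
clear-denominator q@(mkℚ n d _) = suc d , s≤s z≤n , n , ℚP.toℚᵘ-injective (ℚᵘP.≃-trans (ℚP.toℚᵘ-homo-* (ιℚ (+ suc d)) q)
 (ℚᵘP.≃-trans (ℚᵘP.*-cong (ℚP.toℚᵘ-fromℚᵘ (ℚᵘ.mkℚᵘ (+ suc d) 0)) (ℚᵘP.≃-refl {toℚᵘ q})) (ℚᵘP.≃-trans (ℚᵘ.*≡* eq) (ℚᵘP.≃-sym (ℚP.toℚᵘ-fromℚᵘ (ℚᵘ.mkℚᵘ n 0)))))) , ℚP.↥p≡0⇒p≡0 q
 where
 eq : + suc d Z.* n Z.* 1ℤ ≡ n Z.* + (1 * suc d)
 eq = trans (ZP.*-identityʳ (+ suc d Z.* n)) (trans (ZP.*-comm (+ suc d) n) (cong (λ k → n Z.* + k) (sym (*-identityˡ (suc d)))))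

module _ where
 open RingOps ℚ-ring using (solve; _:=_; _:+_; _:*_; con)
 open VecEval ℚ-ring using (pw)
 open Homogeneous ℚ-ring

 ^ℚ-pw : ∀ q k → q ^ℚ k ≡ pw q k
 ^ℚ-pw q zero = refl
 ^ℚ-pw q (suc k) = cong (q ℚ.*_) (^ℚ-pw q k)

 ΣFin-cong : ∀ m {f h : Fin m → ℚ} → (∀ i → f i ≡ h i) → ΣFin m f ≡ ΣFin m h
 ΣFin-cong zero e = refl
 ΣFin-cong (suc m) e = cong₂ ℚ._+_ (e zero) (ΣFin-cong m (λ i → e (suc i)))

 ΣFin-* : ∀ m t (f : Fin m → ℚ) → ΣFin m (λ i → t ℚ.* f i) ≡ t ℚ.* ΣFin m f
 ΣFin-* zero t f = sym (ℚP.*-zeroʳ t)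
 ΣFin-* (suc m) t f = trans (cong (λ z → t ℚ.* f zero ℚ.+ z) (ΣFin-* m t (λ i → f (suc i)))) (sym (ℚP.*-distribˡ-+ t (f zero) (ΣFin m (λ i → f (suc i)))))

 evalHom-form : ∀ {N} (P : Poly N) t z → evalHom P t z ≡ form P t z
 evalHom-form {zero} (c ∷ []) t z = trans (ℚP.+-identityʳ _) (trans (cong (ιℚ c ℚ.*_) (ℚP.*-identityˡ 1ℚ)) (ℚP.*-identityʳ (ιℚ c)))
 evalHom-form {suc N} (c ∷ v) t z = cong₂ ℚ._+_ (cong (ιℚ c ℚ.*_) (trans (ℚP.*-identityˡ (z ^ℚ suc N)) (^ℚ-pw z (suc N))))
  (trans (ΣFin-cong (suc N) (λ i → lemma (ιℚ (lookup v i)) t (t ^ℚ toℕ i) (z ^ℚ (N ∸ toℕ i)))) (trans (ΣFin-* (suc N) t (λ i → ιℚ (lookup v i) ℚ.* ((t ^ℚ toℕ i) ℚ.* (z ^ℚ (N ∸ toℕ i))))) (cong (t ℚ.*_) (evalHom-form v t z))))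
  where
  lemma : ∀ c t p q → c ℚ.* ((t ℚ.* p) ℚ.* q) ≡ t ℚ.* (c ℚ.* (p ℚ.* q))
  lemma = solve 4 (λ c t p q → c :* ((t :* p) :* q) := t :* (c :* (p :* q))) refl

 IntegralPoint : ∀ {N} → ℕ → ℤ → Poly N → Set
 IntegralPoint n d P = Σ ℤ λ U → Σ ℤ λ W → Σ ℤ λ T → Σ ℤ λ Z → U ≢ 0ℤ × pwZ U n ≡ d Z.* (pwZ W n Z.* formZ P T Z)

 -- Let m be the product of the three denominators. Scaling t and z by m multiplies the form by m ^
 -- N, an n-th power because N = n k; it is absorbed by U, and W = m accounts for scaling y.
 integral-point : ∀ {N} n k d (P : Poly N) → N ≡ n * k → HasNontrivialPoint n d P → IntegralPoint n d P
 integral-point {N} n k d P N≡ (y , t , z , y≢0 , eq) with clear-denominator y | clear-denominator t | clear-denominator z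
 ... | a , a≥1 , Y , eY , Y0 | b , b≥1 , T , eT , _ | c , c≥1 , Z , eZ , _ = Y1 Z.* pwZ m k , m , T1 , Z1 , U≢0 , ιℚ-injective _ _ (begin
   ιℚ (pwZ (Y1 Z.* pwZ m k) n) ≡⟨ cong ιℚ (trans (pwZ-* Y1 (pwZ m k) n) (cong (λ u → pwZ Y1 n Z.* u) (trans (pwZ-pw m k n) (cong (pwZ m) (sym N≡))))) ⟩
   ιℚ (pwZ Y1 n Z.* pwZ m N) ≡⟨ ιℚ-* (pwZ Y1 n) (pwZ m N) ⟩
   ιℚ (pwZ Y1 n) ℚ.* ιℚ (pwZ m N) ≡⟨ cong₂ ℚ._*_ (sym (pw-ι Y1 n)) (sym (pw-ι m N)) ⟩
   pw (ιℚ Y1) n ℚ.* pw s N ≡⟨ cong (λ u → pw u n ℚ.* pw s N) (sym sy) ⟩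
   pw (s ℚ.* y) n ℚ.* pw s N ≡⟨ cong (ℚ._* pw s N) (trans (pw-* s y n) (cong (pw s n ℚ.*_) (trans (sym (^ℚ-pw y n)) (trans eq (cong (ιℚ d ℚ.*_) (evalHom-form P t z)))))) ⟩
   pw s n ℚ.* (ιℚ d ℚ.* form P t z) ℚ.* pw s N ≡⟨ lemma (pw s n) (ιℚ d) (form P t z) (pw s N) ⟩
   ιℚ d ℚ.* (pw s n ℚ.* (pw s N ℚ.* form P t z)) ≡⟨ cong (λ u → ιℚ d ℚ.* (pw s n ℚ.* u)) (sym (form-scale P s t z)) ⟩
   ιℚ d ℚ.* (pw s n ℚ.* form P (s ℚ.* t) (s ℚ.* z)) ≡⟨ cong (λ u → ιℚ d ℚ.* (pw s n ℚ.* u)) (trans (form-cong P st sz) (form-ι ℚ-ring P T1 Z1)) ⟩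
   ιℚ d ℚ.* (pw s n ℚ.* ιℚ (formZ P T1 Z1)) ≡⟨ cong (λ u → ιℚ d ℚ.* (u ℚ.* ιℚ (formZ P T1 Z1))) (pw-ι m n) ⟩
   ιℚ d ℚ.* (ιℚ (pwZ m n) ℚ.* ιℚ (formZ P T1 Z1)) ≡⟨ cong (ιℚ d ℚ.*_) (sym (ιℚ-* (pwZ m n) (formZ P T1 Z1))) ⟩
   ιℚ d ℚ.* ιℚ (pwZ m n Z.* formZ P T1 Z1) ≡⟨ sym (ιℚ-* d (pwZ m n Z.* formZ P T1 Z1)) ⟩
   ιℚ (d Z.* (pwZ m n Z.* formZ P T1 Z1)) ∎)
  where
  open ≡-Reasoning
  ιℚ-* = ZRing.ι-* ℚ-ring
  A = + a
  B = + b
  C = + c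
  m = A Z.* (B Z.* C)
  s = ιℚ m
  Y1 = B Z.* C Z.* Y
  T1 = A Z.* C Z.* T
  Z1 = A Z.* B Z.* Z
  lemma : ∀ p d f q → p ℚ.* (d ℚ.* f) ℚ.* q ≡ d ℚ.* (p ℚ.* (q ℚ.* f))
  lemma = solve 4 (λ p d f q → p :* (d :* f) :* q := d :* (p :* (q :* f))) refl
  clear : ∀ E F x X → ιℚ F ℚ.* x ≡ ιℚ X → m ≡ E Z.* F → s ℚ.* x ≡ ιℚ (E Z.* X)
  clear E F x X h e = trans (cong (λ u → ιℚ u ℚ.* x) e) (trans (cong (ℚ._* x) (ιℚ-* E F)) (trans (ℚP.*-assoc (ιℚ E) (ιℚ F) x) (trans (cong (ιℚ E ℚ.*_) h) (sym (ιℚ-* E X)))))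
  sy : s ℚ.* y ≡ ιℚ Y1
  sy = clear (B Z.* C) A y Y eY (ZP.*-comm A (B Z.* C))
  st : s ℚ.* t ≡ ιℚ T1
  st = clear (A Z.* C) B t T eT (l A B C)
   where
   l : ∀ a b c → a Z.* (b Z.* c) ≡ a Z.* c Z.* b
   l = solveZ
  sz : s ℚ.* z ≡ ιℚ Z1
  sz = clear (A Z.* B) C z Z eZ (sym (ZP.*-assoc A B C))
  nz : ∀ {k} → 1 ≤ k → + k ≢ 0ℤ
  nz (s≤s _) ()
  Y≢0 : Y ≢ 0ℤ
  Y≢0 h = y≢0 (Y0 h)
  U≢0 : Y1 Z.* pwZ m k ≢ 0ℤ
  U≢0 = ≢0-* (≢0-* (≢0-* (nz b≥1) (nz c≥1)) Y≢0) (pwZ≢0 k (≢0-* (nz a≥1) (≢0-* (nz b≥1) (nz c≥1))))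

pos-pw : ∀ p k → + (p ^ k) ≡ pwZ (+ p) k
pos-pw p zero = refl
pos-pw p (suc k) = trans (ZP.pos-* p (p ^ k)) (cong (+ p Z.*_) (pos-pw p k))

-- The monic polynomial G with G (a T) = a ^ (N - 1) P (T), where a is the leading coefficient of P.
lower : ∀ {m} → ℤ → Vec ℤ m → Vec ℤ m
lower a [] = []
lower {suc m} a (c ∷ v) = c Z.* pwZ a m ∷ lower a v

lower-ev : ∀ {m} a (v : Vec ℤ (suc m)) t → eval (lower a v) (a Z.* t) ≡ pwZ a m Z.* eval v t
lower-ev {zero} a (c ∷ []) t = lemma a c t
 where
 lemma : ∀ a c t → c Z.* 1ℤ Z.+ a Z.* t Z.* 0ℤ ≡ 1ℤ Z.* (c Z.+ t Z.* 0ℤ)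
 lemma = solveZ
lower-ev {suc m} a (c ∷ v) t = trans (cong (λ z → c Z.* pwZ a (suc m) Z.+ a Z.* t Z.* z) (lower-ev a v t)) (lemma a c t (pwZ a m) (eval v t))
 where
 lemma : ∀ a c t p e → c Z.* (a Z.* p) Z.+ a Z.* t Z.* (p Z.* e) ≡ a Z.* p Z.* (c Z.+ t Z.* e)
 lemma = solveZ

monic-ev : ∀ {m} a (v : Vec ℤ (suc m)) t → eval (lower a v ∷ʳ 1ℤ) (a Z.* t) ≡ pwZ a m Z.* eval (v ∷ʳ a) t
monic-ev {m} a v t = begin
 eval (lower a v ∷ʳ 1ℤ) (a Z.* t) ≡⟨ eval-∷ʳ (lower a v) 1ℤ (a Z.* t) ⟩
 eval (lower a v) (a Z.* t) Z.+ 1ℤ Z.* pwZ (a Z.* t) (suc m) ≡⟨ cong₂ (λ x y → x Z.+ 1ℤ Z.* y) (lower-ev a v t) (pwZ-* a t (suc m)) ⟩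
 pwZ a m Z.* eval v t Z.+ 1ℤ Z.* (pwZ a (suc m) Z.* pwZ t (suc m)) ≡⟨ lemma a (pwZ a m) (eval v t) (pwZ t (suc m)) ⟩
 pwZ a m Z.* (eval v t Z.+ a Z.* pwZ t (suc m)) ≡⟨ cong (pwZ a m Z.*_) (eval-∷ʳ v a t) ⟨
 pwZ a m Z.* eval (v ∷ʳ a) t ∎
 where
 open ≡-Reasoning
 lemma : ∀ a p e q → p Z.* e Z.+ 1ℤ Z.* (a Z.* p Z.* q) ≡ p Z.* (e Z.+ a Z.* q)
 lemma = solveZ

prime-∣-pw : ∀ {p} → Prime p → ∀ z k → + p ∣ᶻ pwZ z k → + p ∣ᶻ z
prime-∣-pw pr z zero d = ⊥-elim (<⇒≱ (prime≥2 pr) (ND.∣⇒≤ (∣⇒∣ᵤ d)))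
prime-∣-pw pr z (suc k) d = [ (λ h → h) , prime-∣-pw pr z k ]′ (prime-∣-* z (pwZ z k) pr d)

form-∷ʳ-0 : ∀ {N} (v : Vec ℤ N) a T → formZ (v ∷ʳ a) T 0ℤ ≡ a Z.* pwZ T N
form-∷ʳ-0 [] a T = sym (ZP.*-identityʳ a)
form-∷ʳ-0 {suc N} (c ∷ v) a T = trans (cong (λ z → c Z.* (0ℤ Z.* pwZ 0ℤ N) Z.+ T Z.* z) (form-∷ʳ-0 v a T)) (lemma c (pwZ 0ℤ N) T a (pwZ T N))
 where
 lemma : ∀ c z T a t → c Z.* (0ℤ Z.* z) Z.+ T Z.* (a Z.* t) ≡ a Z.* (T Z.* t)
 lemma = solveZ

∣-sub : ∀ {p x y} → p ∣ᶻ x Z.- y → p ∣ᶻ x → p ∣ᶻ y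
∣-sub {p} {x} {y} d h = subst (p ∣ᶻ_) (lemma x y) (ZD.∣m∣n⇒∣m-n h d)
 where
 lemma : ∀ x y → x Z.- (x Z.- y) ≡ y
 lemma = solveZ

pw-∣ : ∀ {q} a b k → q ∣ᶻ a Z.- b → q ∣ᶻ pwZ a k Z.- pwZ b k
pw-∣ {q} a b zero d = divides 0ℤ refl
pw-∣ {q} a b (suc k) d = subst (q ∣ᶻ_) (lemma a b (pwZ a k) (pwZ b k)) (ZD.∣m∣n⇒∣m+n (ZD.∣n⇒∣m*n a (pw-∣ a b k d)) (ZD.∣m⇒∣m*n (pwZ b k) d))
 where
 lemma : ∀ a b p r → a Z.* (p Z.- r) Z.+ (a Z.- b) Z.* r ≡ a Z.* p Z.- b Z.* r
 lemma = solveZ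

form-∣ : ∀ {q N} (v : Vec ℤ (suc N)) T {Z Z'} → q ∣ᶻ Z Z.- Z' → q ∣ᶻ formZ v T Z Z.- formZ v T Z'
form-∣ {q} {zero} (c ∷ []) T d = subst (q ∣ᶻ_) (sym (ZP.+-inverseʳ c)) (divides 0ℤ refl)
form-∣ {q} {suc N} (c ∷ v) T {Z} {Z'} d = subst (q ∣ᶻ_) (lemma c T (pwZ Z (suc N)) (pwZ Z' (suc N)) (formZ v T Z) (formZ v T Z'))
  (ZD.∣m∣n⇒∣m+n (ZD.∣n⇒∣m*n c (pw-∣ Z Z' (suc N) d)) (ZD.∣n⇒∣m*n T (form-∣ v T d)))
 where
 lemma : ∀ c T p r f g → c Z.* (p Z.- r) Z.+ T Z.* (f Z.- g) ≡ (c Z.* p Z.+ T Z.* f) Z.- (c Z.* r Z.+ T Z.* g)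
 lemma = solveZ

module _ {p : ℕ} (pr : Prime p) where
 private
  cancelᶻ : ∀ c {a b} → c ≢ 0ℤ → a Z.* c ≡ b Z.* c → a ≡ b
  cancelᶻ c c≢0 h = ZP.*-cancelʳ-≡ _ _ c {{Z.≢-nonZero c≢0}} h

  shrinks : ∀ u → u ≢ 0ℤ → ∣ u ∣ < ∣ u Z.* + p ∣
  shrinks u u≢0 = <-≤-trans (m<m*n ∣ u ∣ p {{≢-nonZero (λ e → u≢0 (ZP.∣i∣≡0⇒i≡0 e))}} (prime≥2 pr)) (≤-reflexive (sym (ZP.abs-* u (+ p))))

 module _ (n : ℕ) (d : ℤ) (p∣d : + p ∣ᶻ d) (free : ¬ + (p ^ n) ∣ᶻ d) where
  -- Comparing p-adic valuations: v(d) is positive and less than n.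
  valuation-descent : ∀ f U W F → ∣ U ∣ < f → U ≢ 0ℤ → ¬ + p ∣ᶻ F → pwZ U n ≡ d Z.* (pwZ W n Z.* F) → ⊥
  valuation-descent zero U W F () _ _ _
  valuation-descent (suc f) U W F lt U≢0 ¬F eq with prime-∣-pw pr U n (subst (+ p ∣ᶻ_) (sym eq) (ZD.∣m⇒∣m*n (pwZ W n Z.* F) p∣d)) | + p ∣ᶻ? (pwZ W n Z.* F)
  ... | divides U' refl | no ¬WF = free (bez (prime-power-bezout (pwZ W n Z.* F) n pr ¬WF))
   where
   pn∣ : + (p ^ n) ∣ᶻ d Z.* (pwZ W n Z.* F)
   pn∣ = divides (pwZ U' n) (trans (sym eq) (trans (pwZ-* U' (+ p) n) (cong (pwZ U' n Z.*_) (sym (pos-pw p n)))))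
   bez : (Σ ℤ λ u → Σ ℤ λ v → u Z.* (pwZ W n Z.* F) Z.+ v Z.* + (p ^ n) ≡ 1ℤ) → + (p ^ n) ∣ᶻ d
   bez (u , v , e) = subst (+ (p ^ n) ∣ᶻ_) (trans (lemma u d (pwZ W n Z.* F) v (+ (p ^ n))) (trans (cong (d Z.*_) e) (ZP.*-identityʳ d)))
    (ZD.∣m∣n⇒∣m+n (ZD.∣n⇒∣m*n u pn∣) (ZD.∣n⇒∣m*n (d Z.* v) (divides 1ℤ (sym (ZP.*-identityˡ (+ (p ^ n)))))))
    where
    lemma : ∀ u d w v q → u Z.* (d Z.* w) Z.+ d Z.* v Z.* q ≡ d Z.* (u Z.* w Z.+ v Z.* q)
    lemma = solveZ
  ... | divides U' refl | yes WF with prime-∣-* (pwZ W n) F pr WF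
  ... | inj₂ h = ¬F h
  ... | inj₁ h with prime-∣-pw pr W n h
  ... | divides W' refl = valuation-descent f U' W' F (<-≤-trans (shrinks U' U'≢0) (≤-pred lt)) U'≢0 ¬F
       (cancelᶻ (pwZ (+ p) n) (pwZ≢0 n (prime≢0 pr)) (trans (sym (pwZ-* U' (+ p) n)) (trans eq (trans (cong (λ z → d Z.* (z Z.* F)) (pwZ-* W' (+ p) n)) (lemma d (pwZ W' n) (pwZ (+ p) n) F)))))
   where
   U'≢0 : U' ≢ 0ℤ
   U'≢0 e = U≢0 (cong (Z._* + p) e)
   lemma : ∀ d w q f → d Z.* (w Z.* q Z.* f) ≡ d Z.* (w Z.* f) Z.* q
   lemma = solveZ

  -- A common factor p of T and Z leaves the form as p ^ N = (p ^ k) ^ n and is absorbed by W. Once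
  -- T and Z are not both divisible by p, `valuation-descent` rules out that p fails to divide the
  -- form.
  primitive-form : ∀ {N} k (P : Vec ℤ (suc (suc N))) → suc N ≡ n * k → ∀ f U W T Z → ∣ T ∣ + ∣ Z ∣ < f → U ≢ 0ℤ → pwZ U n ≡ d Z.* (pwZ W n Z.* formZ P T Z) →
   Σ ℤ λ T → Σ ℤ λ Z → + p ∣ᶻ formZ P T Z × (+ p ∣ᶻ T → + p ∣ᶻ Z → ⊥)
  primitive-form k P N≡ zero U W T Z () _ _
  primitive-form {N} k P N≡ (suc f) U W T Z lt U≢0 eq with + p ∣ᶻ? T | + p ∣ᶻ? Z
  ... | no ¬T | _ = T , Z , decidable-stable (+ p ∣ᶻ? formZ P T Z) (λ ¬F → valuation-descent (suc ∣ U ∣) U W (formZ P T Z) ≤-refl U≢0 ¬F eq) , (λ h _ → ¬T h)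
  ... | yes _ | no ¬Z = T , Z , decidable-stable (+ p ∣ᶻ? formZ P T Z) (λ ¬F → valuation-descent (suc ∣ U ∣) U W (formZ P T Z) ≤-refl U≢0 ¬F eq) , (λ _ h → ¬Z h)
  ... | yes (divides T' refl) | yes (divides Z' refl) = primitive-form k P N≡ f U (W Z.* pwZ (+ p) k) T' Z' (<-≤-trans smaller (≤-pred lt)) U≢0
     (trans eq (cong (d Z.*_) (begin
      pwZ W n Z.* formZ P (T' Z.* + p) (Z' Z.* + p) ≡⟨ cong₂ (λ x y → pwZ W n Z.* formZ P x y) (ZP.*-comm T' (+ p)) (ZP.*-comm Z' (+ p)) ⟩
      pwZ W n Z.* formZ P (+ p Z.* T') (+ p Z.* Z') ≡⟨ cong (pwZ W n Z.*_) (formZ-scale P (+ p) T' Z') ⟩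
      pwZ W n Z.* (pwZ (+ p) (suc N) Z.* formZ P T' Z') ≡⟨ ZP.*-assoc (pwZ W n) (pwZ (+ p) (suc N)) (formZ P T' Z') ⟨
      pwZ W n Z.* pwZ (+ p) (suc N) Z.* formZ P T' Z' ≡⟨ cong (λ z → pwZ W n Z.* z Z.* formZ P T' Z') (trans (cong (pwZ (+ p)) N≡) (sym (pwZ-pw (+ p) k n))) ⟩
      pwZ W n Z.* pwZ (pwZ (+ p) k) n Z.* formZ P T' Z' ≡⟨ cong (Z._* formZ P T' Z') (pwZ-* W (pwZ (+ p) k) n) ⟨
      pwZ (W Z.* pwZ (+ p) k) n Z.* formZ P T' Z' ∎)))
   where
   open ≡-Reasoning
   form-0 : ∀ (P : Vec ℤ (suc (suc N))) → formZ P 0ℤ 0ℤ ≡ 0ℤ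
   form-0 (c ∷ v) = lemma c (pwZ 0ℤ N) (formZ v 0ℤ 0ℤ)
    where
    lemma : ∀ c z f → c Z.* (0ℤ Z.* z) Z.+ 0ℤ Z.* f ≡ 0ℤ
    lemma = solveZ
   weak : ∀ u → ∣ u ∣ ≤ ∣ u Z.* + p ∣
   weak u = ≤-trans (m≤m*n ∣ u ∣ p {{>-nonZero (prime≥1 pr)}}) (≤-reflexive (sym (ZP.abs-* u (+ p))))
   smaller : ∣ T' ∣ + ∣ Z' ∣ < ∣ T' Z.* + p ∣ + ∣ Z' Z.* + p ∣
   smaller with T' Z.≟ 0ℤ | Z' Z.≟ 0ℤ
   ... | no T≢0 | _ = +-mono-<-≤ (shrinks T' T≢0) (weak Z')
   ... | yes _ | no Z≢0 = +-mono-≤-< (weak T') (shrinks Z' Z≢0)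
   ... | yes refl | yes refl = ⊥-elim (pwZ≢0 n U≢0 (trans eq (trans (cong (λ z → d Z.* (pwZ W n Z.* z)) (form-0 P)) (trans (cong (d Z.*_) (ZP.*-zeroʳ (pwZ W n))) (ZP.*-zeroʳ d)))))

 reduce-root : ∀ cs s → + p ∣ᶻ evZ cs s → Σ ℕ λ r → r < p × + p ∣ᶻ evZ cs (+ r)
 reduce-root cs s h = s %ℕ p , n%ℕd<d s p , ∣-sub (subst (+ p ∣ᶻ_) (sym (snd (PolyDiff.ev-diff ℤ-ring cs s (+ (s %ℕ p))))) (ZD.∣m⇒∣m*n _ (divides (s /ℕ p) diff))) h
  where
  instance
   p-nonZero : NonZero p
   p-nonZero = >-nonZero (prime≥1 pr)
  diff : s Z.- + (s %ℕ p) ≡ (s /ℕ p) Z.* + p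
  diff = trans (cong (Z._- + (s %ℕ p)) (a≡a%ℕn+[a/ℕn]*n s p)) (lemma (+ (s %ℕ p)) ((s /ℕ p) Z.* + p))
   where
   lemma : ∀ a b → a Z.+ b Z.- a ≡ b
   lemma = solveZ

 -- If p does not divide Z, the root is a T / Z modulo p. Otherwise the form is congruent to a T ^ N
 -- with T prime to p, so p divides a, and 0 is a root because the constant term of the monic
 -- polynomial is a multiple of a.
 form-root : ∀ {m} a (v : Vec ℤ (suc (suc m))) T Z → + p ∣ᶻ formZ (v ∷ʳ a) T Z → (+ p ∣ᶻ T → + p ∣ᶻ Z → ⊥) → Σ ℤ λ s → + p ∣ᶻ eval (lower a v ∷ʳ 1ℤ) s
 form-root {m} a v T Z h prim with + p ∣ᶻ? Z
 ... | no ¬Z = let (u , w , e) = prime-bezout Z pr ¬Z in a Z.* (u Z.* T) , subst (+ p ∣ᶻ_) (sym (monic-ev a v (u Z.* T)))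
    (ZD.∣n⇒∣m*n (pwZ a (suc m)) (subst (+ p ∣ᶻ_) (formZ-1 (v ∷ʳ a) (u Z.* T)) (∣-sub (form-∣ (v ∷ʳ a) (u Z.* T) (divides (Z.- w) (one u w e)))
     (subst (+ p ∣ᶻ_) (sym (formZ-scale (v ∷ʳ a) u T Z)) (ZD.∣n⇒∣m*n (pwZ u (suc (suc m))) h)))))
   where
   one : ∀ u w → u Z.* Z Z.+ w Z.* + p ≡ 1ℤ → u Z.* Z Z.- 1ℤ ≡ (Z.- w) Z.* + p
   one u w e = trans (cong (λ z → u Z.* Z Z.- z) (sym e)) (lemma (u Z.* Z) w (+ p))
    where
    lemma : ∀ a w p → a Z.- (a Z.+ w Z.* p) ≡ (Z.- w) Z.* p
    lemma = solveZ
 ... | yes p∣Z = 0ℤ , zero-root v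
   where
   p∣a : + p ∣ᶻ a
   p∣a = [ (λ h → h) , (λ q → ⊥-elim (prim (prime-∣-pw pr T (suc (suc m)) q) p∣Z)) ]′ (prime-∣-* a (pwZ T (suc (suc m))) pr
    (subst (+ p ∣ᶻ_) (form-∷ʳ-0 v a T) (∣-sub (form-∣ (v ∷ʳ a) T (subst (+ p ∣ᶻ_) (sym (ZP.+-identityʳ Z)) p∣Z)) h)))
   zero-root : ∀ (v : Vec ℤ (suc (suc m))) → + p ∣ᶻ eval (lower a v ∷ʳ 1ℤ) 0ℤ
   zero-root (c ∷ v) = ZD.∣m∣n⇒∣m+n (ZD.∣n⇒∣m*n c (ZD.∣m⇒∣m*n (pwZ a m) p∣a)) (ZD.∣m⇒∣m*n (eval (lower a v ∷ʳ 1ℤ) 0ℤ) (divides 0ℤ refl))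

local-root : ∀ {m} n k d a (v : Vec ℤ (suc (suc m))) → suc (suc m) ≡ n * k → IntegralPoint n d (v ∷ʳ a) → ∀ {p} → Prime p → p ∣ℕ ∣ d ∣ → ¬ p ^ n ∣ℕ ∣ d ∣ →
 length (Roots.roots (lower a v) p) ≢ 0
local-root {m} n k d a v N≡ (U , W , T , Z , U≢0 , eq) {p} pr p∣d free none =
 let (T' , Z' , h , prim) = primitive-form pr n d (∣ᵤ⇒∣ p∣d) (λ q → free (∣⇒∣ᵤ q)) k (v ∷ʳ a) N≡ (suc (∣ T ∣ + ∣ Z ∣)) U W T Z ≤-refl U≢0 eq
     (s , hs) = form-root pr a v T' Z' h prim
     (r , r<p , hr) = reduce-root pr (toList (lower a v ∷ʳ 1ℤ)) s hs
 in nonempty (Roots.roots⁺ (lower a v) {p} r<p hr) none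
 where
 nonempty : ∀ {A : Set} {l : List A} {x} → x ∈ l → length l ≢ 0
 nonempty {l = _ ∷ _} _ ()

-- Density of n-free integers and part (b)

Squarefree : ℕ → ℕ → Set
Squarefree x d = All (λ m → ¬ (suc (suc m) * suc (suc m) ∣ℕ d)) (upTo (suc x))

squarefree? : ∀ x d → Dec (Squarefree x d)
squarefree? x d = All.all? (λ m → ¬? (suc (suc m) * suc (suc m) ∣ℕ? d)) (upTo (suc x))

-- The sum of 1/m² over m ≥ 2 is at most 1/4 + 1/2, the second term by telescoping from m = 3; so at
-- most three quarters of the integers are excluded.
squarefree-count : ∀ x → x ≤ 4 * length (filter (squarefree? x) (range x))
squarefree-count x = +-cancelʳ-≤ (3 * x) x (4 * SF) (begin
 x + 3 * x ≡⟨⟩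
 4 * x ≤⟨ *-monoʳ-≤ 4 total ⟩
 4 * (SF + Bad) ≡⟨ *-distribˡ-+ 4 SF Bad ⟩
 4 * SF + 4 * Bad ≤⟨ +-monoʳ-≤ (4 * SF) bad≤ ⟩
 4 * SF + 3 * x ∎)
 where
 open ≤-Reasoning
 SF Bad : ℕ
 SF = length (filter (squarefree? x) (range x))
 sq : ℕ → ℕ
 sq m = suc (suc m) * suc (suc m)
 Bad = ∑ (upTo (suc x)) (λ m → x ÷ sq m)
 some : ∀ d (l : List ℕ) → ¬ All (λ m → ¬ (sq m ∣ℕ d)) l → 1 ≤ ∑ l (λ m → χ (sq m ∣ℕ? d))
 some d [] h = ⊥-elim (h All.[])
 some d (m ∷ l) h with sq m ∣ℕ? d
 ... | yes _ = s≤s z≤n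
 ... | no ¬q = some d l (λ r → h (¬q All.∷ r))
 each : ∀ d → 1 ≤ χ (squarefree? x d) + ∑ (upTo (suc x)) (λ m → χ (sq m ∣ℕ? d))
 each d with squarefree? x d
 ... | yes _ = s≤s z≤n
 ... | no ¬q = some d (upTo (suc x)) ¬q
 total : x ≤ SF + Bad
 total = begin
  x ≡⟨ sym (trans (length-map suc (upTo x)) (length-upTo x)) ⟩
  length (range x) ≡⟨ sym (trans (∑-const (range x) 1) (*-identityʳ (length (range x)))) ⟩
  ∑ (range x) (λ _ → 1) ≤⟨ ∑-mono (range x) (λ {d} _ → each d) ⟩
  ∑ (range x) (λ d → χ (squarefree? x d) + ∑ (upTo (suc x)) (λ m → χ (sq m ∣ℕ? d))) ≡⟨ ∑-+ (range x) (λ d → χ (squarefree? x d)) (λ d → ∑ (upTo (suc x)) (λ m → χ (sq m ∣ℕ? d))) ⟩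
  ∑ (range x) (λ d → χ (squarefree? x d)) + ∑ (range x) (λ d → ∑ (upTo (suc x)) (λ m → χ (sq m ∣ℕ? d)))
   ≡⟨ cong₂ _+_ (sym (length-filter-∑ (squarefree? x) (range x))) (∑-swap (range x) (upTo (suc x)) (λ d m → χ (sq m ∣ℕ? d))) ⟩
  SF + ∑ (upTo (suc x)) (λ m → ∑ (range x) (λ d → χ (sq m ∣ℕ? d)))
   ≤⟨ +-monoʳ-≤ SF (∑-mono (upTo (suc x)) (λ {m} _ → ÷-greatest _ (s≤s z≤n) (≤-trans (≤-reflexive (cong (_* sq m) (∑-map (upTo x) suc (λ d → χ (sq m ∣ℕ? d))))) (count-multiples (sq m) x (s≤s z≤n))))) ⟩
  SF + Bad ∎
 tail : ℕ
 tail = ∑ (upTo x) (λ i → x ÷ ((3 + i) * (3 + i)))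
 tail≤ : 2 * tail ≤ x
 tail≤ = *-cancelˡ-≤' (suc (suc x)) (s≤s z≤n) (≤-trans (≤-reflexive (lemma x tail)) (≤-trans (∑-telescope 2 x x (s≤s z≤n)) (*-monoˡ-≤ x (≤-trans (n≤1+n x) (n≤1+n (suc x))))))
  where
  lemma : ∀ x t → suc (suc x) * (2 * t) ≡ 2 * suc (suc x) * t
  lemma = solve-∀
 bad≤ : 4 * Bad ≤ 3 * x
 bad≤ = begin
  4 * Bad ≡⟨ cong (4 *_) (trans (cong (λ n → ∑ (upTo n) (λ m → x ÷ sq m)) (+-comm 1 x)) (trans (∑-upTo-+ x 1 (λ m → x ÷ sq m)) (cong₂ _+_ (+-identityʳ (x ÷ 4)) (∑-cong (upTo x) (λ {i} _ → cong (λ z → x ÷ (z * z)) (cong (2 N.+_) (+-comm i 1))))))) ⟩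
  4 * (x ÷ 4 + tail) ≡⟨ lemma (x ÷ 4) tail ⟩
  x ÷ 4 * 4 + 2 * (2 * tail) ≤⟨ +-mono-≤ (÷-≤ x 4) (*-monoʳ-≤ 2 tail≤) ⟩
  x + 2 * x ∎
  where
  lemma : ∀ a t → 4 * (a + t) ≡ a * 4 + 2 * (2 * t)
  lemma = solve-∀

n-free-list : ∀ n x → 2 ≤ n → Σ (List ℤ) λ M → DistinctIn (NFreeLE n x) M × x ≤ 4 * suc (length M)
n-free-list n x n≥2 = map +_ l , (Uniq.map⁺ ZP.+-injective (Uniq.filter⁺ (λ d → 2 ≤? d) (Uniq.filter⁺ (squarefree? x) (range-Unique x))) , All.tabulate good) , ≤-trans (squarefree-count x) (*-monoʳ-≤ 4 count)
 where
 open ≤-Reasoning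
 l0 = filter (squarefree? x) (range x)
 l = filter (λ d → 2 ≤? d) l0
 good : ∀ {d} → d ∈ map +_ l → NFreeLE n x d
 good m with ∈-map⁻ +_ m
 ... | d , d∈ , refl with ∈-filter⁻ (λ d → 2 ≤? d) {xs = l0} d∈
 ... | d∈0 , d≥2 with ∈-filter⁻ (squarefree? x) {xs = range x} d∈0
 ... | d∈r , sf with range⁻ {x} d∈r
 ... | d≥1 , d≤x = ((λ e → <⇒≱ d≥1 (≤-reflexive (ZP.+-injective e))) , (λ e → <⇒≱ d≥2 (≤-reflexive (ZP.+-injective e))) , free) , d≤x
  where
  free : ∀ p → Prime p → ¬ p ^ n ∣ℕ d
  free p pr dv = excluded p (prime≥2 pr) (ND.∣-trans (square∣ p) dv)
   where
   square∣ : ∀ p → p * p ∣ℕ p ^ n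
   square∣ p = subst (λ k → p * p ∣ℕ p ^ k) (m+[n∸m]≡n n≥2) (subst (_∣ℕ p * (p * p ^ (n ∸ 2))) refl (ND.divides (p ^ (n ∸ 2)) (trans (sym (*-assoc p p (p ^ (n ∸ 2)))) (*-comm (p * p) (p ^ (n ∸ 2))))))
   excluded : ∀ p → 2 ≤ p → ¬ p * p ∣ℕ d
   excluded (suc (suc m)) _ q = All.lookup sf (∈-upTo⁺ (s≤s m≤x)) q
    where
    m≤x : m ≤ x
    m≤x = ≤-trans (≤-trans (n≤1+n m) (n≤1+n (suc m))) (≤-trans (m≤m*n (suc (suc m)) (suc (suc m))) (≤-trans (ND.∣⇒≤ {{>-nonZero d≥1}} q) d≤x))
   excluded (suc zero) (s≤s ())
 count : length l0 ≤ suc (length (map +_ l))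
 count = begin
  length l0 ≡⟨ sym (trans (∑-const l0 1) (*-identityʳ (length l0))) ⟩
  ∑ l0 (λ _ → 1) ≤⟨ ∑-mono l0 (λ {d} d∈ → each d (fst (range⁻ {x} (fst (∈-filter⁻ (squarefree? x) {xs = range x} d∈))))) ⟩
  ∑ l0 (λ d → χ (1 ≟ d) + χ (2 ≤? d)) ≡⟨ ∑-+ l0 (λ d → χ (1 ≟ d)) (λ d → χ (2 ≤? d)) ⟩
  ∑ l0 (λ d → χ (1 ≟ d)) + ∑ l0 (λ d → χ (2 ≤? d))
   ≤⟨ +-mono-≤ (≤-trans (≤-reflexive (sym (length-filter-∑ (1 ≟_) l0))) (at-most-one (Uniq.filter⁺ (1 ≟_) (Uniq.filter⁺ (squarefree? x) (range-Unique x)))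
      (λ a b → trans (sym (snd (∈-filter⁻ (1 ≟_) {xs = l0} a))) (snd (∈-filter⁻ (1 ≟_) {xs = l0} b)))))
     (≤-reflexive (sym (trans (length-map +_ l) (length-filter-∑ (λ d → 2 ≤? d) l0)))) ⟩
  1 + length (map +_ l) ∎
  where
  each : ∀ d → 1 ≤ d → 1 ≤ χ (1 ≟ d) + χ (2 ≤? d)
  each (suc zero) _ = s≤s z≤n
  each (suc (suc d)) _ = ≤-reflexive (sym (χ-yes (2 ≤? suc (suc d)) (s≤s (s≤s z≤n))))

Negligible : ∀ {N} → ℕ → Poly N → ℕ → ℕ → Set
Negligible n P k x0 = ∀ (x : ℕ) → x0 ≤ x → ∀ (L : List ℤ) → DistinctIn (InNPx n P x) L →
 Σ (List ℤ) λ M → DistinctIn (NFreeLE n x) M × (k * length L ≤ length M)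

SmallTwists : ∀ {N} → ℕ → Poly N → Set
SmallTwists n P =
 (Σ ℕ λ p → Σ ℕ λ q → 0 < p × p < q ×
  Σ ℕ λ C → Σ ℕ λ x0 → ∀ (x : ℕ) → x0 ≤ x → ∀ (L : List ℤ) → DistinctIn (InNPx n P x) L →
   length L ^ q * ⌊log₂ x ⌋ ^ p ≤ C * x ^ q) ×
 (∀ (k : ℕ) → 1 ≤ k → Σ ℕ (Negligible n P k))

power-saving⇒small : ∀ {N} n (P : Poly N) q → 2 ≤ n → 1 < q → (Σ ℕ λ C → Σ ℕ λ x0 → ∀ x → x0 ≤ x → ∀ (L : List ℤ) → DistinctIn (InNPx n P x) L → length L ^ q * ⌊log₂ x ⌋ ≤ C * x ^ q) → SmallTwists n P
power-saving⇒small n P q n≥2 q>1 (C , x0 , bd) = (1 , q , s≤s z≤n , q>1 , C , x0 , λ x h L d → subst (λ z → length L ^ q * z ≤ C * x ^ q) (sym (*-identityʳ ⌊log₂ x ⌋)) (bd x h L d)) , density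
 where
 density : ∀ k → 1 ≤ k → Σ ℕ (Negligible n P k)
 density k k≥1 = x0 + (8 + 2 ^ T) , main
  where
  -- Once log₂ x ≥ T, the power saving gives 8 k |L| ≤ x. Together with x ≥ 8 this yields 8 + 8 k
  -- |L| ≤ 2x ≤ 8 + 8 |M|, which also settles the missing integer 1.
  T = suc C * (8 * k) ^ q
  main : Negligible n P k (x0 + (8 + 2 ^ T))
  main x h L dL = let (M , dM , big) = n-free-list n x n≥2 in M , dM , *-cancelˡ-≤ 8 (+-cancelˡ-≤ 8 (8 * (k * length L)) (8 * length M) (begin
    8 + 8 * (k * length L) ≡⟨ cong (8 N.+_) (sym (*-assoc 8 k (length L))) ⟩
    8 + 8 * k * length L ≤⟨ +-mono-≤ x≥8 8kL ⟩
    x + x ≤⟨ +-mono-≤ big big ⟩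
    4 * suc (length M) + 4 * suc (length M) ≡⟨ lemma (length M) ⟩
    8 + 8 * length M ∎))
   where
   open ≤-Reasoning
   lemma : ∀ m → 4 * suc m + 4 * suc m ≡ 8 + 8 * m
   lemma = solve-∀
   rest : 8 + 2 ^ T ≤ x
   rest = ≤-trans (m≤n+m _ x0) h
   x≥8 : 8 ≤ x
   x≥8 = ≤-trans (m≤m+n 8 (2 ^ T)) rest
   x≥1 : 1 ≤ x
   x≥1 = ≤-trans (s≤s z≤n) x≥8
   T≤ : T ≤ ⌊log₂ x ⌋
   T≤ = ≤-pred (pow-< (≤-<-trans (≤-trans (m≤n+m (2 ^ T) 8) rest) (snd (2^⌊log₂⌋ x x≥1))))
    where
    pow-< : ∀ {i j} → 2 ^ i < 2 ^ j → i < j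
    pow-< {i} {j} h with i <? j
    ... | yes q = q
    ... | no ¬q = ⊥-elim (<⇒≱ h (^-monoʳ-≤ 2 (≮⇒≥ ¬q)))
   8kL : 8 * k * length L ≤ x
   8kL = root-≤ q (<⇒≤ q>1) (*-cancelˡ-≤' (suc C) (s≤s z≤n) (begin
    suc C * (8 * k * length L) ^ q ≡⟨ cong (suc C *_) (^-*-distrib q (8 * k) (length L)) ⟩
    suc C * ((8 * k) ^ q * length L ^ q) ≡⟨ trans (sym (*-assoc (suc C) ((8 * k) ^ q) (length L ^ q))) (*-comm T (length L ^ q)) ⟩
    length L ^ q * T ≤⟨ *-monoʳ-≤ (length L ^ q) T≤ ⟩
    length L ^ q * ⌊log₂ x ⌋ ≤⟨ bd x (≤-trans (m≤m+n x0 _) h) L dL ⟩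
    C * x ^ q ≤⟨ *-monoˡ-≤ (x ^ q) (n≤1+n C) ⟩
    suc C * x ^ q ∎))

length-split : ∀ {A : Set} {P : A → Set} (P? : ∀ x → Dec (P x)) (L : List A) → length L ≡ length (filter P? L) + length (filter (λ x → ¬? (P? x)) L)
length-split P? [] = refl
length-split P? (x ∷ L) with P? x
... | yes _ = cong suc (length-split P? L)
... | no _ = trans (cong suc (length-split P? L)) (sym (+-suc (length (filter P? L)) _))

-- Absolute value is injective on each sign, and one of the two signs carries at least half of L.
signed-count : ∀ (Q : ℕ → Set) q ℓ B → (∀ l → Unique l → (∀ {d} → d ∈ l → Q d) → length l ^ q * ℓ ≤ B) → ∀ (L : List ℤ) → Unique L → (∀ {d} → d ∈ L → Q ∣ d ∣) → length L ^ q * ℓ ≤ 2 ^ q * B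
signed-count Q q ℓ B bd L uL good = [ (λ h → finish neg h (neg-bound)) , (λ h → finish pos (≤-trans (≤-reflexive split) (≤-trans (+-monoʳ-≤ (length pos) h) (≤-reflexive (cong (length pos N.+_) (sym (+-identityʳ (length pos))))))) pos-bound) ]′ small
 where
 nonneg? : ∀ z → Dec (z ≡ + ∣ z ∣)
 nonneg? z = z Z.≟ + ∣ z ∣
 pos = filter nonneg? L
 neg = filter (λ z → ¬? (nonneg? z)) L
 split : length L ≡ length pos + length neg
 split = length-split nonneg? L
 abs-neg : ∀ z → z ≢ + ∣ z ∣ → z ≡ Z.- (+ ∣ z ∣)
 abs-neg (+ n) h = ⊥-elim (h refl)
 abs-neg -[1+ n ] h = refl
 abs-list : ∀ l → Unique l → (∀ {y z} → y ∈ l → z ∈ l → ∣ y ∣ ≡ ∣ z ∣ → y ≡ z) → (∀ {z} → z ∈ l → z ∈ L) → length l ^ q * ℓ ≤ B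
 abs-list l ul inj sub = subst (λ k → k ^ q * ℓ ≤ B) (length-map ∣_∣ l) (bd (map ∣_∣ l) (map-Unique ∣_∣ l ul inj) (λ m → let (z , z∈ , e) = ∈-map⁻ ∣_∣ m in subst Q (sym e) (good (sub z∈))))
 pos-bound : length pos ^ q * ℓ ≤ B
 pos-bound = abs-list pos (Uniq.filter⁺ nonneg? uL) (λ a b e → trans (snd (∈-filter⁻ nonneg? {xs = L} a)) (trans (cong +_ e) (sym (snd (∈-filter⁻ nonneg? {xs = L} b))))) (λ m → fst (∈-filter⁻ nonneg? {xs = L} m))
 neg-bound : length neg ^ q * ℓ ≤ B
 neg-bound = abs-list neg (Uniq.filter⁺ (λ z → ¬? (nonneg? z)) uL)
  (λ {y} {z} a b e → trans (abs-neg y (snd (∈-filter⁻ (λ z → ¬? (nonneg? z)) {xs = L} a))) (trans (cong (λ k → Z.- (+ k)) e) (sym (abs-neg z (snd (∈-filter⁻ (λ z → ¬? (nonneg? z)) {xs = L} b)))))) (λ m → fst (∈-filter⁻ (λ z → ¬? (nonneg? z)) {xs = L} m))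
 small : length L ≤ 2 * length neg ⊎ length neg ≤ length pos
 small with ≤-total (length pos) (length neg)
 ... | inj₁ h = inj₁ (≤-trans (≤-reflexive split) (≤-trans (+-monoˡ-≤ (length neg) h) (≤-reflexive (cong (length neg N.+_) (sym (+-identityʳ (length neg)))))))
 ... | inj₂ h = inj₂ h
 finish : ∀ (l : List ℤ) → length L ≤ 2 * length l → length l ^ q * ℓ ≤ B → length L ^ q * ℓ ≤ 2 ^ q * B
 finish l h b = ≤-trans (*-monoˡ-≤ ℓ (≤-trans (^-monoˡ-≤ q h) (≤-reflexive (^-*-distrib q 2 (length l))))) (≤-trans (≤-reflexive (*-assoc (2 ^ q) (length l ^ q) ℓ)) (*-monoʳ-≤ (2 ^ q) b))

small-twists : ∀ {m} n k a (v : Vec ℤ (suc (suc m))) → 2 ≤ n → suc (suc m) ≡ n * k → ¬ ProperFactor (lower a v ∷ʳ 1ℤ) → ¬ ¬ SmallTwists n (v ∷ʳ a)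
small-twists {m} n k a v n≥2 N≡ irr = ¬¬-bind (blocks (lower a v) irr) (λ bl r → r (from bl))
 where
 open Roots (lower a v)
 open Rootless (lower a v)
 from : Blocks → SmallTwists n (v ∷ʳ a)
 from (c , K , y0 , block) = power-saving⇒small n (v ∷ʳ a) (suc c * (2 + K)) n≥2 (≤-trans (m≤m+n 2 K) (m≤m+n (2 + K) (c * (2 + K)))) (2 ^ (suc c * (2 + K)) * C , x0 , main)
  where
  -- Enlarging c to c + 1 and K to K + 2 only weakens the statement about blocks and secures the
  -- bounds c ≥ 1 and K ≥ 2 of the sieve.
  block' : ∀ y → 2 ^ suc y0 ≤ y → ∀ D (w : ℕ → ℕ) → (∀ {p} → p ∈ primes (y ^ (2 + K)) → p * w p ≡ D) → D ≤ suc c * ∑ (primes (y ^ (2 + K))) (λ p → χ (in-block? y p) * w p)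
  block' y h D w pw = ≤-trans (block y (≤-trans (≤-trans (n≤1+n y0) (<⇒≤ (n<2^n (suc y0)))) h) D w (λ m → pw (sub m)))
    (*-mono-≤ (n≤1+n c) (∑-sub (primes (y ^ K)) (primes (y ^ (2 + K))) (λ p → χ (in-block? y p) * w p) (primes-Unique (y ^ K)) sub))
   where
   sub : ∀ {p} → p ∈ primes (y ^ K) → p ∈ primes (y ^ (2 + K))
   sub m = let (pr , le) = primes⁻ {y ^ K} m in primes⁺ pr (≤-trans le (pow-monoʳ (≤-trans (pow≥1 (suc y0) (s≤s z≤n)) h) (m≤n+m K 2)))
  open Sieve (λ p → length (roots p) ≡ 0) rootless? (suc c) (2 + K) (suc y0) (m≤m+n 2 K) block' using (count-bound)
  bound = count-bound (s≤s z≤n) (s≤s z≤n)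
  C = fst bound
  x0 = fst (snd bound)
  q = suc c * (2 + K)
  main : ∀ x → x0 ≤ x → ∀ (L : List ℤ) → DistinctIn (InNPx n (v ∷ʳ a) x) L → length L ^ q * ⌊log₂ x ⌋ ≤ 2 ^ q * C * x ^ q
  main x h L (uL , aL) = ≤-trans (signed-count (λ d → (1 ≤ d × d ≤ x) × (∀ {p} → Prime p → length (roots p) ≡ 0 → ¬ p ∣ℕ d)) q ⌊log₂ x ⌋ (C * x ^ q) (λ l ul good → snd (snd bound) x h l ul good) L uL good)
    (≤-reflexive (sym (*-assoc (2 ^ q) C (x ^ q))))
   where
   good : ∀ {d} → d ∈ L → (1 ≤ ∣ d ∣ × ∣ d ∣ ≤ x) × (∀ {p} → Prime p → length (roots p) ≡ 0 → ¬ p ∣ℕ ∣ d ∣)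
   good {d} d∈ with All.lookup aL d∈
   ... | ((d≢0 , _ , free) , point) , d≤x = (∣i∣≥1 d≢0 , d≤x) , λ {p} pr none p∣d → local-root n k d a v N≡ (integral-point n k d (v ∷ʳ a) N≡ point) pr p∣d (free p pr) none

-- Gauss's lemma and Eisenstein's criterion

coef : List ℤ → ℕ → ℤ
coef [] k = 0ℤ
coef (a ∷ as) zero = a
coef (a ∷ as) (suc k) = coef as k

coef-addP : ∀ as bs k → coef (addP as bs) k ≡ coef as k Z.+ coef bs k
coef-addP [] bs k = sym (ZP.+-identityˡ (coef bs k))
coef-addP (a ∷ as) [] k = sym (ZP.+-identityʳ (coef (a ∷ as) k))
coef-addP (a ∷ as) (b ∷ bs) zero = refl
coef-addP (a ∷ as) (b ∷ bs) (suc k) = coef-addP as bs k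

coef-scaleP : ∀ c as k → coef (scaleP c as) k ≡ c Z.* coef as k
coef-scaleP c [] k = sym (ZP.*-zeroʳ c)
coef-scaleP c (a ∷ as) zero = refl
coef-scaleP c (a ∷ as) (suc k) = coef-scaleP c as k

coef-zero : ∀ {as} → All (_≡ 0ℤ) as → ∀ k → coef as k ≡ 0ℤ
coef-zero All.[] k = refl
coef-zero (e All.∷ zs) zero = e
coef-zero (e All.∷ zs) (suc k) = coef-zero zs k

_≗ₚ_ : List ℤ → List ℤ → Set
as ≗ₚ bs = ∀ t → evZ as t ≡ evZ bs t

coef-≗ : ∀ as bs → as ≗ₚ bs → ∀ k → coef as k ≡ coef bs k
coef-≗ as bs h k = ZP.i-j≡0⇒i≡j (coef as k) (coef bs k) (trans (sym (trans (coef-addP as (scaleP -1ℤ bs) k) (cong (λ z → coef as k Z.+ z) (trans (coef-scaleP -1ℤ bs k) (ZP.-1*i≡-i (coef bs k))))))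
 (coef-zero (polynomial-identity (addP as (scaleP -1ℤ bs)) (λ t → trans (evZ-addP as (scaleP -1ℤ bs) (+ suc t)) (trans (cong₂ Z._+_ (h (+ suc t)) (evZ-scaleP -1ℤ bs (+ suc t))) (lemma (evZ bs (+ suc t)))))) k))
 where
 lemma : ∀ a → a Z.+ -1ℤ Z.* a ≡ 0ℤ
 lemma = solveZ

coef-mul-0 : ∀ a as b bs → coef (mulP (a ∷ as) (b ∷ bs)) 0 ≡ a Z.* b
coef-mul-0 a as b bs = ZP.+-identityʳ (a Z.* b)

coef-mul-suc : ∀ a as bs k → coef (mulP (a ∷ as) bs) (suc k) ≡ a Z.* coef bs (suc k) Z.+ coef (mulP as bs) k
coef-mul-suc a as bs k = trans (coef-addP (scaleP a bs) (0ℤ ∷ mulP as bs) (suc k)) (cong (Z._+ coef (mulP as bs) k) (coef-scaleP a bs (suc k)))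

mulP-comm : ∀ as bs → mulP as bs ≗ₚ mulP bs as
mulP-comm as bs t = trans (evZ-mulP as bs t) (trans (ZP.*-comm (evZ as t) (evZ bs t)) (sym (evZ-mulP bs as t)))

module _ {p : ℕ} (pr : Prime p) where
 Divisible : List ℤ → Set
 Divisible as = ∀ k → + p ∣ᶻ coef as k

 private
  cons : ∀ {a as} → + p ∣ᶻ a → Divisible as → Divisible (a ∷ as)
  cons h d zero = h
  cons h d (suc k) = d k

  strip : ∀ a as bs → + p ∣ᶻ a → Divisible (mulP (a ∷ as) bs) → Divisible (mulP as bs)
  strip a as bs h d k = ZD.∣m+n∣m⇒∣n (subst (+ p ∣ᶻ_) (coef-mul-suc a as bs k) (d (suc k))) (ZD.∣m⇒∣m*n (coef bs (suc k)) h)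

 -- Gauss's lemma modulo p, stripping constant coefficients divisible by p.
 gauss-mod : ∀ as bs → Divisible (mulP as bs) → Divisible as ⊎ Divisible bs
 gauss-mod as bs d = go (length as + length bs) as bs ≤-refl d
  where
  go : ∀ f as bs → length as + length bs ≤ f → Divisible (mulP as bs) → Divisible as ⊎ Divisible bs
  go f [] bs h d = inj₁ (λ k → divides 0ℤ refl)
  go f (a ∷ as) [] h d = inj₂ (λ k → divides 0ℤ refl)
  go (suc f) (a ∷ as) (b ∷ bs) (s≤s h) d with prime-∣-* a b pr (subst (+ p ∣ᶻ_) (coef-mul-0 a as b bs) (d 0))
  ... | inj₁ p∣a = [ (λ q → inj₁ (cons p∣a q)) , inj₂ ]′ (go f as (b ∷ bs) h (strip a as (b ∷ bs) p∣a d))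
  ... | inj₂ p∣b = [ inj₁ , (λ q → inj₂ (cons p∣b q)) ]′ (go f (a ∷ as) bs (≤-trans (≤-reflexive (sym (+-suc (length as) (length bs)))) h)
    (λ k → subst (+ p ∣ᶻ_) (coef-≗ (mulP bs (a ∷ as)) (mulP (a ∷ as) bs) (mulP-comm bs (a ∷ as)) k)
     (strip b bs (a ∷ as) p∣b (λ k → subst (+ p ∣ᶻ_) (coef-≗ (mulP (a ∷ as) (b ∷ bs)) (mulP (b ∷ bs) (a ∷ as)) (mulP-comm (a ∷ as) (b ∷ bs)) k) (d k)) k)))

coef-lookup : ∀ {m} (v : Vec ℤ m) i → coef (toList v) (toℕ i) ≡ lookup v i
coef-lookup (a ∷ v) zero = refl
coef-lookup (a ∷ v) (suc i) = coef-lookup v i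

coef-∷ʳ : ∀ {m} (v : Vec ℤ m) a → coef (toList (v ∷ʳ a)) m ≡ a
coef-∷ʳ [] a = refl
coef-∷ʳ (c ∷ v) a = coef-∷ʳ v a

coef-≥ : ∀ {m} (v : Vec ℤ m) {k} → m ≤ k → coef (toList v) k ≡ 0ℤ
coef-≥ [] h = refl
coef-≥ (c ∷ v) (s≤s h) = coef-≥ v h

vec-≗ : ∀ {m} (u v : Vec ℤ m) → (∀ t → eval u t ≡ eval v t) → u ≡ v
vec-≗ u v h = ext u v (λ i → trans (sym (coef-lookup u i)) (trans (coef-≗ (toList u) (toList v) h (toℕ i)) (coef-lookup v i)))
 where
 ext : ∀ {m} (u v : Vec ℤ m) → (∀ i → lookup u i ≡ lookup v i) → u ≡ v
 ext [] [] h = refl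
 ext (a ∷ u) (b ∷ v) h = cong₂ _∷_ (h zero) (ext u v (λ i → h (suc i)))

IntegralFactor : ∀ {N} → Vec ℤ (suc N) → Set
IntegralFactor {N} P = Σ (Vec ℤ N) λ Q → Σ (Vec ℤ N) λ R → ∀ t → eval P t ≡ eval Q t Z.* eval R t

-- Descent on |c|: a prime dividing c divides all coefficients of g or all of h by `gauss-mod`, and
-- can be cancelled.
gauss : ∀ {N} (P : Vec ℤ (suc N)) → ProperFactor P → IntegralFactor P
gauss {N} P (c , c≢0 , g , h , eq) = go (suc ∣ c ∣) c g h ≤-refl c≢0 eq
 where
 go : ∀ f c (g h : Vec ℤ N) → ∣ c ∣ < f → c ≢ 0ℤ → (∀ t → c Z.* eval P t ≡ eval g t Z.* eval h t) → IntegralFactor P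
 go (suc f) c g h lt c≢0 eq with 2 ≤? ∣ c ∣
 ... | no ¬big = unit c (≤-pred (≰⇒> ¬big)) c≢0 eq
  where
  unit : ∀ c → ∣ c ∣ ≤ 1 → c ≢ 0ℤ → (∀ t → c Z.* eval P t ≡ eval g t Z.* eval h t) → IntegralFactor P
  unit (+ 0) _ c≢0 _ = ⊥-elim (c≢0 refl)
  unit (+ 1) _ _ eq = g , h , λ t → trans (sym (ZP.*-identityˡ (eval P t))) (eq t)
  unit -[1+ 0 ] _ _ eq = -1ℤ ·v g , h , λ t → trans (lem1 (eval P t)) (trans (cong (-1ℤ Z.*_) (eq t)) (trans (sym (ZP.*-assoc -1ℤ (eval g t) (eval h t))) (cong (Z._* eval h t) (sym (eval-· -1ℤ g t)))))
   where
   lem1 : ∀ a → a ≡ -1ℤ Z.* (-1ℤ Z.* a)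
   lem1 = solveZ
  unit (+ suc (suc _)) (s≤s ()) _ _
  unit -[1+ suc _ ] (s≤s ()) _ _
 ... | yes big with prime-divisor ∣ c ∣ big
 ... | p , pr , p∣c with ∣ᵤ⇒∣ {+ p} {c} p∣c
 ... | divides c' refl = [ left , right ]′ (gauss-mod pr (toList g) (toList h) all∣)
  where
  c'≢0 : c' ≢ 0ℤ
  c'≢0 refl = c≢0 refl
  smaller : ∣ c' ∣ < f
  smaller = <-≤-trans (<-≤-trans (m<m*n ∣ c' ∣ p {{≢-nonZero (λ e → c'≢0 (ZP.∣i∣≡0⇒i≡0 e))}} (prime≥2 pr)) (≤-reflexive (sym (ZP.abs-* c' (+ p))))) (≤-pred lt)
  all∣ : Divisible pr (mulP (toList g) (toList h))
  all∣ k = subst (+ p ∣ᶻ_) (trans (sym (coef-scaleP (c' Z.* + p) (toList P) k)) (coef-≗ (scaleP (c' Z.* + p) (toList P)) (mulP (toList g) (toList h))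
   (λ t → trans (evZ-scaleP (c' Z.* + p) (toList P) t) (trans (eq t) (sym (evZ-mulP (toList g) (toList h) t)))) k))
   (ZD.∣m⇒∣m*n (coef (toList P) k) (divides c' refl))
  divided : ∀ (u : Vec ℤ N) → Divisible pr (toList u) → Σ (Vec ℤ N) λ u' → u ≡ (+ p) ·v u'
  divided u d = divide-vec u (λ i → subst (+ p ∣ᶻ_) (coef-lookup u i) (d (toℕ i)))
  cancelp : ∀ {a b} → + p Z.* a ≡ + p Z.* b → a ≡ b
  cancelp e = ZP.*-cancelˡ-≡ (+ p) _ _ {{Z.≢-nonZero (prime≢0 pr)}} e
  lemma1 : ∀ c p P → p Z.* (c Z.* P) ≡ c Z.* p Z.* P
  lemma1 = solveZ
  lemma2 : ∀ p g h → g Z.* (p Z.* h) ≡ p Z.* (g Z.* h)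
  lemma2 = solveZ
  left : Divisible pr (toList g) → IntegralFactor P
  left d = let (g' , e) = divided g d in go f c' g' h smaller c'≢0 (λ t → cancelp (trans (lemma1 c' (+ p) (eval P t)) (trans (eq t) (trans (cong (Z._* eval h t) (trans (cong (λ u → eval u t) e) (eval-· (+ p) g' t))) (ZP.*-assoc (+ p) (eval g' t) (eval h t))))))
  right : Divisible pr (toList h) → IntegralFactor P
  right d = let (h' , e) = divided h d in go f c' g h' smaller c'≢0 (λ t → cancelp (trans (lemma1 c' (+ p) (eval P t)) (trans (eq t) (trans (cong (eval g t Z.*_) (trans (cong (λ u → eval u t) e) (eval-· (+ p) h' t))) (lemma2 (+ p) (eval g t) (eval h' t))))))

stretch : ∀ {m} → ℤ → Vec ℤ m → Vec ℤ m
stretch a [] = []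
stretch a (c ∷ v) = c ∷ a ·v stretch a v

stretch-ev : ∀ {m} a (v : Vec ℤ m) t → eval (stretch a v) t ≡ eval v (a Z.* t)
stretch-ev a [] t = refl
stretch-ev a (c ∷ v) t = cong (λ z → c Z.+ z) (trans (cong (t Z.*_) (trans (eval-· a (stretch a v) t) (cong (a Z.*_) (stretch-ev a v t)))) (lemma a t (eval v (a Z.* t))))
 where
 lemma : ∀ a t e → t Z.* (a Z.* e) ≡ a Z.* t Z.* e
 lemma = solveZ

-- The substitution of a T for T turns the monic polynomial back into a multiple of P and does not
-- raise the degrees of the factors.
demonic : ∀ {m} a (v : Vec ℤ (suc m)) → a ≢ 0ℤ → ProperFactor (lower a v ∷ʳ 1ℤ) → ProperFactor (v ∷ʳ a)
demonic {m} a v a≢0 (c , c≢0 , g , h , eq) = c Z.* pwZ a m , ≢0-* c≢0 (pwZ≢0 m a≢0) , stretch a g , stretch a h , λ t → trans (ZP.*-assoc c (pwZ a m) (eval (v ∷ʳ a) t))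
 (trans (cong (c Z.*_) (sym (monic-ev a v t))) (trans (eq (a Z.* t)) (sym (cong₂ Z._*_ (stretch-ev a g t) (stretch-ev a h t)))))

prime2 : Prime 2
prime2 = prime[2]

-- As b is odd, the even low coefficients of the product force those of the other factor to be even,
-- one after another; the first odd coefficient then appears at the same position N in both.
eisenstein-side : ∀ N as b bs → ¬ + 2 ∣ᶻ b → (∀ {k} → k < N → + 2 ∣ᶻ coef (mulP as (b ∷ bs)) k) → ¬ + 2 ∣ᶻ coef (mulP as (b ∷ bs)) N → ¬ + 2 ∣ᶻ coef as N
eisenstein-side N [] b bs ¬b low ¬top d = ¬top d
eisenstein-side zero (a ∷ as) b bs ¬b low ¬top d = ¬top (subst (+ 2 ∣ᶻ_) (sym (coef-mul-0 a as b bs)) (ZD.∣m⇒∣m*n b d))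
eisenstein-side (suc N) (a ∷ as) b bs ¬b low ¬top d = eisenstein-side N as b bs ¬b (λ {k} lt → ZD.∣m+n∣m⇒∣n (subst (+ 2 ∣ᶻ_) (coef-mul-suc a as (b ∷ bs) k) (low (s≤s lt))) (ZD.∣m⇒∣m*n (coef bs k) a-even))
  (λ q → ¬top (subst (+ 2 ∣ᶻ_) (sym (coef-mul-suc a as (b ∷ bs) N)) (ZD.∣m∣n⇒∣m+n (ZD.∣m⇒∣m*n (coef bs N) a-even) q))) d
 where
 a-even : + 2 ∣ᶻ a
 a-even = [ (λ h → h) , (λ h → ⊥-elim (¬b h)) ]′ (prime-∣-* a b prime2 (subst (+ 2 ∣ᶻ_) (coef-mul-0 a as b bs) (low (s≤s z≤n))))

-- Since 4 does not divide the constant term of P, some factor has odd constant term; the other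
-- would then need an odd coefficient at N, beyond its length.
eisenstein : ∀ {N} (P : Vec ℤ (suc N)) → (∀ {k} → k < N → + 2 ∣ᶻ coef (toList P) k) → ¬ + 2 ∣ᶻ coef (toList P) N → ¬ + 4 ∣ᶻ coef (toList P) 0 → ¬ IntegralFactor P
eisenstein {N} P low ¬top ¬4 (Q , R , eq) = go Q R eq (+ 2 ∣ᶻ? coef (toList R) 0)
 where
 even0 : + 2 ∣ᶻ 0ℤ
 even0 = divides 0ℤ refl
 same-coef : ∀ (Q R : Vec ℤ N) → (∀ t → eval P t ≡ eval Q t Z.* eval R t) → ∀ k → coef (mulP (toList Q) (toList R)) k ≡ coef (toList P) k
 same-coef Q R eq k = coef-≗ (mulP (toList Q) (toList R)) (toList P) (λ t → trans (evZ-mulP (toList Q) (toList R) t) (sym (eq t))) k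
 side : ∀ (Q R : Vec ℤ N) → (∀ t → eval P t ≡ eval Q t Z.* eval R t) → ¬ + 2 ∣ᶻ coef (toList R) 0 → ⊥
 side Q [] eq ¬R = ¬R even0
 side Q R@(r ∷ R') eq ¬R = eisenstein-side N (toList Q) r (toList R') ¬R (λ {k} lt → subst (+ 2 ∣ᶻ_) (sym (same-coef Q R eq k)) (low lt)) (λ h → ¬top (subst (+ 2 ∣ᶻ_) (same-coef Q R eq N) h))
  (subst (+ 2 ∣ᶻ_) (sym (coef-≥ Q ≤-refl)) even0)
 go : ∀ (Q R : Vec ℤ N) → (∀ t → eval P t ≡ eval Q t Z.* eval R t) → Dec (+ 2 ∣ᶻ coef (toList R) 0) → ⊥
 go Q R eq (no ¬R) = side Q R eq ¬R
 go [] [] eq (yes _) = ¬4 (subst (+ 4 ∣ᶻ_) (same-coef [] [] eq 0) (divides 0ℤ refl))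
 go Q@(a ∷ as) R@(b ∷ bs) eq (yes (divides b' b≡)) with + 2 ∣ᶻ? a
 ... | no ¬a = side R Q (λ t → trans (eq t) (ZP.*-comm (eval Q t) (eval R t))) ¬a
 ... | yes (divides a' a≡) = ¬4 (subst (+ 4 ∣ᶻ_) (trans (sym (coef-mul-0 a (toList as) b (toList bs))) (same-coef Q R eq 0)) (divides (a' Z.* b') (trans (cong₂ Z._*_ a≡ b≡) (lemma a' b'))))
  where
  lemma : ∀ a b → a Z.* + 2 Z.* (b Z.* + 2) ≡ a Z.* b Z.* + 4
  lemma = solveZ

-- Interpolation, degrees and multiple roots

synthetic : ∀ {m} → ℤ → Vec ℤ (suc m) → Vec ℤ m
synthetic {zero} r (c ∷ []) = []
synthetic {suc m} r (c ∷ v) = v +v (r ·v (synthetic r v ∷ʳ 0ℤ))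

synthetic-ev : ∀ {m} r (v : Vec ℤ (suc m)) t → eval v t ≡ eval v r Z.+ (t Z.- r) Z.* eval (synthetic r v) t
synthetic-ev {zero} r (c ∷ []) t = lemma c r t
 where
 lemma : ∀ c r t → c Z.+ t Z.* 0ℤ ≡ c Z.+ r Z.* 0ℤ Z.+ (t Z.- r) Z.* 0ℤ
 lemma = solveZ
synthetic-ev {suc m} r (c ∷ v) t = begin
 c Z.+ t Z.* eval v t ≡⟨ lemma1 c r t (eval v t) ⟩
 c Z.+ r Z.* eval v t Z.+ (t Z.- r) Z.* eval v t ≡⟨ cong (λ z → c Z.+ r Z.* z Z.+ (t Z.- r) Z.* eval v t) (synthetic-ev r v t) ⟩
 c Z.+ r Z.* (eval v r Z.+ (t Z.- r) Z.* s) Z.+ (t Z.- r) Z.* eval v t ≡⟨ lemma2 c r t (eval v r) s (eval v t) ⟩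
 c Z.+ r Z.* eval v r Z.+ (t Z.- r) Z.* (eval v t Z.+ r Z.* s) ≡⟨ cong (λ z → c Z.+ r Z.* eval v r Z.+ (t Z.- r) Z.* z) (sym (trans (eval-+ v (r ·v (synthetic r v ∷ʳ 0ℤ)) t)
    (cong (λ z → eval v t Z.+ z) (trans (eval-· r (synthetic r v ∷ʳ 0ℤ) t) (cong (r Z.*_) (trans (eval-∷ʳ (synthetic r v) 0ℤ t) (ZP.+-identityʳ s))))))) ⟩
 c Z.+ r Z.* eval v r Z.+ (t Z.- r) Z.* eval (v +v (r ·v (synthetic r v ∷ʳ 0ℤ))) t ∎
 where
 open ≡-Reasoning
 s = eval (synthetic r v) t
 lemma1 : ∀ c r t e → c Z.+ t Z.* e ≡ c Z.+ r Z.* e Z.+ (t Z.- r) Z.* e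
 lemma1 = solveZ
 lemma2 : ∀ c r t w s e → c Z.+ r Z.* (w Z.+ (t Z.- r) Z.* s) Z.+ (t Z.- r) Z.* e ≡ c Z.+ r Z.* w Z.+ (t Z.- r) Z.* (e Z.+ r Z.* s)
 lemma2 = solveZ

vanishing : ∀ {N} (v : Vec ℤ N) → (∀ {i} → i < N → eval v (+ i) ≡ 0ℤ) → ∀ t → eval v t ≡ 0ℤ
vanishing {zero} [] h t = refl
vanishing {suc N} v h t = trans (synthetic-ev (+ N) v t) (trans (cong₂ (λ x y → x Z.+ (t Z.- + N) Z.* y) (h ≤-refl) (vanishing (synthetic (+ N) v) small t)) (lemma (t Z.- + N)))
 where
 lemma : ∀ a → 0ℤ Z.+ a Z.* 0ℤ ≡ 0ℤ
 lemma = solveZ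
 small : ∀ {i} → i < N → eval (synthetic (+ N) v) (+ i) ≡ 0ℤ
 small {i} lt = [ (λ e → ⊥-elim (<⇒≢ lt (ZP.+-injective (ZP.i-j≡0⇒i≡j (+ i) (+ N) e)))) , (λ e → e) ]′ (ZP.i*j≡0⇒i≡0∨j≡0 (+ i Z.- + N)
  (trans (sym (ZP.+-identityˡ _)) (trans (cong (Z._+ ((+ i Z.- + N) Z.* eval (synthetic (+ N) v) (+ i))) (sym (h ≤-refl))) (trans (sym (synthetic-ev (+ N) v (+ i))) (h (≤-trans lt (n≤1+n N)))))))

interpolation-unique : ∀ {N} (u v : Vec ℤ N) → (∀ {i} → i < N → eval u (+ i) ≡ eval v (+ i)) → ∀ t → eval u t ≡ eval v t
interpolation-unique u v h t = ZP.i-j≡0⇒i≡j (eval u t) (eval v t) (trans (sym (sub t)) (vanishing (u -v v) (λ {i} lt → trans (sub (+ i)) (trans (cong (Z._- eval v (+ i)) (h lt)) (ZP.+-inverseʳ (eval v (+ i))))) t))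
 where
 sub : ∀ t → eval (u -v v) t ≡ eval u t Z.- eval v t
 sub t = trans (eval-+ u (-1ℤ ·v v) t) (cong (λ z → eval u t Z.+ z) (trans (eval-· -1ℤ v t) (ZP.-1*i≡-i (eval v t))))

-- Coefficient lists may end in zeros, so the degree is a relation and not read off from the length.
HasTop : List ℤ → ℕ → Set
HasTop l i = coef l i ≢ 0ℤ × (∀ {x} → i < x → coef l x ≡ 0ℤ)

top? : ∀ l → (∀ k → coef l k ≡ 0ℤ) ⊎ Σ ℕ (HasTop l)
top? [] = inj₁ (λ _ → refl)
top? (a ∷ l) with top? l | a Z.≟ 0ℤ
... | inj₂ (j , nz , hi) | _ = inj₂ (suc j , nz , λ { {suc x} (s≤s lt) → hi lt })
... | inj₁ z | yes refl' = inj₁ (λ { zero → refl' ; (suc k) → z k })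
... | inj₁ z | no a≢0 = inj₂ (0 , a≢0 , λ { {suc x} _ → z x })

coef-mul-0' : ∀ a as bs → coef (mulP (a ∷ as) bs) 0 ≡ a Z.* coef bs 0
coef-mul-0' a as bs = trans (coef-addP (scaleP a bs) (0ℤ ∷ mulP as bs) 0) (trans (ZP.+-identityʳ _) (coef-scaleP a bs 0))

mul-zero : ∀ as bs → (∀ k → coef as k ≡ 0ℤ) → ∀ k → coef (mulP as bs) k ≡ 0ℤ
mul-zero [] bs h k = refl
mul-zero (a ∷ as) bs h zero = trans (coef-mul-0' a as bs) (cong (Z._* coef bs 0) (h 0))
mul-zero (a ∷ as) bs h (suc k) = trans (coef-mul-suc a as bs k) (cong₂ (λ x y → x Z.* coef bs (suc k) Z.+ y) (h 0) (mul-zero as bs (λ k → h (suc k)) k))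

mul-coef : ∀ as bs i j → (∀ {x} → i < x → coef as x ≡ 0ℤ) → (∀ {x} → j < x → coef bs x ≡ 0ℤ) →
 coef (mulP as bs) (i + j) ≡ coef as i Z.* coef bs j × (∀ {x} → i + j < x → coef (mulP as bs) x ≡ 0ℤ)
mul-coef [] bs i j ha hb = refl , (λ _ → refl)
mul-coef (a ∷ as) bs zero j ha hb = low j , above
 where
 zs : ∀ k → coef (mulP as bs) k ≡ 0ℤ
 zs = mul-zero as bs (λ k → ha {suc k} (s≤s z≤n))
 low : ∀ j → coef (mulP (a ∷ as) bs) j ≡ a Z.* coef bs j
 low zero = coef-mul-0' a as bs
 low (suc j) = trans (coef-mul-suc a as bs j) (trans (cong (λ z → a Z.* coef bs (suc j) Z.+ z) (zs j)) (ZP.+-identityʳ _))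
 above : ∀ {x} → j < x → coef (mulP (a ∷ as) bs) x ≡ 0ℤ
 above {x} lt = trans (low x) (trans (cong (a Z.*_) (hb lt)) (ZP.*-zeroʳ a))
mul-coef (a ∷ as) bs (suc i) j ha hb with mul-coef as bs i j (λ lt → ha (s≤s lt)) hb
... | top≡ , hi = trans (coef-mul-suc a as bs (i + j)) (trans (cong₂ (λ x y → a Z.* x Z.+ y) (hb (s≤s (m≤n+m j i))) top≡) (trans (cong (Z._+ (coef as i Z.* coef bs j)) (ZP.*-zeroʳ a)) (ZP.+-identityˡ _)))
 , λ { {suc x} (s≤s lt) → trans (coef-mul-suc a as bs x) (trans (cong₂ (λ u y → a Z.* u Z.+ y) (hb (s≤s (≤-trans (m≤n+m j i) (<⇒≤ lt)))) (hi lt)) (cong (Z._+ 0ℤ) (ZP.*-zeroʳ a))) }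

mul-top : ∀ {as bs i j} → HasTop as i → HasTop bs j → HasTop (mulP as bs) (i + j)
mul-top {as} {bs} {i} {j} (na , ha) (nb , hb) = let (e , hi) = mul-coef as bs i j ha hb in (λ z → [ na , nb ]′ (ZP.i*j≡0⇒i≡0∨j≡0 (coef as i) (trans (sym e) z))) , hi

top-unique : ∀ {as bs i j} → as ≗ₚ bs → HasTop as i → HasTop bs j → i ≡ j
top-unique {as} {bs} {i} {j} h (na , ha) (nb , hb) with <-cmp i j
... | tri< lt _ _ = ⊥-elim (nb (trans (sym (coef-≗ as bs h j)) (ha lt)))
... | tri≈ _ e _ = e
... | tri> _ _ gt = ⊥-elim (na (trans (coef-≗ as bs h i) (hb gt)))

to-vec : ∀ N (l : List ℤ) → (∀ {k} → N ≤ k → coef l k ≡ 0ℤ) → Σ (Vec ℤ N) λ v → ∀ t → eval v t ≡ evZ l t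
to-vec zero l h = [] , λ t → sym (PolyEval.ev-zero ℤ-ring (zeros l (λ k → h z≤n)) t)
 where
 zeros : ∀ l → (∀ k → coef l k ≡ 0ℤ) → All (_≡ 0ℤ) l
 zeros [] h = All.[]
 zeros (a ∷ l) h = h 0 All.∷ zeros l (λ k → h (suc k))
to-vec (suc N) [] h = 0v , λ t → eval-0 (suc N) t
to-vec (suc N) (a ∷ l) h = let (v , e) = to-vec N l (λ le → h (s≤s le)) in a ∷ v , λ t → cong (λ z → a Z.+ t Z.* z) (e t)

coefℚ : List ℚ → ℕ → ℚ
coefℚ [] k = 0ℚ
coefℚ (c ∷ cs) zero = c
coefℚ (c ∷ cs) (suc k) = coefℚ cs k

module _ where
 open RingOps ℚ-ring using (solve; _:=_; _:+_; _:*_)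
 open VecEval ℚ-ring using (pw)
 open Homogeneous ℚ-ring using (pw-*; pw-ι; form-cong)

 private
  ιℚ-* = ZRing.ι-* ℚ-ring
  ιℚ-+ = ZRing.ι-+ ℚ-ring

  assoc-swap : ∀ m D c → (m ℚ.* D) ℚ.* c ≡ (m ℚ.* c) ℚ.* D
  assoc-swap = solve 3 (λ m D c → (m :* D) :* c := (m :* c) :* D) refl

  pull-out : ∀ m D t e → (m ℚ.* D) ℚ.* (t ℚ.* e) ≡ t ℚ.* (m ℚ.* (D ℚ.* e))
  pull-out = solve 4 (λ m D t e → (m :* D) :* (t :* e) := t :* (m :* (D :* e))) refl

  left-swap : ∀ D m q → D ℚ.* (m ℚ.* q) ≡ m ℚ.* (D ℚ.* q)
  left-swap = solve 3 (λ D m q → D :* (m :* q) := m :* (D :* q)) refl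

  interchange : ∀ a b x y → (a ℚ.* b) ℚ.* (x ℚ.* y) ≡ (a ℚ.* x) ℚ.* (b ℚ.* y)
  interchange = solve 4 (λ a b x y → (a :* b) :* (x :* y) := (a :* x) :* (b :* y)) refl

 clear-list : ∀ cs → Σ ℕ λ D → 1 ≤ D × Σ (List ℤ) λ l → (∀ t → ιℚ (+ D) ℚ.* evalList cs (ιℚ t) ≡ ιℚ (evZ l t)) × (∀ k → ιℚ (+ D) ℚ.* coefℚ cs k ≡ ιℚ (coef l k))
 clear-list [] = 1 , s≤s z≤n , [] , (λ t → ℚP.*-zeroʳ (ιℚ (+ 1))) , (λ k → ℚP.*-zeroʳ (ιℚ (+ 1)))
 clear-list (c ∷ cs) with clear-denominator c | clear-list cs
 ... | m , m≥1 , z , ez , _ | D , D≥1 , l , el , cl = m * D , *-mono-≤ m≥1 D≥1 , (z Z.* + D) ∷ scaleP (+ m) l , evals , coefs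
  where
  mD : ιℚ (+ (m * D)) ≡ ιℚ (+ m) ℚ.* ιℚ (+ D)
  mD = trans (cong ιℚ (ZP.pos-* m D)) (ιℚ-* (+ m) (+ D))
  head : ιℚ (+ (m * D)) ℚ.* c ≡ ιℚ (z Z.* + D)
  head = trans (cong (ℚ._* c) mD) (trans (assoc-swap (ιℚ (+ m)) (ιℚ (+ D)) c) (trans (cong (ℚ._* ιℚ (+ D)) ez) (sym (ιℚ-* z (+ D)))))
  evals : ∀ t → ιℚ (+ (m * D)) ℚ.* (c ℚ.+ ιℚ t ℚ.* evalList cs (ιℚ t)) ≡ ιℚ (z Z.* + D Z.+ t Z.* evZ (scaleP (+ m) l) t)
  evals t = begin
   ιℚ (+ (m * D)) ℚ.* (c ℚ.+ ιℚ t ℚ.* E) ≡⟨ ℚP.*-distribˡ-+ (ιℚ (+ (m * D))) c (ιℚ t ℚ.* E) ⟩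
   ιℚ (+ (m * D)) ℚ.* c ℚ.+ ιℚ (+ (m * D)) ℚ.* (ιℚ t ℚ.* E) ≡⟨ cong₂ (λ x y → x ℚ.+ y ℚ.* (ιℚ t ℚ.* E)) head mD ⟩
   ιℚ (z Z.* + D) ℚ.+ (ιℚ (+ m) ℚ.* ιℚ (+ D)) ℚ.* (ιℚ t ℚ.* E) ≡⟨ cong (ιℚ (z Z.* + D) ℚ.+_) (pull-out (ιℚ (+ m)) (ιℚ (+ D)) (ιℚ t) E) ⟩
   ιℚ (z Z.* + D) ℚ.+ ιℚ t ℚ.* (ιℚ (+ m) ℚ.* (ιℚ (+ D) ℚ.* E)) ≡⟨ cong (λ x → ιℚ (z Z.* + D) ℚ.+ ιℚ t ℚ.* (ιℚ (+ m) ℚ.* x)) (el t) ⟩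
   ιℚ (z Z.* + D) ℚ.+ ιℚ t ℚ.* (ιℚ (+ m) ℚ.* ιℚ (evZ l t)) ≡⟨ cong (λ x → ιℚ (z Z.* + D) ℚ.+ ιℚ t ℚ.* x) (trans (sym (ιℚ-* (+ m) (evZ l t))) (cong ιℚ (sym (evZ-scaleP (+ m) l t)))) ⟩
   ιℚ (z Z.* + D) ℚ.+ ιℚ t ℚ.* ιℚ (evZ (scaleP (+ m) l) t) ≡⟨ cong (ιℚ (z Z.* + D) ℚ.+_) (sym (ιℚ-* t (evZ (scaleP (+ m) l) t))) ⟩
   ιℚ (z Z.* + D) ℚ.+ ιℚ (t Z.* evZ (scaleP (+ m) l) t) ≡⟨ sym (ιℚ-+ (z Z.* + D) (t Z.* evZ (scaleP (+ m) l) t)) ⟩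
   ιℚ (z Z.* + D Z.+ t Z.* evZ (scaleP (+ m) l) t) ∎
   where
   open ≡-Reasoning
   E = evalList cs (ιℚ t)
  coefs : ∀ k → ιℚ (+ (m * D)) ℚ.* coefℚ (c ∷ cs) k ≡ ιℚ (coef ((z Z.* + D) ∷ scaleP (+ m) l) k)
  coefs zero = head
  coefs (suc k) = trans (cong (ℚ._* coefℚ cs k) mD) (trans (ℚP.*-assoc (ιℚ (+ m)) (ιℚ (+ D)) (coefℚ cs k)) (trans (cong (ιℚ (+ m) ℚ.*_) (cl k)) (trans (sym (ιℚ-* (+ m) (coef l k))) (cong ιℚ (sym (coef-scaleP (+ m) l k))))))

 ιℚ-cancel : ∀ {D} q → 1 ≤ D → ιℚ (+ D) ℚ.* q ≡ 0ℚ → q ≡ 0ℚ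
 ιℚ-cancel {D} q D≥1 h with clear-denominator q
 ... | m , m≥1 , z , ez , z0 = z0 ([ (λ e → ⊥-elim (<⇒≱ D≥1 (≤-reflexive (ZP.+-injective e)))) , (λ e → e) ]′ (ZP.i*j≡0⇒i≡0∨j≡0 (+ D) (ιℚ-injective (+ D Z.* z) 0ℤ
  (trans (ιℚ-* (+ D) z) (trans (cong (ιℚ (+ D) ℚ.*_) (sym ez)) (trans (left-swap (ιℚ (+ D)) (ιℚ (+ m)) q) (trans (cong (ιℚ (+ m) ℚ.*_) h) (ℚP.*-zeroʳ (ιℚ (+ m))))))))))

 evalVec-list : ∀ {m} (Q : Vec ℚ m) t → evalVec Q t ≡ evalList (V.toList Q) t
 evalVec-list [] t = refl
 evalVec-list (c ∷ Q) t = cong (λ z → c ℚ.+ t ℚ.* z) (evalVec-list Q t)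

 coefℚ-last : ∀ {m} (Q : Vec ℚ (suc m)) → coefℚ (V.toList Q) m ≡ V.last Q
 coefℚ-last (c ∷ []) = refl
 coefℚ-last (c ∷ d ∷ Q) = coefℚ-last (d ∷ Q)

 coefℚ-≥ : ∀ {m} (Q : Vec ℚ m) {k} → m ≤ k → coefℚ (V.toList Q) k ≡ 0ℚ
 coefℚ-≥ [] h = refl
 coefℚ-≥ (c ∷ Q) (s≤s h) = coefℚ-≥ Q h

 clear-vec : ∀ {m} (Q : Vec ℚ (suc m)) → V.last Q ≢ 0ℚ → Σ ℕ λ D → 1 ≤ D × Σ (List ℤ) λ l → (∀ t → ιℚ (+ D) ℚ.* evalVec Q (ιℚ t) ≡ ιℚ (evZ l t)) × HasTop l m
 clear-vec {m} Q last≢0 = let (D , D≥1 , l , el , cl) = clear-list (V.toList Q) in D , D≥1 , l , (λ t → trans (cong (ιℚ (+ D) ℚ.*_) (evalVec-list Q (ιℚ t))) (el t)) ,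
  (λ z → last≢0 (trans (sym (coefℚ-last Q)) (ιℚ-cancel (coefℚ (V.toList Q) m) D≥1 (trans (cl m) (cong ιℚ z))))) ,
  (λ {x} lt → ιℚ-injective (coef l x) 0ℤ (trans (sym (cl x)) (trans (cong (ιℚ (+ D) ℚ.*_) (coefℚ-≥ Q lt)) (ℚP.*-zeroʳ (ιℚ (+ D))))))

 evalPoly-ι : ∀ {N} (P : Poly N) t → evalPoly P (ιℚ t) ≡ ιℚ (eval P t)
 evalPoly-ι P t = trans (evalHom-form P (ιℚ t) 1ℚ) (trans (form-ι ℚ-ring P t 1ℤ) (cong ιℚ (formZ-1 P t)))

 cleared-power : ∀ n a b x y p q r → ιℚ a ℚ.* x ≡ ιℚ q → ιℚ b ℚ.* y ≡ ιℚ r → ιℚ p ≡ (x ^ℚ n) ℚ.* y → (pwZ a n Z.* b) Z.* p ≡ pwZ q n Z.* r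
 cleared-power n a b x y p q r ex ey ep = ιℚ-injective _ _ (begin
  ιℚ ((pwZ a n Z.* b) Z.* p) ≡⟨ trans (ιℚ-* (pwZ a n Z.* b) p) (cong₂ ℚ._*_ (trans (ιℚ-* (pwZ a n) b) (cong (ℚ._* ιℚ b) (sym (pw-ι a n)))) (trans ep (cong (ℚ._* y) (^ℚ-pw x n)))) ⟩
  (pw (ιℚ a) n ℚ.* ιℚ b) ℚ.* (pw x n ℚ.* y) ≡⟨ interchange (pw (ιℚ a) n) (ιℚ b) (pw x n) y ⟩
  (pw (ιℚ a) n ℚ.* pw x n) ℚ.* (ιℚ b ℚ.* y) ≡⟨ cong₂ ℚ._*_ (sym (pw-* (ιℚ a) x n)) ey ⟩
  pw (ιℚ a ℚ.* x) n ℚ.* ιℚ r ≡⟨ cong (λ z → pw z n ℚ.* ιℚ r) ex ⟩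
  pw (ιℚ q) n ℚ.* ιℚ r ≡⟨ cong (ℚ._* ιℚ r) (pw-ι q n) ⟩
  ιℚ (pwZ q n) ℚ.* ιℚ r ≡⟨ sym (ιℚ-* (pwZ q n) r) ⟩
  ιℚ (pwZ q n Z.* r) ∎)
  where open ≡-Reasoning

powP : List ℤ → ℕ → List ℤ
powP q zero = 1ℤ ∷ []
powP q (suc k) = mulP q (powP q k)

powP-ev : ∀ q k t → evZ (powP q k) t ≡ pwZ (evZ q t) k
powP-ev q zero t = cong (λ z → 1ℤ Z.+ z) (ZP.*-zeroʳ t)
powP-ev q (suc k) t = trans (evZ-mulP q (powP q k) t) (cong (evZ q t Z.*_) (powP-ev q k t))

-- If q has degree k + 1 and B has degree j, then N = 2(k + 1) + j, so that both q and q B have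
-- degree below N.
square-factor : ∀ {N} (P : Poly N) → coef (toList P) N ≢ 0ℤ → ∀ k q B c → c ≢ 0ℤ → HasTop q (suc k) →
 (∀ t → c Z.* eval P t ≡ evZ q t Z.* (evZ q t Z.* evZ B t)) → ProperFactor P
square-factor {N} P top≢0 k q B c c≢0 q-top factored = c , c≢0 , fst V1 , fst V2 , λ t → trans (factored t) (sym (cong₂ Z._*_ (snd V1 t) (trans (snd V2 t) (evZ-mulP q B t))))
 where
 cP : List ℤ
 cP = scaleP c (toList P)
 same-poly : cP ≗ₚ mulP q (mulP q B)
 same-poly t = trans (evZ-scaleP c (toList P) t) (trans (factored t) (sym (trans (evZ-mulP q (mulP q B) t) (cong (evZ q t Z.*_) (evZ-mulP q B t)))))
 cP-top : HasTop cP N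
 cP-top = (λ e → [ c≢0 , top≢0 ]′ (ZP.i*j≡0⇒i≡0∨j≡0 c (trans (sym (coef-scaleP c (toList P) N)) e))) , λ {x} lt → trans (coef-scaleP c (toList P) x) (trans (cong (c Z.*_) (coef-≥ P lt)) (ZP.*-zeroʳ c))
 mul-zeroʳ : ∀ l → (∀ k → coef l k ≡ 0ℤ) → ∀ k → coef (mulP q l) k ≡ 0ℤ
 mul-zeroʳ l z k = trans (coef-≗ (mulP q l) (mulP l q) (mulP-comm q l) k) (mul-zero l q z k)
 B-top : Σ ℕ (HasTop B)
 B-top = [ (λ z → ⊥-elim (fst cP-top (trans (coef-≗ cP (mulP q (mulP q B)) same-poly N) (mul-zeroʳ (mulP q B) (mul-zeroʳ B z) N)))) , (λ h → h) ]′ (top? B)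
 j = fst B-top
 qB-top : HasTop (mulP q B) (suc k + j)
 qB-top = mul-top {q} {B} {suc k} {j} q-top (snd B-top)
 N≡ : N ≡ suc k + (suc k + j)
 N≡ = top-unique {cP} {mulP q (mulP q B)} same-poly cP-top (mul-top {q} {mulP q B} {suc k} {suc k + j} q-top qB-top)
 V1 : Σ (Vec ℤ N) λ v → ∀ t → eval v t ≡ evZ q t
 V1 = to-vec N q (λ h → snd q-top (<-≤-trans (m<m+n (suc k) (s≤s (z≤n {k + j}))) (≤-trans (≤-reflexive (sym N≡)) h)))
 V2 : Σ (Vec ℤ N) λ v → ∀ t → eval v t ≡ evZ (mulP q B) t
 V2 = to-vec N (mulP q B) (λ h → snd qB-top (<-≤-trans (m<n+m (suc k + j) (s≤s (z≤n {k}))) (≤-trans (≤-reflexive (sym N≡)) h)))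

-- An n-th power with n ≥ 2 contains a square, hence a proper factorisation after denominators are
-- cleared. This is what places the Eisenstein polynomials in 𝒫(n,N).
multiple-root⇒factor : ∀ {N} n (P : Poly N) → coef (toList P) N ≢ 0ℤ → HasRootOfMultAtLeast (suc (suc n)) P → ProperFactor P
multiple-root⇒factor {N} n P top≢0 (k , Q , R , last≢0 , eq) = assemble (clear-vec Q last≢0) (clear-list R)
 where
 pos≢0 : ∀ {m} → 1 ≤ m → + m ≢ 0ℤ
 pos≢0 (s≤s _) ()
 regroup : ∀ q r t → pwZ (evZ q t) (suc (suc n)) Z.* evZ r t ≡ evZ q t Z.* (evZ q t Z.* evZ (mulP (powP q n) r) t)
 regroup q r t = trans (lemma (evZ q t) (pwZ (evZ q t) n) (evZ r t)) (cong (λ z → evZ q t Z.* (evZ q t Z.* z)) (sym (trans (evZ-mulP (powP q n) r t) (cong (Z._* evZ r t) (powP-ev q n t)))))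
  where
  lemma : ∀ q p r → q Z.* (q Z.* p) Z.* r ≡ q Z.* (q Z.* (p Z.* r))
  lemma = solveZ
 assemble : (Σ ℕ λ D → 1 ≤ D × Σ (List ℤ) λ l → (∀ t → ιℚ (+ D) ℚ.* evalVec Q (ιℚ t) ≡ ιℚ (evZ l t)) × HasTop l (suc k)) →
  (Σ ℕ λ D → 1 ≤ D × Σ (List ℤ) λ l → (∀ t → ιℚ (+ D) ℚ.* evalList R (ιℚ t) ≡ ιℚ (evZ l t)) × (∀ k → ιℚ (+ D) ℚ.* coefℚ R k ≡ ιℚ (coef l k))) → ProperFactor P
 assemble (a , a≥1 , q , eq-q , q-top) (b , b≥1 , r , eq-r , _) = square-factor P top≢0 k q (mulP (powP q n) r) (pwZ (+ a) (suc (suc n)) Z.* + b) (≢0-* (pwZ≢0 (suc (suc n)) (pos≢0 a≥1)) (pos≢0 b≥1)) q-top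
  (λ t → trans (cleared-power (suc (suc n)) (+ a) (+ b) (evalVec Q (ιℚ t)) (evalList R (ιℚ t)) (eval P t) (evZ q t) (evZ r t) (eq-q t) (eq-r t) (trans (sym (evalPoly-ι P t)) (eq (ιℚ t)))) (regroup q r t))

-- Many Eisenstein polynomials of bounded height

even-then-odd : ∀ {m} → Vec ℕ (suc m) → Vec ℤ (suc m)
even-then-odd (b ∷ []) = + (1 + 2 * b) ∷ []
even-then-odd (b ∷ c ∷ bs) = + (2 * b) ∷ even-then-odd (c ∷ bs)

eisenstein-poly : ∀ {m} → Vec ℕ (suc (suc m)) → Poly (suc m)
eisenstein-poly (b ∷ bs) = + (2 + 4 * b) ∷ even-then-odd bs

even-then-odd-inj : ∀ {m} (u v : Vec ℕ (suc m)) → even-then-odd u ≡ even-then-odd v → u ≡ v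
even-then-odd-inj (a ∷ []) (b ∷ []) e = cong (_∷ []) (*-cancelˡ-≡ a b 2 (suc-injective (ZP.+-injective (cong V.head e))))
even-then-odd-inj (a ∷ c ∷ as) (b ∷ d ∷ bs) e = cong₂ _∷_ (*-cancelˡ-≡ a b 2 (ZP.+-injective (cong V.head e))) (even-then-odd-inj (c ∷ as) (d ∷ bs) (cong V.tail e))

eisenstein-poly-inj : ∀ {m} {u v : Vec ℕ (suc (suc m))} → eisenstein-poly u ≡ eisenstein-poly v → u ≡ v
eisenstein-poly-inj {u = a ∷ as} {b ∷ bs} e = cong₂ _∷_ (*-cancelˡ-≡ a b 4 (suc-injective (suc-injective (ZP.+-injective (cong V.head e))))) (even-then-odd-inj as bs (cong V.tail e))

module _ where
 private
  even : ∀ b → + 2 ∣ᶻ + (2 * b)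
  even b = ∣ᵤ⇒∣ (ND.m∣m*n b)

  odd : ∀ b → ¬ + 2 ∣ᶻ + (1 + 2 * b)
  odd b h = <⇒≱ (s≤s (s≤s z≤n)) (ND.∣⇒≤ (ND.∣m+n∣m⇒∣n {2} {2 * b} {1} (subst (2 ∣ℕ_) (+-comm 1 (2 * b)) (∣⇒∣ᵤ h)) (ND.m∣m*n b)))

  low : ∀ {m} (bs : Vec ℕ (suc m)) {k} → k < m → + 2 ∣ᶻ coef (toList (even-then-odd bs)) k
  low (b ∷ c ∷ bs) {zero} lt = even b
  low (b ∷ c ∷ bs) {suc k} (s≤s lt) = low (c ∷ bs) lt

  high : ∀ {m} (bs : Vec ℕ (suc m)) → ¬ + 2 ∣ᶻ coef (toList (even-then-odd bs)) m
  high (b ∷ []) = odd b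
  high (b ∷ c ∷ bs) = high (c ∷ bs)

  small : ∀ {m H} (bs : Vec ℕ (suc m)) → VAll.All (λ b → 2 + 4 * b ≤ H) bs → ∀ i → ∣ lookup (even-then-odd bs) i ∣ ≤ H
  small (b ∷ []) (h VAll.∷ hs) zero = ≤-trans (s≤s (≤-trans (*-monoˡ-≤ b {2} {4} (s≤s (s≤s z≤n))) (n≤1+n _))) h
  small (b ∷ c ∷ bs) (h VAll.∷ hs) zero = ≤-trans (≤-trans (*-monoˡ-≤ b {2} {4} (s≤s (s≤s z≤n))) (m≤n+m (4 * b) 2)) h
  small (b ∷ c ∷ bs) (h VAll.∷ hs) (suc i) = small (c ∷ bs) hs i

 eisenstein-irreducible : ∀ {m} (bs : Vec ℕ (suc (suc m))) → ¬ IntegralFactor (eisenstein-poly bs)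
 eisenstein-irreducible {m} (b ∷ bs) = eisenstein (eisenstein-poly (b ∷ bs)) low' (high bs) ¬4
  where
  low' : ∀ {k} → k < suc m → + 2 ∣ᶻ coef (toList (eisenstein-poly (b ∷ bs))) k
  low' {zero} _ = ∣ᵤ⇒∣ (ND.∣m∣n⇒∣m+n ND.∣-refl (ND.∣-trans (ND.divides 2 refl) (ND.m∣m*n b)))
  low' {suc k} (s≤s lt) = low bs lt
  ¬4 : ¬ + 4 ∣ᶻ + (2 + 4 * b)
  ¬4 h = <⇒≱ (s≤s (s≤s (s≤s z≤n))) (ND.∣⇒≤ (ND.∣m+n∣m⇒∣n {4} {4 * b} {2} (subst (4 ∣ℕ_) (+-comm 2 (4 * b)) (∣⇒∣ᵤ h)) (ND.m∣m*n b)))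

 eisenstein-height : ∀ {m H} (bs : Vec ℕ (suc (suc m))) → VAll.All (λ b → 2 + 4 * b ≤ H) bs → HeightLE (eisenstein-poly bs) H
 eisenstein-height (b ∷ bs) (h VAll.∷ hs) zero = h
 eisenstein-height (b ∷ bs) (h VAll.∷ hs) (suc i) = small bs hs i

 eisenstein-top : ∀ {m} (bs : Vec ℕ (suc (suc m))) → coef (toList (eisenstein-poly bs)) (suc m) ≢ 0ℤ
 eisenstein-top (b ∷ bs) e = high bs (subst (+ 2 ∣ᶻ_) (sym e) (divides 0ℤ refl))

degree-coef : ∀ {N} (P : Poly N) → coeff P (fromℕ N) ≡ coef (toList P) N
degree-coef {N} P = trans (sym (coef-lookup P (fromℕ N))) (cong (coef (toList P)) (toℕ-fromℕ N))

-- Each coefficient is parametrised by ⌊H/4⌋ ≥ H/8 integers: a positive proportion of all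
-- polynomials of height H, sufficient for a bound up to constants.
many-polynomials : ∀ n m H → 4 ≤ H → Σ (List (Poly (suc m))) λ M → DistinctIn (InPH (suc (suc n)) (suc m) H) M × H ^ suc (suc m) ≤ 8 ^ suc (suc m) * length M
many-polynomials n m H H≥4 = M , (Uniq.map⁺ eisenstein-poly-inj (box-Unique B (suc (suc m))) , All.tabulate good) , (begin
  H ^ suc (suc m) ≤⟨ ^-monoˡ-≤ (suc (suc m)) H≤ ⟩
  (8 * B) ^ suc (suc m) ≡⟨ ^-*-distrib (suc (suc m)) 8 B ⟩
  8 ^ suc (suc m) * B ^ suc (suc m) ≡⟨ cong (8 ^ suc (suc m) *_) (sym (trans (length-map eisenstein-poly (vecs (upTo B) (suc (suc m)))) (length-box B (suc (suc m))))) ⟩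
  8 ^ suc (suc m) * length M ∎)
 where
 open ≤-Reasoning
 B = H ÷ 4
 M = map eisenstein-poly (vecs (upTo B) (suc (suc m)))
 B≥1 : 1 ≤ B
 B≥1 = ÷-greatest 1 (s≤s z≤n) H≥4
 H≤ : H ≤ 8 * B
 H≤ = ≤-trans (<⇒≤ (<-÷ H 4 (s≤s z≤n))) (≤-trans (*-monoˡ-≤ 4 (+-monoˡ-≤ B B≥1)) (≤-reflexive (lemma B)))
  where
  lemma : ∀ b → (b + b) * 4 ≡ 8 * b
  lemma = solve-∀
 good : ∀ {P} → P ∈ M → InPH (suc (suc n)) (suc m) H P
 good P∈ with ∈-map⁻ eisenstein-poly P∈
 ... | bs , bs∈ , refl = ((λ e → eisenstein-top bs (trans (sym (degree-coef (eisenstein-poly bs))) e)) ,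
   (λ h → eisenstein-irreducible bs (gauss (eisenstein-poly bs) (multiple-root⇒factor n (eisenstein-poly bs) (eisenstein-top bs) h)))) ,
   eisenstein-height bs (VAll.map entry (∈-vecs⁻ (suc (suc m)) bs∈))
  where
  entry : ∀ {b} → b ∈ upTo B → 2 + 4 * b ≤ H
  entry {b} b∈ = ≤-trans (+-monoˡ-≤ (4 * b) {2} {4} (s≤s (s≤s z≤n))) (≤-trans (≤-reflexive (lemma b)) (≤-trans (*-monoˡ-≤ 4 (∈-upTo⁻ b∈)) (÷-≤ H 4)))
   where
   lemma : ∀ b → 4 + 4 * b ≡ suc b * 4
   lemma = solve-∀

-- Counting reducible polynomials

signs : ℕ → ℕ → List (ℤ × ℤ)
signs x y = (+ x , + y) ∷ (+ x , Z.- + y) ∷ (Z.- + x , + y) ∷ (Z.- + x , Z.- + y) ∷ []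

pairs : ℕ → List (ℤ × ℤ)
pairs Y = concatMap (λ x → concatMap (signs x) (range (Y ÷ x))) (range Y)

∈-pairs : ∀ {Y} u v → u ≢ 0ℤ → v ≢ 0ℤ → ∣ u ∣ * ∣ v ∣ ≤ Y → (u , v) ∈ pairs Y
∈-pairs {Y} u v u≢0 v≢0 h = ∈-concatMap⁺ (λ x → concatMap (signs x) (range (Y ÷ x))) (lose (range⁺ u≥1 (≤-trans (m≤m*n ∣ u ∣ ∣ v ∣ {{>-nonZero v≥1}}) h))
  (∈-concatMap⁺ (signs ∣ u ∣) (lose (range⁺ v≥1 (÷-greatest ∣ v ∣ u≥1 (≤-trans (≤-reflexive (*-comm ∣ v ∣ ∣ u ∣)) h))) (∈-signs u v))))
 where
 u≥1 = ∣i∣≥1 u≢0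
 v≥1 = ∣i∣≥1 v≢0
 ∈-signs : ∀ u v → (u , v) ∈ signs ∣ u ∣ ∣ v ∣
 ∈-signs (+ _) (+ _) = here refl
 ∈-signs (+ _) -[1+ _ ] = there (here refl)
 ∈-signs -[1+ _ ] (+ _) = there (there (here refl))
 ∈-signs -[1+ _ ] -[1+ _ ] = there (there (there (here refl)))

length-pairs : ∀ Y k → Y ≤ 2 ^ k → length (pairs Y) ≤ 4 * (suc k * Y)
length-pairs Y k Y≤ = begin
 length (pairs Y) ≡⟨ ones (pairs Y) ⟩
 ∑ (pairs Y) (λ _ → 1) ≡⟨ ∑-concatMap (range Y) (λ x → concatMap (signs x) (range (Y ÷ x))) (λ _ → 1) ⟩
 ∑ (range Y) (λ x → ∑ (concatMap (signs x) (range (Y ÷ x))) (λ _ → 1)) ≡⟨ ∑-cong (range Y) (λ {x} _ → trans (∑-concatMap (range (Y ÷ x)) (signs x) (λ _ → 1)) (trans (∑-const (range (Y ÷ x)) 4) (trans (cong (_* 4) (trans (length-map suc (upTo (Y ÷ x))) (length-upTo (Y ÷ x)))) (*-comm (Y ÷ x) 4)))) ⟩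
 ∑ (range Y) (λ x → 4 * (Y ÷ x)) ≡⟨ ∑-*ˡ (range Y) 4 (λ x → Y ÷ x) ⟩
 4 * ∑ (range Y) (λ x → Y ÷ x) ≤⟨ *-monoʳ-≤ 4 (∑-sub (range Y) (range (2 ^ k)) (λ x → Y ÷ x) (range-Unique Y) (λ m → let (a , b) = range⁻ {Y} m in range⁺ a (≤-trans b Y≤))) ⟩
 4 * ∑ (range (2 ^ k)) (λ x → Y ÷ x) ≤⟨ *-monoʳ-≤ 4 (harmonic Y (λ x → Y ÷ x) (λ m → ≤-trans (≤-reflexive (*-comm m (Y ÷ m))) (÷-≤ Y m)) k) ⟩
 4 * (suc k * Y) ∎
 where
 open ≤-Reasoning
 ones : ∀ {A : Set} (l : List A) → length l ≡ ∑ l (λ _ → 1)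
 ones l = sym (trans (∑-const l 1) (*-identityʳ (length l)))

ev-bound : ∀ {m} (v : Vec ℤ m) H T t → ‖ v ‖ ≤ H → ∣ t ∣ ≤ T → 1 ≤ T → ∣ eval v t ∣ ≤ m * (H * T ^ m)
ev-bound [] H T t h tT T≥1 = z≤n
ev-bound {suc m} (c ∷ v) H T t h tT T≥1 = begin
 ∣ c Z.+ t Z.* eval v t ∣ ≤⟨ ZP.∣i+j∣≤∣i∣+∣j∣ c (t Z.* eval v t) ⟩
 ∣ c ∣ + ∣ t Z.* eval v t ∣ ≡⟨ cong (∣ c ∣ N.+_) (ZP.abs-* t (eval v t)) ⟩
 ∣ c ∣ + ∣ t ∣ * ∣ eval v t ∣ ≤⟨ +-mono-≤ (≤-trans (m≤m⊔n ∣ c ∣ ‖ v ‖) h) (*-mono-≤ tT (ev-bound v H T t (≤-trans (m≤n⊔m ∣ c ∣ ‖ v ‖) h) tT T≥1)) ⟩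
 H + T * (m * (H * T ^ m)) ≤⟨ +-monoˡ-≤ (T * (m * (H * T ^ m))) (m≤m*n H (T ^ suc m) {{>-nonZero (pow≥1 (suc m) T≥1)}}) ⟩
 H * T ^ suc m + T * (m * (H * T ^ m)) ≡⟨ lemma H T (T ^ m) m ⟩
 suc m * (H * T ^ suc m) ∎
 where
 open ≤-Reasoning
 lemma : ∀ H T p m → H * (T * p) + T * (m * (H * p)) ≡ suc m * (H * (T * p))
 lemma = solve-∀

module _ (N H : ℕ) (N≥1 : 1 ≤ N) where
 private
  _≟v_ : ∀ {m} (u v : Vec ℤ m) → Dec (u ≡ v)
  _≟v_ = ≡-dec Z._≟_

  c1 Y : ℕ
  -- Chosen so that |P(i)| ≤ c1 · H for 0 ≤ i < N, by `ev-bound`.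
  c1 = suc N * N ^ suc N
  Y = c1 * H

  Zero : Vec ℤ (suc N) → ℕ → Set
  Zero P i = eval P (+ i) ≡ 0ℤ

  zero? : ∀ P i → Dec (Zero P i)
  zero? P i = eval P (+ i) Z.≟ 0ℤ

 -- P is determined by its nonconstant coefficients once P i = 0.
 zeros-count : ∀ (L : List (Vec ℤ (suc N))) → Unique L → (∀ {P} → P ∈ L → ‖ P ‖ ≤ H × Any (Zero P) (upTo N)) → length L ≤ N * suc (2 * H) ^ N
 zeros-count L uL good = ≤-trans (fibre-count L (upTo N) Zero zero? (suc (2 * H) ^ N) cover fib) (≤-reflexive (cong (_* suc (2 * H) ^ N) (length-upTo N)))
  where
  cover : ∀ {P} → P ∈ L → ∃ λ i → i ∈ upTo N × Zero P i
  cover P∈ = find (snd (good P∈))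
  fib : ∀ {i} → i ∈ upTo N → length (filter (λ P → zero? P i) L) ≤ suc (2 * H) ^ N
  fib {i} _ = inj-box-count (filter (λ P → zero? P i) L) N H V.tail (Uniq.filter⁺ (λ P → zero? P i) uL)
    (λ {P} {P'} a b e → same-tail P P' (snd (∈-filter⁻ (λ P → zero? P i) {xs = L} a)) (snd (∈-filter⁻ (λ P → zero? P i) {xs = L} b)) e)
    (λ {P} a → tail-norm P (fst (good (fst (∈-filter⁻ (λ P → zero? P i) {xs = L} a)))))
   where
   tail-norm : ∀ (P : Vec ℤ (suc N)) → ‖ P ‖ ≤ H → ‖ V.tail P ‖ ≤ H
   tail-norm (c ∷ v) h = ≤-trans (m≤n⊔m ∣ c ∣ ‖ v ‖) h
   same-tail : ∀ (P P' : Vec ℤ (suc N)) → Zero P i → Zero P' i → V.tail P ≡ V.tail P' → P ≡ P'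
   same-tail (c ∷ v) (c' ∷ .v) z z' refl = cong (_∷ v) (trans (lemma c (+ i Z.* eval v (+ i))) (trans (cong (Z._- (+ i Z.* eval v (+ i))) (trans z (sym z'))) (sym (lemma c' (+ i Z.* eval v (+ i))))))
    where
    lemma : ∀ a b → a ≡ a Z.+ b Z.- b
    lemma = solveZ

 -- A factorisation P = Q R into polynomials of degree < N is determined by the values of Q and R at 0, …, N - 1.
 nonzeros-count : ∀ (L : List (Vec ℤ (suc N))) → Unique L → (∀ {P} → P ∈ L → ‖ P ‖ ≤ H × ¬ Any (Zero P) (upTo N)) → All IntegralFactor L → length L ≤ length (pairs Y) ^ N
 nonzeros-count L uL good factors = ≤-trans (inj-count L (vecs (pairs Y) N) (λ P → code-of P (P ∈? L)) (≡-dec (×-≡-dec Z._≟_ Z._≟_)) uL (λ {P} {P'} a b e → injective P P' a b (P ∈? L) (P' ∈? L) e) (λ {P} a → member P a (P ∈? L)))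
   (≤-reflexive (length-vecs (pairs Y) N))
  where
  open import Data.List.Membership.DecPropositional (≡-dec {n = suc N} Z._≟_) using (_∈?_)
  code : ∀ P → IntegralFactor P → Vec (ℤ × ℤ) N
  code P (Q , R , _) = V.tabulate (λ i → eval Q (+ toℕ i) , eval R (+ toℕ i))
  code-of : ∀ P → Dec (P ∈ L) → Vec (ℤ × ℤ) N
  code-of P (yes m) = code P (All.lookup factors m)
  code-of P (no _) = V.replicate N (0ℤ , 0ℤ)
  code-inj : ∀ P P' (f : IntegralFactor P) (f' : IntegralFactor P') → code P f ≡ code P' f' → P ≡ P'
  code-inj P P' (Q , R , eq) (Q' , R' , eq') e = vec-≗ P P' (λ t → trans (eq t) (trans (cong₂ Z._*_
    (interpolation-unique Q Q' (λ lt → cong fst (at-i lt)) t) (interpolation-unique R R' (λ lt → cong snd (at-i lt)) t)) (sym (eq' t))))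
   where
   at-i : ∀ {i} → i < N → (eval Q (+ i) , eval R (+ i)) ≡ (eval Q' (+ i) , eval R' (+ i))
   at-i {i} lt = subst (λ k → (eval Q (+ k) , eval R (+ k)) ≡ (eval Q' (+ k) , eval R' (+ k))) (toℕ-fromℕ< lt)
    (trans (sym (lookup∘tabulate (λ i → eval Q (+ toℕ i) , eval R (+ toℕ i)) (fromℕ< lt))) (trans (cong (λ v → lookup v (fromℕ< lt)) e) (lookup∘tabulate (λ i → eval Q' (+ toℕ i) , eval R' (+ toℕ i)) (fromℕ< lt))))
  injective : ∀ P P' → P ∈ L → P' ∈ L → (d : Dec (P ∈ L)) (d' : Dec (P' ∈ L)) → code-of P d ≡ code-of P' d' → P ≡ P'
  injective P P' a b (yes m) (yes m') e = code-inj P P' (All.lookup factors m) (All.lookup factors m') e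
  injective P P' a b (no ¬m) _ e = ⊥-elim (¬m a)
  injective P P' a b _ (no ¬m) e = ⊥-elim (¬m b)
  member : ∀ P → P ∈ L → (d : Dec (P ∈ L)) → code-of P d ∈ vecs (pairs Y) N
  member P a (no ¬m) = ⊥-elim (¬m a)
  member P a (yes m) = in-pairs (All.lookup factors m)
   where
   in-pairs : (f : IntegralFactor P) → code P f ∈ vecs (pairs Y) N
   in-pairs (Q , R , eq) = ∈-vecs⁺ (VAllP.tabulate⁺ (λ i → each (toℕ i) (toℕ<n i)))
    where
    each : ∀ i → i < N → (eval Q (+ i) , eval R (+ i)) ∈ pairs Y
    each i lt = ∈-pairs (eval Q (+ i)) (eval R (+ i)) (λ e → nz (trans (eq (+ i)) (cong (Z._* eval R (+ i)) e))) (λ e → nz (trans (eq (+ i)) (trans (cong (eval Q (+ i) Z.*_) e) (ZP.*-zeroʳ (eval Q (+ i))))))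
      (≤-trans (≤-reflexive (trans (sym (ZP.abs-* (eval Q (+ i)) (eval R (+ i)))) (cong ∣_∣ (sym (eq (+ i)))))) (≤-trans (ev-bound P H N (+ i) (fst (good a)) (<⇒≤ lt) N≥1) (≤-reflexive (lemma (suc N) H (N ^ suc N)))))
     where
     nz : eval P (+ i) ≢ 0ℤ
     nz e = snd (good a) (lose (∈-upTo⁺ lt) e)
     lemma : ∀ a b c → a * (b * c) ≡ a * c * b
     lemma = solve-∀

 -- Polynomials with a zero among 0, ..., N - 1 are separated, because a zero value does not
 -- restrict the values of Q and R to finitely many. Both parts are O((H log H) ^ N), against H ^ (N
 -- + 1) in total.
 reducible-count : ∀ k → Y ≤ 2 ^ k → ∀ (L : List (Vec ℤ (suc N))) → Unique L → (∀ {P} → P ∈ L → ‖ P ‖ ≤ H) → All IntegralFactor L →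
  length L ≤ N * suc (2 * H) ^ N + (4 * (suc k * Y)) ^ N
 reducible-count k Y≤ L uL norms factors = ≤-trans (≤-reflexive (length-split any-zero? L)) (+-mono-≤
   (zeros-count (filter any-zero? L) (Uniq.filter⁺ any-zero? uL) (λ m → let (a , b) = ∈-filter⁻ any-zero? {xs = L} m in norms a , b))
   (≤-trans (nonzeros-count (filter (λ P → ¬? (any-zero? P)) L) (Uniq.filter⁺ (λ P → ¬? (any-zero? P)) uL) (λ m → let (a , b) = ∈-filter⁻ (λ P → ¬? (any-zero? P)) {xs = L} m in norms a , b)
    (AllP.filter⁺ (λ P → ¬? (any-zero? P)) factors)) (^-monoˡ-≤ N (length-pairs Y k Y≤))))
  where
  any-zero? : ∀ P → Dec (Any (Zero P) (upTo N))
  any-zero? P = any? (zero? P) (upTo N)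

-- From ℓ ≤ j · 2 ^ (ℓ ÷ j), raised to the j-th power.
log-power : ∀ j ℓ → 1 ≤ j → ℓ ^ j ≤ j ^ j * 2 ^ ℓ
log-power j ℓ j≥1 = begin
 ℓ ^ j ≤⟨ ^-monoˡ-≤ j (≤-trans (<⇒≤ (<-÷ ℓ j j≥1)) (≤-trans (*-monoˡ-≤ j (n<2^n (ℓ ÷ j))) (≤-reflexive (*-comm (2 ^ (ℓ ÷ j)) j)))) ⟩
 (j * 2 ^ (ℓ ÷ j)) ^ j ≡⟨ ^-*-distrib j j (2 ^ (ℓ ÷ j)) ⟩
 j ^ j * (2 ^ (ℓ ÷ j)) ^ j ≡⟨ cong (j ^ j *_) (^-*-assoc 2 (ℓ ÷ j) j) ⟩
 j ^ j * 2 ^ (ℓ ÷ j * j) ≤⟨ *-monoʳ-≤ (j ^ j) (^-monoʳ-≤ 2 (÷-≤ ℓ j)) ⟩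
 j ^ j * 2 ^ ℓ ∎
 where open ≤-Reasoning

density-constant : ℕ → ℕ → ℕ
density-constant m c = (N * 3 ^ N + (4 * ((c + 3) * c)) ^ N) ^ 2 * (2 * suc m) ^ (2 * suc m) * (8 ^ suc N) ^ 2
 where N = suc (suc m)

-- The true ratio is of order ℓ ^ N / H. Its square is compared with ℓ² / H, which amounts to ℓ ^
-- (2N - 2) = O(H), an instance of `log-power` with H ≥ 2 ^ ℓ.
density-arith : ∀ m H ℓ len M c → let N = suc (suc m) in 1 ≤ H → 1 ≤ ℓ → 2 ^ ℓ ≤ H →
 len ≤ N * suc (2 * H) ^ N + (4 * (suc (c + suc ℓ) * (c * H))) ^ N → H ^ suc N ≤ 8 ^ suc N * M →
 len * len * H ≤ density-constant m c * (ℓ * ℓ) * (M * M)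
density-arith m H ℓ len M c H≥1 ℓ≥1 2ℓ≤H len≤ M≥ = begin
 len * len * H ≤⟨ *-monoˡ-≤ H (*-mono-≤ len' len') ⟩
 (C3 * (H ^ N * ℓ ^ N)) * (C3 * (H ^ N * ℓ ^ N)) * H ≡⟨ lem1 C3 (H ^ N) ℓ (ℓ ^ suc m) H ⟩
 C3 ^ 2 * (ℓ * ℓ) * (ℓ ^ suc m * ℓ ^ suc m) * (H ^ N * H ^ N * H)
  ≤⟨ *-monoˡ-≤ (H ^ N * H ^ N * H) (*-monoʳ-≤ (C3 ^ 2 * (ℓ * ℓ)) logs) ⟩
 C3 ^ 2 * (ℓ * ℓ) * (J0 * H) * (H ^ N * H ^ N * H) ≡⟨ lem2 (C3 ^ 2) (ℓ * ℓ) J0 H (H ^ N) ⟩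
 C3 ^ 2 * J0 * (ℓ * ℓ) * (H ^ suc N * H ^ suc N) ≤⟨ *-monoʳ-≤ (C3 ^ 2 * J0 * (ℓ * ℓ)) (*-mono-≤ M≥ M≥) ⟩
 C3 ^ 2 * J0 * (ℓ * ℓ) * (8 ^ suc N * M * (8 ^ suc N * M)) ≡⟨ lem3 (C3 ^ 2) J0 (ℓ * ℓ) (8 ^ suc N) M ⟩
 (C3 ^ 2 * J0 * (8 ^ suc N) ^ 2) * (ℓ * ℓ) * (M * M) ∎
 where
 open ≤-Reasoning
 N C2 C3 J0 : ℕ
 N = suc (suc m)
 C2 = 4 * ((c + 3) * c)
 C3 = N * 3 ^ N + C2 ^ N
 J0 = (2 * suc m) ^ (2 * suc m)
 lem1 : ∀ C h l p H → (C * (h * (l * p))) * (C * (h * (l * p))) * H ≡ (C * (C * 1)) * (l * l) * (p * p) * (h * h * H)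
 lem1 = solve-∀
 lem2 : ∀ C l J H h → C * l * (J * H) * (h * h * H) ≡ C * J * l * ((H * h) * (H * h))
 lem2 = solve-∀
 lem3 : ∀ C J l e M → C * J * l * (e * M * (e * M)) ≡ (C * J * (e * (e * 1))) * l * (M * M)
 lem3 = solve-∀
 logs : ℓ ^ suc m * ℓ ^ suc m ≤ J0 * H
 logs = ≤-trans (≤-reflexive (trans (sym (^-distribˡ-+-* ℓ (suc m) (suc m))) (cong (λ z → ℓ ^ (suc m + z)) (sym (+-identityʳ (suc m))))))
  (≤-trans (log-power (2 * suc m) ℓ (s≤s z≤n)) (*-monoʳ-≤ J0 2ℓ≤H))
 part1 : suc (2 * H) ≤ 3 * (H * ℓ)
 part1 = ≤-trans (+-monoˡ-≤ (2 * H) H≥1) (*-monoʳ-≤ 3 (m≤m*n H ℓ {{>-nonZero ℓ≥1}}))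
 part2 : 4 * (suc (c + suc ℓ) * (c * H)) ≤ C2 * (H * ℓ)
 part2 = ≤-trans (*-monoʳ-≤ 4 (*-monoˡ-≤ (c * H) step)) (≤-reflexive (lem4 c H ℓ))
  where
  step : suc (c + suc ℓ) ≤ (c + 3) * ℓ
  step = ≤-trans (≤-reflexive (lem5 c ℓ)) (≤-trans (+-monoˡ-≤ ℓ (*-monoʳ-≤ (c + 2) ℓ≥1)) (≤-reflexive (lem6 c ℓ)))
   where
   lem5 : ∀ c l → suc (c + suc l) ≡ (c + 2) * 1 + l
   lem5 = solve-∀
   lem6 : ∀ c l → (c + 2) * l + l ≡ (c + 3) * l
   lem6 = solve-∀
  lem4 : ∀ c H l → 4 * ((c + 3) * l * (c * H)) ≡ 4 * ((c + 3) * c) * (H * l)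
  lem4 = solve-∀
 len' : len ≤ C3 * (H ^ N * ℓ ^ N)
 len' = begin
  len ≤⟨ len≤ ⟩
  N * suc (2 * H) ^ N + (4 * (suc (c + suc ℓ) * (c * H))) ^ N ≤⟨ +-mono-≤ (*-monoʳ-≤ N (^-monoˡ-≤ N part1)) (^-monoˡ-≤ N part2) ⟩
  N * (3 * (H * ℓ)) ^ N + (C2 * (H * ℓ)) ^ N ≡⟨ cong₂ (λ x y → N * x + y) (^-*-distrib N 3 (H * ℓ)) (^-*-distrib N C2 (H * ℓ)) ⟩
  N * (3 ^ N * (H * ℓ) ^ N) + C2 ^ N * (H * ℓ) ^ N ≡⟨ lem7 N (3 ^ N) ((H * ℓ) ^ N) (C2 ^ N) ⟩
  C3 * (H * ℓ) ^ N ≡⟨ cong (C3 *_) (^-*-distrib N H ℓ) ⟩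
  C3 * (H ^ N * ℓ ^ N) ∎
  where
  lem7 : ∀ n t p c → n * (t * p) + c * p ≡ (n * t + c) * p
  lem7 = solve-∀

height-norm : ∀ {m H} (P : Vec ℤ m) → (∀ i → ∣ lookup P i ∣ ≤ H) → ‖ P ‖ ≤ H
height-norm [] h = z≤n
height-norm (c ∷ P) h = ⊔-lub (h zero) (height-norm P (λ i → h (suc i)))

-- The exceptional set and the conclusion

Good : ∀ n N → Poly N → Set
Good n N P = InP n N P × SmallTwists n P

-- An integral factor arises from any proper factor of the monic polynomial through `demonic` and
-- `gauss`. Without one, `small-twists` would make P good, up to a double negation.
not-good⇒factor : ∀ n m k → 2 ≤ n → suc (suc m) ≡ n * k → ∀ (P : Poly (suc (suc m))) → InP n (suc (suc m)) P → ¬ Good n (suc (suc m)) P → ¬ ¬ IntegralFactor P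
not-good⇒factor n m k n≥2 N≡ P inP bad with snocView P
... | v ∷ʳ' a = λ r → small-twists n k a v n≥2 N≡ (λ f → r (gauss (v ∷ʳ a) (demonic a v a≢0 f))) (λ s → bad (inP , s))
 where
 a≢0 : a ≢ 0ℤ
 a≢0 e = fst inP (trans (degree-coef (v ∷ʳ a)) (trans (coef-∷ʳ v a) e))

Rare : ∀ n N → ℕ → ℕ → Set
Rare n N C H0 = ∀ H → H0 ≤ H → ∀ (L : List (Poly N)) → DistinctIn (λ P → InPH n N H P × ¬ Good n N P) L →
 Σ (List (Poly N)) λ M → DistinctIn (InPH n N H) M ×
  (length L * length L * H ≤ C * (⌊log₂ H ⌋ * ⌊log₂ H ⌋) * (length M * length M))

few-bad : ∀ n' m k → suc (suc m) ≡ suc (suc n') * k → Σ ℕ λ C → Σ ℕ (Rare (suc (suc n')) (suc (suc m)) C)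
few-bad n' m k N≡ = density-constant m c1 , 4 , main
 where
 n N c1 : ℕ
 n = suc (suc n')
 N = suc (suc m)
 c1 = suc N * N ^ suc N
 main : Rare n N (density-constant m c1) 4
 main H H≥4 L (uL , aL) = let (M , dM , big) = many-polynomials n' (suc m) H H≥4 in M , dM , density-arith m H ℓ (length L) (length M) c1 H≥1 ℓ≥1 (fst (2^⌊log₂⌋ H H≥1)) count big
  where
  H≥1 : 1 ≤ H
  H≥1 = ≤-trans (s≤s z≤n) H≥4
  ℓ = ⌊log₂ H ⌋
  ℓ≥1 : 1 ≤ ℓ
  ℓ≥1 = positive ℓ (≤-<-trans H≥4 (snd (2^⌊log₂⌋ H H≥1)))
   where
   positive : ∀ l → 4 < 2 ^ suc l → 1 ≤ l
   positive zero (s≤s (s≤s ()))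
   positive (suc l) _ = s≤s z≤n
  Y≤ : c1 * H ≤ 2 ^ (c1 + suc ℓ)
  Y≤ = ≤-trans (*-mono-≤ (<⇒≤ (n<2^n c1)) (<⇒≤ (snd (2^⌊log₂⌋ H H≥1)))) (≤-reflexive (sym (^-distribˡ-+-* 2 c1 (suc ℓ))))
  count : length L ≤ N * suc (2 * H) ^ N + (4 * (suc (c1 + suc ℓ) * (c1 * H))) ^ N
  -- The factorisations of the members of L are known only doubly negated; the inequality to be
  -- derived is decidable.
  count = decidable-stable (length L ≤? (N * suc (2 * H) ^ N + (4 * (suc (c1 + suc ℓ) * (c1 * H))) ^ N))
   (¬¬-bind (¬¬-All L (λ {P} P∈ → let ((inP , _) , bad) = All.lookup aL P∈ in not-good⇒factor n m k (s≤s (s≤s z≤n)) N≡ P inP bad))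
    (λ factors r → r (reducible-count N H (s≤s z≤n) (c1 + suc ℓ) Y≤ L uL (λ {P} P∈ → height-norm P (snd (fst (All.lookup aL P∈)))) factors)))

theorem4p2 : (n N : ℕ) → 2 ≤ n → 1 ≤ N → n ∣ N →
  Σ (Poly N → Set) λ S′ →
    (∀ P → S′ P → InP n N P) ×
    -- (a) |𝒫(n,N,H) ∖ S′| ≤ C · log H / √H · |𝒫(n,N,H)| for H ≥ H₀ (squared form)
    (Σ ℕ λ C → Σ ℕ λ H₀ → ∀ (H : ℕ) → H₀ ≤ H →
      ∀ (L : List (Poly N)) → DistinctIn (λ P → InPH n N H P × ¬ S′ P) L →
        Σ (List (Poly N)) λ M → DistinctIn (InPH n N H) M ×
          (length L * length L * H ≤ C * (⌊log₂ H ⌋ * ⌊log₂ H ⌋) * (length M * length M))) ×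
    -- (b) for P ∈ S′: ∃ α = p/q ∈ (0,1), |𝒩_n(P,x)| = O(x · log^(-α) x)
    (∀ (P : Poly N) → S′ P →
      (Σ ℕ λ p → Σ ℕ λ q → 0 < p × p < q ×
        Σ ℕ λ C → Σ ℕ λ x₀ → ∀ (x : ℕ) → x₀ ≤ x →
          ∀ (L : List ℤ) → DistinctIn (InNPx n P x) L →
            length L ^ q * ⌊log₂ x ⌋ ^ p ≤ C * x ^ q) ×
      -- in particular: |𝒩_n(P,x)| / |𝒩_n(x)| → 0
      (∀ (k : ℕ) → 1 ≤ k → Σ ℕ λ x₀ → ∀ (x : ℕ) → x₀ ≤ x →
          ∀ (L : List ℤ) → DistinctIn (InNPx n P x) L →
            Σ (List ℤ) λ M → DistinctIn (NFreeLE n x) M × (k * length L ≤ length M)))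
theorem4p2 (suc zero)     N n≥2 N≥1 (ND.divides k e) = ⊥-elim (<⇒≱ n≥2 ≤-refl)
theorem4p2 (suc (suc n')) zero n≥2 N≥1 (ND.divides k e) = ⊥-elim (<⇒≱ N≥1 z≤n)
theorem4p2 (suc (suc n')) (suc zero) n≥2 N≥1 n∣N = ⊥-elim (<⇒≱ (s≤s (s≤s (z≤n {n'}))) (ND.∣⇒≤ n∣N))
-- n ∣ N and n ≥ 2 force N ≥ 2, so that the polynomial has a second root to adjoin.
theorem4p2 (suc (suc n')) (suc (suc m)) n≥2 N≥1 (ND.divides k e) = Good (suc (suc n')) (suc (suc m)) , (λ P → fst) , few-bad n' m k (trans e (*-comm k (suc (suc n')))) , (λ P → snd)
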